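{- Assume $SRP([\omega_2]^\omega)$ and the Tree Property at $\omega_2$. Whenever $\vec I$ is a tower of ideals which concentrates on the class $GIS_{\omega_1}$ of $\omega_1$-guessing, internally stationary sets, then $\vec I$ is not presaturated.
   Context: The base theory is ZFC. $[X]^\omega$ is the set of countable subsets of $X$; a club in $[X]^\omega$ is a $\subseteq$-cofinal subset closed under unions of countable increasing chains, and stationary means meeting every club. For $X \supseteq \omega_1$, a set $P\subset[X]^\omega$ is projective stationary iff for every stationary $T\subset\omega_1$, $\{Y\in P: Y\cap\omega_1\in T\}$ is stationary in $[X]^\omega$. $SRP([\omega_2]^\omega)$, the Strong Reflection Principle at $\omega_2$ (also written $SRP(\omega_2)$): for every projective stationary $P\subset[H_{\omega_2}]^\omega$ there is a continuous elementary chain $\langle N_\xi:\xi<\omega_1\rangle$ of countable elementary submodels of $H_{\omega_2}$ (i.e. $N_\xi\in N_{\xi+1}$, $N_\xi\subset N_{\xi+1}$, and $N_\xi=\bigcup_{\zeta<\xi}N_\zeta$ for limit $\xi$) with $N_\xi\in P$ for every $\xi<\omega_1$. Tree Property at $\omega_2$: every tree of height $\omega_2$ all of whose levels have size $<\omega_2$ has a cofinal branch. $GIS_{\omega_1}$. $ZF^-$ is ZF without Power Set. A transitive $ZF^-$ model $H$ with $\omega_1\in H$ has the $\omega_1$-approximation property iff for every $\eta\in H$ and $A\subseteq\eta$: if $z\cap A\in H$ for every $z\in H$ which is countable in $H$, then $A\in H$. A set $M$ with $\omega_1\subset M\prec H_\theta$ for some regular uncountable $\theta$ is $\omega_1$-guessing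 iff its transitive collapse has the $\omega_1$-approximation property. $G_{\omega_1}$ is the class of $\omega_1$-guessing $M$ with $|M|=\omega_1\subset M$. $IS_{\omega_1}$ (internally stationary sets) is the class of $M$ with $(M,\in)\models ZF^-$, $\omega_1\subseteq M$, $|M|=\omega_1$, such that $M\cap[M]^\omega$ is stationary in $[M]^\omega$. $GIS_{\omega_1}=G_{\omega_1}\cap IS_{\omega_1}$. Ideals. For a set $Z$, an ideal $I\subset\wp(Z)$ is always proper, countably complete, fine (for every $b\in\bigcup Z$, $\{M\in Z: b\notin M\}\in I$) and normal (if $S\notin I$ and $g$ is a function on $S$ with $g(M)\in M$ for all $M\in S$, then $g$ is constant on some $S'\subseteq S$ with $S'\notin I$). $I^+=\wp(Z)\setminus I$. $I$ concentrates on a class $\Gamma$ iff some $A\subseteq\Gamma$ belongs to the dual filter of $I$. If $I\subset\wp(Z)$, $I'\subset\wp(Z')$ and $\bigcup Z\subseteq\bigcup Z'$, then $I$ is the canonical projection of $I'$ to $Z$ iff $I=\{A\subseteq Z:\{M'\in Z': M'\cap\bigcup Z\in A\}\in I'\}$. Towers. A tower of ideals of height $\delta$ is a sequence $\vec I=\langle I_\lambda : \lambda\in U\rangle$, where the index set $U$ is an unbounded subset of $\delta$, each $I_\lambda$ is an ideal on $Z_\lambda=\wp_\kappa(H_\lambda)$ (the set of subsets of $H_\lambda$ of size $<\kappa$) for a fixed regular $\kappa\le\lambda$, all $I_\lambda$ have the same completeness, and for $\lambda\le\lambda'$ in $U$, $I_\lambda$ is the canonical projection of $I_{\lambda'}$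 to $Z_\lambda$. $\vec I$ concentrates on $\Gamma$ iff every $I_\lambda$ does. $\mathbb P_{\vec I}$ is the poset of pairs $(\lambda,S)$ with $\lambda\in U$ and $S\in I_\lambda^+$, ordered by $(\lambda',S')\le(\lambda,S)$ iff $\lambda'\ge\lambda$ and $S'\subseteq\{M'\in Z_{\lambda'}: M'\cap H_\lambda\in S\}$. A tower $\vec I$ of height $\delta$ is presaturated iff $\delta$ always remains a regular cardinal in generic extensions of $V$ by $\mathbb P_{\vec I}$. -}

module Defs where

open import Level using (Level; Lift; _⊔_) renaming (zero to 0ℓ; suc to lsuc)
open import Data.Bool.Base using (Bool; if_then_else_)
open import Data.Empty using (⊥)
open import Data.Fin.Base using (Fin; zero; suc)
open import Data.Nat.Base using (ℕ; zero; suc)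
open import Data.Product.Base using (Σ; _×_; _,_; proj₂; ∃-syntax)
open import Data.Sum.Base using (_⊎_; [_,_]′)
open import Data.Unit.Base using (⊤)
open import Data.Vec.Base using (Vec; []; _∷_; lookup)
import Data.Vec.Base as Vec
open import Data.Vec.Relation.Unary.All using (All)
open import Function.Bundles using (_⇔_)
open import Relation.Nullary.Negation.Core using (¬_)
open import Relation.Unary using (Pred)

private
  variable
    ℓ ℓ′ : Level
    n : ℕ

1ℓ : Level
1ℓ = lsuc 0ℓ

-- V is Aczel's type of iterative sets.  Granted excluded middle for Set₁
-- and `Choice` below, it satisfies all the axioms of ZFC.  Classes are
-- predicates on V, and set equality is the bisimulation _≐_.

data V : Set₁ where
  sup : (A : Set) → (A → V) → V

Index : V → Set
Index (sup A _) = A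

elt : (x : V) → Index x → V
elt (sup _ f) = f

infix 4 _≐_ _∈_ _⊆_ _≜_ _∈ᶜ_

_≐_ : V → V → Set
sup A f ≐ sup B g = (∀ i → Σ B λ j → f i ≐ g j) × (∀ j → Σ A λ i → f i ≐ g j)

_∈_ : V → V → Set
x ∈ y = Σ (Index y) λ i → x ≐ elt y i

_⊆_ : V → V → Set₁
x ⊆ y = ∀ z → z ∈ x → z ∈ y

_≜_ : V → Pred V ℓ → Set (1ℓ ⊔ ℓ)
x ≜ D = ∀ z → z ∈ x ⇔ D z

-- The class D is a set, and this set is a member of x.
_∈ᶜ_ : Pred V ℓ → V → Set (1ℓ ⊔ ℓ)
D ∈ᶜ x = ∃[ d ] d ≜ D × d ∈ x

-- Separation for predicates that are small already; separation for
-- arbitrary classes needs excluded middle.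
｛_∣_｝ : V → (V → Set) → V
｛ sup A f ∣ φ ｝ = sup (Σ A λ i → φ (f i)) λ (i , _) → f i

∅ : V
∅ = sup ⊥ λ ()

｛_,_｝ : V → V → V
｛ x , y ｝ = sup Bool λ b → if b then x else y

⟨_,_⟩ : V → V → V
⟨ x , y ⟩ = ｛ ｛ x , x ｝ , ｛ x , y ｝ ｝

infixr 6 _∪_
infixr 7 _∩_

_∪_ : V → V → V
sup A f ∪ sup B g = sup (A ⊎ B) [ f , g ]′

_∩_ : V → V → V
x ∩ y = ｛ x ∣ _∈ y ｝

⋃ : V → V
⋃ x = sup (Σ (Index x) λ i → Index (elt x i)) λ (i , j) → elt (elt x i) j

⋃ₙ : (ℕ → V) → V
⋃ₙ c = ⋃ (sup ℕ c)

succ : V → V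
succ x = x ∪ ｛ x , x ｝

ω : V
ω = sup ℕ numeral
  where
  numeral : ℕ → V
  numeral zero    = ∅
  numeral (suc k) = succ (numeral k)

trcl : V → V
trcl (sup A f) = sup A f ∪ ⋃ (sup A λ i → trcl (f i))

Transitive : V → Set₁
Transitive x = ∀ y → y ∈ x → y ⊆ x

IsFunctionOn : V → V → Set₁
IsFunctionOn f a =
    (∀ p → p ∈ f → ∃[ x ] ∃[ y ] x ∈ a × p ≐ ⟨ x , y ⟩)
  × (∀ x → x ∈ a → ∃[ y ] ⟨ x , y ⟩ ∈ f × (∀ z → ⟨ x , z ⟩ ∈ f → z ≐ y))

-- The value of f at x is the union of the (singleton) set of all y with
-- ⟨ x , y ⟩ ∈ f; for Kuratowski pairs these y all lie in ⋃ (⋃ f).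
infixl 8 _‵_

_‵_ : V → V → V
f ‵ x = ⋃ ｛ ⋃ (⋃ f) ∣ (λ y → ⟨ x , y ⟩ ∈ f) ｝

IsInjection : V → V → V → Set₁
IsInjection f a b =
    IsFunctionOn f a
  × (∀ x → x ∈ a → f ‵ x ∈ b)
  × (∀ x y → x ∈ a → y ∈ a → f ‵ x ≐ f ‵ y → x ≐ y)

IsBijection : V → V → V → Set₁
IsBijection f a b =
  IsInjection f a b × (∀ y → y ∈ b → ∃[ x ] x ∈ a × f ‵ x ≐ y)

infix 4 _≼_ _≈_

_≼_ : V → V → Set₁
a ≼ b = ∃[ f ] IsInjection f a b

_≈_ : V → V → Set₁
a ≈ b = ∃[ f ] IsBijection f a b

Countable : V → Set₁
Countable a = a ≼ ω

Choice : Set₁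
Choice = ∀ a → (∀ x → x ∈ a → ∃[ y ] y ∈ x) →
  ∃[ f ] IsFunctionOn f a × (∀ x → x ∈ a → f ‵ x ∈ x)

IsOrdinal : V → Set₁
IsOrdinal α = Transitive α × (∀ β → β ∈ α → Transitive β)

IsLimit : V → Set₁
IsLimit α = IsOrdinal α × ∅ ∈ α × (∀ β → β ∈ α → succ β ∈ α)

IsCardinal : V → Set₁
IsCardinal κ = IsOrdinal κ × (∀ α → α ∈ κ → ¬ (κ ≼ α))

IsSuccessorCardinal : V → V → Set₁
IsSuccessorCardinal κ μ =
  IsCardinal μ × κ ∈ μ × (∀ α → α ∈ μ → α ≼ κ)

∣_∣<_ : V → V → Set₁
∣ a ∣< κ = ∃[ α ] α ∈ κ × a ≼ α

H : V → Pred V 1ℓ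
H θ x = ∣ trcl x ∣< θ

℘<[_] : V → Pred V ℓ → Pred V (1ℓ ⊔ ℓ)
℘<[ κ ] X M = (∀ x → x ∈ M → X x) × ∣ M ∣< κ

[_]^ω : Pred V ℓ → Pred V (1ℓ ⊔ ℓ)
[ X ]^ω Y = (∀ x → x ∈ Y → X x) × Countable Y

infix  8 _∈̇_ _≈̇_
infix  7 ¬̇_
infixr 6 _∧̇_
infixr 5 _∨̇_
infixr 4 _⇒̇_
infix  3 _⇔̇_
infix  2 ∀̇_ ∃̇_

-- Variables are de Bruijn indices.
data Formula : ℕ → Set where
  _∈̇_ _≈̇_ : Fin n → Fin n → Formula n
  ¬̇_      : Formula n → Formula n
  _∧̇_     : Formula n → Formula n → Formula n
  ∀̇_      : Formula (suc n) → Formula n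

_∨̇_ _⇒̇_ _⇔̇_ : Formula n → Formula n → Formula n
φ ∨̇ ψ = ¬̇ (¬̇ φ ∧̇ ¬̇ ψ)
φ ⇒̇ ψ = ¬̇ (φ ∧̇ ¬̇ ψ)
φ ⇔̇ ψ = (φ ⇒̇ ψ) ∧̇ (ψ ⇒̇ φ)

∃̇_ : Formula (suc n) → Formula n
∃̇ φ = ¬̇ (∀̇ ¬̇ φ)

∀̇∈ ∃̇∈ : Fin n → Formula (suc n) → Formula n
∀̇∈ a φ = ∀̇ (zero ∈̇ suc a ⇒̇ φ)
∃̇∈ a φ = ∃̇ (zero ∈̇ suc a ∧̇ φ)

infix 4 _⊨_[_]

_⊨_[_] : Pred V ℓ → Formula n → Vec V n → Set (1ℓ ⊔ ℓ)
_⊨_[_] {ℓ} D (i ∈̇ j) ρ = Lift (1ℓ ⊔ ℓ) (lookup ρ i ∈ lookup ρ j)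
_⊨_[_] {ℓ} D (i ≈̇ j) ρ = Lift (1ℓ ⊔ ℓ) (lookup ρ i ≐ lookup ρ j)
D ⊨ ¬̇ φ     [ ρ ] = ¬ (D ⊨ φ [ ρ ])
D ⊨ φ ∧̇ ψ   [ ρ ] = (D ⊨ φ [ ρ ]) × (D ⊨ ψ [ ρ ])
D ⊨ ∀̇ φ     [ ρ ] = ∀ x → D x → D ⊨ φ [ x ∷ ρ ]

infix 4 _≺_

_≺_ : V → Pred V ℓ → Set (1ℓ ⊔ ℓ)
M ≺ D =
    (∀ x → x ∈ M → D x)
  × (∀ {n} (φ : Formula n) (ρ : Vec V n) → All (_∈ M) ρ →
       (_∈ M) ⊨ φ [ ρ ] ⇔ D ⊨ φ [ ρ ])

-- (D , ∈) is a model of ZF without Power Set; D need not be transitive.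
record ZF⁻ (D : Pred V ℓ) : Set (1ℓ ⊔ ℓ) where
  field
    extensionality : ∀ x y → D x → D y →
      (∀ z → D z → z ∈ x ⇔ z ∈ y) → x ≐ y
    foundation : ∀ x → D x → (∃[ y ] D y × y ∈ x) →
      ∃[ y ] D y × y ∈ x × (∀ z → D z → z ∈ y → ¬ (z ∈ x))
    pairing : ∀ x y → D x → D y →
      ∃[ p ] D p × (∀ z → D z → z ∈ p ⇔ (z ≐ x ⊎ z ≐ y))
    union : ∀ a → D a →
      ∃[ u ] D u × (∀ z → D z → z ∈ u ⇔ (∃[ y ] D y × y ∈ a × z ∈ y))
    infinity : ∃[ w ] D w
      × (∃[ e ] D e × e ∈ w × (∀ z → D z → ¬ (z ∈ e)))
      × (∀ x → D x → x ∈ w →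
           ∃[ s ] D s × s ∈ w × (∀ z → D z → z ∈ s ⇔ (z ∈ x ⊎ z ≐ x)))
    separation : ∀ {n} (φ : Formula (suc n)) (ρ : Vec V n) → All D ρ →
      ∀ a → D a →
      ∃[ b ] D b × (∀ x → D x → x ∈ b ⇔ (x ∈ a × D ⊨ φ [ x ∷ ρ ]))
    replacement : ∀ {n} (φ : Formula (suc (suc n))) (ρ : Vec V n) → All D ρ →
      ∀ a → D a →
      (∀ x → D x → x ∈ a →
         ∃[ y ] D y × D ⊨ φ [ x ∷ y ∷ ρ ]
           × (∀ z → D z → D ⊨ φ [ x ∷ z ∷ ρ ] → z ≐ y)) →
      ∃[ b ] D b × (∀ y → D y →
        y ∈ b ⇔ (∃[ x ] D x × x ∈ a × D ⊨ φ [ x ∷ y ∷ ρ ]))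

-- Regularity is given as a formula, so that it can be evaluated in V and
-- also forced.

private
  v₀ : Fin (suc n)
  v₀ = zero

  v₁ : Fin (suc (suc n))
  v₁ = suc zero

  v₂ : Fin (suc (suc (suc n)))
  v₂ = suc (suc zero)

  v₃ : Fin (suc (suc (suc (suc n))))
  v₃ = suc (suc (suc zero))

  ↑ : Fin n → Fin (suc n)
  ↑ = suc

  ↑² : Fin n → Fin (suc (suc n))
  ↑² i = suc (suc i)

  ↑³ : Fin n → Fin (suc (suc (suc n)))
  ↑³ i = suc (suc (suc i))

isUnorderedPair : (z x y : Fin n) → Formula n
isUnorderedPair z x y = ∀̇ (v₀ ∈̇ ↑ z ⇔̇ (v₀ ≈̇ ↑ x ∨̇ v₀ ≈̇ ↑ y))

isOrderedPair : (p x y : Fin n) → Formula n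
isOrderedPair p x y =
  ∀̇ (v₀ ∈̇ ↑ p ⇔̇ (isUnorderedPair v₀ (↑ x) (↑ x) ∨̇ isUnorderedPair v₀ (↑ x) (↑ y)))

maps : (f x y : Fin n) → Formula n
maps f x y = ∃̇∈ f (isOrderedPair v₀ (↑ x) (↑ y))

isFunction : (f a b : Fin n) → Formula n
isFunction f a b =
     ∀̇∈ f (∃̇∈ (↑ a) (∃̇∈ (↑² b) (isOrderedPair v₂ v₁ v₀)))
  ∧̇ ∀̇∈ a (∃̇ (maps (↑² f) v₁ v₀ ∧̇ (∀̇ (maps (↑³ f) v₂ v₀ ⇒̇ v₀ ≈̇ v₁))))

isInjective : (f : Fin n) → Formula n
isInjective f =
  ∀̇ ∀̇ ∀̇ (maps (↑³ f) v₂ v₀ ∧̇ maps (↑³ f) v₁ v₀ ⇒̇ v₂ ≈̇ v₁)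

isTransitive : (a : Fin n) → Formula n
isTransitive a = ∀̇∈ a (∀̇∈ v₀ (v₀ ∈̇ ↑² a))

isOrdinal : (a : Fin n) → Formula n
isOrdinal a = isTransitive a ∧̇ ∀̇∈ a (isTransitive v₀)

isCardinal : (δ : Fin n) → Formula n
isCardinal δ =
  isOrdinal δ ∧̇ ∀̇∈ δ (¬̇ (∃̇ (isFunction v₀ (↑² δ) v₁ ∧̇ isInjective v₀)))

-- The second and third conjuncts say that δ is infinite: it is nonempty
-- and has no largest member.
isRegularCardinal : (δ : Fin n) → Formula n
isRegularCardinal δ =
     isCardinal δ
  ∧̇ (∃̇∈ δ (v₀ ≈̇ v₀))
  ∧̇ ∀̇∈ δ (∃̇∈ (↑ δ) (v₁ ∈̇ v₀))
  ∧̇ ∀̇∈ δ (∀̇ (isFunction v₀ v₁ (↑² δ) ⇒̇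
       (∃̇∈ (↑² δ) (∀̇∈ v₂ (∀̇ (maps v₃ v₁ v₀ ⇒̇ v₀ ∈̇ v₂))))))

IsRegularCardinal : V → Set₁
IsRegularCardinal κ = (λ _ → ⊤) ⊨ isRegularCardinal zero [ κ ∷ [] ]

IsClub[_]^ω : Pred V ℓ → V → Set (1ℓ ⊔ ℓ)
IsClub[ X ]^ω C =
    (∀ Y → Y ∈ C → [ X ]^ω Y)
  × (∀ Y → [ X ]^ω Y → ∃[ Z ] Z ∈ C × Y ⊆ Z)
  × ((c : ℕ → V) → (∀ k → c k ∈ C) → (∀ k → c k ⊆ c (suc k)) → ⋃ₙ c ∈ C)

IsStationary[_]^ω : Pred V ℓ → Pred V ℓ′ → Set (1ℓ ⊔ ℓ ⊔ ℓ′)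
IsStationary[ X ]^ω S =
    (∀ Y → S Y → [ X ]^ω Y)
  × (∀ C → IsClub[ X ]^ω C → ∃[ Y ] Y ∈ C × S Y)

IsClubIn : V → V → Set₁
IsClubIn κ C =
    C ⊆ κ
  × (∀ α → α ∈ κ → ∃[ β ] β ∈ C × α ∈ β)
  × (∀ α → α ∈ κ → IsLimit α →
       (∀ β → β ∈ α → ∃[ γ ] γ ∈ C × γ ∈ α × β ∈ γ) → α ∈ C)

IsStationaryIn : V → V → Set₁
IsStationaryIn κ T = T ⊆ κ × (∀ C → IsClubIn κ C → ∃[ α ] α ∈ C × α ∈ T)

IsProjectiveStationary : (ω₁ : V) → Pred V ℓ → V → Set (1ℓ ⊔ ℓ)
IsProjectiveStationary ω₁ X P =
    (∀ Y → Y ∈ P → [ X ]^ω Y)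
  × (∀ T → IsStationaryIn ω₁ T →
       IsStationary[ X ]^ω (λ Y → Y ∈ P × Y ∩ ω₁ ∈ T))

record IsContinuousElementaryChain (ω₁ : V) (D : Pred V ℓ) (N : V) : Set (1ℓ ⊔ ℓ) where
  field
    function   : IsFunctionOn N ω₁
    countable  : ∀ ξ → ξ ∈ ω₁ → Countable (N ‵ ξ)
    elementary : ∀ ξ → ξ ∈ ω₁ → N ‵ ξ ≺ D
    member     : ∀ ξ → ξ ∈ ω₁ → N ‵ ξ ∈ N ‵ succ ξ
    increasing : ∀ ξ → ξ ∈ ω₁ → N ‵ ξ ⊆ N ‵ succ ξ
    continuous : ∀ ξ → ξ ∈ ω₁ → IsLimit ξ →
      N ‵ ξ ≜ λ x → ∃[ ζ ] ζ ∈ ξ × x ∈ N ‵ ζ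

SRP : (ω₁ ω₂ : V) → Set₁
SRP ω₁ ω₂ = ∀ P → IsProjectiveStationary ω₁ (H ω₂) P →
  ∃[ N ] IsContinuousElementaryChain ω₁ (H ω₂) N × (∀ ξ → ξ ∈ ω₁ → N ‵ ξ ∈ P)

pred : (T R t : V) → V
pred T R t = ｛ T ∣ (λ s → ⟨ s , t ⟩ ∈ R) ｝

record IsTree (T R : V) : Set₁ where
  field
    irreflexive : ∀ s → s ∈ T → ¬ (⟨ s , s ⟩ ∈ R)
    transitive  : ∀ s t u → s ∈ T → t ∈ T → u ∈ T →
      ⟨ s , t ⟩ ∈ R → ⟨ t , u ⟩ ∈ R → ⟨ s , u ⟩ ∈ R
    linear      : ∀ t → t ∈ T → ∀ r s → r ∈ pred T R t → s ∈ pred T R t →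
      ⟨ r , s ⟩ ∈ R ⊎ r ≐ s ⊎ ⟨ s , r ⟩ ∈ R
    wellFounded : ∀ t → t ∈ T → ∀ a → a ⊆ pred T R t → (∃[ s ] s ∈ a) →
      ∃[ s ] s ∈ a × (∀ r → r ∈ a → ¬ (⟨ r , s ⟩ ∈ R))

HasHeight : (T R t α : V) → Set₁
HasHeight T R t α = IsOrdinal α × (∃[ f ] IsBijection f (pred T R t) α
  × (∀ r s → r ∈ pred T R t → s ∈ pred T R t → ⟨ r , s ⟩ ∈ R ⇔ f ‵ r ∈ f ‵ s))

Level[_,_] : (T R α : V) → Pred V 1ℓ
Level[ T , R ] α t = t ∈ T × HasHeight T R t α

-- The height of the tree is the set of α whose level is nonempty.
HasTreeHeight : (T R κ : V) → Set₁
HasTreeHeight T R κ = κ ≜ λ α → ∃[ t ] Level[ T , R ] α t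

record IsCofinalBranch (T R κ b : V) : Set₁ where
  field
    subset     : b ⊆ T
    linear     : ∀ s t → s ∈ b → t ∈ b → ⟨ s , t ⟩ ∈ R ⊎ s ≐ t ⊎ ⟨ t , s ⟩ ∈ R
    downClosed : ∀ s t → s ∈ T → t ∈ b → ⟨ s , t ⟩ ∈ R → s ∈ b
    cofinal    : ∀ α → α ∈ κ → ∃[ t ] t ∈ b × HasHeight T R t α

TreeProperty : V → Set₁
TreeProperty κ = ∀ T R → IsTree T R → HasTreeHeight T R κ →
  (∀ α → α ∈ κ → ∃[ L ] L ≜ Level[ T , R ] α × ∣ L ∣< κ) →
  ∃[ b ] IsCofinalBranch T R κ b

record HasApproximationProperty (ω₁ T : V) : Set₁ where
  field
    transitive : Transitive T
    zf⁻        : ZF⁻ (_∈ T)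
    ω₁∈T       : ω₁ ∈ T
    approx     : ∀ η A → η ∈ T → A ⊆ η →
      (∀ z → z ∈ T → (∃[ f ] f ∈ T × IsInjection f z ω) → z ∩ A ∈ T) →
      A ∈ T

IsTransitiveCollapse : V → V → Set₁
IsTransitiveCollapse M T = Transitive T × (∃[ π ] IsBijection π M T
  × (∀ x y → x ∈ M → y ∈ M → x ∈ y ⇔ π ‵ x ∈ π ‵ y))

IsGuessing : (ω₁ : V) → Pred V 1ℓ
IsGuessing ω₁ M =
    ω₁ ⊆ M
  × (∃[ θ ] IsRegularCardinal θ × ω ∈ θ × M ≺ H θ)
  × (∃[ T ] IsTransitiveCollapse M T × HasApproximationProperty ω₁ T)

G IS GIS : (ω₁ : V) → Pred V 1ℓ
G ω₁ M = IsGuessing ω₁ M × M ≈ ω₁ × ω₁ ⊆ M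
IS ω₁ M =
  ZF⁻ (_∈ M) × ω₁ ⊆ M × M ≈ ω₁ ×
  IsStationary[ _∈ M ]^ω (λ Y → Y ∈ M × [ _∈ M ]^ω Y)
GIS ω₁ M = G ω₁ M × IS ω₁ M

⋃ᶜ : Pred V ℓ → Pred V (1ℓ ⊔ ℓ)
⋃ᶜ Z b = ∃[ M ] Z M × b ∈ M

record IsIdeal (Z : Pred V ℓ) (I : V) : Set (1ℓ ⊔ ℓ) where
  field
    subsets           : ∀ A → A ∈ I → ∀ M → M ∈ A → Z M
    empty             : ∅ ∈ I
    downClosed        : ∀ A B → A ∈ I → B ⊆ A → B ∈ I
    countablyComplete : (A : ℕ → V) → (∀ k → A k ∈ I) → ⋃ₙ A ∈ I
    proper            : ¬ (Z ∈ᶜ I)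
    fine              : ∀ b → ⋃ᶜ Z b → (λ M → Z M × ¬ (b ∈ M)) ∈ᶜ I
    normal            : ∀ S g → (∀ M → M ∈ S → Z M) → ¬ (S ∈ I) →
      IsFunctionOn g S → (∀ M → M ∈ S → g ‵ M ∈ M) →
      ∃[ S′ ] S′ ⊆ S × ¬ (S′ ∈ I) × (∃[ b ] (∀ M → M ∈ S′ → g ‵ M ≐ b))

IsPositive : Pred V ℓ → (I S : V) → Set (1ℓ ⊔ ℓ)
IsPositive Z I S = (∀ M → M ∈ S → Z M) × ¬ (S ∈ I)

ConcentratesOn : Pred V ℓ → V → Pred V ℓ′ → Set (1ℓ ⊔ ℓ ⊔ ℓ′)
ConcentratesOn Z I Γ = ∃[ A ]
  (∀ M → M ∈ A → Z M × Γ M) × (λ M → Z M × ¬ (M ∈ A)) ∈ᶜ I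

IsComplete[<_] : (μ I : V) → Set₁
IsComplete[< μ ] I = ∀ F → F ⊆ I → ∣ F ∣< μ → ⋃ F ∈ I

IsCanonicalProjection : Pred V ℓ → V → Pred V ℓ′ → V → Set (1ℓ ⊔ ℓ ⊔ ℓ′)
IsCanonicalProjection Z I Z′ I′ =
  I ≜ λ A → (∀ M → M ∈ A → Z M)
          × (λ M′ → Z′ M′ × (λ x → x ∈ M′ × ⋃ᶜ Z x) ∈ᶜ A) ∈ᶜ I′

record IsTower (δ κ U I : V) : Set₁ where
  Z : V → Pred V 1ℓ
  Z α = ℘<[ κ ] (H α)

  field
    height           : IsOrdinal δ
    indices          : U ⊆ δ
    unbounded        : ∀ α → α ∈ δ → ∃[ μ ] μ ∈ U × α ⊆ μ
    κ-regular        : IsRegularCardinal κ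
    cardinals        : ∀ μ → μ ∈ U → IsCardinal μ × κ ⊆ μ
    sequence         : IsFunctionOn I U
    ideals           : ∀ μ → μ ∈ U → IsIdeal (Z μ) (I ‵ μ)
    sameCompleteness : ∀ μ μ′ → μ ∈ U → μ′ ∈ U → ∀ ν → IsCardinal ν →
      IsComplete[< ν ] (I ‵ μ) ⇔ IsComplete[< ν ] (I ‵ μ′)
    projections      : ∀ μ μ′ → μ ∈ U → μ′ ∈ U → μ ⊆ μ′ →
      IsCanonicalProjection (Z μ) (I ‵ μ) (Z μ′) (I ‵ μ′)

TowerConcentratesOn : (κ U I : V) → Pred V 1ℓ → Set₁
TowerConcentratesOn κ U I Γ =
  ∀ μ → μ ∈ U → ConcentratesOn (℘<[ κ ] (H μ)) (I ‵ μ) Γ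

IsTowerCondition : (κ U I : V) → Pred V 1ℓ
IsTowerCondition κ U I p = ∃[ μ ] ∃[ S ]
  p ≐ ⟨ μ , S ⟩ × μ ∈ U × IsPositive (℘<[ κ ] (H μ)) (I ‵ μ) S

TowerOrder : (κ q p : V) → Set₁
TowerOrder κ q p = ∃[ μ′ ] ∃[ S′ ] ∃[ μ ] ∃[ S ]
  q ≐ ⟨ μ′ , S′ ⟩ × p ≐ ⟨ μ , S ⟩ × μ ⊆ μ′
  × (∀ M′ → M′ ∈ S′ → ℘<[ κ ] (H μ′) M′ × (λ x → x ∈ M′ × H μ x) ∈ᶜ S)

module Forcing (P : V) (_≤_ : V → V → Set₁) where

  Condition : Set
  Condition = Index P

  infix 4 _⊑_

  _⊑_ : Condition → Condition → Set₁
  q ⊑ p = elt P q ≤ elt P p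

  data Name : Set₁ where
    name : (A : Set) → (A → Name) → (A → Condition) → Name

  -- P need not have a greatest element, so every condition is used.
  check : V → Name
  check (sup A f) = name (A × Condition) (λ (i , _) → check (f i)) proj₂

  DenseBelow : Condition → (Condition → Set₁) → Set₁
  DenseBelow p D = ∀ q → q ⊑ p → Σ Condition λ r → r ⊑ q × D r

  infix 4 _⊩_≈_ _⊩_∈_ _⊩_[_]

  _⊩_≈_ : Condition → Name → Name → Set₁
  p ⊩ name A σ s ≈ name B τ t =
      (∀ i → DenseBelow p λ q → q ⊑ s i → Σ B λ j → q ⊑ t j × (q ⊩ σ i ≈ τ j))
    × (∀ j → DenseBelow p λ q → q ⊑ t j → Σ A λ i → q ⊑ s i × (q ⊩ σ i ≈ τ j))

  _⊩_∈_ : Condition → Name → Name → Set₁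
  p ⊩ σ ∈ name B τ t = DenseBelow p λ q → Σ B λ j → q ⊑ t j × (q ⊩ σ ≈ τ j)

  _⊩_[_] : Condition → Formula n → Vec Name n → Set₁
  p ⊩ i ∈̇ j [ ρ ] = p ⊩ lookup ρ i ∈ lookup ρ j
  p ⊩ i ≈̇ j [ ρ ] = p ⊩ lookup ρ i ≈ lookup ρ j
  p ⊩ ¬̇ φ   [ ρ ] = ∀ q → q ⊑ p → ¬ (q ⊩ φ [ ρ ])
  p ⊩ φ ∧̇ ψ [ ρ ] = (p ⊩ φ [ ρ ]) × (p ⊩ ψ [ ρ ])
  p ⊩ ∀̇ φ   [ ρ ] = ∀ σ → p ⊩ φ [ σ ∷ ρ ]

  -- φ holds in every generic extension: every condition forces it.
  Forced : Formula n → Vec V n → Set₁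
  Forced φ ρ = ∀ p → p ⊩ φ [ Vec.map check ρ ]

-- δ remains regular, so in particular it is regular in V.  This also rules
-- out the empty tower, for which there is nothing to force with.
IsPresaturated : (δ κ U I : V) → Set₁
IsPresaturated δ κ U I =
    IsRegularCardinal δ
  × (∃[ P ] P ≜ IsTowerCondition κ U I
    × Forcing.Forced P (TowerOrder κ) (isRegularCardinal zero) (δ ∷ []))

{-# OPTIONS --safe #-}

-- Suppose that the tower is presaturated.  Write coll M for the transitive collapse of M.
--
-- 1. Suppose that, for each set r of bounded subsets of ω₁, the ordinals coll M ξ, for M in
--    GIS whose bounded subsets of ω₁ form r, were bounded in ω₂.  An injection of the bound into ω₁
--    then turns ξ ↦ coll M ξ into regressive functions on the sets of the tower; by normality the
--    generic filter decides them, and this is an injection of δ into ω₁ in the extension.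
--    Hence for some r these M have arbitrarily large coll M ξ below ω₂.  This replaces the argument
--    with the generic ultrapower.  Normality and approximation also give 2^ω > ω₁.
-- 2. For γ < ω₂ consider the sets coll M ∩ ℘(γ), M as above, as nodes at level γ.
--    As M is internally stationary, a node contains y_ν for stationary many ν < ω₁, where the y_ν
--    are a continuous exhaustion of γ.  By approximation and the choice of r, two nodes with
--    cofinally many y_ν in common are equal.  As SRP makes the nonstationary ideal on ω₁ saturated,
--    there are at most ω₁ nodes at each level.
-- 3. The Tree Property gives a cofinal branch B.
-- 4. As in the theorem of Gitik and Veličković, every club in [H_ω₂]^ω has, for stationary
--    many ν, 2^ω members with trace ν on ω₁, and with distinct traces on ω₂ all below one γ < ω₂.
--    As a node has size ω₁, the set of X with X ∩ ω₂ ∉ B is projective stationary.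
-- 5. A chain through this set given by SRP has a union whose trace on ω₂ is some γ < ω₂,
--    so that its members are y_ν on γ for club many ν, contrary to the stationarity of the node
--    of B at γ.

module Submission where

open import Defs
  using (V; sup; Index; elt; 1ℓ; ∅; ω; Choice; IsSuccessorCardinal; Formula; _∈̇_; _≈̇_; ¬̇_; _∧̇_;
    ∀̇_; _∨̇_; _⇒̇_; _⇔̇_; ∃̇_; isUnorderedPair; isOrderedPair; maps; isFunction; isInjective;
    isRegularCardinal; module Forcing; GIS; ZF⁻; HasApproximationProperty; IsTower;
    TowerConcentratesOn; IsPresaturated; TowerOrder; IsIdeal; SRP; IsContinuousElementaryChain;
    _⊨_[_]; TreeProperty; IsTree; IsCofinalBranch)
import Defs as D
open import Axiom.ExcludedMiddle using (ExcludedMiddle)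
open import Data.Bool.Base using (Bool; true; false; if_then_else_)
open import Data.Empty using (⊥; ⊥-elim)
open import Data.Nat.Base using (ℕ; zero; suc; _+_; _<_; s≤s⁻¹)
open import Data.Nat.Properties
  using (<-cmp; +-suc; +-identityʳ; m≤n⇒m<n∨m≡n; n<1+n; m<n⇒m<1+n; suc-injective; +-comm)
open import Data.Product.Base using (Σ; _×_; _,_; proj₁; proj₂; ∃-syntax)
open import Data.Sum.Base using (_⊎_; inj₁; inj₂; [_,_]′)
open import Data.Unit.Base using (⊤; tt)
open import Function.Base using (id)
open import Function.Bundles using (module Equivalence; mk⇔; _⇔_)
open import Level using (Lift; lift; lower; _⊔_) renaming (suc to lsuc)
open import Relation.Binary.PropositionalEquality.Core
  using (_≡_; refl; sym; trans; cong; subst; cong₂)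
open import Relation.Nullary.Decidable.Core using (yes; no)
open import Relation.Nullary.Negation.Core using (¬_)

-- Since 2^ω > ω₁, a model of size ω₁ misses some reals, and two models need not have the same ones;
-- this is why step 1 must fix r. If Y in M is a countable set of ordinals, its collapse to an
-- ordinal lies in M and turns subsets of Y into bounded subsets of ω₁. When M and M′ share these, a
-- subset of y_ν passes from coll M to coll M′ as soon as both see y_ν, and approximation glues the
-- countable pieces together; this is the uniqueness of nodes in step 2. So a condition can decide a
-- value once and for all. In step 4 the traces are separated by a game of length ω. If β₀ < β₁ are
-- both winning answers and the chosen injection of β₁ into ω₁ sends β₀ outside ν, then no set with
-- trace ν closed under these injections contains both. Two standard facts are drawn from the
-- hypotheses: SRP yields that H_ω₂ is a set, and any model yields an injection of ω₁ × ω₁ into ω₁.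

module Sets (em : ExcludedMiddle 1ℓ) where
  open Equivalence public using (to; from)

  -- Classical logic and elementary set theory in `V`.

  lem : (A : Set₁) → A ⊎ ¬ A
  lem A with em {A}
  ... | yes p = inj₁ p
  ... | no ¬p = inj₂ ¬p

  lem₀ : (A : Set) → A ⊎ ¬ A
  lem₀ A with lem (Lift 1ℓ A)
  ... | inj₁ p = inj₁ (lower p)
  ... | inj₂ ¬p = inj₂ (λ p → ¬p (lift p))

  dne : {A : Set₁} → ¬ ¬ A → A
  dne {A} h with lem A
  ... | inj₁ p = p
  ... | inj₂ ¬p = ⊥-elim (h ¬p)

  dne₀ : {A : Set} → ¬ ¬ A → A
  dne₀ {A} h with lem₀ A
  ... | inj₁ p = p
  ... | inj₂ ¬p = ⊥-elim (h ¬p)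

  -- Separation on `V` accepts only predicates with values in `Set`, whereas most conditions here
  -- quantify over `V`. Excluded middle decides a large proposition, and the decision is small.
  Small : Set₁ → Set
  Small A = [ (λ _ → ⊤) , (λ _ → ⊥) ]′ (lem A)

  small : {A : Set₁} → A → Small A
  small {A} p with lem A
  ... | inj₁ _ = tt
  ... | inj₂ ¬p = ¬p p

  unsmall : {A : Set₁} → Small A → A
  unsmall {A} s with lem A
  ... | inj₁ p = p

  infix 4 _≐_ _∈_ _⊆_
  infixr 6 _∪_
  infixr 7 _∩_
  infixl 8 _‵_

  -- Opaque, so that the sets can be inferred from a membership between them.
  opaque
    _≐_ _∈_ : V → V → Set
    _≐_ = D._≐_
    _∈_ = D._∈_

    ｛_,_｝ ⟨_,_⟩ _∪_ _∩_ _‵_ : V → V → V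
    ｛_,_｝ = D.｛_,_｝
    ⟨_,_⟩ = D.⟨_,_⟩
    _∪_ = D._∪_
    _∩_ = D._∩_
    _‵_ = D._‵_

    ⋃ succ trcl : V → V
    ⋃ = D.⋃
    succ = D.succ
    trcl = D.trcl

    ⟪_∣_⟫ : V → (V → Set₁) → V
    ⟪ a ∣ D ⟫ = D.｛ a ∣ (λ x → Small (D x)) ｝

    -- Two-valued functions on the index type suffice, as excluded middle decides membership in a
    -- subset; so the power set needs no larger universe.
    Pow : V → V
    Pow a = sup (Index a → Bool) λ p → sup (Σ (Index a) λ i → p i ≡ true) λ (i , _) → elt a i

    graph : V → (V → V) → V
    graph a g = sup (Index a) λ i → D.⟨ elt a i , g (elt a i) ⟩

  _⊆_ : V → V → Set₁
  x ⊆ y = ∀ z → z ∈ x → z ∈ y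

  Resp : ∀ {ℓ} → (V → Set ℓ) → Set (1ℓ ⊔ ℓ)
  Resp D = ∀ {x y} → x ≐ y → D x → D y

  Ext : (V → V) → Set₁
  Ext g = ∀ {x y} → x ≐ y → g x ≐ g y

  opaque
    unfolding _∈_

    ≐-refl : ∀ {x} → x ≐ x
    ≐-refl {sup A f} = (λ i → i , ≐-refl) , (λ i → i , ≐-refl)

    ≐-sym : ∀ {x y} → x ≐ y → y ≐ x
    ≐-sym {sup A f} {sup B g} (h , k) =
      (λ j → proj₁ (k j) , ≐-sym {f _} {g j} (proj₂ (k j))) ,
      (λ i → proj₁ (h i) , ≐-sym {f i} {g _} (proj₂ (h i)))

    ≐-trans : ∀ {x y z} → x ≐ y → y ≐ z → x ≐ z
    ≐-trans {sup A f} {sup B g} {sup C e} (h , k) (h′ , k′) =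
      (λ i → proj₁ (h′ (proj₁ (h i))) , ≐-trans {f i} {g _} {e _} (proj₂ (h i)) (proj₂ (h′ (proj₁ (h i))))) ,
      (λ c → proj₁ (k (proj₁ (k′ c))) , ≐-trans {f _} {g _} {e c} (proj₂ (k (proj₁ (k′ c)))) (proj₂ (k′ c)))

    elt∈ : ∀ {x} (i : Index x) → elt x i ∈ x
    elt∈ {x} i = i , ≐-refl {elt x i}

    mem : ∀ {x z} → z ∈ x → Σ (Index x) λ i → z ≐ elt x i
    mem p = p

    ∈-respˡ : ∀ {x y z} → x ≐ y → x ∈ z → y ∈ z
    ∈-respˡ {x} {y} {z} e (i , p) = i , ≐-trans {y} {x} {elt z i} (≐-sym {x} {y} e) p

    ∈-respʳ : ∀ {x y z} → y ≐ z → x ∈ y → x ∈ z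
    ∈-respʳ {x} {sup A f} {sup B g} (h , _) (i , p) = proj₁ (h i) , ≐-trans {x} {f i} {g _} p (proj₂ (h i))

    ⊆-antisym : ∀ {x y} → x ⊆ y → y ⊆ x → x ≐ y
    ⊆-antisym {sup A f} {sup B g} h k =
      (λ i → h (f i) (i , ≐-refl {f i})) ,
      (λ j → proj₁ (k (g j) (j , ≐-refl {g j})) , ≐-sym {g j} {f _} (proj₂ (k (g j) (j , ≐-refl {g j}))))

    ∈-ind : ∀ {ℓ} (P : V → Set ℓ) → (∀ x → (∀ y → y ∈ x → P y) → P x) → ∀ x → P x
    ∈-ind P step x = go x x (≐-refl {x})
      where
      go : ∀ x y → y ≐ x → P y
      go (sup A f) y e = step y λ z z∈y →
        let (i , p) = ∈-respʳ {z} {y} {sup A f} e z∈y in go (f i) z p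

    sep-in : ∀ {a D z} → Resp D → z ∈ a → D z → z ∈ ⟪ a ∣ D ⟫
    sep-in {sup A f} r (i , p) d = (i , small (r p d)) , p

    sep-out : ∀ {a D z} → Resp D → z ∈ ⟪ a ∣ D ⟫ → z ∈ a × D z
    sep-out {sup A f} {D} {z} r ((i , s) , p) = (i , p) , r (≐-sym {z} {f i} p) (unsmall s)

    ∩-in : ∀ {x y z} → z ∈ x → z ∈ y → z ∈ x ∩ y
    ∩-in {sup A f} {y} {z} (i , p) q = (i , ∈-respˡ {z} {f i} {y} p q) , p

    ∩-out : ∀ {x y z} → z ∈ x ∩ y → z ∈ x × z ∈ y
    ∩-out {sup A f} {y} {z} ((i , s) , p) = (i , p) , ∈-respˡ {f i} {z} {y} (≐-sym {z} {f i} p) s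

    ∪-inˡ : ∀ {x y z} → z ∈ x → z ∈ x ∪ y
    ∪-inˡ {sup A f} {sup B g} (i , p) = inj₁ i , p

    ∪-inʳ : ∀ {x y z} → z ∈ y → z ∈ x ∪ y
    ∪-inʳ {sup A f} {sup B g} (i , p) = inj₂ i , p

    ∪-out : ∀ {x y z} → z ∈ x ∪ y → z ∈ x ⊎ z ∈ y
    ∪-out {sup A f} {sup B g} (inj₁ i , p) = inj₁ (i , p)
    ∪-out {sup A f} {sup B g} (inj₂ i , p) = inj₂ (i , p)

    ⋃-in : ∀ {x y z} → z ∈ y → y ∈ x → z ∈ ⋃ x
    ⋃-in {x} {y} {z} q (i , p) = let (j , r) = ∈-respʳ {z} {y} {elt x i} p q in (i , j) , r

    ⋃-out : ∀ {x z} → z ∈ ⋃ x → ∃[ y ] y ∈ x × z ∈ y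
    ⋃-out {x} ((i , j) , p) = elt x i , elt∈ {x} i , (j , p)

    pair-inˡ : ∀ {x y z} → z ≐ x → z ∈ ｛ x , y ｝
    pair-inˡ p = true , p

    pair-inʳ : ∀ {x y z} → z ≐ y → z ∈ ｛ x , y ｝
    pair-inʳ p = false , p

    pair-out : ∀ {x y z} → z ∈ ｛ x , y ｝ → z ≐ x ⊎ z ≐ y
    pair-out (true , p) = inj₁ p
    pair-out (false , p) = inj₂ p

    ∅-out : ∀ {z} → ¬ z ∈ ∅
    ∅-out ()

    ⟨⟩-def : ∀ {x y} → ⟨ x , y ⟩ ≐ ｛ ｛ x , x ｝ , ｛ x , y ｝ ｝
    ⟨⟩-def {x} {y} = ≐-refl {D.⟨ x , y ⟩}

    succ-in : ∀ {x z} → z ∈ x → z ∈ succ x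
    succ-in {x} {z} p = ∪-inˡ {x} {｛ x , x ｝} {z} p

    succ-in≐ : ∀ {x z} → z ≐ x → z ∈ succ x
    succ-in≐ {x} {z} p = ∪-inʳ {x} {｛ x , x ｝} {z} (true , p)

    succ-out : ∀ {x z} → z ∈ succ x → z ∈ x ⊎ z ≐ x
    succ-out {x} {z} p with ∪-out {x} {｛ x , x ｝} {z} p
    ... | inj₁ q = inj₁ q
    ... | inj₂ (true , q) = inj₂ q
    ... | inj₂ (false , q) = inj₂ q

    Pow-out : ∀ {a x} → x ∈ Pow a → x ⊆ a
    Pow-out {a} {x} (p , e) z q =
      let ((i , _) , r) = ∈-respʳ {z} {x} {elt (Pow a) p} e q in i , r

    Pow-in : ∀ {a x} → x ⊆ a → x ∈ Pow a
    Pow-in {a} {x} h = p , ⊆-antisym {x} {elt (Pow a) p} fwd bwd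
      where
      b : {A : Set} → A ⊎ ¬ A → Bool
      b = [ (λ _ → true) , (λ _ → false) ]′
      b⁻ : {A : Set} (s : A ⊎ ¬ A) → b s ≡ true → A
      b⁻ (inj₁ q) _ = q
      b⁺ : {A : Set} (s : A ⊎ ¬ A) → A → b s ≡ true
      b⁺ (inj₁ _) _ = refl
      b⁺ (inj₂ n) q = ⊥-elim (n q)
      p : Index a → Bool
      p i = b (lem₀ (elt a i ∈ x))
      fwd : x ⊆ elt (Pow a) p
      fwd z q = let (i , r) = h z q in
        (i , b⁺ (lem₀ (elt a i ∈ x)) (∈-respˡ {z} {elt a i} {x} r q)) , r
      bwd : elt (Pow a) p ⊆ x
      bwd z ((i , e) , r) = ∈-respˡ {elt a i} {z} {x} (≐-sym {z} {elt a i} r) (b⁻ (lem₀ (elt a i ∈ x)) e)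

    ‵-out : ∀ {f x z} → z ∈ f ‵ x → ∃[ y ] ⟨ x , y ⟩ ∈ f × z ∈ y
    ‵-out {f} (((i , s) , j) , r) = elt (⋃ (⋃ f)) i , s , (j , r)

    ‵-in : ∀ {f x y z} → ⟨ x , y ⟩ ∈ f → z ∈ y → z ∈ f ‵ x
    ‵-in {f} {x} {y} {z} p q = ⋃-in {S} {y} {z} q (go (⋃-in {⋃ f} {｛ x , y ｝} {y} (false , ≐-refl {y})
        (⋃-in {f} {⟨ x , y ⟩} {｛ x , y ｝} (false , ≐-refl {｛ x , y ｝}) p)))
      where
      S : V
      S = D.｛ ⋃ (⋃ f) ∣ (λ z → ⟨ x , z ⟩ ∈ f) ｝
      pair≐ : ∀ {y y′} → y ≐ y′ → ⟨ x , y ⟩ ≐ ⟨ x , y′ ⟩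
      pair≐ e = (λ { true → true , ≐-refl {｛ x , x ｝} ; false → false , lemma e }) ,
                (λ { true → true , ≐-refl {｛ x , x ｝} ; false → false , lemma e })
        where
        lemma : ∀ {y y′} → y ≐ y′ → ｛ x , y ｝ ≐ ｛ x , y′ ｝
        lemma e = (λ { true → true , ≐-refl {x} ; false → false , e }) ,
                  (λ { true → true , ≐-refl {x} ; false → false , e })
      go : y ∈ ⋃ (⋃ f) → y ∈ S
      go (i , e) = (i , ∈-respˡ {⟨ x , y ⟩} {⟨ x , elt (⋃ (⋃ f)) i ⟩} {f} (pair≐ e) p) , e

    graph-mem : ∀ {a g z} → z ∈ graph a g → ∃[ x ] x ∈ a × z ≐ ⟨ x , g x ⟩
    graph-mem {a} {g} (i , p) = elt a i , elt∈ {a} i , p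

    graph-elt : ∀ {a g x} → x ∈ a → ∃[ x′ ] x ≐ x′ × ⟨ x′ , g x′ ⟩ ∈ graph a g
    graph-elt {a} {g} (i , p) = elt a i , p , i , ≐-refl {⟨ elt a i , g (elt a i) ⟩}

  ≐⇒⊆ : ∀ {x y} → x ≐ y → x ⊆ y
  ≐⇒⊆ e z = ∈-respʳ e

  ∈-irrefl : ∀ {x} → ¬ x ∈ x
  ∈-irrefl {x} = ∈-ind (λ x → ¬ x ∈ x) (λ x ih x∈x → ih x x∈x x∈x) x

  ∈-asym : ∀ {x y} → x ∈ y → ¬ y ∈ x
  ∈-asym {x} {y} = ∈-ind (λ x → ∀ y → x ∈ y → ¬ y ∈ x) (λ x ih y p q → ih y q x q p) x y

  minimal : (D : V → Set₁) → ∀ x → D x → ∃[ m ] D m × (∀ y → y ∈ m → ¬ D y)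
  minimal D = ∈-ind _ step
    where
    step : ∀ x → (∀ y → y ∈ x → D y → ∃[ m ] D m × (∀ y → y ∈ m → ¬ D y)) →
      D x → ∃[ m ] D m × (∀ y → y ∈ m → ¬ D y)
    step x ih d with lem (∃[ y ] y ∈ x × D y)
    ... | inj₁ (y , p , dy) = ih y p dy
    ... | inj₂ n = x , d , λ y p dy → n (y , p , dy)

  sep-⊆ : ∀ {a D} → Resp D → ⟪ a ∣ D ⟫ ⊆ a
  sep-⊆ r z p = proj₁ (sep-out r p)

  pair-cong : ∀ {x y x′ y′} → x ≐ x′ → y ≐ y′ → ｛ x , y ｝ ≐ ｛ x′ , y′ ｝
  pair-cong p q = ⊆-antisym (go p q) (go (≐-sym p) (≐-sym q))
    where
    go : ∀ {x y x′ y′} → x ≐ x′ → y ≐ y′ → ｛ x , y ｝ ⊆ ｛ x′ , y′ ｝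
    go p q z r with pair-out r
    ... | inj₁ e = pair-inˡ (≐-trans e p)
    ... | inj₂ e = pair-inʳ (≐-trans e q)

  single-out : ∀ {x z} → z ∈ ｛ x , x ｝ → z ≐ x
  single-out p = [ id , id ]′ (pair-out p)

  ⟨⟩-cong : ∀ {x y x′ y′} → x ≐ x′ → y ≐ y′ → ⟨ x , y ⟩ ≐ ⟨ x′ , y′ ⟩
  ⟨⟩-cong p q = ≐-trans ⟨⟩-def (≐-trans (pair-cong (pair-cong p p) (pair-cong p q)) (≐-sym ⟨⟩-def))

  pair-injˢ : ∀ {x y z} → ｛ x , x ｝ ≐ ｛ y , z ｝ → y ≐ x × z ≐ x
  pair-injˢ e = single-out (∈-respʳ (≐-sym e) (pair-inˡ ≐-refl)) ,
    single-out (∈-respʳ (≐-sym e) (pair-inʳ ≐-refl))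

  pair-cancel : ∀ {x y z} → ｛ x , y ｝ ≐ ｛ x , z ｝ → y ≐ z
  pair-cancel {x} {y} {z} e with pair-out (∈-respʳ e (pair-inʳ ≐-refl))
  ... | inj₂ p = p
  ... | inj₁ y≐x with pair-out (∈-respʳ (≐-sym e) (pair-inʳ ≐-refl))
  ...   | inj₁ z≐x = ≐-trans y≐x (≐-sym z≐x)
  ...   | inj₂ z≐y = ≐-sym z≐y

  ⟨⟩-inj : ∀ {x y x′ y′} → ⟨ x , y ⟩ ≐ ⟨ x′ , y′ ⟩ → x ≐ x′ × y ≐ y′
  ⟨⟩-inj {x} {y} {x′} {y′} e = x≐x′ , pair-cancel (pair-cancel e″)
    where
    e′ : ｛ ｛ x , x ｝ , ｛ x , y ｝ ｝ ≐ ｛ ｛ x′ , x′ ｝ , ｛ x′ , y′ ｝ ｝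
    e′ = ≐-trans (≐-sym ⟨⟩-def) (≐-trans e ⟨⟩-def)
    x≐x′ : x ≐ x′
    x≐x′ with pair-out (∈-respʳ e′ (pair-inˡ ≐-refl))
    ... | inj₁ p = ≐-sym (proj₁ (pair-injˢ p))
    ... | inj₂ p = ≐-sym (proj₁ (pair-injˢ p))
    e″ : ｛ ｛ x , x ｝ , ｛ x , y ｝ ｝ ≐ ｛ ｛ x , x ｝ , ｛ x , y′ ｝ ｝
    e″ = ≐-trans e′ (pair-cong (pair-cong (≐-sym x≐x′) (≐-sym x≐x′)) (pair-cong (≐-sym x≐x′) ≐-refl))

  succ-self : ∀ {x} → x ∈ succ x
  succ-self = succ-in≐ ≐-refl

  succ-ext : Ext succ
  succ-ext e = ⊆-antisym (λ z p → go e (succ-out p)) (λ z p → go (≐-sym e) (succ-out p))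
    where
    go : ∀ {x y z} → x ≐ y → z ∈ x ⊎ z ≐ x → z ∈ succ y
    go e (inj₁ p) = succ-in (∈-respʳ e p)
    go e (inj₂ p) = succ-in≐ (≐-trans p e)

  ⋃-ext : Ext ⋃
  ⋃-ext e = ⊆-antisym (go e) (go (≐-sym e))
    where
    go : ∀ {x y} → x ≐ y → ⋃ x ⊆ ⋃ y
    go e z p = let (w , q , r) = ⋃-out p in ⋃-in r (∈-respʳ e q)

  ∩-ext : ∀ {x x′ y y′} → x ≐ x′ → y ≐ y′ → x ∩ y ≐ x′ ∩ y′
  ∩-ext p q = ⊆-antisym (go p q) (go (≐-sym p) (≐-sym q))
    where
    go : ∀ {x x′ y y′} → x ≐ x′ → y ≐ y′ → x ∩ y ⊆ x′ ∩ y′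
    go p q z r = let (u , v) = ∩-out r in ∩-in (∈-respʳ p u) (∈-respʳ q v)

  ∪-ext : ∀ {x x′ y y′} → x ≐ x′ → y ≐ y′ → x ∪ y ≐ x′ ∪ y′
  ∪-ext p q = ⊆-antisym (go p q) (go (≐-sym p) (≐-sym q))
    where
    go : ∀ {x x′ y y′} → x ≐ x′ → y ≐ y′ → x ∪ y ⊆ x′ ∪ y′
    go p q z r with ∪-out r
    ... | inj₁ s = ∪-inˡ (∈-respʳ p s)
    ... | inj₂ s = ∪-inʳ (∈-respʳ q s)

  sep-ext : ∀ {a b} {D E : V → Set₁} → Resp D → Resp E → a ≐ b →
    (∀ z → z ∈ a → D z → E z) → (∀ z → z ∈ b → E z → D z) → ⟪ a ∣ D ⟫ ≐ ⟪ b ∣ E ⟫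
  sep-ext rD rE e h k = ⊆-antisym
    (λ z p → let (q , d) = sep-out rD p in sep-in rE (∈-respʳ e q) (h z q d))
    (λ z p → let (q , d) = sep-out rE p in sep-in rD (∈-respʳ (≐-sym e) q) (k z q d))

  -- The member of a satisfying D, if there is exactly one; otherwise a junk value.
  opaque
    the : V → (V → Set₁) → V
    the a D = ⋃ ⟪ a ∣ D ⟫

    the-≐ : ∀ {a D y} → Resp D → y ∈ a → D y → (∀ z → z ∈ a → D z → z ≐ y) → the a D ≐ y
    the-≐ {a} {D} {y} r p d u = ⊆-antisym
      (λ z q → let (w , s , t) = ⋃-out q ; (s₁ , s₂) = sep-out r s in ∈-respʳ (u w s₁ s₂) t)
      (λ z q → ⋃-in q (sep-in r p d))

    the-∅ : ∀ {a D} → Resp D → (∀ z → ¬ D z) → the a D ≐ ∅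
    the-∅ r n = ⊆-antisym (λ z p → let (w , q , _) = ⋃-out p in ⊥-elim (n w (proj₂ (sep-out r q)))) (λ z p → ⊥-elim (∅-out p))

    the-ext : ∀ {a b} {D E : V → Set₁} → Resp D → Resp E → a ≐ b →
      (∀ z → z ∈ a → D z → E z) → (∀ z → z ∈ b → E z → D z) → the a D ≐ the b E
    the-ext rD rE e h k = ⋃-ext (sep-ext rD rE e h k)

  IsFunctionOn : V → V → Set₁
  IsFunctionOn f a =
      (∀ p → p ∈ f → ∃[ x ] ∃[ y ] x ∈ a × p ≐ ⟨ x , y ⟩)
    × (∀ x → x ∈ a → ∃[ y ] ⟨ x , y ⟩ ∈ f × (∀ z → ⟨ x , z ⟩ ∈ f → z ≐ y))

  IsInjection : V → V → V → Set₁
  IsInjection f a b =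
      IsFunctionOn f a
    × (∀ x → x ∈ a → f ‵ x ∈ b)
    × (∀ x y → x ∈ a → y ∈ a → f ‵ x ≐ f ‵ y → x ≐ y)

  infix 4 _≼_

  _≼_ : V → V → Set₁
  a ≼ b = ∃[ f ] IsInjection f a b

  ‵-ext : ∀ {f g x y} → f ≐ g → x ≐ y → f ‵ x ≐ g ‵ y
  ‵-ext p q = ⊆-antisym (go p q) (go (≐-sym p) (≐-sym q))
    where
    go : ∀ {f g x y} → f ≐ g → x ≐ y → f ‵ x ⊆ g ‵ y
    go p q z r = let (w , s , t) = ‵-out r in
      ‵-in (∈-respʳ p (∈-respˡ (⟨⟩-cong q ≐-refl) s)) t

  value : ∀ {f a x y} → IsFunctionOn f a → x ∈ a → ⟨ x , y ⟩ ∈ f → f ‵ x ≐ y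
  value {f} {a} {x} {y} (_ , u) x∈a xy∈f = ⊆-antisym
    (λ z p → let (w , q , r) = ‵-out p ; (_ , _ , h) = u x x∈a in
      ∈-respʳ (≐-trans (h w q) (≐-sym (h y xy∈f))) r)
    (λ z p → ‵-in xy∈f p)

  graph-in : ∀ {a g x y} → Ext g → x ∈ a → y ≐ g x → ⟨ x , y ⟩ ∈ graph a g
  graph-in e p q = let (x′ , r , s) = graph-elt p in
    ∈-respˡ (⟨⟩-cong (≐-sym r) (≐-trans (e (≐-sym r)) (≐-sym q))) s

  graph-fun : ∀ {a g} → Ext g → IsFunctionOn (graph a g) a
  graph-fun {a} {g} e =
    (λ p q → let (x , r , s) = graph-mem q in x , g x , r , s) ,
    (λ x x∈a → g x , graph-in e x∈a ≐-refl , λ z q →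
      let (x′ , r , s) = graph-mem q ; (q₁ , q₂) = ⟨⟩-inj s in ≐-trans q₂ (e (≐-sym q₁)))

  graph-value : ∀ {a g x} → Ext g → x ∈ a → graph a g ‵ x ≐ g x
  graph-value e p = value (graph-fun e) p (graph-in e p ≐-refl)

  Inj : V → V → Set₁
  Inj a b = Σ (V → V) λ g → Ext g × (∀ x → x ∈ a → g x ∈ b)
    × (∀ x y → x ∈ a → y ∈ a → g x ≐ g y → x ≐ y)

  ≼⇒Inj : ∀ {a b} → a ≼ b → Inj a b
  ≼⇒Inj (f , _ , r , i) = (f ‵_) , (λ e → ‵-ext ≐-refl e) , r , i

  Inj⇒≼ : ∀ {a b} → Inj a b → a ≼ b
  Inj⇒≼ (g , e , r , i) = graph _ g , graph-fun e ,
    (λ x p → ∈-respˡ (≐-sym (graph-value e p)) (r x p)) ,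
    (λ x y p q h → i x y p q (≐-trans (≐-sym (graph-value e p)) (≐-trans h (graph-value e q))))

  ≼-trans : ∀ {a b c} → a ≼ b → b ≼ c → a ≼ c
  ≼-trans p q with ≼⇒Inj p | ≼⇒Inj q
  ... | (g , e , r , i) | (g′ , e′ , r′ , i′) = Inj⇒≼ ((λ x → g′ (g x)) , (λ h → e′ (e h)) ,
    (λ x h → r′ _ (r x h)) , (λ x y h k l → i x y h k (i′ _ _ (r x h) (r y k) l)))

  ⊆⇒≼ : ∀ {a b} → a ⊆ b → a ≼ b
  ⊆⇒≼ h = Inj⇒≼ ((λ x → x) , (λ e → e) , h , (λ x y _ _ e → e))

  IsFunctionOn-resp : ∀ {f g a b} → f ≐ g → a ≐ b → IsFunctionOn f a → IsFunctionOn g b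
  IsFunctionOn-resp p q (h , u) =
    (λ z r → let (x , y , s , t) = h z (∈-respʳ (≐-sym p) r) in x , y , ∈-respʳ q s , t) ,
    (λ x r → let (y , s , t) = u x (∈-respʳ (≐-sym q) r) in
      y , ∈-respʳ p s , λ z w → t z (∈-respʳ (≐-sym p) w))

  IsInjection-resp : ∀ {f g a a′ b b′} → f ≐ g → a ≐ a′ → b ≐ b′ → IsInjection f a b → IsInjection g a′ b′
  IsInjection-resp p q r (F , t , i) =
    IsFunctionOn-resp p q F ,
    (λ x s → ∈-respʳ r (∈-respˡ (‵-ext p ≐-refl) (t x (∈-respʳ (≐-sym q) s)))) ,
    (λ x y s u e → i x y (∈-respʳ (≐-sym q) s) (∈-respʳ (≐-sym q) u)
      (≐-trans (‵-ext p ≐-refl) (≐-trans e (≐-sym (‵-ext p ≐-refl)))))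

  -- Ordinals.

  Transitive : V → Set₁
  Transitive x = ∀ y → y ∈ x → y ⊆ x

  IsOrdinal : V → Set₁
  IsOrdinal α = Transitive α × (∀ β → β ∈ α → Transitive β)

  IsLimit : V → Set₁
  IsLimit α = IsOrdinal α × ∅ ∈ α × (∀ β → β ∈ α → succ β ∈ α)

  Transitive-resp : Resp Transitive
  Transitive-resp e t z p w q = ∈-respʳ e (t z (∈-respʳ (≐-sym e) p) w q)

  IsOrdinal-resp : Resp IsOrdinal
  IsOrdinal-resp e (t , h) = Transitive-resp e t , λ β p → h β (∈-respʳ (≐-sym e) p)

  ord-elt : ∀ {α β} → IsOrdinal α → β ∈ α → IsOrdinal β
  ord-elt (t , h) p = h _ p , λ γ q → h γ (t _ p γ q)

  trichotomy : ∀ {α β} → IsOrdinal α → IsOrdinal β → α ∈ β ⊎ α ≐ β ⊎ β ∈ α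
  trichotomy {α} {β} oα oβ = ∈-ind (λ α → ∀ β → IsOrdinal α → IsOrdinal β → α ∈ β ⊎ α ≐ β ⊎ β ∈ α)
    (λ α ihα β oα → ∈-ind (λ β → IsOrdinal β → α ∈ β ⊎ α ≐ β ⊎ β ∈ α) (step α ihα oα) β) α β oα oβ
    where
    step : ∀ α → (∀ γ → γ ∈ α → ∀ β → IsOrdinal γ → IsOrdinal β → γ ∈ β ⊎ γ ≐ β ⊎ β ∈ γ) → IsOrdinal α →
      ∀ β → (∀ γ → γ ∈ β → IsOrdinal γ → α ∈ γ ⊎ α ≐ γ ⊎ γ ∈ α) → IsOrdinal β → α ∈ β ⊎ α ≐ β ⊎ β ∈ α
    step α ihα oα β ihβ oβ with lem₀ (α ∈ β) | lem₀ (β ∈ α)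
    ... | inj₁ p | _ = inj₁ p
    ... | inj₂ _ | inj₁ p = inj₂ (inj₂ p)
    ... | inj₂ n | inj₂ m = inj₂ (inj₁ (⊆-antisym fwd bwd))
      where
      fwd : α ⊆ β
      fwd x p with ihα x p β (ord-elt oα p) oβ
      ... | inj₁ q = q
      ... | inj₂ (inj₁ q) = ⊥-elim (m (∈-respˡ q p))
      ... | inj₂ (inj₂ q) = ⊥-elim (m (proj₁ oα x p β q))
      bwd : β ⊆ α
      bwd x p with ihβ x p (ord-elt oβ p)
      ... | inj₁ q = ⊥-elim (n (proj₁ oβ x p α q))
      ... | inj₂ (inj₁ q) = ⊥-elim (n (∈-respˡ (≐-sym q) p))
      ... | inj₂ (inj₂ q) = q

  ord-⊆ : ∀ {α β} → IsOrdinal α → IsOrdinal β → α ⊆ β → α ∈ β ⊎ α ≐ β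
  ord-⊆ oα oβ h with trichotomy oα oβ
  ... | inj₁ p = inj₁ p
  ... | inj₂ (inj₁ p) = inj₂ p
  ... | inj₂ (inj₂ p) = ⊥-elim (∈-irrefl (h _ p))

  ord-∉ : ∀ {α β} → IsOrdinal α → IsOrdinal β → ¬ β ∈ α → α ⊆ β
  ord-∉ oα oβ n with trichotomy oα oβ
  ... | inj₁ p = proj₁ oβ _ p
  ... | inj₂ (inj₁ p) = ≐⇒⊆ p
  ... | inj₂ (inj₂ p) = ⊥-elim (n p)

  ord-⊆∈ : ∀ {α β γ} → IsOrdinal α → IsOrdinal γ → α ⊆ β → β ∈ γ → α ∈ γ
  ord-⊆∈ {α} {β} oα oγ h p with ord-⊆ oα (ord-elt oγ p) h
  ... | inj₁ q = proj₁ oγ β p α q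
  ... | inj₂ q = ∈-respˡ (≐-sym q) p

  ord-trans : ∀ {α β γ} → IsOrdinal γ → α ∈ β → β ∈ γ → α ∈ γ
  ord-trans oγ p q = proj₁ oγ _ q _ p

  ord-succ : ∀ {α} → IsOrdinal α → IsOrdinal (succ α)
  ord-succ {α} oα@(t , h) = tr , λ β p → [ h β , (λ e → Transitive-resp (≐-sym e) t) ]′ (succ-out p)
    where
    tr : Transitive (succ α)
    tr y p z q with succ-out p
    ... | inj₁ r = succ-in (t y r z q)
    ... | inj₂ e = succ-in (∈-respʳ e q)

  ord-⋃ : ∀ {x} → (∀ α → α ∈ x → IsOrdinal α) → IsOrdinal (⋃ x)
  ord-⋃ h = (λ y p z q → let (α , r , s) = ⋃-out p in ⋃-in (proj₁ (h α r) y s z q) r) ,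
    (λ y p → let (α , r , s) = ⋃-out p in proj₂ (h α r) y s)

  ord-max : ∀ {α β γ} → IsOrdinal γ → α ∈ γ → β ∈ γ → α ∪ β ∈ γ
  ord-max {α} {β} oγ p q with trichotomy (ord-elt oγ p) (ord-elt oγ q)
  ... | inj₁ r = ∈-respˡ (⊆-antisym (λ z s → ∪-inʳ s) (λ z s → [ proj₁ (ord-elt oγ q) α r z , id ]′ (∪-out s))) q
  ... | inj₂ (inj₁ r) = ∈-respˡ (⊆-antisym (λ z s → ∪-inʳ s) (λ z s → [ ∈-respʳ r , id ]′ (∪-out s))) q
  ... | inj₂ (inj₂ r) = ∈-respˡ (⊆-antisym (λ z s → ∪-inˡ s) (λ z s → [ id , proj₁ (ord-elt oγ p) β r z ]′ (∪-out s))) p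

  -- A junk value unless some member of the ordinal α satisfies D.
  opaque
    least : V → (V → Set₁) → V
    least α D = the α λ ξ → D ξ × (∀ η → η ∈ ξ → ¬ D η)

    least-spec : ∀ {α D} → IsOrdinal α → Resp D → (∃[ ξ ] ξ ∈ α × D ξ) →
      least α D ∈ α × D (least α D) × (∀ η → η ∈ least α D → ¬ D η)
    least-spec {α} {D} oα r (ξ , p , d) =
      ∈-respˡ (≐-sym e) m∈ , r (≐-sym e) dm , λ η q → mmin η (∈-respʳ e q)
      where
      D′ : V → Set₁
      D′ ξ = D ξ × (∀ η → η ∈ ξ → ¬ D η)
      r′ : Resp D′
      r′ e (d , h) = r e d , λ η q → h η (∈-respʳ (≐-sym e) q)
      m : ∃[ m ] (m ∈ α × D m) × (∀ η → η ∈ m → ¬ (η ∈ α × D η))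
      m = minimal (λ ξ → ξ ∈ α × D ξ) ξ (p , d)
      m∈ : proj₁ m ∈ α
      m∈ = proj₁ (proj₁ (proj₂ m))
      dm : D (proj₁ m)
      dm = proj₂ (proj₁ (proj₂ m))
      mmin : ∀ η → η ∈ proj₁ m → ¬ D η
      mmin η q d = proj₂ (proj₂ m) η q (ord-trans oα q m∈ , d)
      e : least α D ≐ proj₁ m
      e = the-≐ r′ m∈ (dm , mmin) λ z q (dz , hz) → go z q dz hz (trichotomy (ord-elt oα q) (ord-elt oα m∈))
        where
        go : ∀ z → z ∈ α → D z → (∀ η → η ∈ z → ¬ D η) → z ∈ proj₁ m ⊎ z ≐ proj₁ m ⊎ proj₁ m ∈ z → z ≐ proj₁ m
        go z q dz hz (inj₁ s) = ⊥-elim (mmin z s dz)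
        go z q dz hz (inj₂ (inj₁ s)) = s
        go z q dz hz (inj₂ (inj₂ s)) = ⊥-elim (hz _ s dm)

    least-ext : ∀ {α α′} {D E : V → Set₁} → Resp D → Resp E → α ≐ α′ → (∀ ξ → D ξ → E ξ) → (∀ ξ → E ξ → D ξ) →
      least α D ≐ least α′ E
    least-ext r s e h k = the-ext
      (λ e (d , m) → r e d , λ η q → m η (∈-respʳ (≐-sym e) q))
      (λ e (d , m) → s e d , λ η q → m η (∈-respʳ (≐-sym e) q)) e
      (λ z _ (d , m) → h z d , λ η q c → m η q (k η c))
      (λ z _ (d , m) → k z d , λ η q c → m η q (h η c))

  -- Transitive closures and the classes H θ.

  opaque
    unfolding _∈_

    trcl-min : ∀ {t} → Transitive t → ∀ x → x ⊆ t → trcl x ⊆ t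
    trcl-min {t} tr (sup A f) h z p = [ h z , go ]′ (∪-out {sup A f} {D.⋃ (sup A λ i → trcl (f i))} {z} p)
      where
      go : z ∈ ⋃ (sup A λ i → trcl (f i)) → z ∈ t
      go ((i , j) , e) = trcl-min {t} tr (f i) (tr (f i) (h (f i) (i , ≐-refl {f i}))) z (j , e)

    trcl-self : ∀ x → x ⊆ trcl x
    trcl-self (sup A f) z p = ∪-inˡ {sup A f} {D.⋃ (sup A λ i → trcl (f i))} {z} p

    trcl-trans : ∀ x → Transitive (trcl x)
    trcl-trans (sup A f) y p z q = ∪-inʳ {sup A f} {D.⋃ (sup A λ i → trcl (f i))} {z}
      ([ (λ (i , e) → into i (trcl-self (f i) z (∈-respʳ {z} {y} {f i} e q))) ,
         (λ ((i , j) , e) → into i (trcl-trans (f i) y (j , e) z q)) ]′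
        (∪-out {sup A f} {D.⋃ (sup A λ i → trcl (f i))} {y} p))
      where
      into : ∀ i → z ∈ trcl (f i) → z ∈ ⋃ (sup A λ i → trcl (f i))
      into i (j , e) = (i , j) , e

  trcl-∈ : ∀ {x y} → y ∈ x → trcl y ⊆ trcl x
  trcl-∈ {x} {y} p = trcl-min (trcl-trans x) y (trcl-trans x y (trcl-self x y p))

  trcl-⊆ : ∀ {x y} → x ⊆ y → trcl x ⊆ trcl y
  trcl-⊆ {x} {y} h = trcl-min (trcl-trans y) x λ z p → trcl-self y z (h z p)

  H : V → V → Set₁
  H θ x = ∃[ α ] α ∈ θ × trcl x ≼ α

  H-∈ : ∀ {θ x y} → y ∈ x → H θ x → H θ y
  H-∈ p (α , α∈ , i) = α , α∈ , ≼-trans (⊆⇒≼ (trcl-∈ p)) i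

  H-⊆ : ∀ {θ x y} → y ⊆ x → H θ x → H θ y
  H-⊆ h (α , α∈ , i) = α , α∈ , ≼-trans (⊆⇒≼ (trcl-⊆ h)) i

  H-resp : ∀ {θ} → Resp (H θ)
  H-resp e = H-⊆ (≐⇒⊆ (≐-sym e))

  H-mono : ∀ {θ θ′ x} → θ ⊆ θ′ → H θ x → H θ′ x
  H-mono h (α , α∈ , i) = α , h α α∈ , i

  H-transitive : ∀ {θ α x} → Transitive x → x ≼ α → α ∈ θ → H θ x
  H-transitive {x = x} t i p = _ , p , ≼-trans (⊆⇒≼ (trcl-min t x λ _ q → q)) i

  H-⊆ord : ∀ {θ α x} → IsOrdinal α → α ∈ θ → x ⊆ α → H θ x
  H-⊆ord o p h = H-⊆ h (H-transitive (proj₁ o) (⊆⇒≼ λ _ q → q) p)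

-- Choice, countability, and the arithmetic of ω₁ and ω₂.

module Cardinals (em : ExcludedMiddle 1ℓ) (choice : Choice) (ω₁ ω₂ : V)
  (s₁ : IsSuccessorCardinal ω ω₁) (s₂ : IsSuccessorCardinal ω₁ ω₂) where
  open import Data.List.Base using (List; []; _∷_; length)
  open import Relation.Binary.Definitions using (tri<; tri≈; tri>)

  open Sets em

  opaque
    unfolding _∈_

    Im : (V → V) → V → V
    Im g a = sup (Index a) λ i → g (elt a i)

    Im-in : ∀ {g a x y} → Ext g → x ∈ a → y ≐ g x → y ∈ Im g a
    Im-in {g} {a} {x} {y} e (i , p) q = i , ≐-trans {y} {g x} {g (elt a i)} q (e p)

    Im-out : ∀ {g a y} → y ∈ Im g a → ∃[ x ] x ∈ a × y ≐ g x
    Im-out {g} {a} (i , p) = elt a i , elt∈ {a} i , p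

    choiceᵒ : ∀ a → (∀ x → x ∈ a → ∃[ y ] y ∈ x) → ∃[ f ] IsFunctionOn f a × (∀ x → x ∈ a → f ‵ x ∈ x)
    choiceᵒ = choice

    -- The hypothesis already computes a witness, but one that depends on the proof of `x ∈ a` and
    -- hence on an index. Collecting the witnesses over all indices of `x` gives a set that depends
    -- on `x` only up to `≐`, and the axiom of choice picks from it, so the result is extensional.
    choose : ∀ a (D : V → V → Set₁) → (∀ {x x′ y y′} → x ≐ x′ → y ≐ y′ → D x y → D x′ y′) →
      (∀ x → x ∈ a → ∃[ y ] D x y) → Σ (V → V) λ g → Ext g × (∀ x → x ∈ a → D x (g x))
    choose a D r h = g , g-ext , g-D
      where
      c : V → V
      c x = sup (Σ (Index a) λ i → x ≐ elt a i) λ (i , _) → proj₁ (h (elt a i) (elt∈ {a} i))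
      c⊆ : ∀ {x x′} → x ≐ x′ → c x ⊆ c x′
      c⊆ {x} {x′} e z ((i , p) , q) = (i , ≐-trans {x′} {x} {elt a i} (≐-sym {x} {x′} e) p) , q
      c-ext : Ext c
      c-ext {x} {x′} e = ⊆-antisym {c x} {c x′} (c⊆ e) (c⊆ (≐-sym {x} {x′} e))
      f : ∃[ f ] IsFunctionOn f (Im c a) × (∀ x → x ∈ Im c a → f ‵ x ∈ x)
      f = choiceᵒ (Im c a) λ x p → let (w , (i , q) , s) = Im-out {c} {a} {x} p in
        proj₁ (h (elt a i) (elt∈ {a} i)) ,
        ∈-respʳ {_} {c w} {x} (≐-sym {x} {c w} s) ((i , q) , ≐-refl {proj₁ (h (elt a i) (elt∈ {a} i))})
      g : V → V
      g x = proj₁ f ‵ c x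
      g-ext : Ext g
      g-ext {x} {x′} e = ‵-ext {proj₁ f} {proj₁ f} {c x} {c x′} (≐-refl {proj₁ f}) (c-ext e)
      g-D : ∀ x → x ∈ a → D x (g x)
      g-D x p with proj₂ (proj₂ f) (c x) (Im-in {c} {a} {x} {c x} c-ext p (≐-refl {c x}))
      ... | ((i , q) , s) = r (≐-sym {x} {elt a i} q) (≐-sym {g x} {proj₁ (h (elt a i) (elt∈ {a} i))} s)
        (proj₂ (h (elt a i) (elt∈ {a} i)))

    num : ℕ → V
    num = elt ω

    num∈ω : ∀ n → num n ∈ ω
    num∈ω n = elt∈ {ω} n

    ω-out : ∀ {z} → z ∈ ω → Σ ℕ λ n → z ≐ num n
    ω-out p = p

    num-zero : ∀ {z} → ¬ z ∈ num 0
    num-zero ()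

    num-suc : ∀ n → num (suc n) ≐ succ (num n)
    num-suc n = ≐-refl {D.succ (num n)}

    num-∅ : num 0 ≐ ∅
    num-∅ = ⊆-antisym {num 0} {∅} (λ _ ()) (λ _ ())

  Im-ext : ∀ {g} → Ext g → Ext (Im g)
  Im-ext e p = ⊆-antisym (go p) (go (≐-sym p))
    where
    go : ∀ {x y} → x ≐ y → Im _ x ⊆ Im _ y
    go p z q = let (w , s , t) = Im-out q in Im-in e (∈-respʳ p s) t

  num-out : ∀ {n z} → z ∈ num n → Σ ℕ λ m → m < n × z ≐ num m
  num-out {zero} p = ⊥-elim (num-zero p)
  num-out {suc n} p with succ-out (∈-respʳ (num-suc n) p)
  ... | inj₂ e = n , n<1+n n , e
  ... | inj₁ q = let (m , s , e) = num-out q in m , m<n⇒m<1+n s , e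

  num-< : ∀ {m n} → m < n → num m ∈ num n
  num-< {m} {suc n} p with m≤n⇒m<n∨m≡n (s≤s⁻¹ p)
  ... | inj₁ q = ∈-respʳ (≐-sym (num-suc n)) (succ-in (num-< q))
  ... | inj₂ refl = ∈-respʳ (≐-sym (num-suc n)) succ-self

  num-inj : ∀ {m n} → num m ≐ num n → m ≡ n
  num-inj {m} {n} e with <-cmp m n
  ... | tri< p _ _ = ⊥-elim (∈-irrefl (∈-respʳ (≐-sym e) (num-< p)))
  ... | tri≈ _ p _ = p
  ... | tri> _ _ p = ⊥-elim (∈-irrefl (∈-respʳ e (num-< p)))

  ord-num : ∀ n → IsOrdinal (num n)
  ord-num zero = (λ y p → ⊥-elim (num-zero p)) , (λ y p → ⊥-elim (num-zero p))
  ord-num (suc n) = IsOrdinal-resp (≐-sym (num-suc n)) (ord-succ (ord-num n))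

  ord-ω : IsOrdinal ω
  ord-ω = (λ y p z q → let (n , e) = ω-out p ; (m , _ , e′) = num-out (∈-respʳ e q) in ∈-respˡ (≐-sym e′) (num∈ω m)) ,
    (λ y p → let (n , e) = ω-out p in Transitive-resp (≐-sym e) (proj₁ (ord-num n)))

  -- Countability, witnessed by a sequence that may leave the given class.
  Cov : ∀ {ℓ} → (V → Set ℓ) → Set (1ℓ ⊔ ℓ)
  Cov D = Σ (ℕ → V) λ h → ∀ x → D x → Σ ℕ λ n → x ≐ h n

  Countable : V → Set₁
  Countable a = a ≼ ω

  countable⇒cov : ∀ {a} → Countable a → Cov (_∈ a)
  countable⇒cov {a} (f , _ , r , i) = h , λ x p →
    let (n , e) = ω-out (r x p) in n , go x p n e (lem (∃[ x ] x ∈ a × f ‵ x ≐ num n))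
    where
    pick : ∀ n → (∃[ x ] x ∈ a × f ‵ x ≐ num n) ⊎ ¬ (∃[ x ] x ∈ a × f ‵ x ≐ num n) → V
    pick n (inj₁ (x , _)) = x
    pick n (inj₂ _) = ∅
    h : ℕ → V
    h n = pick n (lem _)
    go : ∀ x → x ∈ a → ∀ n → f ‵ x ≐ num n → ∀ d → x ≐ pick n d
    go x p n e (inj₁ (y , q , e′)) = i x y p q (≐-trans e (≐-sym e′))
    go x p n e (inj₂ ¬c) = ⊥-elim (¬c (x , p , e))

  cov⇒countable : ∀ {a} → Cov (_∈ a) → Countable a
  cov⇒countable {a} (h , c) = Inj⇒≼ (g , g-ext , (λ x p → proj₁ (spec x p)) , inj)
    where
    E : V → V → Set₁
    E x ξ = Lift 1ℓ (Σ ℕ λ n → ξ ≐ num n × x ≐ h n)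
    rE : ∀ {x} → Resp (E x)
    rE e (lift (n , p , q)) = lift (n , ≐-trans (≐-sym e) p , q)
    g : V → V
    g x = least ω (E x)
    g-ext : Ext g
    g-ext e = least-ext rE rE ≐-refl
      (λ _ (lift (n , p , q)) → lift (n , p , ≐-trans (≐-sym e) q)) (λ _ (lift (n , p , q)) → lift (n , p , ≐-trans e q))
    spec : ∀ x → x ∈ a → g x ∈ ω × E x (g x) × (∀ η → η ∈ g x → ¬ E x η)
    spec x p = let (n , e) = c x p in least-spec ord-ω rE (num n , num∈ω n , lift (n , ≐-refl , e))
    same : ∀ {x y n m} → n ≡ m → x ≐ h n → y ≐ h m → x ≐ y
    same refl t t′ = ≐-trans t (≐-sym t′)
    inj : ∀ x y → x ∈ a → y ∈ a → g x ≐ g y → x ≐ y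
    inj x y p q e = let lift (n , s , t) = proj₁ (proj₂ (spec x p)) ; lift (m , s′ , t′) = proj₁ (proj₂ (spec y q)) in
      same (num-inj (≐-trans (≐-sym s) (≐-trans e s′))) t t′

  -- Walks along the antidiagonals of ℕ × ℕ: from (0 , b) it jumps to (b + 1 , 0), the start of the
  -- next one.
  unpair : ℕ → ℕ × ℕ
  unpair-next : ℕ × ℕ → ℕ × ℕ
  unpair-next (zero , b) = suc b , 0
  unpair-next (suc a , b) = a , suc b
  unpair zero = 0 , 0
  unpair (suc n) = unpair-next (unpair n)

  unpair-surj : ∀ a b → Σ ℕ λ n → unpair n ≡ (a , b)
  unpair-surj a b = slide b (proj₁ (row (a + b))) a (proj₂ (row (a + b)))
    where
    slide : ∀ b n a → unpair n ≡ (a + b , 0) → Σ ℕ λ n → unpair n ≡ (a , b)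
    slide zero n a e rewrite +-identityʳ a = n , e
    slide (suc b) n a e =
      let (m , e′) = slide b n (suc a) (trans e (cong (_, 0) (+-suc a b))) in suc m , cong unpair-next e′
    row : ∀ s → Σ ℕ λ n → unpair n ≡ (s , 0)
    row zero = 0 , refl
    row (suc s) = let (n , e) = row s ; (m , e′) = slide s n 0 e in suc m , cong unpair-next e′

  -- Enumerates all finite sequences; this keeps hulls countable and makes the binary tree of plays
  -- countable.
  unlist : ℕ → List ℕ
  unlist k = go (proj₁ (unpair k)) (proj₂ (unpair k))
    module Unlist where
    go : ℕ → ℕ → List ℕ
    go zero n = []
    go (suc f) n = proj₁ (unpair n) ∷ go f (proj₂ (unpair n))

  unlist-surj : ∀ l → Σ ℕ λ n → unlist n ≡ l
  unlist-surj l =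
    let (m , e) = code l ; (n , e′) = unpair-surj (length l) m in
    n , trans (cong (λ p → Unlist.go n (proj₁ p) (proj₂ p)) e′) (trans (same n 0 (length l) m) e)
    where
    same : ∀ k k′ f n → Unlist.go k f n ≡ Unlist.go k′ f n
    same k k′ zero n = refl
    same k k′ (suc f) n = cong (_ ∷_) (same k k′ f _)
    code : ∀ l → Σ ℕ λ m → Unlist.go 0 (length l) m ≡ l
    code [] = 0 , refl
    code (x ∷ l) = let (m , e) = code l ; (n , e′) = unpair-surj x m in
      n , trans (cong (λ p → proj₁ p ∷ Unlist.go 0 (length l) (proj₂ p)) e′) (cong (x ∷_) e)

  cov-surj : ∀ {ℓ} {D : V → Set ℓ} {I : Set} (e : ℕ → I) → (∀ i → Σ ℕ λ n → e n ≡ i) →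
    (h : I → V) → (∀ x → D x → Σ I λ i → x ≐ h i) → Cov D
  cov-surj e s h c = (λ n → h (e n)) , λ x d → let (i , p) = c x d ; (n , q) = s i in
    n , subst (λ i → x ≐ h i) (sym q) p

  cov-⋃ : ∀ {ℓ} {D : ℕ → V → Set ℓ} → (∀ n → Cov (D n)) → Cov (λ x → Σ ℕ λ n → D n x)
  cov-⋃ c = cov-surj unpair (λ (a , b) → unpair-surj a b) (λ (n , m) → proj₁ (c n) m)
    λ x (n , d) → let (m , e) = proj₂ (c n) x d in (n , m) , e

  cov-mono : ∀ {ℓ ℓ′} {D : V → Set ℓ} {E : V → Set ℓ′} → (∀ x → E x → D x) → Cov D → Cov E
  cov-mono f (h , c) = h , λ x e → c x (f x e)

  cov-image : ∀ {ℓ ℓ′} {D : V → Set ℓ} {E : V → Set ℓ′} {g : V → V} → Ext g →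
    (∀ y → E y → ∃[ x ] D x × y ≐ g x) → Cov D → Cov E
  cov-image {g = g} e f (h , c) = (λ n → g (h n)) , λ y d → let (x , p , q) = f y d ; (n , s) = c x p in
    n , ≐-trans q (e s)

  cov-∅ : ∀ {ℓ} {D : V → Set ℓ} → (∀ x → ¬ D x) → Cov D
  cov-∅ n = (λ _ → ∅) , λ x d → ⊥-elim (n x d)

  cov-bind : ∀ {D : V → Set₁} {E : V → V → Set₁} → Resp D → Cov D →
    (∀ {x x′ y} → x ≐ x′ → E x y → E x′ y) → (∀ x → D x → Cov (E x)) → Cov (λ y → ∃[ x ] D x × E x y)
  cov-bind {D = D} {E} rD (h , c) rE k = cov-mono
    (λ y (x , d , e) → let (n , p) = c x d in n , rD p d , rE p e)
    (cov-⋃ λ n → pick n (lem (D (h n))))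
    where
    pick : ∀ n → D (h n) ⊎ ¬ D (h n) → Cov (λ y → D (h n) × E (h n) y)
    pick n (inj₁ d) = cov-mono (λ _ p → proj₂ p) (k (h n) d)
    pick n (inj₂ m) = cov-∅ (λ _ p → m (proj₁ p))

  -- The cardinals ω₁ and ω₂.

  opaque
    unfolding _∈_

    cardinal-facts : (IsOrdinal ω₁ × IsOrdinal ω₂) × (ω ∈ ω₁ × ω₁ ∈ ω₂)
      × ((∀ α → α ∈ ω₁ → ¬ ω₁ ≼ α) × (∀ α → α ∈ ω₂ → ¬ ω₂ ≼ α))
      × ((∀ α → α ∈ ω₁ → α ≼ ω) × (∀ α → α ∈ ω₂ → α ≼ ω₁))
    cardinal-facts = let ((o₁ , c₁) , m₁ , l₁) = s₁ ; ((o₂ , c₂) , m₂ , l₂) = s₂ in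
      (o₁ , o₂) , (m₁ , m₂) , (c₁ , c₂) , (l₁ , l₂)

  ord-ω₁ : IsOrdinal ω₁
  ord-ω₁ = proj₁ (proj₁ cardinal-facts)

  ord-ω₂ : IsOrdinal ω₂
  ord-ω₂ = proj₂ (proj₁ cardinal-facts)

  ω∈ω₁ : ω ∈ ω₁
  ω∈ω₁ = proj₁ (proj₁ (proj₂ cardinal-facts))

  ω₁∈ω₂ : ω₁ ∈ ω₂
  ω₁∈ω₂ = proj₂ (proj₁ (proj₂ cardinal-facts))

  ω₁⋠ : ∀ {α} → α ∈ ω₁ → ¬ ω₁ ≼ α
  ω₁⋠ = proj₁ (proj₁ (proj₂ (proj₂ cardinal-facts))) _

  ω₂⋠ : ∀ {α} → α ∈ ω₂ → ¬ ω₂ ≼ α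
  ω₂⋠ = proj₂ (proj₁ (proj₂ (proj₂ cardinal-facts))) _

  ω₁-countable : ∀ {α} → α ∈ ω₁ → Countable α
  ω₁-countable = proj₁ (proj₂ (proj₂ (proj₂ cardinal-facts))) _

  ω₂-small : ∀ {α} → α ∈ ω₂ → α ≼ ω₁
  ω₂-small = proj₂ (proj₂ (proj₂ (proj₂ cardinal-facts))) _

  ω₁-cov : ∀ {α} → α ∈ ω₁ → Cov (_∈ α)
  ω₁-cov p = countable⇒cov (ω₁-countable p)

  ord-in : ∀ {α κ μ} → IsOrdinal μ → (∀ {γ} → γ ∈ μ → ¬ μ ≼ γ) → κ ∈ μ → IsOrdinal α → α ≼ κ → α ∈ μ
  ord-in oμ c p oα q with trichotomy oα oμ
  ... | inj₁ r = r
  ... | inj₂ (inj₁ r) = ⊥-elim (c p (≼-trans (⊆⇒≼ (≐⇒⊆ (≐-sym r))) q))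
  ... | inj₂ (inj₂ r) = ⊥-elim (c p (≼-trans (⊆⇒≼ (proj₁ oα _ r)) q))

  ∈ω₁ : ∀ {α} → IsOrdinal α → Cov (_∈ α) → α ∈ ω₁
  ∈ω₁ oα c = ord-in ord-ω₁ ω₁⋠ ω∈ω₁ oα (cov⇒countable c)

  ∈ω₂ : ∀ {α} → IsOrdinal α → α ≼ ω₁ → α ∈ ω₂
  ∈ω₂ = ord-in ord-ω₂ ω₂⋠ ω₁∈ω₂

  ω₁⊆ω₂ : ω₁ ⊆ ω₂
  ω₁⊆ω₂ = proj₁ ord-ω₂ ω₁ ω₁∈ω₂

  cov-one : ∀ {ℓ} {D : V → Set ℓ} y → (∀ x → D x → x ≐ y) → Cov D
  cov-one y e = (λ _ → y) , λ x d → 0 , e x d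

  cov-single : ∀ {x} → Cov (_∈ ｛ x , x ｝)
  cov-single = cov-one _ λ _ → single-out

  cov-⊎ : ∀ {ℓ ℓ′} {D : V → Set ℓ} {E : V → Set ℓ′} → Cov D → Cov E → Cov (λ x → D x ⊎ E x)
  cov-⊎ {D = D} {E} (h , c) (k , d) = cov-mono
    (λ { x (inj₁ p) → let (n , e) = c x p in 0 , n , e ; x (inj₂ p) → let (n , e) = d x p in 1 , n , e })
    (cov-⋃ {D = λ m x → Σ ℕ λ n → x ≐ f m n} λ m → f m , λ x p → p)
    where
    f : ℕ → ℕ → V
    f zero = h
    f (suc _) = k

  cov-∪ : ∀ {x y} → Cov (_∈ x) → Cov (_∈ y) → Cov (_∈ x ∪ y)
  cov-∪ c d = cov-mono (λ _ p → ∪-out p) (cov-⊎ c d)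

  cov-succ : ∀ {x} → Cov (_∈ x) → Cov (_∈ succ x)
  cov-succ c = cov-mono (λ _ p → succ-out p) (cov-⊎ c (cov-one _ λ _ e → e))

  succ∈ω₁ : ∀ {α} → α ∈ ω₁ → succ α ∈ ω₁
  succ∈ω₁ p = ∈ω₁ (ord-succ (ord-elt ord-ω₁ p)) (cov-succ (ω₁-cov p))

  num∈ω₁ : ∀ n → num n ∈ ω₁
  num∈ω₁ n = ord-trans ord-ω₁ (num∈ω n) ω∈ω₁

  ∅∈ω₁ : ∅ ∈ ω₁
  ∅∈ω₁ = ∈-respˡ num-∅ (num∈ω₁ 0)

  -- The least ordinal above all members of a set of ordinals.
  bnd : V → V
  bnd a = ⋃ (Im succ a)

  bnd-ext : Ext bnd
  bnd-ext e = ⋃-ext (Im-ext succ-ext e)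

  bnd-in : ∀ {a x} → x ∈ a → x ∈ bnd a
  bnd-in p = ⋃-in succ-self (Im-in succ-ext p ≐-refl)

  bnd-out : ∀ {a x} → x ∈ bnd a → ∃[ y ] y ∈ a × x ∈ succ y
  bnd-out p = let (w , q , r) = ⋃-out p ; (y , s , t) = Im-out q in y , s , ∈-respʳ t r

  ord-bnd : ∀ {a} → (∀ x → x ∈ a → IsOrdinal x) → IsOrdinal (bnd a)
  ord-bnd h = ord-⋃ λ α p → let (x , q , e) = Im-out p in IsOrdinal-resp (≐-sym e) (ord-succ (h x q))

  bnd∈ω₁ : ∀ {a} → Cov (_∈ a) → a ⊆ ω₁ → bnd a ∈ ω₁
  bnd∈ω₁ {a} c s = ∈ω₁ (ord-bnd λ x p → ord-elt ord-ω₁ (s x p)) (cov-mono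
    (λ x p → let (y , q , r) = bnd-out p in y , lift q , lift r)
    (cov-bind {D = λ y → Lift 1ℓ (y ∈ a)} {E = λ y x → Lift 1ℓ (x ∈ succ y)}
      (λ e (lift p) → lift (∈-respˡ e p)) (cov-mono (λ x (lift p) → p) c)
      (λ e (lift p) → lift (∈-respʳ (succ-ext e) p))
      λ y (lift p) → cov-mono (λ x (lift q) → q) (ω₁-cov (succ∈ω₁ (s y p)))))

  opaque
    cond : Set₁ → V → V → V
    cond D u v = ⟪ u ∣ (λ _ → D) ⟫ ∪ ⟪ v ∣ (λ _ → ¬ D) ⟫

    cond-yes : ∀ {D u v} → D → cond D u v ≐ u
    cond-yes d = ⊆-antisym
      (λ z p → [ (λ q → proj₁ (sep-out (λ _ x → x) q)) , (λ q → ⊥-elim (proj₂ (sep-out (λ _ x → x) q) d)) ]′ (∪-out p))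
      (λ z p → ∪-inˡ (sep-in (λ _ x → x) p d))

    cond-no : ∀ {D u v} → ¬ D → cond D u v ≐ v
    cond-no d = ⊆-antisym
      (λ z p → [ (λ q → ⊥-elim (d (proj₂ (sep-out (λ _ x → x) q)))) , (λ q → proj₁ (sep-out (λ _ x → x) q)) ]′ (∪-out p))
      (λ z p → ∪-inʳ (sep-in (λ _ x → x) p d))

    cond-ext : ∀ {D E u u′ v v′} → (D → E) → (E → D) → u ≐ u′ → v ≐ v′ → cond D u v ≐ cond E u′ v′
    cond-ext f g p q = ∪-ext
      (sep-ext (λ _ x → x) (λ _ x → x) p (λ _ _ → f) (λ _ _ → g))
      (sep-ext (λ _ x → x) (λ _ x → x) q (λ _ _ n e → n (g e)) (λ _ _ n d → n (f d)))

  even-inj : ∀ m n → m + m ≡ n + n → m ≡ n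
  even-inj zero zero e = refl
  even-inj (suc m) (suc n) e = cong suc (even-inj m n
    (suc-injective (trans (sym (+-suc m m)) (trans (suc-injective e) (+-suc n n)))))

  even≢odd : ∀ m n → ¬ m + m ≡ suc (n + n)
  even≢odd (suc m) zero e with trans (sym (+-suc m m)) (suc-injective e)
  ... | ()
  even≢odd (suc m) (suc n) e = even≢odd m n
    (suc-injective (trans (sym (+-suc m m)) (trans (suc-injective e) (cong suc (+-suc n n)))))

  num-cong : ∀ {m n} → m ≡ n → num m ≐ num n
  num-cong refl = ≐-refl

  opaque
    img : (ℕ → ℕ) → V → V
    img s y = the ω λ ξ → Lift 1ℓ (Σ ℕ λ n → y ≐ num n × ξ ≐ num (s n))

    img-≐ : ∀ {s y} n → y ≐ num n → img s y ≐ num (s n)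
    img-≐ {s} {y} n e = the-≐ (λ { e (lift (n , p , q)) → lift (n , p , ≐-trans (≐-sym e) q) }) (num∈ω _)
      (lift (n , e , ≐-refl))
      λ { z _ (lift (m , p , q)) → ≐-trans q (num-cong (cong s (num-inj (≐-trans (≐-sym p) e)))) }

    img-ext : ∀ {s} → Ext (img s)
    img-ext e = the-ext (λ { e (lift (n , p , q)) → lift (n , p , ≐-trans (≐-sym e) q) })
      (λ { e (lift (n , p , q)) → lift (n , p , ≐-trans (≐-sym e) q) }) ≐-refl
      (λ { _ _ (lift (n , p , q)) → lift (n , ≐-trans (≐-sym e) p , q) })
      (λ { _ _ (lift (n , p , q)) → lift (n , ≐-trans e p , q) })

  IsNum : V → Set₁
  IsNum y = Lift 1ℓ (Σ ℕ λ n → y ≐ num n)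

  -- Hilbert's hotel: numerals move to the even ones.
  opaque
    double : V → V
    double y = cond (IsNum y) (img (λ n → n + n) y) y

    double-ext : Ext double
    double-ext e = cond-ext (λ (lift (n , p)) → lift (n , ≐-trans (≐-sym e) p))
      (λ (lift (n , p)) → lift (n , ≐-trans e p)) (img-ext e) e

    double-cases : ∀ y → (Σ ℕ λ n → y ≐ num n × double y ≐ num (n + n)) ⊎ (¬ IsNum y × double y ≐ y)
    double-cases y = go (lem (IsNum y))
      where
      go : IsNum y ⊎ ¬ IsNum y → (Σ ℕ λ n → y ≐ num n × double y ≐ num (n + n)) ⊎ (¬ IsNum y × double y ≐ y)
      go (inj₁ p@(lift (n , e))) = inj₁ (n , e , ≐-trans (cond-yes p) (img-≐ n e))
      go (inj₂ n) = inj₂ (n , cond-no n)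

  double-inj : ∀ {y z} → double y ≐ double z → y ≐ z
  double-inj {y} {z} e = go (double-cases y) (double-cases z)
    where
    Cases : V → Set₁
    Cases y = (Σ ℕ λ n → y ≐ num n × double y ≐ num (n + n)) ⊎ (¬ IsNum y × double y ≐ y)
    go : Cases y → Cases z → y ≐ z
    go (inj₁ (n , p , q)) (inj₁ (m , p′ , q′)) = ≐-trans p (≐-trans
      (num-cong (even-inj n m (num-inj (≐-trans (≐-sym q) (≐-trans e q′))))) (≐-sym p′))
    go (inj₁ (n , p , q)) (inj₂ (¬N , q′)) = ⊥-elim (¬N (lift (n + n , ≐-trans (≐-sym q′) (≐-trans (≐-sym e) q))))
    go (inj₂ (¬N , q)) (inj₁ (n , p , q′)) = ⊥-elim (¬N (lift (n + n , ≐-trans (≐-sym q) (≐-trans e q′))))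
    go (inj₂ (_ , q)) (inj₂ (_ , q′)) = ≐-trans (≐-sym q) (≐-trans e q′)

  double≢odd : ∀ {y} n → ¬ double y ≐ num (suc (n + n))
  double≢odd {y} n e = [ (λ (m , _ , q) → even≢odd m n (num-inj (≐-trans (≐-sym q) e))) ,
    (λ (¬N , q) → ¬N (lift (_ , ≐-trans (≐-sym q) e))) ]′ (double-cases y)

  -- Moving the numerals among the values of the first injection to even numerals frees the odd ones
  -- for `c`. This replaces cardinal addition when countably many elements join a set.
  absorb : ∀ {a b c} → a ≼ b → Cov (_∈ c) → ω ⊆ b → a ∪ c ≼ b
  absorb {a} {b} {c} a≼b cc ω⊆b = go (≼⇒Inj a≼b) (≼⇒Inj (cov⇒countable cc))
    where
    go : Inj a b → Inj c ω → a ∪ c ≼ b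
    go (g , eg , gr , gi) (k , ek , kr , ki) = Inj⇒≼ (f , f-ext , f∈ , f-inj)
      where
      f : V → V
      f x = cond (Lift 1ℓ (x ∈ a)) (double (g x)) (img (λ n → suc (n + n)) (k x))
      f-ext : Ext f
      f-ext e = cond-ext (λ (lift p) → lift (∈-respˡ e p)) (λ (lift p) → lift (∈-respˡ (≐-sym e) p))
        (double-ext (eg e)) (img-ext (ek e))
      Cases : V → Set
      Cases x = (x ∈ a × f x ≐ double (g x)) ⊎ (x ∈ c × Σ ℕ λ n → k x ≐ num n × f x ≐ num (suc (n + n)))
      F : ∀ x → x ∈ a ∪ c → Cases x
      F x p = by (lem₀ (x ∈ a)) (∪-out p)
        where
        by : x ∈ a ⊎ ¬ x ∈ a → x ∈ a ⊎ x ∈ c → Cases x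
        by (inj₁ q) _ = inj₁ (q , cond-yes (lift q))
        by (inj₂ q) (inj₁ r) = ⊥-elim (q r)
        by (inj₂ q) (inj₂ r) = let (n , e) = ω-out (kr x r) in
          inj₂ (r , n , e , ≐-trans (cond-no (λ (lift s) → q s)) (img-≐ n e))
      f∈ : ∀ x → x ∈ a ∪ c → f x ∈ b
      f∈ x p = [ (λ (q , e) → [ (λ (n , _ , e′) → ω⊆b _ (∈-respˡ (≐-sym (≐-trans e e′)) (num∈ω _))) ,
          (λ (_ , e′) → ∈-respˡ (≐-sym (≐-trans e e′)) (gr x q)) ]′ (double-cases (g x))) ,
        (λ (_ , n , _ , e) → ω⊆b _ (∈-respˡ (≐-sym e) (num∈ω _))) ]′ (F x p)
      f-inj : ∀ x y → x ∈ a ∪ c → y ∈ a ∪ c → f x ≐ f y → x ≐ y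
      f-inj x y p q e = by (F x p) (F y q)
        where
        by : Cases x → Cases y → x ≐ y
        by (inj₁ (r , s)) (inj₁ (r′ , s′)) = gi x y r r′ (double-inj (≐-trans (≐-sym s) (≐-trans e s′)))
        by (inj₁ (r , s)) (inj₂ (r′ , n , _ , s′)) = ⊥-elim (double≢odd n (≐-trans (≐-sym s) (≐-trans e s′)))
        by (inj₂ (r′ , n , _ , s′)) (inj₁ (r , s)) = ⊥-elim (double≢odd n (≐-trans (≐-sym s) (≐-trans (≐-sym e) s′)))
        by (inj₂ (r , n , t , s)) (inj₂ (r′ , m , t′ , s′)) = ki x y r r′ (≐-trans t (≐-trans
          (num-cong (even-inj n m (suc-injective (num-inj (≐-trans (≐-sym s) (≐-trans e s′)))))) (≐-sym t′)))

  ω⊆ω₁ : ω ⊆ ω₁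
  ω⊆ω₁ = proj₁ ord-ω₁ ω ω∈ω₁

  succ∈ω₂ : ∀ {α} → α ∈ ω₂ → succ α ∈ ω₂
  succ∈ω₂ {α} p = ∈ω₂ (ord-succ (ord-elt ord-ω₂ p)) (≼-trans
    (⊆⇒≼ λ x q → [ ∪-inˡ , (λ e → ∪-inʳ (pair-inˡ e)) ]′ (succ-out q))
    (absorb (ω₂-small p) cov-single ω⊆ω₁))

  -- Kept as a hypothesis, because the collapse of any guessing model supplies it: it contains all
  -- pairs of countable ordinals and has size at most ω₁. Gödel's pairing of ordinals is thus
  -- avoided.
  Pairing : Set₁
  Pairing = Σ (V → V → V) λ p → (∀ {x x′ y y′} → x ≐ x′ → y ≐ y′ → p x y ≐ p x′ y′)
    × (∀ x y → x ∈ ω₁ → y ∈ ω₁ → p x y ∈ ω₁)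
    × (∀ x y x′ y′ → x ∈ ω₁ → y ∈ ω₁ → x′ ∈ ω₁ → y′ ∈ ω₁ → p x y ≐ p x′ y′ → x ≐ x′ × y ≐ y′)

  module _ (pairing : Pairing) where

    union-small : ∀ {g} → Ext g → (∀ ν → ν ∈ ω₁ → g ν ≼ ω₁) → ⋃ (Im g ω₁) ≼ ω₁
    union-small {g} eg h = Inj⇒≼ (f , f-ext , into , inj)
      where
      p = proj₁ pairing
      p-ext = proj₁ (proj₂ pairing)
      p∈ = proj₁ (proj₂ (proj₂ pairing))
      p-inj = proj₂ (proj₂ (proj₂ pairing))
      Φ = choose ω₁ (λ ν f → IsInjection f (g ν) ω₁) (λ e e′ → IsInjection-resp e′ (eg e) ≐-refl) h
      φ = proj₁ Φ
      N = choose (⋃ (Im g ω₁)) (λ x ν → Lift 1ℓ (ν ∈ ω₁ × x ∈ g ν))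
        (λ { e e′ (lift (p , q)) → lift (∈-respˡ e′ p , ∈-respˡ e (∈-respʳ (eg e′) q)) })
        (λ x q → let (w , r , s) = ⋃-out q ; (ν , t , u) = Im-out r in ν , lift (t , ∈-respʳ u s))
      n = proj₁ N
      n∈ : ∀ {x} → x ∈ ⋃ (Im g ω₁) → n x ∈ ω₁
      n∈ q = proj₁ (lower (proj₂ (proj₂ N) _ q))
      n∋ : ∀ {x} → x ∈ ⋃ (Im g ω₁) → x ∈ g (n x)
      n∋ q = proj₂ (lower (proj₂ (proj₂ N) _ q))
      φ-inj : ∀ {x} → x ∈ ⋃ (Im g ω₁) → IsInjection (φ (n x)) (g (n x)) ω₁
      φ-inj q = proj₂ (proj₂ Φ) _ (n∈ q)
      f : V → V
      f x = p (n x) (φ (n x) ‵ x)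
      f-ext : Ext f
      f-ext e = p-ext (proj₁ (proj₂ N) e) (‵-ext (proj₁ (proj₂ Φ) (proj₁ (proj₂ N) e)) e)
      v∈ : ∀ x → x ∈ ⋃ (Im g ω₁) → φ (n x) ‵ x ∈ ω₁
      v∈ x q = proj₁ (proj₂ (φ-inj q)) x (n∋ q)
      into : ∀ x → x ∈ ⋃ (Im g ω₁) → f x ∈ ω₁
      into x q = p∈ _ _ (n∈ q) (v∈ x q)
      inj : ∀ x y → x ∈ ⋃ (Im g ω₁) → y ∈ ⋃ (Im g ω₁) → f x ≐ f y → x ≐ y
      inj x y q r e with p-inj _ _ _ _ (n∈ q) (v∈ x q) (n∈ r) (v∈ y r) e
      ... | (a , b) = proj₂ (proj₂ (φ-inj q)) x y (n∋ q) (∈-respʳ (eg (≐-sym a)) (n∋ r))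
        (≐-trans b (‵-ext (proj₁ (proj₂ Φ) (≐-sym a)) ≐-refl))

    bnd∈ω₂ : ∀ {g} → Ext g → (∀ ν → ν ∈ ω₁ → g ν ∈ ω₂) → bnd (Im g ω₁) ∈ ω₂
    bnd∈ω₂ {g} eg h = ∈ω₂ (ord-bnd λ x q → let (ν , r , s) = Im-out q in
        ord-elt ord-ω₂ (∈-respˡ (≐-sym s) (h ν r)))
      (≼-trans (⊆⇒≼ λ x q → let (y , r , s) = bnd-out q ; (ν , t , u) = Im-out r in
          ⋃-in (∈-respʳ (succ-ext u) s) (Im-in (λ e → succ-ext (eg e)) t ≐-refl))
        (union-small (λ e → succ-ext (eg e)) λ ν q → ω₂-small (succ∈ω₂ (h ν q))))

  -- One choice of injections `E β` for the whole proof. They define the exhaustions of ordinals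
  -- below ω₂, the values decided in the tower, and the separation of plays in the game.
  E-system : Σ (V → V) λ E → Ext E × (∀ β → β ∈ ω₂ → IsInjection (E β) β ω₁)
  E-system = choose ω₂ (λ β f → IsInjection f β ω₁) (λ e e′ → IsInjection-resp e′ e ≐-refl) (λ β → ω₂-small)

  E : V → V
  E = proj₁ E-system

  E-ext : Ext E
  E-ext = proj₁ (proj₂ E-system)

  E∈ : ∀ {β ξ} → β ∈ ω₂ → ξ ∈ β → E β ‵ ξ ∈ ω₁
  E∈ p q = proj₁ (proj₂ (proj₂ (proj₂ E-system) _ p)) _ q

  E-inj : ∀ {β ξ η} → β ∈ ω₂ → ξ ∈ β → η ∈ β → E β ‵ ξ ≐ E β ‵ η → ξ ≐ η
  E-inj p q r = proj₂ (proj₂ (proj₂ (proj₂ E-system) _ p)) _ _ q r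

  Bdd : V → Set₁
  Bdd x = ∃[ ε ] ε ∈ ω₁ × x ⊆ ε

  Bdd-resp : Resp Bdd
  Bdd-resp e (ε , p , h) = ε , p , λ z q → h z (∈-respʳ (≐-sym e) q)

  -- These stand for the reals of `M`: a subset of a countable set of ordinals in `M` is coded,
  -- through the order type, by a bounded subset of ω₁.
  R : V → V
  R a = ⟪ a ∣ Bdd ⟫

-- The forcing relation, and a name for an injection that destroys a cardinal.

module Forced (em : ExcludedMiddle 1ℓ) (P : V) (_≤_ : V → V → Set₁)
  (≤-refl : ∀ i → elt P i ≤ elt P i)
  (≤-trans : ∀ i j k → elt P i ≤ elt P j → elt P j ≤ elt P k → elt P i ≤ elt P k) where
  open import Data.Fin.Base using (Fin; zero; suc)
  open import Data.Vec.Base using (Vec; []; _∷_; lookup)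

  open Sets em
  open Forcing P _≤_

  private
    variable
      n : ℕ

  ⊑-refl : ∀ {p} → p ⊑ p
  ⊑-refl {p} = ≤-refl p

  ⊑-trans : ∀ {p q r} → p ⊑ q → q ⊑ r → p ⊑ r
  ⊑-trans {p} {q} {r} = ≤-trans p q r

  dense-mono : ∀ {p q D} → q ⊑ p → DenseBelow p D → DenseBelow q D
  dense-mono q⊑p d r r⊑q = d r (⊑-trans r⊑q q⊑p)

  dense-map : ∀ {p} {D E : Condition → Set₁} → (∀ q → q ⊑ p → D q → E q) → DenseBelow p D → DenseBelow p E
  dense-map f d q q⊑p = let (r , r⊑q , e) = d q q⊑p in r , r⊑q , f r (⊑-trans r⊑q q⊑p) e

  dense-for : ∀ {p} {D E : Condition → Set₁} → DenseBelow p D → (∀ q → q ⊑ p → D q → E q) → DenseBelow p E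
  dense-for d f = dense-map f d

  dense-bind : ∀ {p} {D E : Condition → Set₁} → DenseBelow p D → (∀ q → q ⊑ p → D q → DenseBelow q E) → DenseBelow p E
  dense-bind d f q q⊑p =
    let (r , r⊑q , e) = d q q⊑p ; (s , s⊑r , e′) = f r (⊑-trans r⊑q q⊑p) e r ⊑-refl in s , ⊑-trans s⊑r r⊑q , e′

  dense-now : ∀ {p} {D : Condition → Set₁} → (∀ q → q ⊑ p → D q) → DenseBelow p D
  dense-now f q q⊑p = q , ⊑-refl , f q q⊑p

  ⊩≈-mono : ∀ {p q σ τ} → q ⊑ p → p ⊩ σ ≈ τ → q ⊩ σ ≈ τ
  ⊩≈-mono {σ = name A σ s} {name B τ t} h (f , g) = (λ i → dense-mono h (f i)) , (λ j → dense-mono h (g j))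

  ⊩≈-dense : ∀ {p σ τ} → DenseBelow p (λ q → q ⊩ σ ≈ τ) → p ⊩ σ ≈ τ
  ⊩≈-dense {σ = name A σ s} {name B τ t} d =
    (λ i → dense-bind d λ q _ (f , _) → f i) , (λ j → dense-bind d λ q _ (_ , g) → g j)

  ⊩≈-refl : ∀ {p} σ → p ⊩ σ ≈ σ
  ⊩≈-refl (name A σ s) = (λ i → dense-now λ q _ h → i , h , ⊩≈-refl (σ i)) ,
    (λ i → dense-now λ q _ h → i , h , ⊩≈-refl (σ i))

  ⊩≈-sym : ∀ {p} σ τ → p ⊩ σ ≈ τ → p ⊩ τ ≈ σ
  ⊩≈-sym (name A σ s) (name B τ t) (f , g) =
    (λ j → dense-for (g j) λ q _ k h → let (i , a , b) = k h in i , a , ⊩≈-sym (σ i) (τ j) b) ,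
    (λ i → dense-for (f i) λ q _ k h → let (j , a , b) = k h in j , a , ⊩≈-sym (σ i) (τ j) b)

  ⊩≈-trans : ∀ {p} σ τ υ → p ⊩ σ ≈ τ → p ⊩ τ ≈ υ → p ⊩ σ ≈ υ
  ⊩≈-trans {p} (name A σ s) (name B τ t) (name C υ u) (f , g) (f′ , g′) = fwd , bwd
    where
    fwd : ∀ i → DenseBelow p λ q → q ⊑ s i → Σ C λ k → q ⊑ u k × (q ⊩ σ i ≈ υ k)
    fwd i q q⊑p = by (lem (q ⊑ s i))
      where
      by : q ⊑ s i ⊎ ¬ q ⊑ s i → Σ Condition λ v → v ⊑ q × (v ⊑ s i → Σ C λ k → v ⊑ u k × (v ⊩ σ i ≈ υ k))
      by (inj₂ ¬h) = q , ⊑-refl , λ h → ⊥-elim (¬h h)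
      by (inj₁ q⊑s) =
        let (v , v⊑q , h) = f i q q⊑p ; (j , a , b) = h (⊑-trans v⊑q q⊑s)
            (w , w⊑v , h′) = f′ j v (⊑-trans v⊑q q⊑p) ; (l , a′ , b′) = h′ (⊑-trans w⊑v a) in
        w , ⊑-trans w⊑v v⊑q , λ _ → l , a′ , ⊩≈-trans (σ i) (τ j) (υ l) (⊩≈-mono w⊑v b) b′
    bwd : ∀ k → DenseBelow p λ q → q ⊑ u k → Σ A λ i → q ⊑ s i × (q ⊩ σ i ≈ υ k)
    bwd k q q⊑p = by (lem (q ⊑ u k))
      where
      by : q ⊑ u k ⊎ ¬ q ⊑ u k → Σ Condition λ v → v ⊑ q × (v ⊑ u k → Σ A λ i → v ⊑ s i × (v ⊩ σ i ≈ υ k))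
      by (inj₂ ¬h) = q , ⊑-refl , λ h → ⊥-elim (¬h h)
      by (inj₁ q⊑u) =
        let (v , v⊑q , h) = g′ k q q⊑p ; (j , a , b) = h (⊑-trans v⊑q q⊑u)
            (w , w⊑v , h′) = g j v (⊑-trans v⊑q q⊑p) ; (l , a′ , b′) = h′ (⊑-trans w⊑v a) in
        w , ⊑-trans w⊑v v⊑q , λ _ → l , a′ , ⊩≈-trans (σ l) (τ j) (υ k) b′ (⊩≈-mono w⊑v b)

  ⊩∈-dense : ∀ {p σ τ} → DenseBelow p (λ q → q ⊩ σ ∈ τ) → p ⊩ σ ∈ τ
  ⊩∈-dense {τ = name B τ t} d = dense-bind d λ _ _ h → h

  ⊩∈-mono : ∀ {p q σ τ} → q ⊑ p → p ⊩ σ ∈ τ → q ⊩ σ ∈ τ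
  ⊩∈-mono {τ = name B τ t} = dense-mono

  ⊩∈-respˡ : ∀ {p} σ σ′ τ → p ⊩ σ ≈ σ′ → p ⊩ σ ∈ τ → p ⊩ σ′ ∈ τ
  ⊩∈-respˡ σ σ′ (name B τ t) e = dense-map λ q q⊑p (j , a , b) →
    j , a , ⊩≈-trans σ′ σ (τ j) (⊩≈-sym σ σ′ (⊩≈-mono q⊑p e)) b

  ⊩∈-respʳ : ∀ {p} σ τ τ′ → p ⊩ τ ≈ τ′ → p ⊩ σ ∈ τ → p ⊩ σ ∈ τ′
  ⊩∈-respʳ σ (name B τ t) (name C υ u) (f , g) d = dense-bind d λ q q⊑p (j , a , b) → dense-for
    (dense-mono q⊑p (f j))
    λ r r⊑q h → let (l , a′ , b′) = h (⊑-trans r⊑q a) in l , a′ , ⊩≈-trans σ (τ j) (υ l) (⊩≈-mono r⊑q b) b′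

  ⊩≈-ext : ∀ {p} τ τ′ → (∀ q → q ⊑ p → ∀ σ → q ⊩ σ ∈ τ → q ⊩ σ ∈ τ′) →
    (∀ q → q ⊑ p → ∀ σ → q ⊩ σ ∈ τ′ → q ⊩ σ ∈ τ) → p ⊩ τ ≈ τ′
  ⊩≈-ext {p} (name B τ t) (name C υ u) h k = fwd , bwd
    where
    fwd : ∀ i → DenseBelow p λ q → q ⊑ t i → Σ C λ j → q ⊑ u j × (q ⊩ τ i ≈ υ j)
    fwd i q q⊑p = [ (λ q⊑t → let (r , r⊑q , e) = h q q⊑p (τ i)
                                               (dense-now λ r r⊑q → i , ⊑-trans r⊑q q⊑t , ⊩≈-refl (τ i)) q ⊑-refl in r , r⊑q , λ _ → e) ,
      (λ n → q , ⊑-refl , λ q⊑t → ⊥-elim (n q⊑t)) ]′ (lem (q ⊑ t i))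
    bwd : ∀ j → DenseBelow p λ q → q ⊑ u j → Σ B λ i → q ⊑ t i × (q ⊩ τ i ≈ υ j)
    bwd j q q⊑p = [ (λ q⊑u → let (r , r⊑q , (i , a , b)) = k q q⊑p (υ j)
                                               (dense-now λ r r⊑q → j , ⊑-trans r⊑q q⊑u , ⊩≈-refl (υ j)) q ⊑-refl in
          r , r⊑q , λ _ → i , a , ⊩≈-sym (υ j) (τ i) b) ,
      (λ n → q , ⊑-refl , λ q⊑u → ⊥-elim (n q⊑u)) ]′ (lem (q ⊑ u j))

  ⊩-mono : ∀ {p q} (φ : Formula n) ρ → q ⊑ p → p ⊩ φ [ ρ ] → q ⊩ φ [ ρ ]
  ⊩-mono (i ∈̇ j) ρ h = ⊩∈-mono h
  ⊩-mono (i ≈̇ j) ρ h = ⊩≈-mono h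
  ⊩-mono (¬̇ φ) ρ h f r r⊑q = f r (⊑-trans r⊑q h)
  ⊩-mono (φ ∧̇ ψ) ρ h (a , b) = ⊩-mono φ ρ h a , ⊩-mono ψ ρ h b
  ⊩-mono (∀̇ φ) ρ h f σ = ⊩-mono φ (σ ∷ ρ) h (f σ)

  ⊩-dense : ∀ {p} (φ : Formula n) ρ → DenseBelow p (λ q → q ⊩ φ [ ρ ]) → p ⊩ φ [ ρ ]
  ⊩-dense (i ∈̇ j) ρ d = ⊩∈-dense d
  ⊩-dense (i ≈̇ j) ρ d = ⊩≈-dense d
  ⊩-dense (¬̇ φ) ρ d q q⊑p h = let (r , r⊑q , n) = d q q⊑p in n r ⊑-refl (⊩-mono φ ρ r⊑q h)
  ⊩-dense (φ ∧̇ ψ) ρ d = ⊩-dense φ ρ (dense-map (λ _ _ → proj₁) d) , ⊩-dense ψ ρ (dense-map (λ _ _ → proj₂) d)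
  ⊩-dense (∀̇ φ) ρ d σ = ⊩-dense φ (σ ∷ ρ) (dense-map (λ _ _ f → f σ) d)

  -- The coded implication, disjunction and existential are negations, and forcing a negation says
  -- that no stronger condition forces the formula. Classically this yields density, on which the
  -- eliminations below rest.
  ¬¬-dense : ∀ {p} {D : Condition → Set₁} → (∀ q → q ⊑ p → ¬ (∀ r → r ⊑ q → ¬ D r)) → DenseBelow p D
  ¬¬-dense h q q⊑p = dne λ n → h q q⊑p λ r r⊑q d → n (r , r⊑q , d)

  ⇒-intro : ∀ {p} (φ ψ : Formula n) ρ → (∀ q → q ⊑ p → q ⊩ φ [ ρ ] → q ⊩ ψ [ ρ ]) → p ⊩ φ ⇒̇ ψ [ ρ ]
  ⇒-intro φ ψ ρ f q q⊑p (a , b) = b q ⊑-refl (f q q⊑p a)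

  ⇒-elim : ∀ {p} (φ ψ : Formula n) ρ → p ⊩ φ ⇒̇ ψ [ ρ ] → p ⊩ φ [ ρ ] → p ⊩ ψ [ ρ ]
  ⇒-elim φ ψ ρ f a = ⊩-dense ψ ρ (¬¬-dense λ q q⊑p n → f q q⊑p (⊩-mono φ ρ q⊑p a , n))

  ∃-intro : ∀ {p} (φ : Formula (suc n)) ρ → DenseBelow p (λ q → Σ Name λ σ → q ⊩ φ [ σ ∷ ρ ]) → p ⊩ ∃̇ φ [ ρ ]
  ∃-intro φ ρ d q q⊑p n = let (r , r⊑q , σ , h) = d q q⊑p in n σ r r⊑q h

  ∃-elim : ∀ {p} (φ : Formula (suc n)) ρ → p ⊩ ∃̇ φ [ ρ ] → DenseBelow p (λ q → Σ Name λ σ → q ⊩ φ [ σ ∷ ρ ])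
  ∃-elim φ ρ f = ¬¬-dense λ q q⊑p n → f q q⊑p λ σ r r⊑q h → n r r⊑q (σ , h)

  ∨-intro : ∀ {p} (φ ψ : Formula n) ρ → DenseBelow p (λ q → (q ⊩ φ [ ρ ]) ⊎ (q ⊩ ψ [ ρ ])) → p ⊩ φ ∨̇ ψ [ ρ ]
  ∨-intro φ ψ ρ d q q⊑p (a , b) = let (r , r⊑q , h) = d q q⊑p in [ a r r⊑q , b r r⊑q ]′ h

  ∨-elim : ∀ {p} (φ ψ : Formula n) ρ → p ⊩ φ ∨̇ ψ [ ρ ] → DenseBelow p (λ q → (q ⊩ φ [ ρ ]) ⊎ (q ⊩ ψ [ ρ ]))
  ∨-elim φ ψ ρ f = ¬¬-dense λ q q⊑p n →
    f q q⊑p ((λ r r⊑q h → n r r⊑q (inj₁ h)) , (λ r r⊑q h → n r r⊑q (inj₂ h)))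

  ⇔-intro : ∀ {p} (φ ψ : Formula n) ρ → (∀ q → q ⊑ p → q ⊩ φ [ ρ ] → q ⊩ ψ [ ρ ]) →
    (∀ q → q ⊑ p → q ⊩ ψ [ ρ ] → q ⊩ φ [ ρ ]) → p ⊩ φ ⇔̇ ψ [ ρ ]
  ⇔-intro φ ψ ρ f g = ⇒-intro φ ψ ρ f , ⇒-intro ψ φ ρ g

  -- Names for the unordered and the ordered pair. Every condition occurs as a label, since no
  -- greatest condition is at hand.
  up op : Name → Name → Name
  up σ τ = name (Bool × Condition) (λ (b , _) → if b then σ else τ) proj₂
  op σ τ = up (up σ σ) (up σ τ)

  up-inˡ : ∀ {p} ν σ τ → p ⊩ ν ≈ σ → p ⊩ ν ∈ up σ τ
  up-inˡ ν σ τ e = dense-now λ q q⊑p → (true , q) , ⊑-refl , ⊩≈-mono q⊑p e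

  up-inʳ : ∀ {p} ν σ τ → p ⊩ ν ≈ τ → p ⊩ ν ∈ up σ τ
  up-inʳ ν σ τ e = dense-now λ q q⊑p → (false , q) , ⊑-refl , ⊩≈-mono q⊑p e

  up-out : ∀ {p} ν σ τ → p ⊩ ν ∈ up σ τ → DenseBelow p (λ q → (q ⊩ ν ≈ σ) ⊎ (q ⊩ ν ≈ τ))
  up-out ν σ τ = dense-map λ { q _ ((true , _) , _ , e) → inj₁ e ; q _ ((false , _) , _ , e) → inj₂ e }

  up-in : ∀ {p} ν σ τ → DenseBelow p (λ q → (q ⊩ ν ≈ σ) ⊎ (q ⊩ ν ≈ τ)) → p ⊩ ν ∈ up σ τ
  up-in ν σ τ d = ⊩∈-dense (dense-map (λ q _ → [ up-inˡ ν σ τ , up-inʳ ν σ τ ]′) d)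

  up-cong : ∀ {p} σ τ σ′ τ′ → p ⊩ σ ≈ σ′ → p ⊩ τ ≈ τ′ → p ⊩ up σ τ ≈ up σ′ τ′
  up-cong {p} σ τ σ′ τ′ e f = ⊩≈-ext (up σ τ) (up σ′ τ′)
    (λ q q⊑p ν h → go q q⊑p ν σ τ σ′ τ′ e f h)
    (λ q q⊑p ν h → go q q⊑p ν σ′ τ′ σ τ (⊩≈-sym σ σ′ e) (⊩≈-sym τ τ′ f) h)
    where
    go : ∀ q → q ⊑ p → ∀ ν σ τ σ′ τ′ → p ⊩ σ ≈ σ′ → p ⊩ τ ≈ τ′ → q ⊩ ν ∈ up σ τ → q ⊩ ν ∈ up σ′ τ′
    go q q⊑p ν σ τ σ′ τ′ e f h = up-in ν σ′ τ′ (dense-map (λ r r⊑q →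
      [ (λ a → inj₁ (⊩≈-trans ν σ σ′ a (⊩≈-mono (⊑-trans r⊑q q⊑p) e))) ,
        (λ a → inj₂ (⊩≈-trans ν τ τ′ a (⊩≈-mono (⊑-trans r⊑q q⊑p) f))) ]′) (up-out ν σ τ h))

  op-cong : ∀ {p} σ τ σ′ τ′ → p ⊩ σ ≈ σ′ → p ⊩ τ ≈ τ′ → p ⊩ op σ τ ≈ op σ′ τ′
  op-cong σ τ σ′ τ′ e f = up-cong (up σ σ) (up σ τ) (up σ′ σ′) (up σ′ τ′) (up-cong σ σ σ′ σ′ e e) (up-cong σ τ σ′ τ′ e f)

  up-injˢ : ∀ {p} σ τ υ → p ⊩ up σ σ ≈ up τ υ → (p ⊩ τ ≈ σ) × (p ⊩ υ ≈ σ)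
  up-injˢ σ τ υ e = get τ (up-inˡ τ τ υ (⊩≈-refl τ)) , get υ (up-inʳ υ τ υ (⊩≈-refl υ))
    where
    get : ∀ ν → _ ⊩ ν ∈ up τ υ → _ ⊩ ν ≈ σ
    get ν h = ⊩≈-dense (dense-map (λ _ _ → [ (λ a → a) , (λ a → a) ]′)
      (up-out ν σ σ (⊩∈-respʳ ν (up τ υ) (up σ σ) (⊩≈-sym (up σ σ) (up τ υ) e) h)))

  up-cancel : ∀ {p} σ τ υ → p ⊩ up σ τ ≈ up σ υ → p ⊩ τ ≈ υ
  up-cancel σ τ υ e = ⊩≈-dense (dense-bind
    (up-out τ σ υ (⊩∈-respʳ τ (up σ τ) (up σ υ) e (up-inʳ τ σ τ (⊩≈-refl τ))))
    λ q q⊑p → [ (λ a → dense-map (λ r r⊑q →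
        [ (λ b → ⊩≈-trans τ σ υ (⊩≈-mono r⊑q a) (⊩≈-sym υ σ b)) , (λ b → ⊩≈-sym υ τ b) ]′)
        (dense-mono q⊑p (up-out υ σ τ (⊩∈-respʳ υ (up σ υ) (up σ τ) (⊩≈-sym (up σ τ) (up σ υ) e) (up-inʳ υ σ υ (⊩≈-refl υ)))))) ,
      (λ a → dense-now λ r r⊑q → ⊩≈-mono r⊑q a) ]′)

  op-inj : ∀ {p} σ τ σ′ τ′ → p ⊩ op σ τ ≈ op σ′ τ′ → (p ⊩ σ ≈ σ′) × (p ⊩ τ ≈ τ′)
  op-inj {p} σ τ σ′ τ′ e = σ≈σ′ , up-cancel σ τ τ′ (up-cancel (up σ σ) (up σ τ) (up σ τ′)
    (⊩≈-trans (op σ τ) (op σ′ τ′) (op σ τ′) e (op-cong σ′ τ′ σ τ′ (⊩≈-sym σ σ′ σ≈σ′) (⊩≈-refl τ′))))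
    where
    σ≈σ′ : p ⊩ σ ≈ σ′
    σ≈σ′ = ⊩≈-dense (dense-map (λ q _ → [ (λ a → ⊩≈-sym σ′ σ (proj₁ (up-injˢ σ σ′ σ′ a))) ,
        (λ a → ⊩≈-sym σ′ σ (proj₁ (up-injˢ σ σ′ τ′ a))) ]′)
      (up-out (up σ σ) (up σ′ σ′) (up σ′ τ′) (⊩∈-respʳ (up σ σ) (op σ τ) (op σ′ τ′) e
        (up-inˡ (up σ σ) (up σ σ) (up σ τ) (⊩≈-refl (up σ σ))))))

  UP-intro : ∀ {p} (z x y : Fin n) ρ → p ⊩ lookup ρ z ≈ up (lookup ρ x) (lookup ρ y) → p ⊩ isUnorderedPair z x y [ ρ ]
  UP-intro z x y ρ e ν = ⇔-intro (zero ∈̇ suc z) (zero ≈̇ suc x ∨̇ zero ≈̇ suc y) (ν ∷ ρ)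
    (λ q q⊑p h → ∨-intro (zero ≈̇ suc x) (zero ≈̇ suc y) (ν ∷ ρ)
      (up-out ν _ _ (⊩∈-respʳ ν (lookup ρ z) _ (⊩≈-mono q⊑p e) h)))
    (λ q q⊑p h → ⊩∈-respʳ ν _ (lookup ρ z) (⊩≈-sym (lookup ρ z) _ (⊩≈-mono q⊑p e))
      (up-in ν _ _ (∨-elim (zero ≈̇ suc x) (zero ≈̇ suc y) (ν ∷ ρ) h)))

  UP-elim : ∀ {p} (z x y : Fin n) ρ → p ⊩ isUnorderedPair z x y [ ρ ] → p ⊩ lookup ρ z ≈ up (lookup ρ x) (lookup ρ y)
  UP-elim z x y ρ h = ⊩≈-ext (lookup ρ z) _
    (λ q q⊑p ν a → up-in ν _ _ (∨-elim φ ψ (ν ∷ ρ) (⇒-elim χ (φ ∨̇ ψ) (ν ∷ ρ) (⊩-mono (χ ⇒̇ (φ ∨̇ ψ)) (ν ∷ ρ) q⊑p (proj₁ (h ν))) a)))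
    (λ q q⊑p ν a → ⇒-elim (φ ∨̇ ψ) χ (ν ∷ ρ) (⊩-mono ((φ ∨̇ ψ) ⇒̇ χ) (ν ∷ ρ) q⊑p (proj₂ (h ν)))
      (∨-intro φ ψ (ν ∷ ρ) (up-out ν _ _ a)))
    where
    φ = zero ≈̇ suc x
    ψ = zero ≈̇ suc y
    χ = zero ∈̇ suc z

  OP-intro : ∀ {p} (z x y : Fin n) ρ → p ⊩ lookup ρ z ≈ op (lookup ρ x) (lookup ρ y) → p ⊩ isOrderedPair z x y [ ρ ]
  OP-intro z x y ρ e ν = ⇔-intro (zero ∈̇ suc z) (φ ∨̇ ψ) (ν ∷ ρ)
    (λ q q⊑p h → ∨-intro φ ψ (ν ∷ ρ) (dense-map
      (λ r _ → [ (λ a → inj₁ (UP-intro zero (suc x) (suc x) (ν ∷ ρ) a)) , (λ a → inj₂ (UP-intro zero (suc x) (suc y) (ν ∷ ρ) a)) ]′)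
      (up-out ν _ _ (⊩∈-respʳ ν (lookup ρ z) _ (⊩≈-mono q⊑p e) h))))
    (λ q q⊑p h → ⊩∈-respʳ ν _ (lookup ρ z) (⊩≈-sym (lookup ρ z) _ (⊩≈-mono q⊑p e))
      (up-in ν _ _ (dense-map (λ r _ → [ (λ a → inj₁ (UP-elim zero (suc x) (suc x) (ν ∷ ρ) a)) , (λ a → inj₂ (UP-elim zero (suc x) (suc y) (ν ∷ ρ) a)) ]′)
        (∨-elim φ ψ (ν ∷ ρ) h))))
    where
    φ = isUnorderedPair zero (suc x) (suc x)
    ψ = isUnorderedPair zero (suc x) (suc y)

  OP-elim : ∀ {p} (z x y : Fin n) ρ → p ⊩ isOrderedPair z x y [ ρ ] → p ⊩ lookup ρ z ≈ op (lookup ρ x) (lookup ρ y)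
  OP-elim z x y ρ h = ⊩≈-ext (lookup ρ z) _
    (λ q q⊑p ν a → up-in ν _ _ (dense-map (λ r _ → [ (λ a → inj₁ (UP-elim zero (suc x) (suc x) (ν ∷ ρ) a)) , (λ a → inj₂ (UP-elim zero (suc x) (suc y) (ν ∷ ρ) a)) ]′)
      (∨-elim φ ψ (ν ∷ ρ) (⇒-elim χ (φ ∨̇ ψ) (ν ∷ ρ) (⊩-mono (χ ⇒̇ (φ ∨̇ ψ)) (ν ∷ ρ) q⊑p (proj₁ (h ν))) a))))
    (λ q q⊑p ν a → ⇒-elim (φ ∨̇ ψ) χ (ν ∷ ρ) (⊩-mono ((φ ∨̇ ψ) ⇒̇ χ) (ν ∷ ρ) q⊑p (proj₂ (h ν)))
      (∨-intro φ ψ (ν ∷ ρ) (dense-map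
      (λ r _ → [ (λ a → inj₁ (UP-intro zero (suc x) (suc x) (ν ∷ ρ) a)) , (λ a → inj₂ (UP-intro zero (suc x) (suc y) (ν ∷ ρ) a)) ]′)
        (up-out ν _ _ a))))
    where
    φ = isUnorderedPair zero (suc x) (suc x)
    ψ = isUnorderedPair zero (suc x) (suc y)
    χ = zero ∈̇ suc z

  maps-intro : ∀ {p} (f x y : Fin n) ρ → p ⊩ op (lookup ρ x) (lookup ρ y) ∈ lookup ρ f → p ⊩ maps f x y [ ρ ]
  maps-intro f x y ρ h = ∃-intro (zero ∈̇ suc f ∧̇ isOrderedPair zero (suc x) (suc y)) ρ (dense-now λ q q⊑p → op (lookup ρ x) (lookup ρ y) , ⊩∈-mono q⊑p h ,
    OP-intro zero (suc x) (suc y) (op (lookup ρ x) (lookup ρ y) ∷ ρ) (⊩≈-refl _))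

  maps-elim : ∀ {p} (f x y : Fin n) ρ → p ⊩ maps f x y [ ρ ] → p ⊩ op (lookup ρ x) (lookup ρ y) ∈ lookup ρ f
  maps-elim f x y ρ h = ⊩∈-dense (dense-map (λ q _ (ν , a , b) →
      ⊩∈-respˡ ν _ (lookup ρ f) (OP-elim zero (suc x) (suc y) (ν ∷ ρ) b) a)
    (∃-elim (zero ∈̇ suc f ∧̇ isOrderedPair zero (suc x) (suc y)) ρ h))

  opaque
    unfolding _∈_

    check-≐ : ∀ {p} x y → x ≐ y → p ⊩ check x ≈ check y
    check-≐ (sup A f) (sup B g) (h , k) =
      (λ (i , _) → dense-now λ q _ q⊑c → (proj₁ (h i) , q) , ⊑-refl , check-≐ (f i) (g _) (proj₂ (h i))) ,
      (λ (j , _) → dense-now λ q _ q⊑c → (proj₁ (k j) , q) , ⊑-refl , check-≐ (f _) (g j) (proj₂ (k j)))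

    -- Each element of a canonical name also occurs with the label `p`, so below `p` its presence is
    -- certain, and forced equality returns actual indices of the other set.
    check-inj : ∀ {p} x y → p ⊩ check x ≈ check y → x ≐ y
    check-inj {p} (sup A f) (sup B g) (h , k) =
      (λ i → let (r , r⊑p , e) = h (i , p) p ⊑-refl ; ((j , _) , _ , a) = e r⊑p in j , check-inj (f i) (g j) a) ,
      (λ j → let (r , r⊑p , e) = k (j , p) p ⊑-refl ; ((i , _) , _ , a) = e r⊑p in i , check-inj (f i) (g j) a)

    check-in : ∀ {p} x y → x ∈ y → p ⊩ check x ∈ check y
    check-in x (sup B g) (j , e) = dense-now λ q _ → (j , q) , ⊑-refl , check-≐ x (g j) e

    check-out : ∀ {p} σ y → p ⊩ σ ∈ check y → DenseBelow p (λ q → Σ (Index y) λ j → q ⊩ σ ≈ check (elt y j))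
    check-out σ (sup B g) = dense-map λ q _ ((j , _) , _ , e) → j , e

  -- `Good p ξ i` means that `p` decides the value of the generic function at ξ to be `i`. Deciding
  -- densely, uniquely and injectively is enough to name an injection of δ into κ; a generic filter
  -- is never formed.
  module _ (δ κ : V) (κ∈δ : κ ∈ δ) (Good : Condition → V → V → Set₁)
    (good-mono : ∀ {p q ξ i} → q ⊑ p → Good p ξ i → Good q ξ i)
    (good-resp : ∀ {p ξ ξ′ i i′} → ξ ≐ ξ′ → i ≐ i′ → Good p ξ i → Good p ξ′ i′)
    (good-dense : ∀ p ξ → ξ ∈ δ → Σ Condition λ q → q ⊑ p × (∃[ i ] i ∈ κ × Good q ξ i))
    (good-unique : ∀ {p ξ i i′} → Good p ξ i → Good p ξ i′ → i ≐ i′)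
    (good-inj : ∀ {p ξ ξ′ i} → ξ ∈ δ → ξ′ ∈ δ → Good p ξ i → Good p ξ′ i → ξ ≐ ξ′) where

    -- An argument, a value and a condition deciding it; `Small` keeps the index type of the name in
    -- `Set`.
    K : Set
    K = Σ (Index δ × Index κ × Condition) λ (a , b , c) → Small (Good c (elt δ a) (elt κ b))

    ḟ : Name
    ḟ = name K (λ ((a , b , _) , _) → op (check (elt δ a)) (check (elt κ b))) (λ ((_ , _ , c) , _) → c)

    Value : Condition → Name → Name → Set₁
    Value q σ τ = Σ (Index δ × Index κ) λ (a , b) → Good q (elt δ a) (elt κ b)
      × (q ⊩ σ ≈ check (elt δ a)) × (q ⊩ τ ≈ check (elt κ b))

    value-out : ∀ {p} σ τ → p ⊩ op σ τ ∈ ḟ → DenseBelow p (λ q → Value q σ τ)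
    value-out σ τ = dense-map λ q _ (((a , b , c) , s) , q⊑c , e) →
      (a , b) , good-mono q⊑c (unsmall s) , op-inj σ τ (check (elt δ a)) (check (elt κ b)) e

    value-in : ∀ {p} σ τ → Value p σ τ → p ⊩ op σ τ ∈ ḟ
    value-in {p} σ τ ((a , b) , g , e , e′) = dense-now λ q q⊑p → ((a , b , p) , small g) , q⊑p ,
      op-cong σ τ (check (elt δ a)) (check (elt κ b)) (⊩≈-mono q⊑p e) (⊩≈-mono q⊑p e′)

    value-unique : ∀ {p} σ τ τ′ → Value p σ τ → Value p σ τ′ → p ⊩ τ ≈ τ′
    value-unique σ τ τ′ ((a , b) , g , e , f) ((a′ , b′) , g′ , e′ , f′) =
      ⊩≈-trans τ (check (elt κ b)) τ′ f (⊩≈-trans (check (elt κ b)) (check (elt κ b′)) τ′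
        (check-≐ _ _ (good-unique g (good-resp (check-inj (elt δ a′) (elt δ a)
          (⊩≈-trans _ σ _ (⊩≈-sym σ (check (elt δ a′)) e′) e)) ≐-refl g′)))
        (⊩≈-sym τ′ (check (elt κ b′)) f′))

    value-injective : ∀ {p} σ σ′ τ → Value p σ τ → Value p σ′ τ → p ⊩ σ ≈ σ′
    value-injective σ σ′ τ ((a , b) , g , e , f) ((a′ , b′) , g′ , e′ , f′) =
      ⊩≈-trans σ (check (elt δ a)) σ′ e (⊩≈-trans (check (elt δ a)) (check (elt δ a′)) σ′
        (check-≐ _ _ (good-inj (elt∈ a) (elt∈ a′) g (good-resp ≐-refl (check-inj (elt κ b′) (elt κ b)
          (⊩≈-trans _ τ _ (⊩≈-sym τ (check (elt κ b′)) f′) f)) g′)))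
        (⊩≈-sym σ′ (check (elt δ a′)) e′))

    Value-mono : ∀ {p q σ τ} → q ⊑ p → Value p σ τ → Value q σ τ
    Value-mono h (ab , g , e , e′) = ab , good-mono h g , ⊩≈-mono h e , ⊩≈-mono h e′

    ρ₀ : Vec Name 3
    ρ₀ = ḟ ∷ check κ ∷ check δ ∷ []

    private
      #0 : ∀ {n} → Fin (suc n)
      #0 = zero
      #1 : ∀ {n} → Fin (suc (suc n))
      #1 = suc zero
      #2 : ∀ {n} → Fin (suc (suc (suc n)))
      #2 = suc (suc zero)
      #3 : ∀ {n} → Fin (suc (suc (suc (suc n))))
      #3 = suc (suc (suc zero))

    forced-function : ∀ p → p ⊩ isFunction #0 #2 #1 [ ρ₀ ]
    forced-function p = (λ z → ⇒-intro (#0 ∈̇ #1) inDomain (z ∷ ρ₀) λ q q⊑p h → into q z h) ,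
      (λ x → ⇒-intro (#0 ∈̇ #3) (∃̇ hasValue) (x ∷ ρ₀) λ q q⊑p h → total q x h)
      where
      isPair : Formula 6
      isPair = isOrderedPair #2 #1 #0
      inRange : Formula 5
      inRange = #0 ∈̇ suc #3 ∧̇ (∃̇ (#0 ∈̇ suc (suc #2) ∧̇ isPair))
      inDomain : Formula 4
      inDomain = ∃̇ inRange
      noOther : Formula 6
      noOther = maps #3 #2 #0 ⇒̇ #0 ≈̇ #1
      hasValue : Formula 5
      hasValue = maps #2 #1 #0 ∧̇ (∀̇ noOther)
      into : ∀ q z → q ⊩ z ∈ ḟ → q ⊩ inDomain [ z ∷ ρ₀ ]
      into q z h = ∃-intro inRange (z ∷ ρ₀) (dense-map (λ r r⊑q (((a , b , c) , s) , _ , e) →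
          check (elt δ a) , check-in _ _ (elt∈ a) ,
          ∃-intro (#0 ∈̇ suc (suc #2) ∧̇ isPair) (check (elt δ a) ∷ z ∷ ρ₀) (dense-now λ r′ r′⊑r →
            check (elt κ b) , check-in _ _ (elt∈ b) ,
            OP-intro #2 #1 #0 (check (elt κ b) ∷ check (elt δ a) ∷ z ∷ ρ₀) (⊩≈-mono r′⊑r e))) h)
      total : ∀ q x → q ⊩ x ∈ check δ → q ⊩ ∃̇ hasValue [ x ∷ ρ₀ ]
      total q x h = ∃-intro hasValue (x ∷ ρ₀) (dense-bind (check-out x δ h) λ r r⊑q (a , e) s s⊑r → go r a e s s⊑r)
        where
        go : ∀ r a → r ⊩ x ≈ check (elt δ a) → ∀ s → s ⊑ r → Σ Condition λ t → t ⊑ s × Σ Name λ y →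
          t ⊩ hasValue [ y ∷ x ∷ ρ₀ ]
        go r a e s s⊑r =
          let (t , t⊑s , i , i∈κ , g) = good-dense s (elt δ a) (elt∈ a) ; (b , i≐) = mem i∈κ
              y = check (elt κ b)
              v : Value t x y
              v = (a , b) , good-resp ≐-refl i≐ g , ⊩≈-mono (⊑-trans t⊑s s⊑r) e , ⊩≈-refl y in
          t , t⊑s , y , maps-intro #2 #1 #0 (y ∷ x ∷ ρ₀) (value-in x y v) ,
          λ y′ → ⇒-intro (maps #3 #2 #0) (#0 ≈̇ #1) (y′ ∷ y ∷ x ∷ ρ₀) λ u u⊑t m → ⊩≈-dense (dense-map
            (λ w w⊑u v′ → value-unique x y′ y v′ (Value-mono (⊑-trans w⊑u u⊑t) v))
            (value-out x y′ (maps-elim #3 #2 #0 (y′ ∷ y ∷ x ∷ ρ₀) m)))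

    forced-injective : ∀ p → p ⊩ isInjective #0 [ ρ₀ ]
    forced-injective p x x′ y = ⇒-intro (maps #3 #2 #0 ∧̇ maps #3 #1 #0) (#2 ≈̇ #1) (y ∷ x′ ∷ x ∷ ρ₀)
      λ q q⊑p (m , m′) → ⊩≈-dense (dense-bind
      (value-out x y (maps-elim #3 #2 #0 (y ∷ x′ ∷ x ∷ ρ₀) m)) λ r r⊑q v → dense-map
        (λ s s⊑r v′ → value-injective x x′ y (Value-mono s⊑r v) v′)
        (dense-mono r⊑q (value-out x′ y (maps-elim #3 #1 #0 (y ∷ x′ ∷ x ∷ ρ₀) m′))))

    -- One condition suffices: it forces δ to be a cardinal, hence not injectable into its member κ,
    -- against the name `ḟ`.
    collapsed : Condition → ¬ Forced (isRegularCardinal zero) (δ ∷ [])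
    collapsed p h = ⇒-elim (#0 ∈̇ #1) (¬̇ (∃̇ isInj))
        (check κ ∷ check δ ∷ []) (proj₂ (proj₁ (h p)) (check κ)) (check-in κ δ κ∈δ) p ⊑-refl
        (∃-intro isInj (check κ ∷ check δ ∷ []) (dense-now λ q _ → ḟ , forced-function q , forced-injective q))
      where
      isInj : Formula 3
      isInj = isFunction #0 #2 #1 ∧̇ isInjective #0

-- Transitive collapses and the models obtained from GIS.

module Collapse (em : ExcludedMiddle 1ℓ) (choice : Choice) (ω₁ ω₂ : V)
  (s₁ : IsSuccessorCardinal ω ω₁) (s₂ : IsSuccessorCardinal ω₁ ω₂) where
  open import Data.Fin.Base using (zero; suc)
  open import Data.Vec.Base using ([]; _∷_)
  open import Data.Vec.Relation.Unary.All using ([]; _∷_)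

  open Sets em
  open Cardinals em choice ω₁ ω₂ s₁ s₂

  opaque
    unfolding _∈_

    -- The transitive collapse of M, extended to all sets x by collapsing M ∩ x.
    coll : V → V → V
    coll M (sup A f) = sup (Σ A λ i → f i ∈ M) λ (i , _) → coll M (f i)

    coll-ext : ∀ {M} → Ext (coll M)
    coll-ext {M} {sup A f} {sup B g} (h , k) =
      (λ (i , p) → (proj₁ (h i) , ∈-respˡ {f i} {g _} {M} (proj₂ (h i)) p) , coll-ext {M} {f i} {g _} (proj₂ (h i))) ,
      (λ (j , p) → (proj₁ (k j) , ∈-respˡ {g j} {f _} {M} (≐-sym {f _} {g j} (proj₂ (k j))) p) ,
        coll-ext {M} {f _} {g j} (proj₂ (k j)))

    coll-in : ∀ {M x y} → y ∈ x → y ∈ M → coll M y ∈ coll M x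
    coll-in {M} {sup A f} {y} (i , e) p = (i , ∈-respˡ {y} {f i} {M} e p) , coll-ext {M} {y} {f i} e

    coll-out : ∀ {M x z} → z ∈ coll M x → ∃[ y ] y ∈ x × y ∈ M × z ≐ coll M y
    coll-out {M} {sup A f} ((i , p) , e) = f i , elt∈ {sup A f} i , p , e

  Coll : V → V
  Coll M = Im (coll M) M

  coll∈Coll : ∀ {M x} → x ∈ M → coll M x ∈ Coll M
  coll∈Coll p = Im-in coll-ext p ≐-refl

  Coll-out : ∀ {M z} → z ∈ Coll M → ∃[ x ] x ∈ M × z ≐ coll M x
  Coll-out = Im-out

  Coll-trans : ∀ {M} → Transitive (Coll M)
  Coll-trans y p z q = let (x , r , e) = Coll-out p ; (w , s , t , u) = coll-out (∈-respʳ e q) in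
    Im-in coll-ext t u

  -- Below a transitive set the collapse sees only the members of `M` in that set. This makes
  -- collapses of ordinals stable under restriction along the tower.
  coll-cong : ∀ {M M′ λ′} → Transitive λ′ → (∀ y → y ∈ λ′ → y ∈ M → y ∈ M′) → (∀ y → y ∈ λ′ → y ∈ M′ → y ∈ M) →
    ∀ x → x ⊆ λ′ → coll M x ≐ coll M′ x
  coll-cong {M} {M′} {λ′} t f g = ∈-ind (λ x → x ⊆ λ′ → coll M x ≐ coll M′ x) λ x ih h → ⊆-antisym
    (λ z p → let (y , q , r , e) = coll-out p in
      ∈-respˡ (≐-sym (≐-trans e (ih y q (t y (h y q))))) (coll-in q (f y (h y q) r)))
    (λ z p → let (y , q , r , e) = coll-out p in
      ∈-respˡ (≐-trans (ih y q (t y (h y q))) (≐-sym e)) (coll-in q (g y (h y q) r)))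

  coll-congᴹ : ∀ {M M′} → M ≐ M′ → ∀ x → coll M x ≐ coll M′ x
  coll-congᴹ e = ∈-ind _ λ x ih → ⊆-antisym
    (λ z p → let (y , q , r , e′) = coll-out p in
      ∈-respˡ (≐-sym (≐-trans e′ (ih y q))) (coll-in q (∈-respʳ e r)))
    (λ z p → let (y , q , r , e′) = coll-out p in
      ∈-respˡ (≐-trans (ih y q) (≐-sym e′)) (coll-in q (∈-respʳ (≐-sym e) r)))

  coll-id : ∀ {M λ′} → Transitive λ′ → λ′ ⊆ M → ∀ x → x ⊆ λ′ → coll M x ≐ x
  coll-id {M} {λ′} t f = ∈-ind (λ x → x ⊆ λ′ → coll M x ≐ x) λ x ih h → ⊆-antisym
    (λ z p → let (y , q , r , e) = coll-out p in ∈-respˡ (≐-sym (≐-trans e (ih y q (t y (h y q))))) q)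
    (λ y q → ∈-respˡ (ih y q (t y (h y q))) (coll-in q (f y (h y q))))

  ord-coll : ∀ {M x} → IsOrdinal x → IsOrdinal (coll M x)
  ord-coll {M} {x} o = tr o , λ y p → let (w , q , r , e) = coll-out p in
      Transitive-resp (≐-sym e) (tr (ord-elt o q))
    where
    tr : ∀ {x} → IsOrdinal x → Transitive (coll M x)
    tr o y p z q = let (w , s , r , e) = coll-out p ; (v , s′ , r′ , e′) = coll-out (∈-respʳ e q) in
      ∈-respˡ (≐-sym e′) (coll-in (ord-trans o s′ s) r′)

  coll-strict : ∀ {Y η η′} → IsOrdinal η → IsOrdinal η′ → η ∈ Y → η′ ∈ Y → coll Y η ≐ coll Y η′ → η ≐ η′
  coll-strict o o′ p p′ e = [ (λ q → ⊥-elim (∈-irrefl (∈-respʳ (≐-sym e) (coll-in q p)))) , [ id ,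
    (λ q → ⊥-elim (∈-irrefl (∈-respʳ e (coll-in q p′)))) ]′ ]′ (trichotomy o o′)

  -- The union of a chain enters as any `Z` with the right members, so clubs can be handled without
  -- a fixed form of countable unions.
  IsClubω : V → V → Set₁
  IsClubω X C =
      (∀ Y → Y ∈ C → Y ⊆ X × Countable Y)
    × (∀ Y → Y ⊆ X → Countable Y → ∃[ Z ] Z ∈ C × Y ⊆ Z)
    × ((c : ℕ → V) → (∀ k → c k ∈ C) → (∀ k → c k ⊆ c (suc k)) → ∀ Z → (∀ z → z ∈ Z → Σ ℕ λ k → z ∈ c k) →
        (∀ k → c k ⊆ Z) → Z ∈ C)

  -- What the argument retains of membership in GIS. The collapse given by the definition is
  -- replaced by the canonical one, `Coll M`, which makes different models comparable.
  record Model (M : V) : Set₁ where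
    field
      ω₁⊆M : ω₁ ⊆ M
      M≼ω₁ : M ≼ ω₁
      coll-inj : ∀ {x y} → x ∈ M → y ∈ M → coll M x ≐ coll M y → x ≐ y
      ω₁∈Coll : ω₁ ∈ Coll M
      Coll-pair : ∀ {x y} → x ∈ Coll M → y ∈ Coll M → ｛ x , y ｝ ∈ Coll M
      Coll-∩ : ∀ {x y} → x ∈ Coll M → y ∈ Coll M → x ∩ y ∈ Coll M
      approx : ∀ η A → η ∈ Coll M → A ⊆ η → (∀ z → z ∈ Coll M → Countable z → z ∩ A ∈ Coll M) → A ∈ Coll M
      stationary : ∀ C → IsClubω M C → ∃[ Y ] Y ∈ C × Y ∈ M × Y ⊆ M × Countable Y
      θ : V
      ord-θ : IsOrdinal θ
      ω∈θ : ω ∈ θ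
      elementary : D._≺_ M (D.H θ)

    Coll≼ω₁ : Coll M ≼ ω₁
    Coll≼ω₁ = ≼-trans (Inj⇒≼ (g , g-ext , (λ z p → proj₁ (g-spec z p)) ,
        λ z w p q e → ≐-trans (proj₂ (g-spec z p)) (≐-trans (coll-ext e) (≐-sym (proj₂ (g-spec w q)))))) M≼ω₁
      where
      G : Σ (V → V) λ g → Ext g × (∀ z → z ∈ Coll M → Lift 1ℓ (g z ∈ M × z ≐ coll M (g z)))
      G = choose (Coll M) (λ z x → Lift 1ℓ (x ∈ M × z ≐ coll M x))
        (λ e e′ (lift (p , q)) → lift (∈-respˡ e′ p , ≐-trans (≐-sym e) (≐-trans q (coll-ext e′))))
        (λ z p → let (x , q , e) = Coll-out p in x , lift (q , e))
      g : V → V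
      g = proj₁ G
      g-ext : Ext g
      g-ext = proj₁ (proj₂ G)
      g-spec : ∀ z → z ∈ Coll M → g z ∈ M × z ≐ coll M (g z)
      g-spec z p = lower (proj₂ (proj₂ G) z p)

    pairing : Pairing
    pairing = go (≼⇒Inj Coll≼ω₁)
      where
      pr∈ : ∀ {x y} → x ∈ ω₁ → y ∈ ω₁ → ⟨ x , y ⟩ ∈ Coll M
      pr∈ p q = let x∈ = Coll-trans _ ω₁∈Coll _ p ; y∈ = Coll-trans _ ω₁∈Coll _ q in
        ∈-respˡ (≐-sym ⟨⟩-def) (Coll-pair (Coll-pair x∈ x∈) (Coll-pair x∈ y∈))
      go : Inj (Coll M) ω₁ → Pairing
      go (g , eg , gr , gi) = (λ x y → g ⟨ x , y ⟩) , (λ e e′ → eg (⟨⟩-cong e e′)) ,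
        (λ x y p q → gr _ (pr∈ p q)) ,
        (λ x y x′ y′ p q p′ q′ e → ⟨⟩-inj (gi _ _ (pr∈ p q) (pr∈ p′ q′) e))

  -- Stated with inclusion in `coll M ξ` instead of membership, so that for fixed `r` the witnessed
  -- ordinals are visibly closed downwards.
  Witness : V → V → Set₁
  Witness r β = ∃[ M ] ∃[ ξ ] Model M × R M ≐ r × ξ ∈ M × IsOrdinal ξ × β ⊆ coll M ξ

  opaque
    unfolding _∈_

    regular-ord : ∀ κ → D.IsRegularCardinal κ → IsOrdinal κ
    regular-ord κ ((( t , h ) , _) , _) =
      (λ y p z q → lower (dne λ n → t y tt (lift p , λ k → k z tt (lift q , n)))) ,
      (λ β r y p z q → lower (dne λ n → h β tt (lift r , λ k → k y tt (lift p , λ k → k z tt (lift q , n)))))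

  module FromGIS (M : V) where

    private
      record Raw : Set₁ where
        field
          T π : V
          T-trans : Transitive T
          π-inj : IsInjection π M T
          π-onto : ∀ y → y ∈ T → ∃[ x ] x ∈ M × π ‵ x ≐ y
          π-in : ∀ {x y} → x ∈ M → y ∈ M → x ∈ y → π ‵ x ∈ π ‵ y
          π-out : ∀ {x y} → x ∈ M → y ∈ M → π ‵ x ∈ π ‵ y → x ∈ y
          ω₁⊆M : ω₁ ⊆ M
          M≼ω₁ : M ≼ ω₁
          ω₁∈T : ω₁ ∈ T
          T-pair : ∀ {x y} → x ∈ T → y ∈ T → ∃[ p ] p ∈ T × (∀ z → z ∈ T → (z ∈ p → z ≐ x ⊎ z ≐ y) × (z ≐ x ⊎ z ≐ y → z ∈ p))
          T-∩ : ∀ {x y} → x ∈ T → y ∈ T → ∃[ p ] p ∈ T × (∀ z → z ∈ T → (z ∈ p → z ∈ x × z ∈ y) × (z ∈ x × z ∈ y → z ∈ p))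
          approx : ∀ η A → η ∈ T → A ⊆ η → (∀ z → z ∈ T → Countable z → z ∩ A ∈ T) → A ∈ T
          stationary : ∀ C → IsClubω M C → ∃[ Y ] Y ∈ C × Y ∈ M × Y ⊆ M × Countable Y
          θ : V
          ord-θ : IsOrdinal θ
          ω∈θ : ω ∈ θ
          elementary : D._≺_ M (D.H θ)

    opaque
      unfolding _∈_

      raw : GIS ω₁ M → Raw
      raw (((ω₁⊆M , (θ , reg , ω∈θ , el) , (T , (tr , π , (inj , onto) , iso) , ap)) , (f , (fi , _)) , _) ,
          (_ , _ , _ , (_ , stat))) = record
        { T = T ; π = π ; T-trans = tr ; π-inj = inj ; π-onto = onto
        ; π-in = λ {x} {y} p q → to (iso x y p q)
        ; π-out = λ {x} {y} p q → from (iso x y p q)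
        ; ω₁⊆M = ω₁⊆M ; M≼ω₁ = f , fi ; ω₁∈T = A.ω₁∈T
        ; T-pair = λ {x} {y} p q → let (r , r∈ , h) = Z.pairing x y p q in r , r∈ , λ z z∈ → to (h z z∈) , from (h z z∈)
        ; T-∩ = λ {x} {y} p q → let (r , r∈ , h) = Z.separation (zero ∈̇ suc zero) (y ∷ []) (q ∷ []) x p in
            r , r∈ , λ z z∈ → (λ s → let (a , b) = to (h z z∈) s in a , lower b) , (λ (a , b) → from (h z z∈) (a , lift b))
        ; approx = λ η A e s h → A.approx η A e s λ z z∈ (g , _ , gi) → h z z∈ (g , gi)
        ; stationary = stat′
        ; θ = θ ; ord-θ = regular-ord θ reg ; ω∈θ = ω∈θ ; elementary = el }
        where
        stat′ : ∀ C → IsClubω M C → ∃[ Y ] Y ∈ C × Y ∈ M × Y ⊆ M × Countable Y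
        stat′ C (c₁ , c₂ , c₃) = let (Y , Y∈C , Y∈M , Y⊆M , cY) = stat C club in Y , Y∈C , Y∈M , Y⊆M , cY
          where
          club : D.IsClub[ D._∈ M ]^ω C
          club = c₁ , (λ Y (h , c) → c₂ Y h c) ,
            λ c h k → c₃ c h k (D.⋃ₙ c) (λ z ((n , j) , e) → n , (j , e)) (λ k z (j , e) → (k , j) , e)
        module A = HasApproximationProperty ap
        module Z = ZF⁻ A.zf⁻

    opaque
      model : GIS ω₁ M → Model M
      model gis = record
        { ω₁⊆M = R.ω₁⊆M ; M≼ω₁ = R.M≼ω₁
        ; coll-inj = λ {x} {y} p q e → proj₂ (proj₂ R.π-inj) x y p q (≐-trans (π≐ x p) (≐-trans e (≐-sym (π≐ y q))))
        ; ω₁∈Coll = ∈-respʳ T≐ R.ω₁∈T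
        ; Coll-pair = λ {x} {y} p q →
            let x∈ = ∈-respʳ (≐-sym T≐) p ; y∈ = ∈-respʳ (≐-sym T≐) q ; (r , r∈ , h) = R.T-pair x∈ y∈ in
            ∈-respˡ (⊆-antisym (λ z s → [ pair-inˡ , pair-inʳ ]′ (proj₁ (h z (R.T-trans r r∈ z s)) s))
              (λ z s → [ (λ e → proj₂ (h z (∈-respˡ (≐-sym e) x∈)) (inj₁ e)) ,
                (λ e → proj₂ (h z (∈-respˡ (≐-sym e) y∈)) (inj₂ e)) ]′ (pair-out s))) (∈-respʳ T≐ r∈)
        ; Coll-∩ = λ {x} {y} p q →
            let x∈ = ∈-respʳ (≐-sym T≐) p ; y∈ = ∈-respʳ (≐-sym T≐) q ; (r , r∈ , h) = R.T-∩ x∈ y∈ in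
            ∈-respˡ (⊆-antisym (λ z s → let (a , b) = proj₁ (h z (R.T-trans r r∈ z s)) s in ∩-in a b)
              (λ z s → let (a , b) = ∩-out s in proj₂ (h z (R.T-trans x x∈ z a)) (a , b))) (∈-respʳ T≐ r∈)
        ; approx = λ η A e s h → ∈-respʳ T≐ (R.approx η A (∈-respʳ (≐-sym T≐) e) s
            λ z z∈ c → ∈-respʳ (≐-sym T≐) (h z (∈-respʳ T≐ z∈) c))
        ; stationary = R.stationary ; θ = R.θ ; ord-θ = R.ord-θ ; ω∈θ = R.ω∈θ ; elementary = R.elementary }
        where
        module R = Raw (raw gis)
        π∈T : ∀ {x} → x ∈ M → R.π ‵ x ∈ R.T
        π∈T = proj₁ (proj₂ R.π-inj) _
        -- Uniqueness of the Mostowski collapse: an isomorphism onto a transitive set satisfies the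
        -- recursion of `coll M`.
        π≐ : ∀ x → x ∈ M → R.π ‵ x ≐ coll M x
        π≐ = ∈-ind (λ x → x ∈ M → R.π ‵ x ≐ coll M x) λ x ih p → ⊆-antisym
          (λ z q → let (y , y∈ , e) = R.π-onto z (R.T-trans _ (π∈T p) z q)
                       y∈x = R.π-out y∈ p (∈-respˡ (≐-sym e) q) in
            ∈-respˡ (≐-trans (≐-sym (ih y y∈x y∈)) e) (coll-in y∈x y∈))
          (λ z q → let (y , y∈x , y∈ , e) = coll-out q in
            ∈-respˡ (≐-sym (≐-trans e (≐-sym (ih y y∈x y∈)))) (R.π-in y∈ p y∈x))
        T≐ : R.T ≐ Coll M
        T≐ = ⊆-antisym
          (λ z q → let (y , y∈ , e) = R.π-onto z q in Im-in coll-ext y∈ (≐-trans (≐-sym e) (π≐ y y∈)))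
          (λ z q → let (y , y∈ , e) = Coll-out q in ∈-respˡ (≐-trans (π≐ y y∈) (≐-sym e)) (π∈T y∈))

-- Normality in the tower: 2^ω > ω₁, and unboundedly many collapsed ordinals for one r.

module Tower (em : ExcludedMiddle 1ℓ) (choice : Choice) (ω₁ ω₂ : V)
  (s₁ : IsSuccessorCardinal ω ω₁) (s₂ : IsSuccessorCardinal ω₁ ω₂)
  (δ κ U I : V) (tower : IsTower δ κ U I) (conc : TowerConcentratesOn κ U I (GIS ω₁))
  (presat : IsPresaturated δ κ U I) where
  open import Data.Fin.Base using (zero)
  open import Data.Vec.Base using ([]; _∷_)

  open Sets em
  open Cardinals em choice ω₁ ω₂ s₁ s₂
  open Collapse em choice ω₁ ω₂ s₁ s₂ using (Model; module Model; Witness; regular-ord; module FromGIS; coll; coll-ext; coll-in; coll-out; coll-cong; coll-congᴹ; coll-id; Coll; coll∈Coll; Coll-trans; ord-coll)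

  Z : V → V → Set₁
  Z μ M = (∀ x → x ∈ M → H μ x) × (∃[ α ] α ∈ κ × M ≼ α)

  restr : V → V → V
  restr μ M = ⟪ M ∣ H μ ⟫

  -- `A` and `d` record the concentration on GIS: `A` consists of models, and the null set `d`
  -- covers the rest of `Z μ`.
  record Ideal (μ J : V) : Set₁ where
    field
      down : ∀ A B → A ∈ J → B ⊆ A → B ∈ J
      empty : ∅ ∈ J
      ⋃-closed : (A : ℕ → V) → (∀ k → A k ∈ J) → ∀ B → (∀ z → z ∈ B → Σ ℕ λ k → z ∈ A k) → B ∈ J
      proper : ∀ d → (∀ z → z ∈ d → Z μ z) → (∀ z → Z μ z → z ∈ d) → ¬ d ∈ J
      fine : ∀ b → (∃[ M ] Z μ M × b ∈ M) →
        ∃[ d ] (∀ z → Z μ z → ¬ b ∈ z → z ∈ d) × d ∈ J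
      normal : ∀ S g → (∀ M → M ∈ S → Z μ M) → ¬ S ∈ J → IsFunctionOn g S → (∀ M → M ∈ S → g ‵ M ∈ M) →
        ∃[ S′ ] S′ ⊆ S × ¬ S′ ∈ J × (∃[ b ] (∀ M → M ∈ S′ → g ‵ M ≐ b))
      A d : V
      A-Z : ∀ M → M ∈ A → Z μ M
      A-model : ∀ M → M ∈ A → Model M
      d-Z : ∀ M → M ∈ d → Z μ M
      A∪d : ∀ M → Z μ M → ¬ M ∈ A → M ∈ d
      d∈J : d ∈ J

    ∪-closed : ∀ {B C} → B ∈ J → C ∈ J → ∀ X → X ⊆ B ∪ C → X ∈ J
    ∪-closed {B} {C} p q X h = ⋃-closed f f∈ X λ z r → [ (λ s → 0 , s) , (λ s → 1 , s) ]′ (∪-out (h z r))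
      where
      f : ℕ → V
      f zero = B
      f (suc _) = C
      f∈ : ∀ k → f k ∈ J
      f∈ zero = p
      f∈ (suc _) = q

    nonempty : ∀ {S} → ¬ S ∈ J → ∃[ M ] M ∈ S
    nonempty n = dne λ e → n (down ∅ _ empty λ z p → ⊥-elim (e (z , p)))

    A-positive : ¬ A ∈ J
    A-positive p = proper (A ∪ d) (λ z q → [ A-Z z , d-Z z ]′ (∪-out q))
      (λ z q → [ ∪-inˡ , (λ n → ∪-inʳ (A∪d z q n)) ]′ (lem₀ (z ∈ A)))
      (∪-closed p d∈J (A ∪ d) λ _ q → q)

    meet : ∀ {S} → (∀ M → M ∈ S → Z μ M) → ¬ S ∈ J → ∃[ M ] M ∈ S × M ∈ A
    meet {S} h n = dne λ e → n (down d S d∈J λ z p → A∪d z (h z p) λ q → e (z , p , q))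

  opaque
    unfolding _∈_

    tower-facts : IsOrdinal δ × (U ⊆ δ) × (∀ α → α ∈ δ → ∃[ μ ] μ ∈ U × α ⊆ μ) × IsOrdinal κ
      × (∀ μ → μ ∈ U → κ ⊆ μ)
    tower-facts = T.height , T.indices , T.unbounded , regular-ord κ T.κ-regular , λ μ p → proj₂ (T.cardinals μ p)
      where module T = IsTower tower

    ideal : ∀ μ → μ ∈ U → Ideal μ (I ‵ μ)
    ideal μ p = record
      { down = J.downClosed
      ; empty = J.empty
      ; ⋃-closed = λ A h B c → J.downClosed (D.⋃ₙ A) B (J.countablyComplete A h) λ z q →
          let (k , (j , e)) = c z q in (k , j) , e
      ; proper = λ d h k q → J.proper (d , (λ z → mk⇔ (h z) (k z)) , q)
      ; fine = λ b e → let (d , h , q) = J.fine b e in d , (λ z r n → from (h z) (r , n)) , q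
      ; normal = J.normal
      ; A = proj₁ c ; d = proj₁ (proj₂ (proj₂ c))
      ; A-Z = λ M q → proj₁ (proj₁ (proj₂ c) M q)
      ; A-model = λ M q → FromGIS.model M (proj₂ (proj₁ (proj₂ c) M q))
      ; d-Z = λ M q → proj₁ (to (proj₁ (proj₂ (proj₂ (proj₂ c))) M) q)
      ; A∪d = λ M q n → from (proj₁ (proj₂ (proj₂ (proj₂ c))) M) (q , n)
      ; d∈J = proj₂ (proj₂ (proj₂ (proj₂ c))) }
      where
      module J = IsIdeal (IsTower.ideals tower μ p)
      c : D.ConcentratesOn (D.℘<[ κ ] (D.H μ)) (I ‵ μ) (GIS ω₁)
      c = conc μ p

    -- Lifting to a higher level preserves positivity, in contrapositive form. By the covering
    -- hypothesis the union of `Z μ` is all of `H μ`, so intersecting with that union is the same as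
    -- `restr μ`.
    project : ∀ μ μ′ → μ ∈ U → μ′ ∈ U → μ ⊆ μ′ → ∀ S → (∀ M → M ∈ S → Z μ M) →
      (∀ x → H μ x → ∃[ M ] Z μ M × x ∈ M) → ∀ d →
      (∀ M → M ∈ d → Z μ′ M × restr μ M ∈ S) → (∀ M → Z μ′ M → restr μ M ∈ S → M ∈ d) → d ∈ I ‵ μ′ → S ∈ I ‵ μ
    project μ μ′ p p′ h S S-Z cover d f g q = from (IsTower.projections tower μ μ′ p p′ h S)
      (S-Z , d , (λ M → mk⇔
        (λ r → let (z , s) = f M r in z , restr μ M , (λ x → mk⇔
          (λ t → let (a , b) = sep-out {M} {H μ} {x} (λ {x} {y} → H-resp {μ} {x} {y}) t in a , cover x b)
          (λ (a , M′ , b , c) → sep-in {M} {H μ} {x} (λ {x} {y} → H-resp {μ} {x} {y}) a (proj₁ b x c))) , s)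
        (λ (z , e , k , s) → g M z (∈-respˡ {e} {restr μ M} {S} (⊆-antisym {e} {restr μ M}
          (λ x t → let (a , M′ , b , c) = to (k x) t in sep-in {M} {H μ} {x} (λ {x} {y} → H-resp {μ} {x} {y}) a (proj₁ b x c))
          (λ x t → let (a , b) = sep-out {M} {H μ} {x} (λ {x} {y} → H-resp {μ} {x} {y}) t in from (k x) (a , cover x b))) s))) , q)

    δ-nonempty : ∃[ ξ ] ξ ∈ δ
    δ-nonempty = let (_ , h , _) = proj₁ presat in dne λ n → h λ x _ (lift p , _) → n (x , p)

    δ-limit : ∀ ξ → ξ ∈ δ → ∃[ η ] η ∈ δ × ξ ∈ η
    δ-limit ξ p = let (_ , _ , h , _) = proj₁ presat in
      dne λ n → h ξ tt (lift p , λ k → k λ η _ (lift q , lift r) → n (η , q , r))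

  ord-δ : IsOrdinal δ
  ord-δ = proj₁ tower-facts

  U⊆δ : U ⊆ δ
  U⊆δ = proj₁ (proj₂ tower-facts)

  unbounded : ∀ α → α ∈ δ → ∃[ μ ] μ ∈ U × α ⊆ μ
  unbounded = proj₁ (proj₂ (proj₂ tower-facts))

  ord-κ : IsOrdinal κ
  ord-κ = proj₁ (proj₂ (proj₂ (proj₂ tower-facts)))

  κ⊆ : ∀ {μ} → μ ∈ U → κ ⊆ μ
  κ⊆ = proj₂ (proj₂ (proj₂ (proj₂ tower-facts))) _

  opaque
    μ₀ : V
    μ₀ = proj₁ (unbounded _ (proj₂ δ-nonempty))

    μ₀∈U : μ₀ ∈ U
    μ₀∈U = proj₁ (proj₂ (unbounded _ (proj₂ δ-nonempty)))

  module Iᵘ {μ : V} (p : μ ∈ U) = Ideal (ideal μ p)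

  opaque
    M₀ : ∃[ M ] M ∈ Iᵘ.A μ₀∈U
    M₀ = Iᵘ.nonempty μ₀∈U (Iᵘ.A-positive μ₀∈U)

    model₀ : Model (proj₁ M₀)
    model₀ = Iᵘ.A-model μ₀∈U _ (proj₂ M₀)

  -- A model in the tower contains ω₁ but has size less than κ.
  ω₁∈κ : ω₁ ∈ κ
  ω₁∈κ = let (_ , α , α∈κ , i) = Iᵘ.A-Z μ₀∈U _ (proj₂ M₀) in
    ord-⊆∈ ord-ω₁ ord-κ (ord-∉ ord-ω₁ (ord-elt ord-κ α∈κ) λ α∈ω₁ →
      ω₁⋠ α∈ω₁ (≼-trans (⊆⇒≼ (Model.ω₁⊆M model₀)) i)) α∈κ

  ω₁∈μ : ∀ {μ} → μ ∈ U → ω₁ ∈ μ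
  ω₁∈μ p = κ⊆ p ω₁ ω₁∈κ

  cover : ∀ {μ} x → H μ x → ∃[ M ] Z μ M × x ∈ M
  cover x h = ｛ x , x ｝ , ((λ y p → H-resp (≐-sym (single-out p)) h) , ω₁ , ω₁∈κ ,
    ≼-trans (cov⇒countable cov-single) (⊆⇒≼ ω⊆ω₁)) , pair-inˡ ≐-refl

  Bdd-H : ∀ {μ x} → μ ∈ U → Bdd x → H μ x
  Bdd-H p (ε , q , h) = H-⊆ord ord-ω₁ (ω₁∈μ p) λ z r → proj₁ ord-ω₁ ε q z (h z r)

  Positive : V → V → Set₁
  Positive μ S = (∀ M → M ∈ S → Z μ M) × ¬ S ∈ I ‵ μ

  opaque
    -- The least `ε` with `Q M ε` is a countable ordinal and thus a member of `M`; choosing it is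
    -- regressive, and normality makes it constant on a positive set.
    pressing : ∀ {μ S} (p : μ ∈ U) → Positive μ S → S ⊆ Iᵘ.A p → (Q : V → V → Set₁) →
      (∀ {M M′ ε ε′} → M ≐ M′ → ε ≐ ε′ → Q M ε → Q M′ ε′) → (∀ M → M ∈ S → ∃[ ε ] ε ∈ ω₁ × Q M ε) →
      ∃[ ε ] ε ∈ ω₁ × Positive μ ⟪ S ∣ (λ M → Q M ε) ⟫
    pressing {μ} {S} p (S-Z , pos) S⊆A Q r h = b , b∈ , (λ M q → S-Z M (proj₁ (sep-out rQ q))) ,
        λ q → S′-pos (Iᵘ.down p _ S′ q λ M s → sep-in rQ (S′⊆S M s) (r ≐-refl
          (≐-trans (≐-sym (graph-value g-ext (S′⊆S M s))) (S′-b M s)) (proj₁ (proj₂ (spec M (S′⊆S M s))))))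
      where
      g : V → V
      g M = least ω₁ (Q M)
      g-ext : Ext g
      g-ext e = least-ext (r ≐-refl) (r ≐-refl) ≐-refl (λ _ → r e ≐-refl) (λ _ → r (≐-sym e) ≐-refl)
      spec : ∀ M → M ∈ S → g M ∈ ω₁ × Q M (g M) × (∀ η → η ∈ g M → ¬ Q M η)
      spec M q = least-spec ord-ω₁ (r ≐-refl) (h M q)
      N : ∃[ S′ ] S′ ⊆ S × ¬ S′ ∈ I ‵ μ × (∃[ b ] (∀ M → M ∈ S′ → graph S g ‵ M ≐ b))
      N = Iᵘ.normal p S (graph S g) S-Z pos (graph-fun g-ext) λ M q →
        Model.ω₁⊆M (Iᵘ.A-model p M (S⊆A M q)) _ (∈-respˡ (≐-sym (graph-value g-ext q)) (proj₁ (spec M q)))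
      S′ : V
      S′ = proj₁ N
      S′⊆S : S′ ⊆ S
      S′⊆S = proj₁ (proj₂ N)
      S′-pos : ¬ S′ ∈ I ‵ μ
      S′-pos = proj₁ (proj₂ (proj₂ N))
      b : V
      b = proj₁ (proj₂ (proj₂ (proj₂ N)))
      S′-b : ∀ M → M ∈ S′ → graph S g ‵ M ≐ b
      S′-b = proj₂ (proj₂ (proj₂ (proj₂ N)))
      rQ : Resp (λ M → Q M b)
      rQ e = r e ≐-refl
      b∈ : b ∈ ω₁
      b∈ = let (M , q) = Iᵘ.nonempty p S′-pos in
        ∈-respˡ (≐-trans (≐-sym (graph-value g-ext (S′⊆S M q))) (S′-b M q)) (proj₁ (spec M (S′⊆S M q)))

  -- If 2^ω ≼ ω₁, then by normality some M in the tower contains all bounded subsets of ω₁,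
  -- hence by approximation its collapse contains all subsets of ω₁, which are too many.
  module Continuum (ρ : (ℕ → Bool) → V) (ρ∈ : ∀ r → ρ r ∈ ω₁) (ρ-inj : ∀ r s → ρ r ≐ ρ s → ∀ n → r n ≡ s n) where

    opaque
      unfolding _∈_

      select : (ℕ → V) → (ℕ → Bool) → V
      select h r = sup (Σ ℕ λ n → r n ≡ true) λ (n , _) → h n

      select-in : ∀ {h r z} n → r n ≡ true → z ≐ h n → z ∈ select h r
      select-in n e p = (n , e) , p

      select-out : ∀ {h r z} → z ∈ select h r → Σ ℕ λ n → r n ≡ true × z ≐ h n
      select-out ((n , e) , p) = n , e , p

    select-cong : ∀ {h r s} → (∀ n → r n ≡ s n) → select h r ⊆ select h s
    select-cong e z p = let (n , q , t) = select-out p in select-in n (trans (sym (e n)) q) t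

    bool : {A : Set} → A ⊎ ¬ A → Bool
    bool (inj₁ _) = true
    bool (inj₂ _) = false

    bool⁻ : {A : Set} (d : A ⊎ ¬ A) → bool d ≡ true → A
    bool⁻ (inj₁ p) _ = p

    bool⁺ : {A : Set} (d : A ⊎ ¬ A) → A → bool d ≡ true
    bool⁺ (inj₁ _) _ = refl
    bool⁺ (inj₂ n) p = ⊥-elim (n p)

    code : (h : ℕ → V) (x : V) → (∀ z → z ∈ x → Σ ℕ λ n → z ≐ h n) → Σ (ℕ → Bool) λ r → select h r ≐ x
    code h x c = r , ⊆-antisym
        (λ z p → let (n , e , q) = select-out p in ∈-respˡ (≐-sym q) (bool⁻ (lem₀ (h n ∈ x)) e))
        (λ z p → let (n , e) = c z p in select-in n (bool⁺ (lem₀ (h n ∈ x)) (∈-respˡ e p)) e)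
      where
      r : ℕ → Bool
      r n = bool (lem₀ (h n ∈ x))

    -- Otherwise every `M` in the filter set misses some bounded set. Pressing down fixes its bound
    -- ε and then, through ρ, the code of the missing set relative to an enumeration of ε. So one
    -- set is missed by positively many `M`, against fineness.
    full : ∃[ M ] Model M × (∀ x → Bdd x → x ∈ M)
    full = dne λ none → absurd λ M M∈A → dne λ n → none (M , Iᵘ.A-model μ₀∈U M M∈A , λ x (ε , p , h) →
        dne₀ λ q → n (ε , p , x , h , q))
      where
      absurd : ¬ (∀ M → M ∈ Iᵘ.A μ₀∈U → ∃[ ε ] ε ∈ ω₁ × (∃[ x ] x ⊆ ε × ¬ x ∈ M))
      absurd hyp = first (pressing μ₀∈U (Iᵘ.A-Z μ₀∈U , Iᵘ.A-positive μ₀∈U) (λ _ q → q) Q₁ r₁ hyp)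
        where
        Q₁ : V → V → Set₁
        Q₁ M ε = ∃[ x ] x ⊆ ε × ¬ x ∈ M
        r₁ : ∀ {M M′ ε ε′} → M ≐ M′ → ε ≐ ε′ → Q₁ M ε → Q₁ M′ ε′
        r₁ e e′ (x , h , n) = x , (λ z q → ∈-respʳ e′ (h z q)) , λ q → n (∈-respʳ (≐-sym e) q)
        first : ¬ (∃[ ε ] ε ∈ ω₁ × Positive μ₀ ⟪ Iᵘ.A μ₀∈U ∣ (λ M → Q₁ M ε) ⟫)
        first (ε , ε∈ , S₁-pos) = second (ω₁-cov ε∈)
          where
          S₁ : V
          S₁ = ⟪ Iᵘ.A μ₀∈U ∣ (λ M → Q₁ M ε) ⟫
          second : ¬ Cov (_∈ ε)
          second (h , c) = third (pressing μ₀∈U S₁-pos (sep-⊆ (λ e → r₁ e ≐-refl)) Q₂ r₂ hyp₂)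
            where
            Q₂ : V → V → Set₁
            Q₂ M ι = Σ (ℕ → Bool) λ r → ρ r ≐ ι × select h r ⊆ ε × ¬ select h r ∈ M
            r₂ : ∀ {M M′ ι ι′} → M ≐ M′ → ι ≐ ι′ → Q₂ M ι → Q₂ M′ ι′
            r₂ e e′ (r , p , q , n) = r , ≐-trans p e′ , q , λ s → n (∈-respʳ (≐-sym e) s)
            hyp₂ : ∀ M → M ∈ S₁ → ∃[ ι ] ι ∈ ω₁ × Q₂ M ι
            hyp₂ M q = let (_ , x , x⊆ε , n) = sep-out (λ e → r₁ e ≐-refl) q
                           (r , e) = code h x (λ z s → c z (x⊆ε z s)) in
              ρ r , ρ∈ r , r , ≐-refl , (λ z s → x⊆ε z (∈-respʳ e s)) , λ s → n (∈-respˡ e s)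
            third : ¬ (∃[ ι ] ι ∈ ω₁ × Positive μ₀ ⟪ S₁ ∣ (λ M → Q₂ M ι) ⟫)
            third (ι , _ , S₂-Z , S₂-pos) = fourth (Iᵘ.nonempty μ₀∈U S₂-pos)
              where
              S₂ : V
              S₂ = ⟪ S₁ ∣ (λ M → Q₂ M ι) ⟫
              Q₂-out : ∀ {M} → M ∈ S₂ → Q₂ M ι
              Q₂-out q = proj₂ (sep-out (λ e → r₂ e ≐-refl) q)
              fourth : ¬ (∃[ M ] M ∈ S₂)
              fourth (M , q) = fifth (Q₂-out q)
                where
                fifth : ¬ Q₂ M ι
                fifth (r , e , b⊆ε , _) =
                  let (d , h′ , d∈) = Iᵘ.fine μ₀∈U (select h r) (cover (select h r) (Bdd-H μ₀∈U (ε , ε∈ , b⊆ε))) in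
                  S₂-pos (Iᵘ.down μ₀∈U d S₂ d∈ λ M q → h′ M (S₂-Z M q) (avoid M (Q₂-out q)))
                  where
                  avoid : ∀ M → Q₂ M ι → ¬ select h r ∈ M
                  avoid M (r′ , e′ , _ , n) s = n (∈-respˡ (⊆-antisym
                    (select-cong (ρ-inj r r′ (≐-trans e (≐-sym e′))))
                    (select-cong (ρ-inj r′ r (≐-trans e′ (≐-sym e))))) s)

    contradiction : ⊥
    contradiction = cantor (≼⇒Inj Coll≼ω₁)
      where
      M : V
      M = proj₁ full
      open Model (proj₁ (proj₂ full))
      all : ∀ A → A ⊆ ω₁ → A ∈ Coll M
      -- A countable set meets `A` in a bounded subset of ω₁, which lies in `M` and is fixed by the
      -- collapse.
      all A A⊆ω₁ = approx ω₁ A ω₁∈Coll A⊆ω₁ λ z z∈ c →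
        let z∩A⊆ = λ x p → A⊆ω₁ x (proj₂ (∩-out p))
            b∈ = bnd∈ω₁ (cov-mono (λ x p → proj₁ (∩-out p)) (countable⇒cov c)) z∩A⊆
            x∈M = proj₂ (proj₂ full) (z ∩ A) (_ , b∈ , λ x p → bnd-in p) in
        ∈-respˡ (coll-id (proj₁ ord-ω₁) ω₁⊆M _ z∩A⊆) (coll∈Coll x∈M)
      cantor : ¬ Inj (Coll M) ω₁
      cantor (g , eg , gr , gi) = out (lem₀ (g A ∈ A))
        where
        -- Cantor's diagonal for the injection `g`: the set it defines lies in the collapse, as
        -- every subset of ω₁ does, so it has a code itself.
        Diag : V → Set₁
        Diag ξ = ∃[ t ] t ∈ Coll M × g t ≐ ξ × ¬ ξ ∈ t
        rD : Resp Diag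
        rD e (t , p , q , n) = t , p , ≐-trans q e , λ s → n (∈-respˡ (≐-sym e) s)
        A : V
        A = ⟪ ω₁ ∣ Diag ⟫
        A∈ : A ∈ Coll M
        A∈ = all A (sep-⊆ rD)
        notin : ¬ g A ∈ A
        notin p = let (_ , t , q , e , n) = sep-out rD p in n (∈-respʳ (≐-sym (gi _ _ q A∈ e)) p)
        out : g A ∈ A ⊎ ¬ g A ∈ A → ⊥
        out (inj₁ p) = notin p
        out (inj₂ n) = n (sep-in rD (gr A A∈) (A , A∈ , ≐-refl , n))

  some-model : ∃[ M ] Model M
  some-model = proj₁ M₀ , model₀

  restr-⊆ : ∀ {μ M} → restr μ M ⊆ M
  restr-⊆ = sep-⊆ H-resp

  restr-ext : ∀ {μ μ′ M} → μ ≐ μ′ → restr μ M ≐ restr μ′ M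
  restr-ext e = sep-ext H-resp H-resp ≐-refl (λ _ _ → H-mono (≐⇒⊆ e)) (λ _ _ → H-mono (≐⇒⊆ (≐-sym e)))

  restr-self : ∀ {μ M} → Z μ M → restr μ M ≐ M
  restr-self (h , _) = ⊆-antisym restr-⊆ λ z p → sep-in H-resp p (h z p)

  restr-restr : ∀ {μ μ′ M} → μ ⊆ μ′ → restr μ (restr μ′ M) ≐ restr μ M
  restr-restr h = ⊆-antisym
    (λ z p → let (q , r) = sep-out H-resp p in sep-in H-resp (restr-⊆ z q) r)
    (λ z p → let (q , r) = sep-out H-resp p in sep-in H-resp (sep-in H-resp q (H-mono h r)) r)

  restr-cong : ∀ {μ M M′} → M ≐ M′ → restr μ M ≐ restr μ M′
  restr-cong e = sep-ext H-resp H-resp e (λ _ _ p → p) (λ _ _ p → p)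

  P : V
  P = proj₁ (proj₂ presat)

  _⊑_ : Index P → Index P → Set₁
  q ⊑ p = TowerOrder κ (elt P q) (elt P p)

  opaque
    unfolding _∈_

    cond-out : ∀ p → ∃[ μ ] ∃[ S ] elt P p ≐ ⟨ μ , S ⟩ × μ ∈ U × Positive μ S
    cond-out p = to (proj₁ (proj₂ (proj₂ presat)) (elt P p)) (elt∈ {P} p)

    cond-in : ∀ μ S → μ ∈ U → Positive μ S → Σ (Index P) λ p → elt P p ≐ ⟨ μ , S ⟩
    cond-in μ S p q = let (i , e) = from (proj₁ (proj₂ (proj₂ presat)) ⟨ μ , S ⟩) (μ , S , ≐-refl {⟨ μ , S ⟩} , p , q) in
      i , ≐-sym {⟨ μ , S ⟩} {elt P i} e

    order-out : ∀ {q p} → q ⊑ p → ∃[ μ′ ] ∃[ S′ ] ∃[ μ ] ∃[ S ] elt P q ≐ ⟨ μ′ , S′ ⟩ × elt P p ≐ ⟨ μ , S ⟩ × μ ⊆ μ′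
      × (∀ M → M ∈ S′ → restr μ M ∈ S)
    order-out (μ′ , S′ , μ , S , e , e′ , h , k) = μ′ , S′ , μ , S , e , e′ , h , λ M r →
      let (_ , w , f , s) = k M r in ∈-respˡ {w} {restr μ M} {S} (⊆-antisym {w} {restr μ M}
        (λ x t → let (a , b) = to (f x) t in sep-in {M} {H μ} {x} (λ {x} {y} → H-resp {μ} {x} {y}) a b)
        (λ x t → from (f x) (sep-out {M} {H μ} {x} (λ {x} {y} → H-resp {μ} {x} {y}) t))) s

    order-in : ∀ {q p μ′ S′ μ S} → elt P q ≐ ⟨ μ′ , S′ ⟩ → elt P p ≐ ⟨ μ , S ⟩ → μ ⊆ μ′ →
      (∀ M → M ∈ S′ → Z μ′ M × restr μ M ∈ S) → q ⊑ p
    order-in {q} {p} {μ′} {S′} {μ} {S} e e′ h k = μ′ , S′ , μ , S , e , e′ , h , λ M r →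
      proj₁ (k M r) , restr μ M , (λ x → mk⇔ (sep-out {M} {H μ} {x} (λ {x} {y} → H-resp {μ} {x} {y}))
        (λ (a , b) → sep-in {M} {H μ} {x} (λ {x} {y} → H-resp {μ} {x} {y}) a b)) , proj₂ (k M r)

    forced : Forcing.Forced P (TowerOrder κ) (D.isRegularCardinal zero) (δ ∷ [])
    forced = proj₂ (proj₂ (proj₂ presat))

  order-out′ : ∀ {q p μ′ S′ μ S} → q ⊑ p → elt P q ≐ ⟨ μ′ , S′ ⟩ → elt P p ≐ ⟨ μ , S ⟩ →
    μ ⊆ μ′ × (∀ M → M ∈ S′ → restr μ M ∈ S)
  order-out′ o e e′ = let (_ , _ , _ , _ , f , f′ , h , k) = order-out o
                          (a , b) = ⟨⟩-inj (≐-trans (≐-sym f) e) ; (a′ , b′) = ⟨⟩-inj (≐-trans (≐-sym f′) e′) in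
    (λ z p → ∈-respʳ a (h z (∈-respʳ (≐-sym a′) p))) ,
    (λ M p → ∈-respˡ (restr-ext a′) (∈-respʳ b′ (k M (∈-respʳ (≐-sym b) p))))

  ⊑-reflexive : ∀ p → p ⊑ p
  ⊑-reflexive p = let (μ , S , e , _ , (h , _)) = cond-out p in
    order-in e e (λ _ q → q) λ M q → h M q , ∈-respˡ (≐-sym (restr-self (h M q))) q

  ⊑-transitive : ∀ r q p → r ⊑ q → q ⊑ p → r ⊑ p
  ⊑-transitive r q p o o′ =
    let (μ″ , S″ , e″ , _ , (h″ , _)) = cond-out r ; (μ′ , S′ , e′ , _) = cond-out q ; (μ , S , e , _) = cond-out p
        (i , k) = order-out′ o e″ e′ ; (i′ , k′) = order-out′ o′ e′ e in
    order-in e″ e (λ z s → i z (i′ z s)) λ M s → h″ M s , ∈-respˡ (restr-restr i′) (k′ _ (k M s))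

  -- If for every r the ordinals coll M ξ with R M ≐ r were bounded in ω₂, then an injection of the
  -- bound into ω₁ would, by normality, let the generic filter decide an injection of δ into ω₁.
  module Reflect (neg : ∀ r → ∃[ β ] β ∈ ω₂ × ¬ Witness r β) where

    opaque
      -- The witnessed ordinals form an initial segment of ω₂, hence an ordinal, and by `neg` not ω₂
      -- itself. This is the bound on all `coll M ξ` with `R M ≐ r`.
      h : V → V
      h r = ⟪ ω₂ ∣ Witness r ⟫

      Witness-resp : ∀ {r r′ β β′} → r ≐ r′ → β ≐ β′ → Witness r β → Witness r′ β′
      Witness-resp e e′ (M , ξ , g , p , q , o , s) = M , ξ , g , ≐-trans p e , q , o ,
        λ z t → s z (∈-respʳ (≐-sym e′) t)

      h-ext : Ext h
      h-ext e = sep-ext (Witness-resp ≐-refl) (Witness-resp ≐-refl) ≐-refl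
        (λ _ _ → Witness-resp e ≐-refl) (λ _ _ → Witness-resp (≐-sym e) ≐-refl)

      h∈ω₂ : ∀ r → h r ∈ ω₂
      h∈ω₂ r = by (ord-⊆ ord-h ord-ω₂ (sep-⊆ (Witness-resp ≐-refl)))
        where
        ord-h : IsOrdinal (h r)
        ord-h = (λ β p γ q → let (β∈ , M , ξ , g , e , r , o , s) = sep-out (Witness-resp ≐-refl) p in
            sep-in (Witness-resp ≐-refl) (ord-trans ord-ω₂ q β∈)
              (M , ξ , g , e , r , o , λ z t → proj₁ (ord-coll o) γ (s γ q) z t)) ,
          (λ β p → proj₁ (ord-elt ord-ω₂ (proj₁ (sep-out (Witness-resp ≐-refl) p))))
        by : h r ∈ ω₂ ⊎ h r ≐ ω₂ → h r ∈ ω₂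
        by (inj₁ p) = p
        by (inj₂ e) = let (β , β∈ , n) = neg r in
          ⊥-elim (n (proj₂ (sep-out (Witness-resp ≐-refl) (∈-respʳ (≐-sym e) β∈))))

      coll∈h : ∀ {M ξ} → Model M → ξ ∈ M → IsOrdinal ξ → coll M ξ ∈ h (R M)
      coll∈h {M} {ξ} g p o = sep-in (Witness-resp ≐-refl)
        (∈ω₂ (ord-coll o) (≼-trans (⊆⇒≼ (Coll-trans _ (coll∈Coll p))) (Model.Coll≼ω₁ g)))
        (M , ξ , g , ≐-refl , p , o , λ _ q → q)

      -- For an ordinal ξ, the set `M` enters only through `R M` and its ordinals below ξ. This is
      -- what makes the value the same on all levels of the tower.
      val : V → V → V
      val M ξ = E (h (R M)) ‵ coll M ξ

      val-ext : ∀ {M M′ ξ ξ′} → M ≐ M′ → ξ ≐ ξ′ → val M ξ ≐ val M′ ξ′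
      val-ext e e′ = ‵-ext (E-ext (h-ext (sep-ext Bdd-resp Bdd-resp e (λ _ _ p → p) (λ _ _ p → p))))
        (≐-trans (coll-congᴹ e _) (coll-ext e′))

      val∈ω₁ : ∀ {M ξ} → Model M → ξ ∈ M → IsOrdinal ξ → val M ξ ∈ ω₁
      val∈ω₁ g p o = E∈ (h∈ω₂ _) (coll∈h g p o)

      val-inj : ∀ {M ξ ξ′} → Model M → ξ ∈ M → IsOrdinal ξ → ξ′ ∈ M → IsOrdinal ξ′ → val M ξ ≐ val M ξ′ → ξ ≐ ξ′
      val-inj {M} g p o p′ o′ e = Model.coll-inj g p p′
        (E-inj (h∈ω₂ _) (coll∈h g p o) (coll∈h g p′ o′) e)

      -- Bounded subsets of ω₁ and ordinals below μ lie in `H μ`, so restriction loses nothing on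
      -- which the value depends.
      val-restr : ∀ {M μ ξ} → μ ∈ U → ξ ∈ μ → val (restr μ M) ξ ≐ val M ξ
      val-restr {M} {μ} {ξ} p q = ‵-ext (E-ext (h-ext (⊆-antisym
          (λ z r → let (a , b) = sep-out Bdd-resp r in sep-in Bdd-resp (restr-⊆ z a) b)
          (λ z r → let (a , b) = sep-out Bdd-resp r in sep-in Bdd-resp (sep-in H-resp a (Bdd-H p b)) b))))
        (coll-cong (proj₁ oξ) (λ y _ → restr-⊆ y)
          (λ y r s → sep-in H-resp s (H-⊆ord (ord-elt oξ r) (ord-trans oμ r q) λ _ t → t)) ξ (λ _ r → r))
        where
        oμ : IsOrdinal μ
        oμ = ord-elt ord-δ (U⊆δ μ p)
        oξ : IsOrdinal ξ
        oξ = ord-elt oμ q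

    Good : Index P → V → V → Set₁
    Good p ξ i = ∃[ μ ] ∃[ S ] elt P p ≐ ⟨ μ , S ⟩ × μ ∈ U × Positive μ S × ξ ∈ μ
      × (∀ M → M ∈ S → ξ ∈ M × val M ξ ≐ i)

    good-mono : ∀ {p q ξ i} → q ⊑ p → Good p ξ i → Good q ξ i
    good-mono {p} {q} o (μ , S , e , μ∈ , pos , ξ∈ , g) =
      let (μ′ , S′ , e′ , μ′∈ , pos′) = cond-out q ; (h , k) = order-out′ o e′ e in
      μ′ , S′ , e′ , μ′∈ , pos′ , h _ ξ∈ , λ M r → let (a , b) = g _ (k M r) in
        restr-⊆ _ a , ≐-trans (≐-sym (val-restr μ∈ ξ∈)) b

    good-resp : ∀ {p ξ ξ′ i i′} → ξ ≐ ξ′ → i ≐ i′ → Good p ξ i → Good p ξ′ i′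
    good-resp e e′ (μ , S , f , μ∈ , pos , ξ∈ , g) = μ , S , f , μ∈ , pos , ∈-respˡ e ξ∈ ,
      λ M r → let (a , b) = g M r in ∈-respˡ e a , ≐-trans (val-ext ≐-refl (≐-sym e)) (≐-trans b e′)

    good-unique : ∀ {p ξ i i′} → Good p ξ i → Good p ξ i′ → i ≐ i′
    good-unique (μ , S , e , μ∈ , pos , _ , g) (μ′ , S′ , e′ , _ , _ , _ , g′) =
      let (M , r) = Iᵘ.nonempty μ∈ (proj₂ pos) ; (_ , b) = ⟨⟩-inj (≐-trans (≐-sym e) e′) in
      ≐-trans (≐-sym (proj₂ (g M r))) (proj₂ (g′ M (∈-respʳ b r)))

    -- A positive set contains a genuine model, and within one model both the collapse and the
    -- injection `E` separate ordinals.
    good-inj : ∀ {p ξ ξ′ i} → ξ ∈ δ → ξ′ ∈ δ → Good p ξ i → Good p ξ′ i → ξ ≐ ξ′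
    good-inj d d′ (μ , S , e , μ∈ , pos , _ , g) (μ′ , S′ , e′ , _ , _ , _ , g′) =
      let (M , r , s) = Iᵘ.meet μ∈ (proj₁ pos) (proj₂ pos) ; (_ , b) = ⟨⟩-inj (≐-trans (≐-sym e) e′)
          (m , v) = g M r ; (m′ , v′) = g′ M (∈-respʳ b r) in
      val-inj (Iᵘ.A-model μ∈ M s) m (ord-elt ord-δ d) m′ (ord-elt ord-δ d′) (≐-trans v (≐-sym v′))

    -- Pass to a level above both μ and ξ, keep the models that have ξ as a member, which by
    -- fineness loses only a null set, and press down on the countable ordinal `val M ξ`.
    good-dense : ∀ p ξ → ξ ∈ δ → Σ (Index P) λ q → q ⊑ p × (∃[ i ] i ∈ ω₁ × Good q ξ i)
    good-dense p ξ ξ∈δ = first (cond-out p) (δ-limit ξ ξ∈δ)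
      where
      Goal : Set₁
      Goal = Σ (Index P) λ q → q ⊑ p × (∃[ i ] i ∈ ω₁ × Good q ξ i)
      first : (∃[ μ ] ∃[ S ] elt P p ≐ ⟨ μ , S ⟩ × μ ∈ U × Positive μ S) → (∃[ η ] η ∈ δ × ξ ∈ η) → Goal
      first (μ , S , e , μ∈ , (S-Z , S-pos)) (η , η∈ , ξ∈η) = second (unbounded _ (ord-max ord-δ (U⊆δ μ μ∈) η∈))
        where
        second : (∃[ μ′ ] μ′ ∈ U × μ ∪ η ⊆ μ′) → Goal
        second (μ′ , μ′∈ , above) = third (Iᵘ.fine μ′∈ ξ (cover ξ Hξ))
          where
          ξ∈μ′ : ξ ∈ μ′
          ξ∈μ′ = above ξ (∪-inʳ ξ∈η)
          μ⊆μ′ : μ ⊆ μ′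
          μ⊆μ′ z q = above z (∪-inˡ q)
          oξ : IsOrdinal ξ
          oξ = ord-elt ord-δ ξ∈δ
          Hξ : H μ′ ξ
          Hξ = H-⊆ord oξ ξ∈μ′ λ _ q → q
          Up : V → Set₁
          Up M = Lift 1ℓ (restr μ M ∈ S)
          rUp : Resp Up
          rUp e (lift q) = lift (∈-respˡ (restr-cong e) q)
          In : V → Set₁
          In M = Lift 1ℓ (restr μ M ∈ S × ξ ∈ M)
          rIn : Resp In
          rIn e (lift (q , r)) = lift (∈-respˡ (restr-cong e) q , ∈-respʳ e r)
          S↑ T : V
          S↑ = ⟪ Iᵘ.A μ′∈ ∣ In ⟫
          T = ⟪ Iᵘ.A μ′∈ ∪ Iᵘ.d μ′∈ ∣ Up ⟫
          T-Z : ∀ M → M ∈ Iᵘ.A μ′∈ ∪ Iᵘ.d μ′∈ → Z μ′ M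
          T-Z M q = [ Iᵘ.A-Z μ′∈ M , Iᵘ.d-Z μ′∈ M ]′ (∪-out q)
          third : (∃[ d ] (∀ z → Z μ′ z → ¬ ξ ∈ z → z ∈ d) × d ∈ I ‵ μ′) → Goal
          third (d , d-in , d∈) = fourth (pressing μ′∈ ((λ M q → Iᵘ.A-Z μ′∈ M (sep-⊆ rIn M q)) , S↑-pos)
              (sep-⊆ rIn) Q rQ λ M q → let (a , lift (_ , b)) = sep-out rIn q in
                val M ξ , val∈ω₁ (Iᵘ.A-model μ′∈ M a) b oξ , lift ≐-refl)
            where
            Q : V → V → Set₁
            Q M i = Lift 1ℓ (val M ξ ≐ i)
            rQ : ∀ {M M′ ε ε′} → M ≐ M′ → ε ≐ ε′ → Q M ε → Q M′ ε′
            rQ e e′ (lift q) = lift (≐-trans (val-ext (≐-sym e) ≐-refl) (≐-trans q e′))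
            T⊆ : ∀ M → M ∈ T → M ∈ S↑ ∪ (d ∪ Iᵘ.d μ′∈)
            T⊆ M q = by (sep-out rUp q) (lem₀ (ξ ∈ M)) (lem₀ (M ∈ Iᵘ.A μ′∈))
              where
              by : M ∈ Iᵘ.A μ′∈ ∪ Iᵘ.d μ′∈ × Up M → ξ ∈ M ⊎ ¬ ξ ∈ M → M ∈ Iᵘ.A μ′∈ ⊎ ¬ M ∈ Iᵘ.A μ′∈ →
                M ∈ S↑ ∪ (d ∪ Iᵘ.d μ′∈)
              by (m , lift u) (inj₁ a) (inj₁ b) = ∪-inˡ (sep-in rIn b (lift (u , a)))
              by (m , lift u) (inj₂ a) _ = ∪-inʳ (∪-inˡ (d-in M (T-Z M m) a))
              by (m , lift u) _ (inj₂ b) = ∪-inʳ (∪-inʳ (Iᵘ.A∪d μ′∈ M (T-Z M m) b))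
            -- `T` is the whole lift of `S` and exceeds `S↑` only by null sets; a null `S↑` would
            -- make `T` null and, by projection, `S` as well.
            S↑-pos : ¬ S↑ ∈ I ‵ μ′
            S↑-pos q = S-pos (project μ μ′ μ∈ μ′∈ μ⊆μ′ S S-Z cover T
              (λ M r → let (a , lift b) = sep-out rUp r in T-Z M a , b)
              (λ M z r → sep-in rUp ([ ∪-inˡ , (λ n → ∪-inʳ (Iᵘ.A∪d μ′∈ M z n)) ]′ (lem₀ (M ∈ Iᵘ.A μ′∈))) (lift r))
              (Iᵘ.∪-closed μ′∈ q (Iᵘ.∪-closed μ′∈ d∈ (Iᵘ.d∈J μ′∈) _ λ _ r → r) T T⊆))
            fourth : (∃[ i ] i ∈ ω₁ × Positive μ′ ⟪ S↑ ∣ (λ M → Q M i) ⟫) → Goal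
            fourth (i , i∈ , pos) =
              let (q , e′) = cond-in μ′ ⟪ S↑ ∣ (λ M → Q M i) ⟫ μ′∈ pos in
              q , order-in e′ e μ⊆μ′ (λ M r → proj₁ pos M r ,
                  proj₁ (lower (proj₂ (sep-out rIn (sep-⊆ (λ f → rQ f ≐-refl) M r))))) ,
              i , i∈ , μ′ , _ , e′ , μ′∈ , pos , ξ∈μ′ , λ M r →
                let (a , lift b) = sep-out (λ f → rQ f ≐-refl) r in proj₂ (lower (proj₂ (sep-out rIn a))) , b

    contradiction : ⊥
    contradiction = collapsed p₀ forced
      where
      p₀ : Index P
      p₀ = proj₁ (cond-in μ₀ (Iᵘ.A μ₀∈U) μ₀∈U (Iᵘ.A-Z μ₀∈U , Iᵘ.A-positive μ₀∈U))

      collapsed : Index P → ¬ Forcing.Forced P (TowerOrder κ) (D.isRegularCardinal zero) (δ ∷ [])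
      collapsed = Forced.collapsed em P (TowerOrder κ) ⊑-reflexive ⊑-transitive δ ω₁
        (proj₁ ord-δ _ (U⊆δ μ₀ μ₀∈U) _ (ω₁∈μ μ₀∈U)) Good
        (λ {p} {q} → good-mono {p} {q}) (λ {p} → good-resp {p}) good-dense
        (λ {p} → good-unique {p}) (λ {p} → good-inj {p})

  reflect : ∃[ r ] (∀ β → β ∈ ω₂ → Witness r β)
  reflect = dne λ n → Reflect.contradiction λ r → dne λ m → n (r , λ β p → dne λ w → m (β , p , w))

-- Clubs as closure under operations, and stationary subsets of ω₁.

module Clubs (em : ExcludedMiddle 1ℓ) (choice : Choice) (ω₁ ω₂ : V)
  (s₁ : IsSuccessorCardinal ω ω₁) (s₂ : IsSuccessorCardinal ω₁ ω₂) where
  open import Data.List.Base using (List; []; _∷_; map)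
  open import Data.List.Relation.Binary.Pointwise.Base using (Pointwise; []; _∷_)
  open import Data.List.Relation.Unary.All using (All; []; _∷_)

  open Sets em
  open Cardinals em choice ω₁ ω₂ s₁ s₂
  open Collapse em choice ω₁ ω₂ s₁ s₂ using (IsClubω)

  infix 4 _⊆*_

  _⊆*_ : List V → V → Set₁
  l ⊆* Y = All (_∈ Y) l

  ⊆*-mono : ∀ {Y Z l} → Y ⊆ Z → l ⊆* Y → l ⊆* Z
  ⊆*-mono h [] = []
  ⊆*-mono h (p ∷ q) = h _ p ∷ ⊆*-mono h q

  ⊆*-resp : ∀ {Y l l′} → Pointwise _≐_ l l′ → l ⊆* Y → l′ ⊆* Y
  ⊆*-resp [] [] = []
  ⊆*-resp (e ∷ es) (p ∷ ps) = ∈-respˡ e p ∷ ⊆*-resp es ps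

  Pointwise-refl : ∀ l → Pointwise _≐_ l l
  Pointwise-refl [] = []
  Pointwise-refl (x ∷ l) = ≐-refl ∷ Pointwise-refl l

  Pointwise-sym : ∀ {l l′} → Pointwise _≐_ l l′ → Pointwise _≐_ l′ l
  Pointwise-sym [] = []
  Pointwise-sym (e ∷ es) = ≐-sym e ∷ Pointwise-sym es

  -- A family of countably many finitary operations on X, given by the
  -- countable set of all values at a tuple.
  record Ops (X : V) : Set₁ where
    no-eta-equality
    field
      app : List V → V
      app-ext : ∀ {l l′} → Pointwise _≐_ l l′ → app l ≐ app l′
      app-⊆ : ∀ {l} → l ⊆* X → app l ⊆ X
      app-cov : ∀ {l} → l ⊆* X → Cov (_∈ app l)
  open Ops

  record Closed {X : V} (G : Ops X) (Y : V) : Set₁ where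
    constructor closed
    field
      values : ∀ l → l ⊆* Y → app G l ⊆ Y
  open Closed

  Closed-resp : ∀ {X} (G : Ops X) → Resp (Closed G)
  Closed-resp G e c = closed λ l h z p → ∈-respʳ e (values c l (⊆*-mono (≐⇒⊆ (≐-sym e)) h) z p)

  infixr 5 _⊕_

  _⊕_ : ∀ {X} → Ops X → Ops X → Ops X
  app (F ⊕ G) l = app F l ∪ app G l
  app-ext (F ⊕ G) h = ∪-ext (app-ext F h) (app-ext G h)
  app-⊆ (F ⊕ G) h z p = [ app-⊆ F h z , app-⊆ G h z ]′ (∪-out p)
  app-cov (F ⊕ G) h = cov-∪ (app-cov F h) (app-cov G h)

  closed-⊕ˡ : ∀ {X Y} (F G : Ops X) → Closed (F ⊕ G) Y → Closed F Y
  closed-⊕ˡ F G c = closed λ l h z p → values c l h z (∪-inˡ p)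

  closed-⊕ʳ : ∀ {X Y} (F G : Ops X) → Closed (F ⊕ G) Y → Closed G Y
  closed-⊕ʳ F G c = closed λ l h z p → values c l h z (∪-inʳ p)

  unary : ∀ {X} (f : V → V) → Ext f → (∀ x → x ∈ X → f x ⊆ X) → (∀ x → x ∈ X → Cov (_∈ f x)) → Ops X
  app (unary f e h c) (x ∷ []) = f x
  app (unary f e h c) _ = ∅
  app-ext (unary f e h c) [] = ≐-refl
  app-ext (unary f e h c) (p ∷ []) = e p
  app-ext (unary f e h c) (_ ∷ _ ∷ _) = ≐-refl
  app-⊆ (unary f e h c) [] z p = ⊥-elim (∅-out p)
  app-⊆ (unary f e h c) (q ∷ []) z p = h _ q z p
  app-⊆ (unary f e h c) (_ ∷ _ ∷ _) z p = ⊥-elim (∅-out p)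
  app-cov (unary f e h c) [] = cov-∅ λ _ → ∅-out
  app-cov (unary f e h c) (q ∷ []) = c _ q
  app-cov (unary f e h c) (_ ∷ _ ∷ _) = cov-∅ λ _ → ∅-out

  singleton : ∀ {X} (f : V → V) → Ext f → (∀ x → x ∈ X → f x ∈ X) → Ops X
  singleton f e h = unary (λ x → ｛ f x , f x ｝) (λ p → pair-cong (e p) (e p))
    (λ x p z q → ∈-respˡ (≐-sym (single-out q)) (h x p)) (λ x p → cov-single)

  binary : ∀ {X} (f : V → V → V) → (∀ {x x′ y y′} → x ≐ x′ → y ≐ y′ → f x y ≐ f x′ y′) →
    (∀ x y → x ∈ X → y ∈ X → f x y ⊆ X) → (∀ x y → x ∈ X → y ∈ X → Cov (_∈ f x y)) → Ops X
  app (binary f e h c) (x ∷ y ∷ []) = f x y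
  app (binary f e h c) _ = ∅
  app-ext (binary f e h c) [] = ≐-refl
  app-ext (binary f e h c) (_ ∷ []) = ≐-refl
  app-ext (binary f e h c) (p ∷ q ∷ []) = e p q
  app-ext (binary f e h c) (_ ∷ _ ∷ _ ∷ _) = ≐-refl
  app-⊆ (binary f e h c) [] z p = ⊥-elim (∅-out p)
  app-⊆ (binary f e h c) (_ ∷ []) z p = ⊥-elim (∅-out p)
  app-⊆ (binary f e h c) (q ∷ r ∷ []) z p = h _ _ q r z p
  app-⊆ (binary f e h c) (_ ∷ _ ∷ _ ∷ _) z p = ⊥-elim (∅-out p)
  app-cov (binary f e h c) [] = cov-∅ λ _ → ∅-out
  app-cov (binary f e h c) (_ ∷ []) = cov-∅ λ _ → ∅-out
  app-cov (binary f e h c) (q ∷ r ∷ []) = c _ _ q r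
  app-cov (binary f e h c) (_ ∷ _ ∷ _ ∷ _) = cov-∅ λ _ → ∅-out

  opaque
    unfolding _∈_

    ⋃ₙ : (ℕ → V) → V
    ⋃ₙ = D.⋃ₙ

    ⋃ₙ-in : ∀ {c z} k → z ∈ c k → z ∈ ⋃ₙ c
    ⋃ₙ-in k (j , e) = (k , j) , e

    ⋃ₙ-out : ∀ {c z} → z ∈ ⋃ₙ c → Σ ℕ λ k → z ∈ c k
    ⋃ₙ-out ((k , j) , e) = k , (j , e)

    enlarge : (List V → V) → V → V
    enlarge g Y = sup (Index Y ⊎ Σ (List (Index Y)) λ l → Index (g (map (elt Y) l)))
      λ { (inj₁ i) → elt Y i ; (inj₂ (l , j)) → elt (g (map (elt Y) l)) j }

    enlarge-self : ∀ {g Y} → Y ⊆ enlarge g Y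
    enlarge-self z (i , e) = inj₁ i , e

    enlarge-in : ∀ {g Y l z} → (∀ {l l′} → Pointwise _≐_ l l′ → g l ≐ g l′) → l ⊆* Y → z ∈ g l → z ∈ enlarge g Y
    enlarge-in {g} {Y} {l} {z} e h p =
      let (is , q) = indices l h ; (j , r) = ∈-respʳ {z} {g l} {g (map (elt Y) is)} (e q) p in inj₂ (is , j) , r
      where
      indices : ∀ l → l ⊆* Y → Σ (List (Index Y)) λ is → Pointwise _≐_ l (map (elt Y) is)
      indices [] [] = [] , []
      indices (x ∷ l) ((i , e) ∷ h) = let (is , es) = indices l h in i ∷ is , e ∷ es

    enlarge-out : ∀ {g Y z} → z ∈ enlarge g Y → z ∈ Y ⊎ (∃[ l ] l ⊆* Y × z ∈ g l)
    enlarge-out (inj₁ i , e) = inj₁ (i , e)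
    enlarge-out {g} {Y} (inj₂ (l , j) , e) = inj₂ (map (elt Y) l , members l , (j , e))
      where
      members : ∀ l → map (elt Y) l ⊆* Y
      members [] = []
      members (i ∷ l) = elt∈ {Y} i ∷ members l

  module Hull {X : V} (G : Ops X) where

    opaque
      stage : V → ℕ → V
      stage A zero = A
      stage A (suc n) = enlarge (app G) (stage A n)

      hull : V → V
      hull A = ⋃ₙ (stage A)

      hull-self : ∀ {A} → A ⊆ hull A
      hull-self z p = ⋃ₙ-in 0 p

      stage-mono : ∀ {A} m n → stage A n ⊆ stage A (m + n)
      stage-mono zero n z p = p
      stage-mono (suc m) n z p = enlarge-self z (stage-mono m n z p)

      bounded : ∀ {A l} → l ⊆* hull A → Σ ℕ λ n → l ⊆* stage A n
      bounded [] = 0 , []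
      bounded {A} {x ∷ l} (p ∷ ps) = let (m , q) = ⋃ₙ-out p ; (n , qs) = bounded ps in
        m + n , subst (λ k → x ∈ stage A k) (+-comm n m) (stage-mono n m x q)
          ∷ ⊆*-mono (stage-mono m n) qs

      hull-closed : ∀ {A} → Closed G (hull A)
      hull-closed = closed λ l h z p → let (n , q) = bounded h in ⋃ₙ-in (suc n) (enlarge-in (app-ext G) q p)

      hull-min : ∀ {A Y} → A ⊆ Y → Closed G Y → hull A ⊆ Y
      hull-min {A} {Y} h c z p = let (n , q) = ⋃ₙ-out p in go n z q
        where
        go : ∀ n → stage A n ⊆ Y
        go zero = h
        go (suc n) z q = [ go n z , (λ (l , r , s) → values c l (⊆*-mono (go n) r) z s) ]′ (enlarge-out q)

      hull-cov : ∀ {A} → A ⊆ X → Cov (_∈ A) → Cov (_∈ hull A)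
      hull-cov {A} h c = cov-mono (λ z → ⋃ₙ-out) (cov-⋃ λ n → proj₂ (go n))
        where
        next : ∀ {Y} → Y ⊆ X → Cov (_∈ Y) → Cov (_∈ enlarge (app G) Y)
        next {Y} h (e , c) = cov-mono (λ z → enlarge-out) (cov-⊎ (e , c) (cov-mono
            (λ z (l , q , p) → let (ns , es) = numbers l q ; (n , eq) = unlist-surj ns in
              n , subst (λ ns → map e ns ⊆* X × z ∈ app G (map e ns)) (sym eq)
                (⊆*-resp es (⊆*-mono h q) , ∈-respʳ (app-ext G es) p))
            (cov-⋃ {D = λ n z → map e (unlist n) ⊆* X × z ∈ app G (map e (unlist n))}
              λ n → pick (map e (unlist n)) (lem _))))
          where
          numbers : ∀ l → l ⊆* Y → Σ (List ℕ) λ ns → Pointwise _≐_ l (map e ns)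
          numbers [] [] = [] , []
          numbers (x ∷ l) (p ∷ ps) = let (n , q) = c x p ; (ns , qs) = numbers l ps in n ∷ ns , q ∷ qs
          pick : ∀ l → l ⊆* X ⊎ ¬ l ⊆* X → Cov (λ z → l ⊆* X × z ∈ app G l)
          pick l (inj₁ q) = cov-mono (λ _ → proj₂) (app-cov G q)
          pick l (inj₂ n) = cov-∅ λ _ p → n (proj₁ p)
        sub : ∀ {Y} → Y ⊆ X → enlarge (app G) Y ⊆ X
        sub h z q = [ h z , (λ (l , r , s) → app-⊆ G (⊆*-mono h r) z s) ]′ (enlarge-out q)
        go : ∀ n → stage A n ⊆ X × Cov (_∈ stage A n)
        go zero = h , c
        go (suc n) = let (h , c) = go n in sub h , next h c

    hull-⊆ : ∀ {A} → A ⊆ X → hull A ⊆ X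
    hull-⊆ h = hull-min h (closed λ l → app-⊆ G)

    hull-mono : ∀ {A B} → A ⊆ B → hull A ⊆ hull B
    hull-mono h = hull-min (λ z p → hull-self z (h z p)) hull-closed

    hull-ext : Ext hull
    hull-ext e = ⊆-antisym (hull-mono (≐⇒⊆ e)) (hull-mono (≐⇒⊆ (≐-sym e)))

  closed-union : ∀ {X} (G : Ops X) {ℓ} {I : Set ℓ} (c : I → V) {Z} → (∀ i → Closed G (c i)) → (∀ i → c i ⊆ Z) →
    (∀ l → l ⊆* Z → Σ I λ i → l ⊆* c i) → Closed G Z
  closed-union G c h k d = closed λ l p z q → let (i , r) = d l p in k i z (values (h i) l r z q)

  chain-bound : ∀ (c : ℕ → V) → (∀ k → c k ⊆ c (suc k)) → ∀ {Z} → (∀ z → z ∈ Z → Σ ℕ λ k → z ∈ c k) →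
    ∀ l → l ⊆* Z → Σ ℕ λ k → l ⊆* c k
  chain-bound c h {Z} out [] [] = 0 , []
  chain-bound c h {Z} out (x ∷ l) (p ∷ ps) =
    let (m , q) = out x p ; (n , qs) = chain-bound c h out l ps in
    m + n , subst (λ k → x ∈ c k) (+-comm n m) (up n m x q) ∷ ⊆*-mono (up m n) qs
    where
    up : ∀ m n → c n ⊆ c (m + n)
    up zero n z p = p
    up (suc m) n z p = h _ z (up m n z p)

  ops⇒club : ∀ {X} (G : Ops X) → ∃[ C ] IsClubω X C × (∀ Y → Y ∈ C → Closed G Y)
  ops⇒club {X} G = C , ((λ Y p → let (q , r , _) = sep-out rK p in Pow-out q , r) ,
      (λ Y h c → hull Y , sep-in rK (Pow-in (hull-⊆ h))
        (cov⇒countable (hull-cov h (countable⇒cov c)) , hull-closed) , hull-self) ,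
      cl) , λ Y p → proj₂ (proj₂ (sep-out rK p))
    where
    open Hull G
    K : V → Set₁
    K Y = Countable Y × Closed G Y
    rK : Resp K
    rK e (c , d) = ≼-trans (⊆⇒≼ (≐⇒⊆ (≐-sym e))) c , Closed-resp G e d
    C : V
    C = ⟪ Pow X ∣ K ⟫
    cl : (c : ℕ → V) → (∀ k → c k ∈ C) → (∀ k → c k ⊆ c (suc k)) →
      ∀ Z → (∀ z → z ∈ Z → Σ ℕ λ k → z ∈ c k) → (∀ k → c k ⊆ Z) → Z ∈ C
    cl c h inc Z out into = sep-in rK
      (Pow-in λ z p → let (k , q) = out z p in Pow-out (proj₁ (sep-out rK (h k))) z q)
      (cov⇒countable (cov-mono (λ z → out z) (cov-⋃ λ k → countable⇒cov (proj₁ (proj₂ (sep-out rK (h k)))))) ,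
       closed-union G c (λ k → proj₂ (proj₂ (sep-out rK (h k)))) into (chain-bound c inc out))

  opaque
    unfolding _∈_

    Prod : V → V → V
    Prod a b = sup (Index a × Index b) λ (i , j) → D.⟨ elt a i , elt b j ⟩

    Prod-in′ : ∀ {a b x y} → x ∈ a → y ∈ b → ∃[ x′ ] ∃[ y′ ] x ≐ x′ × y ≐ y′ × ⟨ x′ , y′ ⟩ ∈ Prod a b
    Prod-in′ {a} {b} (i , e) (j , e′) = elt a i , elt b j , e , e′ , (i , j) , ≐-refl {⟨ elt a i , elt b j ⟩}

    Prod-out : ∀ {a b z} → z ∈ Prod a b → ∃[ x ] ∃[ y ] x ∈ a × y ∈ b × z ≐ ⟨ x , y ⟩
    Prod-out {a} {b} ((i , j) , e) = elt a i , elt b j , elt∈ {a} i , elt∈ {b} j , e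

  Prod-in : ∀ {a b x y} → x ∈ a → y ∈ b → ⟨ x , y ⟩ ∈ Prod a b
  Prod-in p q = let (_ , _ , e , e′ , r) = Prod-in′ p q in ∈-respˡ (⟨⟩-cong (≐-sym e) (≐-sym e′)) r

  -- Kueker's description of clubs. Each finite sequence is assigned a member of `C` that contains
  -- its first entry and includes the member assigned to its tail; along an enumeration of a closed
  -- `Y` these increase to `Y`.
  club⇒ops : ∀ {X C} → IsClubω X C → Σ (Ops X) λ G → ∀ Y → Y ⊆ X → Countable Y → Closed G Y → Y ∈ C
  club⇒ops {X} {C} (C-⊆ , C-cof , C-closed) = G , closed⇒∈
    where
    Ext₂ : V → V → Set₁
    Ext₂ p W = ∃[ x ] ∃[ Z ] p ≐ ⟨ x , Z ⟩ × W ∈ C × Z ⊆ W × x ∈ W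
    extend : Σ (V → V) λ g → Ext g × (∀ p → p ∈ Prod X C → Ext₂ p (g p))
    extend = choose (Prod X C) Ext₂
      (λ e e′ (x , Z , p , q , r , s) → x , Z , ≐-trans (≐-sym e) p , ∈-respˡ e′ q ,
        (λ z t → ∈-respʳ e′ (r z t)) , ∈-respʳ e′ s)
      (λ p q → let (x , Z , r , s , e) = Prod-out q
                   (W , W∈C , h) = C-cof (｛ x , x ｝ ∪ Z) (sub r s) (cov⇒countable (cov-∪
                     cov-single (countable⇒cov (proj₂ (C-⊆ Z s))))) in
        W , x , Z , e , W∈C , (λ z t → h z (∪-inʳ t)) , h x (∪-inˡ (pair-inˡ ≐-refl)))
      where
      sub : ∀ {x Z} → x ∈ X → Z ∈ C → ｛ x , x ｝ ∪ Z ⊆ X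
      sub r s z t = [ (λ u → ∈-respˡ (≐-sym (single-out u)) r) , proj₁ (C-⊆ _ s) z ]′ (∪-out t)
    g : V → V
    g = proj₁ extend
    start : ∃[ Z ] Z ∈ C × ∅ ⊆ Z
    start = C-cof ∅ (λ z p → ⊥-elim (∅-out p)) (cov⇒countable (cov-∅ λ _ → ∅-out))
    c : List V → V
    c [] = proj₁ start
    c (x ∷ l) = g ⟨ x , c l ⟩
    grow : ∀ {x l} → x ∈ X → c l ∈ C → c (x ∷ l) ∈ C × c l ⊆ c (x ∷ l) × x ∈ c (x ∷ l)
    grow {x} {l} p q = let (x′ , Z , e , r , s , t) = proj₂ (proj₂ extend) _ (Prod-in p q) ; (a , b) = ⟨⟩-inj e in
      r , (λ z u → s z (∈-respʳ b u)) , ∈-respˡ (≐-sym a) t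
    c∈C : ∀ {l} → l ⊆* X → c l ∈ C
    c∈C [] = proj₁ (proj₂ start)
    c∈C {x ∷ l} (p ∷ ps) = proj₁ (grow {x} {l} p (c∈C ps))
    c-ext : ∀ {l l′} → Pointwise _≐_ l l′ → c l ≐ c l′
    c-ext [] = ≐-refl
    c-ext (e ∷ es) = proj₁ (proj₂ extend) (⟨⟩-cong e (c-ext es))
    G : Ops X
    G = record { app = c ; app-ext = c-ext ; app-⊆ = λ h → proj₁ (C-⊆ _ (c∈C h))
      ; app-cov = λ h → countable⇒cov (proj₂ (C-⊆ _ (c∈C h))) }
    closed⇒∈ : ∀ Y → Y ⊆ X → Countable Y → Closed G Y → Y ∈ C
    closed⇒∈ Y Y⊆X cY cl = by (countable⇒cov cY)
      where
      by : Cov (_∈ Y) → Y ∈ C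
      by (h , cov) = C-closed (λ k → c (lst k)) (λ k → c∈C (⊆*-mono Y⊆X (lst⊆ k))) inc Y
        (λ z p → let (n , e) = cov z p in suc n , hit n z e (∈-respˡ e p) (lem₀ (h n ∈ Y)))
        (λ k → values cl (lst k) (lst⊆ k))
        where
        -- The enumeration may leave `Y`; entries outside are skipped.
        add : ∀ {x} → x ∈ Y ⊎ ¬ x ∈ Y → List V → List V
        add {x} (inj₁ _) l = x ∷ l
        add (inj₂ _) l = l
        lst : ℕ → List V
        lst zero = []
        lst (suc k) = add (lem₀ (h k ∈ Y)) (lst k)
        add⊆ : ∀ {x l} (d : x ∈ Y ⊎ ¬ x ∈ Y) → l ⊆* Y → add d l ⊆* Y
        add⊆ (inj₁ p) q = p ∷ q
        add⊆ (inj₂ _) q = q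
        lst⊆ : ∀ k → lst k ⊆* Y
        lst⊆ zero = []
        lst⊆ (suc k) = add⊆ (lem₀ (h k ∈ Y)) (lst⊆ k)
        inc′ : ∀ {x l} (d : x ∈ Y ⊎ ¬ x ∈ Y) → l ⊆* X → c l ⊆ c (add d l)
        inc′ {x} {l} (inj₁ p) q = proj₁ (proj₂ (grow {x} {l} (Y⊆X _ p) (c∈C q)))
        inc′ (inj₂ _) q z r = r
        inc : ∀ k → c (lst k) ⊆ c (lst (suc k))
        inc k = inc′ (lem₀ (h k ∈ Y)) (⊆*-mono Y⊆X (lst⊆ k))
        hit : ∀ n z → z ≐ h n → h n ∈ Y → (d : h n ∈ Y ⊎ ¬ h n ∈ Y) → z ∈ c (add d (lst n))
        hit n z e p (inj₁ q) = ∈-respˡ (≐-sym e) (proj₂ (proj₂ (grow {h n} {lst n} (Y⊆X _ q) (c∈C (⊆*-mono Y⊆X (lst⊆ n))))))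
        hit n z e p (inj₂ m) = ⊥-elim (m p)

  -- Stationary subsets of ω₁.

  IsClub₁ : V → Set₁
  IsClub₁ C = C ⊆ ω₁ × (∀ α → α ∈ ω₁ → ∃[ β ] β ∈ C × α ∈ β)
    × (∀ α → α ∈ ω₁ → IsLimit α → (∀ β → β ∈ α → ∃[ γ ] γ ∈ C × γ ∈ α × β ∈ γ) → α ∈ C)

  Stat : V → Set₁
  Stat T = T ⊆ ω₁ × (∀ C → IsClub₁ C → ∃[ α ] α ∈ C × α ∈ T)

  ∅∈limit : ∀ {ν} → IsLimit ν → ∅ ∈ ν
  ∅∈limit (_ , p , _) = p

  -- The limit ordinals closed under the operations form a club: iterating the hull ω times gives
  -- cofinality, and bounding finitely many arguments at once gives closure.
  closed-point : ∀ {T} → Stat T → (G : Ops ω₁) → ∃[ ν ] ν ∈ T × IsLimit ν × Closed G ν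
  closed-point {T} (_ , s) G = let (ν , p , q) = s C (sep-⊆ rK , unb , cl) ; (_ , a , b) = sep-out rK p in ν , q , a , b
    where
    open Hull G
    K : V → Set₁
    K ν = IsLimit ν × Closed G ν
    rK : Resp K
    rK e ((o , p , h) , c) = (IsOrdinal-resp e o , ∈-respʳ e p , λ β q → ∈-respʳ e (h β (∈-respʳ (≐-sym e) q))) ,
      Closed-resp G e c
    C : V
    C = ⟪ ω₁ ∣ K ⟫
    ⊆ω₁ : ∀ {α} → α ∈ ω₁ → α ⊆ ω₁
    ⊆ω₁ p z q = ord-trans ord-ω₁ q p
    unb : ∀ α → α ∈ ω₁ → ∃[ β ] β ∈ C × α ∈ β
    unb α α∈ = ⋃ₙ ν , sep-in rK (∈ω₁ ord-ν (cov-mono (λ z → ⋃ₙ-out) (cov-⋃ λ n → ω₁-cov (ν∈ n)))) (limit , ν-closed) ,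
      ⋃ₙ-in 0 succ-self
      where
      ν : ℕ → V
      ν zero = succ α
      ν (suc n) = succ (bnd (hull (ν n)))
      ν∈ : ∀ n → ν n ∈ ω₁
      ν∈ zero = succ∈ω₁ α∈
      ν∈ (suc n) = succ∈ω₁ (bnd∈ω₁ (hull-cov (⊆ω₁ (ν∈ n)) (ω₁-cov (ν∈ n))) (hull-⊆ (⊆ω₁ (ν∈ n))))
      ord : ∀ n → IsOrdinal (ν n)
      ord n = ord-elt ord-ω₁ (ν∈ n)
      hull⊆ : ∀ n → hull (ν n) ⊆ ν (suc n)
      hull⊆ n z p = succ-in (bnd-in p)
      below : ∀ {β} n → IsOrdinal β → β ⊆ ν n → β ∈ ν (suc n)
      below {β} n o h = ord-⊆∈ o (ord (suc n)) (λ z p → bnd-in (hull-self z (h z p))) succ-self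
      ord-ν : IsOrdinal (⋃ₙ ν)
      ord-ν = (λ y p z q → let (n , r) = ⋃ₙ-out p in ⋃ₙ-in n (proj₁ (ord n) y r z q)) ,
        λ y p → let (n , r) = ⋃ₙ-out p in proj₂ (ord n) y r
      limit : IsLimit (⋃ₙ ν)
      limit = ord-ν , ⋃ₙ-in 1 (below 0 (ord-elt ord-ω₁ ∅∈ω₁) λ z p → ⊥-elim (∅-out p)) , λ β p →
        let (n , r) = ⋃ₙ-out p in ⋃ₙ-in (suc n) (below n (ord-succ (ord-elt (ord n) r))
          λ z q → [ (λ t → ord-trans (ord n) t r) , (λ e → ∈-respˡ (≐-sym e) r) ]′ (succ-out q))
      ν-closed : Closed G (⋃ₙ ν)
      ν-closed = closed λ l h z p → let (n , q) = chain-bound ν (λ n z r → hull⊆ n z (hull-self z r)) (λ z → ⋃ₙ-out) l h in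
        ⋃ₙ-in (suc n) (hull⊆ n z (values hull-closed l (⊆*-mono hull-self q) z p))
    cl : ∀ α → α ∈ ω₁ → IsLimit α → (∀ β → β ∈ α → ∃[ γ ] γ ∈ C × γ ∈ α × β ∈ γ) → α ∈ C
    cl α α∈ lim h = sep-in rK α∈ (lim , closed λ l p z q → let (γ , a , b , c) = bound l p in
        ord-trans (proj₁ lim) (values (proj₂ (proj₂ (sep-out rK a))) l c z q) b)
      where
      bound : ∀ l → l ⊆* α → ∃[ γ ] γ ∈ C × γ ∈ α × l ⊆* γ
      bound [] [] = let (γ , a , b , _) = h ∅ (∅∈limit lim) in γ , a , b , []
      bound (x ∷ l) (p ∷ ps) = let (γ , a , b , c) = bound l ps
                                   (γ′ , a′ , b′ , c′) = h (γ ∪ x) (ord-max (proj₁ lim) b p) in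
        γ′ , a′ , b′ , inside b′ p c′ b ∷ ⊆*-mono (λ z r → up b′ c′ b p z r) c
        where
        inside : ∀ {γ γ′ x} → γ′ ∈ α → x ∈ α → γ ∪ x ∈ γ′ → γ ∈ α → x ∈ γ′
        inside b′ p c′ b = ord-⊆∈ (ord-elt (proj₁ lim) p) (ord-elt (proj₁ lim) b′) (λ z → ∪-inʳ) c′
        up : ∀ {γ γ′ x} → γ′ ∈ α → γ ∪ x ∈ γ′ → γ ∈ α → x ∈ α → γ ⊆ γ′
        up b′ c′ b p z r = proj₁ (ord-elt (proj₁ lim) b′) _ c′ z (∪-inˡ r)

  -- The countable ordinals in the hull of `succ i ∪ A` are bounded by a countable `f i`. If ν is a
  -- limit closed under `f`, the hull of `ν ∪ A` is the directed union of these hulls over i < ν, so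
  -- it contains no countable ordinal outside ν.
  trace-point : ∀ {X T A} → ω₁ ⊆ X → A ⊆ X → Cov (_∈ A) → Stat T → (G : Ops X) →
    ∃[ ν ] ν ∈ T × IsLimit ν × Hull.hull G (ν ∪ A) ∩ ω₁ ⊆ ν
  trace-point {X} {T} {A} ω₁⊆X A⊆X cA sT G = finish (closed-point sT F)
    where
    open Hull G
    f : V → V
    f i = bnd (hull (succ i ∪ A) ∩ ω₁)
    f-ext : Ext f
    f-ext e = bnd-ext (∩-ext (hull-ext (∪-ext (succ-ext e) ≐-refl)) ≐-refl)
    sub : ∀ {i} → i ∈ ω₁ → i ∪ A ⊆ X
    sub p z q = [ (λ r → ω₁⊆X z (ord-trans ord-ω₁ r p)) , A⊆X z ]′ (∪-out q)
    f∈ : ∀ {i} → i ∈ ω₁ → f i ∈ ω₁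
    f∈ p = bnd∈ω₁ (cov-mono (λ z q → proj₁ (∩-out q)) (hull-cov (sub (succ∈ω₁ p)) (cov-∪ (ω₁-cov (succ∈ω₁ p)) cA)))
      λ z q → proj₂ (∩-out q)
    F : Ops ω₁
    F = singleton f f-ext λ i → f∈
    finish : (∃[ ν ] ν ∈ T × IsLimit ν × Closed F ν) → ∃[ ν ] ν ∈ T × IsLimit ν × hull (ν ∪ A) ∩ ω₁ ⊆ ν
    finish (ν , ν∈T , lim , cl) = ν , ν∈T , lim , λ z p →
        let (a , b) = ∩-out p ; (i , q , r) = split z a in
        ord-trans (proj₁ lim) (bnd-in (∩-in r b)) (values cl (i ∷ []) (q ∷ []) (f i) (pair-inˡ ≐-refl))
      where
      Y : V
      Y = ⋃ (Im (λ i → hull (succ i ∪ A)) ν)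
      g-ext : Ext (λ i → hull (succ i ∪ A))
      g-ext e = hull-ext (∪-ext (succ-ext e) ≐-refl)
      Y-in : ∀ {i z} → i ∈ ν → z ∈ hull (succ i ∪ A) → z ∈ Y
      Y-in p q = ⋃-in q (Im-in g-ext p ≐-refl)
      Y-out : ∀ z → z ∈ Y → ∃[ i ] i ∈ ν × z ∈ hull (succ i ∪ A)
      Y-out z p = let (w , q , r) = ⋃-out p ; (i , s , e) = Im-out q in i , s , ∈-respʳ e r
      wider : ∀ {i j k} → i ∈ ν → j ∈ ν → i ⊆ k → IsOrdinal k → hull (succ i ∪ A) ⊆ hull (succ k ∪ A)
      wider {i} {j} {k} p q h ok = hull-mono λ z r → [ (λ s → ∪-inˡ ([ (λ t → succ-in (h z t)) ,
        (λ e → ord-⊆∈ (IsOrdinal-resp (≐-sym e) (ord-elt (proj₁ lim) p)) (ord-succ ok)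
          (λ y t → h y (∈-respʳ e t)) succ-self) ]′ (succ-out s))) , ∪-inʳ ]′ (∪-out r)
      bound : ∀ l → l ⊆* Y → ∃[ i ] i ∈ ν × l ⊆* hull (succ i ∪ A)
      bound [] [] = ∅ , ∅∈limit lim , []
      bound (x ∷ l) (p ∷ ps) = let (i , q , r) = Y-out x p ; (j , s , t) = bound l ps ; m = ord-max (proj₁ lim) q s in
        i ∪ j , m , wider q s (λ z → ∪-inˡ) (ord-elt (proj₁ lim) m) x r ∷
          ⊆*-mono (wider s q (λ z → ∪-inʳ) (ord-elt (proj₁ lim) m)) t
      Y-closed : Closed G Y
      Y-closed = closed λ l p z q → let (i , r , s) = bound l p in Y-in r (values hull-closed l s z q)
      split : ∀ z → z ∈ hull (ν ∪ A) → ∃[ i ] i ∈ ν × z ∈ hull (succ i ∪ A)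
      split z p = Y-out z (hull-min (λ w q → [ (λ r → Y-in r (hull-self w (∪-inˡ succ-self))) ,
        (λ r → Y-in (∅∈limit lim) (hull-self w (∪-inʳ r))) ]′ (∪-out q)) Y-closed z p)

-- Consequences of SRP: continuous chains and saturation.

module Reflection (em : ExcludedMiddle 1ℓ) (choice : Choice) (ω₁ ω₂ : V)
  (s₁ : IsSuccessorCardinal ω ω₁) (s₂ : IsSuccessorCardinal ω₁ ω₂) (srp : SRP ω₁ ω₂) where
  open import Data.List.Base using ([]; _∷_)
  open import Data.List.Relation.Unary.All using ([]; _∷_)

  open Sets em
  open Cardinals em choice ω₁ ω₂ s₁ s₂
  open Collapse em choice ω₁ ω₂ s₁ s₂ using (IsClubω)
  open Clubs em choice ω₁ ω₂ s₁ s₂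
  open Closed

  IsClubᴴ : V → Set₁
  IsClubᴴ C =
      (∀ Y → Y ∈ C → (∀ x → x ∈ Y → H ω₂ x) × Countable Y)
    × (∀ Y → (∀ x → x ∈ Y → H ω₂ x) × Countable Y → ∃[ Z ] Z ∈ C × Y ⊆ Z)
    × ((c : ℕ → V) → (∀ k → c k ∈ C) → (∀ k → c k ⊆ c (suc k)) → ⋃ₙ c ∈ C)

  opaque
    unfolding _∈_ ⋃ₙ

    srpᵒ : ∀ P → (∀ Y → Y ∈ P → (∀ x → x ∈ Y → H ω₂ x) × Countable Y) →
      (∀ T → Stat T → ∀ C → IsClubᴴ C → ∃[ Y ] Y ∈ C × Y ∈ P × Y ∩ ω₁ ∈ T) →
      ∃[ N ] (∀ ξ → ξ ∈ ω₁ → N ‵ ξ ∈ P × N ‵ ξ ∈ N ‵ succ ξ × N ‵ ξ ⊆ N ‵ succ ξ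
        × (IsLimit ξ → ∀ z → z ∈ N ‵ ξ → ∃[ ζ ] ζ ∈ ξ × z ∈ N ‵ ζ)
        × (IsLimit ξ → ∀ z ζ → ζ ∈ ξ → z ∈ N ‵ ζ → z ∈ N ‵ ξ))
    srpᵒ P h k =
      let (N , c , m) = srp P (h , λ T s → (λ Y q → h Y (proj₁ q)) , k T s) in
      N , λ ξ p → m ξ p , IsContinuousElementaryChain.member c ξ p , IsContinuousElementaryChain.increasing c ξ p ,
        (λ lim z q → to (IsContinuousElementaryChain.continuous c ξ p lim z) q) ,
        (λ lim z ζ q r → from (IsContinuousElementaryChain.continuous c ξ p lim z) (ζ , q , r))

  -- If there were no club in [H_ω₂]^ω, then the empty set would be projective stationary.
  some-club : ∃[ C ] IsClubᴴ C
  some-club = dne λ n →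
    let (N , h) = srpᵒ ∅ (λ Y p → ⊥-elim (∅-out p)) (λ T s C c → ⊥-elim (n (C , c))) in ∅-out (proj₁ (h ∅ ∅∈ω₁))

  opaque
    -- A priori `H ω₂` is only a class. Clubs are cofinal, so each of its elements lies in a member
    -- of the club found above, and the union of that club bounds the class by a set.
    Hω₂ : V
    Hω₂ = ⟪ ⋃ (proj₁ some-club) ∣ H ω₂ ⟫

    Hω₂-out : ∀ {x} → x ∈ Hω₂ → H ω₂ x
    Hω₂-out p = proj₂ (sep-out H-resp p)

    Hω₂-in : ∀ {x} → H ω₂ x → x ∈ Hω₂
    Hω₂-in {x} h = sep-in H-resp (by (proj₁ (proj₂ (proj₂ some-club)) ｛ x , x ｝
        ((λ y p → H-resp (≐-sym (single-out p)) h) , cov⇒countable cov-single))) h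
      where
      by : (∃[ Z ] Z ∈ proj₁ some-club × ｛ x , x ｝ ⊆ Z) → x ∈ ⋃ (proj₁ some-club)
      by (Z , p , q) = ⋃-in (q x (pair-inˡ ≐-refl)) p

  club-Hω₂ : ∀ {C} → IsClubᴴ C → IsClubω Hω₂ C
  club-Hω₂ (h , k , l) = (λ Y p → let (a , b) = h Y p in (λ x q → Hω₂-in (a x q)) , b) ,
    (λ Y a b → k Y ((λ x q → Hω₂-out (a x q)) , b)) ,
    λ c p q Z out into → ∈-respˡ (⊆-antisym (λ z r → let (n , s) = ⋃ₙ-out r in into n z s)
      (λ z r → let (n , s) = out z r in ⋃ₙ-in n s)) (l c p q)

  ω₂⊆Hω₂ : ω₂ ⊆ Hω₂
  ω₂⊆Hω₂ β p = Hω₂-in (H-⊆ord (ord-elt ord-ω₂ p) p λ _ q → q)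

  ω₁⊆Hω₂ : ω₁ ⊆ Hω₂
  ω₁⊆Hω₂ ξ p = ω₂⊆Hω₂ ξ (ω₁⊆ω₂ ξ p)

  ⊆ω₁-Hω₂ : ∀ {S} → S ⊆ ω₁ → S ∈ Hω₂
  ⊆ω₁-Hω₂ h = Hω₂-in (H-⊆ord ord-ω₁ ω₁∈ω₂ h)

  cond-out : ∀ {A u z} → z ∈ cond A u ∅ → A × z ∈ u
  cond-out {A} p = [ (λ a → a , ∈-respʳ (cond-yes a) p) , (λ n → ⊥-elim (∅-out (∈-respʳ (cond-no n) p))) ]′ (lem A)

  -- Sets closed under these operations have a transitive trace on ω₁, and contain the traces of their members.
  opaque
    std₁ std₂ std : Ops Hω₂
    std₁ = unary (λ x → cond (Lift 1ℓ (x ∈ ω₁)) x ∅)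
      (λ e → cond-ext (λ (lift p) → lift (∈-respˡ e p)) (λ (lift p) → lift (∈-respˡ (≐-sym e) p)) e ≐-refl)
      (λ x _ z p → let (lift q , r) = cond-out p in ω₁⊆Hω₂ z (ord-trans ord-ω₁ r q))
      (λ x _ → by x (lem (Lift 1ℓ (x ∈ ω₁))))
      where
      by : ∀ x → Lift 1ℓ (x ∈ ω₁) ⊎ ¬ Lift 1ℓ (x ∈ ω₁) → Cov (_∈ cond (Lift 1ℓ (x ∈ ω₁)) x ∅)
      by x (inj₁ (lift p)) = cov-mono (λ z q → proj₂ (cond-out q)) (ω₁-cov p)
      by x (inj₂ n) = cov-∅ λ z q → n (proj₁ (cond-out q))
    std₂ = unary (λ x → cond (Lift 1ℓ (x ∩ ω₁ ∈ ω₁)) ｛ x ∩ ω₁ , x ∩ ω₁ ｝ ∅)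
      (λ e → let e′ = ∩-ext e ≐-refl in cond-ext (λ (lift p) → lift (∈-respˡ e′ p))
        (λ (lift p) → lift (∈-respˡ (≐-sym e′) p)) (pair-cong e′ e′) ≐-refl)
      (λ x _ z p → let (lift q , r) = cond-out p in ω₁⊆Hω₂ z (∈-respˡ (≐-sym (single-out r)) q))
      (λ x _ → cov-one (x ∩ ω₁) λ z p → let (_ , r) = cond-out p in single-out r)
    std = std₁ ⊕ std₂

    std-trans : ∀ {Y} → Closed std Y → ∀ {ξ} → ξ ∈ Y → ξ ∈ ω₁ → ξ ⊆ Y
    std-trans c p q z r = values (closed-⊕ˡ std₁ std₂ c) (_ ∷ []) (p ∷ []) z (∈-respʳ (≐-sym (cond-yes (lift q))) r)

    std-trace : ∀ {Y} → Closed std Y → ∀ {x} → x ∈ Y → x ∩ ω₁ ∈ ω₁ → x ∩ ω₁ ∈ Y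
    std-trace c p q = values (closed-⊕ʳ std₁ std₂ c) (_ ∷ []) (p ∷ []) _ (∈-respʳ (≐-sym (cond-yes (lift q))) (pair-inˡ ≐-refl))

  trace-ord : ∀ {Y} → Closed std Y → IsOrdinal (Y ∩ ω₁)
  trace-ord c = (λ y p z q → let (a , b) = ∩-out p in ∩-in (std-trans c a b z q) (ord-trans ord-ω₁ q b)) ,
    λ y p → proj₁ (ord-elt ord-ω₁ (proj₂ (∩-out p)))

  record Chain (F : Ops Hω₂) (Q : V → Set₁) (N : V) : Set₁ where
    field
      cov : ∀ {ξ} → ξ ∈ ω₁ → Cov (_∈ N ‵ ξ)
      ⊆H : ∀ {ξ} → ξ ∈ ω₁ → N ‵ ξ ⊆ Hω₂
      closedˢ : ∀ {ξ} → ξ ∈ ω₁ → Closed std (N ‵ ξ)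
      closedᶠ : ∀ {ξ} → ξ ∈ ω₁ → Closed F (N ‵ ξ)
      holds : ∀ {ξ} → ξ ∈ ω₁ → Q (N ‵ ξ)
      member : ∀ {ξ} → ξ ∈ ω₁ → N ‵ ξ ∈ N ‵ succ ξ
      increasing : ∀ {ξ} → ξ ∈ ω₁ → N ‵ ξ ⊆ N ‵ succ ξ
      limit-out : ∀ {ξ} → ξ ∈ ω₁ → IsLimit ξ → ∀ z → z ∈ N ‵ ξ → ∃[ ζ ] ζ ∈ ξ × z ∈ N ‵ ζ
      limit-in : ∀ {ξ} → ξ ∈ ω₁ → IsLimit ξ → ∀ z ζ → ζ ∈ ξ → z ∈ N ‵ ζ → z ∈ N ‵ ξ

  -- SRP applied to the countable sets with `Q` that are closed under `std` and `F`. As every club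
  -- contains all countable sets closed under suitable operations, projective stationarity needs
  -- testing only on such sets.
  chain : (F : Ops Hω₂) (Q : V → Set₁) → Resp Q →
    (∀ T → Stat T → (G : Ops Hω₂) → ∃[ Y ] Y ⊆ Hω₂ × Cov (_∈ Y) × Closed G Y × Y ∩ ω₁ ∈ T × Q Y) → ∃[ N ] Chain F Q N
  chain F Q rQ h = by (srpᵒ P (λ Y p → let (a , b , _) = P-out p in (λ x q → Hω₂-out (a x q)) , b) ps)
    where
    K : V → Set₁
    K Y = Countable Y × Closed std Y × Closed F Y × Q Y
    rK : Resp K
    rK e (a , b , c , d) = ≼-trans (⊆⇒≼ (≐⇒⊆ (≐-sym e))) a , Closed-resp std e b , Closed-resp F e c , rQ e d
    P : V
    P = ⟪ Pow Hω₂ ∣ K ⟫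
    P-out : ∀ {Y} → Y ∈ P → Y ⊆ Hω₂ × K Y
    P-out p = let (a , b) = sep-out rK p in Pow-out a , b
    ps : ∀ T → Stat T → ∀ C → IsClubᴴ C → ∃[ Y ] Y ∈ C × Y ∈ P × Y ∩ ω₁ ∈ T
    ps T s C c = let (G , g) = club⇒ops (club-Hω₂ c)
                     (Y , a , b , d , e , q) = h T s (G ⊕ std ⊕ F) in
      Y , g Y a (cov⇒countable b) (closed-⊕ˡ G (std ⊕ F) d) ,
      sep-in rK (Pow-in a) (cov⇒countable b , closed-⊕ˡ std F (closed-⊕ʳ G (std ⊕ F) d) ,
        closed-⊕ʳ std F (closed-⊕ʳ G (std ⊕ F) d) , q) , e
    by : (∃[ N ] (∀ ξ → ξ ∈ ω₁ → N ‵ ξ ∈ P × N ‵ ξ ∈ N ‵ succ ξ × N ‵ ξ ⊆ N ‵ succ ξ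
        × (IsLimit ξ → ∀ z → z ∈ N ‵ ξ → ∃[ ζ ] ζ ∈ ξ × z ∈ N ‵ ζ)
        × (IsLimit ξ → ∀ z ζ → ζ ∈ ξ → z ∈ N ‵ ζ → z ∈ N ‵ ξ))) → ∃[ N ] Chain F Q N
    by (N , f) = N , record
      { cov = λ p → countable⇒cov (proj₁ (proj₂ (P-out (proj₁ (f _ p)))))
      ; ⊆H = λ p → proj₁ (P-out (proj₁ (f _ p)))
      ; closedˢ = λ p → proj₁ (proj₂ (proj₂ (P-out (proj₁ (f _ p)))))
      ; closedᶠ = λ p → proj₁ (proj₂ (proj₂ (proj₂ (P-out (proj₁ (f _ p))))))
      ; holds = λ p → proj₂ (proj₂ (proj₂ (proj₂ (P-out (proj₁ (f _ p))))))
      ; member = λ p → proj₁ (proj₂ (f _ p))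
      ; increasing = λ p → proj₁ (proj₂ (proj₂ (f _ p)))
      ; limit-out = λ p → proj₁ (proj₂ (proj₂ (proj₂ (f _ p))))
      ; limit-in = λ p → proj₂ (proj₂ (proj₂ (proj₂ (f _ p)))) }

  ∅∈ord : ∀ {ξ ζ} → IsOrdinal ξ → ζ ∈ ξ → ∅ ∈ ξ
  ∅∈ord o p = [ id , [ (λ e → ⊥-elim (∅-out (∈-respʳ (≐-sym e) p))) , (λ q → ⊥-elim (∅-out q)) ]′ ]′
    (trichotomy (ord-elt ord-ω₁ ∅∈ω₁) o)

  succ⊆ : ∀ {ξ ζ} → IsOrdinal ξ → ζ ∈ ξ → succ ζ ⊆ ξ
  succ⊆ o p z q = [ (λ r → ord-trans o r p) , (λ e → ∈-respˡ (≐-sym e) p) ]′ (succ-out q)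

  limit-or-succ : ∀ {ξ ζ} → IsOrdinal ξ → ζ ∈ ξ → IsLimit ξ ⊎ (∃[ η ] η ∈ ξ × ξ ≐ succ η)
  limit-or-succ {ξ} o p with lem (∃[ η ] η ∈ ξ × ξ ≐ succ η)
  ... | inj₁ q = inj₂ q
  ... | inj₂ n = inj₁ (o , ∅∈ord o p , λ β q →
    [ id , (λ e → ⊥-elim (n (β , q , ≐-sym e))) ]′ (ord-⊆ (ord-succ (ord-elt o q)) o (succ⊆ o q)))

  module ChainFacts {F Q N} (ch : Chain F Q N) where
    open Chain ch public

    mono : ∀ {ξ ζ} → ξ ∈ ω₁ → ζ ∈ ξ → N ‵ ζ ⊆ N ‵ ξ
    mono {ξ} {ζ} = ∈-ind (λ ξ → ∀ ζ → ξ ∈ ω₁ → ζ ∈ ξ → N ‵ ζ ⊆ N ‵ ξ) step ξ ζ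
      where
      step : ∀ ξ → (∀ η → η ∈ ξ → ∀ ζ → η ∈ ω₁ → ζ ∈ η → N ‵ ζ ⊆ N ‵ η) → ∀ ζ → ξ ∈ ω₁ → ζ ∈ ξ → N ‵ ζ ⊆ N ‵ ξ
      step ξ ih ζ p q z r = by (limit-or-succ (ord-elt ord-ω₁ p) q)
        where
        by : IsLimit ξ ⊎ (∃[ η ] η ∈ ξ × ξ ≐ succ η) → z ∈ N ‵ ξ
        by (inj₁ lim) = limit-in p lim z ζ q r
        by (inj₂ (η , η∈ , e)) = ∈-respʳ (‵-ext ≐-refl (≐-sym e)) (increasing η∈ω₁ z
          ([ (λ s → ih η η∈ ζ η∈ω₁ s z r) , (λ f → ∈-respʳ (‵-ext ≐-refl f) r) ]′ (succ-out (∈-respʳ e q))))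
          where
          η∈ω₁ : η ∈ ω₁
          η∈ω₁ = ord-trans ord-ω₁ η∈ p

    trace∈ω₁ : ∀ {ξ} → ξ ∈ ω₁ → N ‵ ξ ∩ ω₁ ∈ ω₁
    trace∈ω₁ p = ∈ω₁ (trace-ord (closedˢ p)) (cov-mono (λ z q → proj₁ (∩-out q)) (cov p))

    -- Since each set of the chain is a member of the next, closure under `std₂` puts its trace on
    -- ω₁ there as well. So the traces increase strictly and dominate the index.
    self⊆ : ∀ {ξ} → ξ ∈ ω₁ → ξ ⊆ N ‵ ξ
    self⊆ {ξ} = ∈-ind (λ ξ → ξ ∈ ω₁ → ξ ⊆ N ‵ ξ) step ξ
      where
      step : ∀ ξ → (∀ ζ → ζ ∈ ξ → ζ ∈ ω₁ → ζ ⊆ N ‵ ζ) → ξ ∈ ω₁ → ξ ⊆ N ‵ ξ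
      step ξ ih p ζ q = [ (λ r → mono p r ζ ζ∈) , (λ e → ∈-respʳ (‵-ext ≐-refl e) ζ∈) ]′
          (ord-⊆ (ord-succ (ord-elt oξ q)) oξ (succ⊆ oξ q))
        where
        oξ : IsOrdinal ξ
        oξ = ord-elt ord-ω₁ p
        ζ∈ω₁ : ζ ∈ ω₁
        ζ∈ω₁ = ord-trans ord-ω₁ q p
        ζ∈ : ζ ∈ N ‵ succ ζ
        ζ∈ = proj₁ (∩-out (ord-⊆∈ (ord-elt ord-ω₁ ζ∈ω₁) (trace-ord (closedˢ (succ∈ω₁ ζ∈ω₁)))
          (λ z r → ∩-in (ih ζ q ζ∈ω₁ z r) (ord-trans ord-ω₁ r ζ∈ω₁))
          (∩-in (std-trace (closedˢ (succ∈ω₁ ζ∈ω₁)) (member ζ∈ω₁) (trace∈ω₁ ζ∈ω₁)) (trace∈ω₁ ζ∈ω₁))))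

    N-ext : Ext (N ‵_)
    N-ext = ‵-ext ≐-refl

    W : V
    W = ⋃ (Im (N ‵_) ω₁)

    W-in : ∀ {ξ x} → ξ ∈ ω₁ → x ∈ N ‵ ξ → x ∈ W
    W-in p q = ⋃-in q (Im-in N-ext p ≐-refl)

    W-out : ∀ {x} → x ∈ W → ∃[ ξ ] ξ ∈ ω₁ × x ∈ N ‵ ξ
    W-out p = let (w , q , r) = ⋃-out p ; (ξ , s , e) = Im-out q in ξ , s , ∈-respʳ e r

    W≼ω₁ : Pairing → W ≼ ω₁
    W≼ω₁ pr = union-small pr N-ext λ ξ p → ≼-trans (cov⇒countable (cov p)) (⊆⇒≼ ω⊆ω₁)

    -- Closing ν under the suprema of the traces of earlier sets bounds the trace at ν by ν; the
    -- other inclusion is `self⊆`. The operations `K` are accommodated by the same club.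
    point : ∀ {T} → Stat T → (K : Ops ω₁) → ∃[ ν ] ν ∈ T × ν ∈ ω₁ × IsLimit ν × Closed K ν × N ‵ ν ∩ ω₁ ≐ ν
    point {T} sT K = by (closed-point sT (B ⊕ K))
      where
      b : V → V
      b ζ = bnd (N ‵ ζ ∩ ω₁)
      b-ext : Ext b
      b-ext e = bnd-ext (∩-ext (N-ext e) ≐-refl)
      B : Ops ω₁
      B = singleton b b-ext λ ζ p →
        bnd∈ω₁ (cov-mono (λ z q → proj₁ (∩-out q)) (cov p)) λ z q → proj₂ (∩-out q)
      by : (∃[ ν ] ν ∈ T × IsLimit ν × Closed (B ⊕ K) ν) →
        ∃[ ν ] ν ∈ T × ν ∈ ω₁ × IsLimit ν × Closed K ν × N ‵ ν ∩ ω₁ ≐ ν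
      by (ν , ν∈T , lim , cl) = ν , ν∈T , ν∈ω₁ , lim , closed-⊕ʳ B K cl , ⊆-antisym
          (λ z p → let (q , r) = ∩-out p ; (ζ , s , t) = limit-out ν∈ω₁ lim z q in
            ord-trans (proj₁ lim) (bnd-in (∩-in t r))
              (values (closed-⊕ˡ B K cl) (ζ ∷ []) (s ∷ []) (b ζ) (pair-inˡ ≐-refl)))
          (λ z p → ∩-in (self⊆ ν∈ω₁ z p) (ord-trans ord-ω₁ p ν∈ω₁))
        where
        ν∈ω₁ : ν ∈ ω₁
        ν∈ω₁ = proj₁ sT ν ν∈T

  hull-point : ∀ {T A} → A ⊆ Hω₂ → Cov (_∈ A) → Stat T → (G : Ops Hω₂) →
    ∃[ ν ] ν ∈ T × (∃[ Y ] A ⊆ Y × Y ⊆ Hω₂ × Cov (_∈ Y) × Closed G Y × Y ∩ ω₁ ≐ ν)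
  hull-point {T} {A} h c sT G = by (trace-point ω₁⊆Hω₂ h c sT G)
    where
    open Hull G
    by : (∃[ ν ] ν ∈ T × IsLimit ν × hull (ν ∪ A) ∩ ω₁ ⊆ ν) →
      ∃[ ν ] ν ∈ T × (∃[ Y ] A ⊆ Y × Y ⊆ Hω₂ × Cov (_∈ Y) × Closed G Y × Y ∩ ω₁ ≐ ν)
    by (ν , p , lim , q) = ν , p , hull (ν ∪ A) , (λ z r → hull-self z (∪-inʳ r)) , hull-⊆ sub ,
        hull-cov sub (cov-∪ (ω₁-cov (proj₁ sT ν p)) c) , hull-closed ,
        ⊆-antisym q (λ z r → ∩-in (hull-self z (∪-inˡ r)) (ord-trans ord-ω₁ r (proj₁ sT ν p)))
      where
      sub : ν ∪ A ⊆ Hω₂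
      sub z r = [ (λ s → ω₁⊆Hω₂ z (ord-trans ord-ω₁ s (proj₁ sT ν p))) , h z ]′ (∪-out r)

  -- A form of the saturation of the nonstationary ideal: an antichain of stationary sets,
  -- indexed by arbitrary sets x, is captured by a set of size ω₁.
  module Saturation (pairing : Pairing) (Fam : V → V → Set₁)
    (fam-resp : ∀ {x x′ S S′} → x ≐ x′ → S ≐ S′ → Fam x S → Fam x′ S′)
    (fam-stat : ∀ {x S} → Fam x S → Stat S)
    (fam-unique : ∀ {x x′ S S′} → Fam x S → Fam x′ S′ → Stat (S ∩ S′) → x ≐ x′) where

    -- Every stationary set has stationary intersection with some set of this kind: with one from
    -- the family or, failing that, with itself. The second alternative makes the antichain
    -- predense.
    Dense : V → Set₁
    Dense S = (∃[ x ] Fam x S) ⊎ (Stat S × (∀ x S′ → Fam x S′ → ¬ Stat (S ∩ S′)))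

    Stat-resp : Resp Stat
    Stat-resp e (h , k) = (λ z p → h z (∈-respʳ (≐-sym e) p)) , λ C c → let (α , p , q) = k C c in α , p , ∈-respʳ e q

    Dense-resp : Resp Dense
    Dense-resp e (inj₁ (x , f)) = inj₁ (x , fam-resp ≐-refl e f)
    Dense-resp e (inj₂ (s , n)) = inj₂ (Stat-resp e s , λ x S′ f s′ → n x S′ f (Stat-resp (∩-ext (≐-sym e) ≐-refl) s′))

    dense-⊆ : ∀ {S} → Dense S → S ⊆ ω₁
    dense-⊆ (inj₁ (x , f)) = proj₁ (fam-stat f)
    dense-⊆ (inj₂ (s , _)) = proj₁ s

    Q : V → Set₁
    Q Y = ∃[ S ] S ∈ Y × Dense S × Y ∩ ω₁ ∈ S

    Q-resp : Resp Q
    Q-resp e (S , p , d , q) = S , ∈-respʳ e p , d , ∈-respˡ (∩-ext e ≐-refl) q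

    -- Take a `Dense` set `S` with `T ∩ S` stationary, put it into the hull, and aim the trace at
    -- `T ∩ S`.
    enough : ∀ T → Stat T → (G : Ops Hω₂) → ∃[ Y ] Y ⊆ Hω₂ × Cov (_∈ Y) × Closed G Y × Y ∩ ω₁ ∈ T × Q Y
    enough T sT G = by (lem (∃[ x ] ∃[ S ] Fam x S × Stat (T ∩ S)))
      where
      Goal : Set₁
      Goal = ∃[ Y ] Y ⊆ Hω₂ × Cov (_∈ Y) × Closed G Y × Y ∩ ω₁ ∈ T × Q Y
      use : ∀ S → Dense S → Stat (T ∩ S) → Goal
      use S d s = go (hull-point (λ z p → ∈-respˡ (≐-sym (single-out p)) (⊆ω₁-Hω₂ (dense-⊆ d)))
          cov-single s G)
        where
        go : (∃[ ν ] ν ∈ T ∩ S × (∃[ Y ] ｛ S , S ｝ ⊆ Y × Y ⊆ Hω₂ × Cov (_∈ Y) × Closed G Y × Y ∩ ω₁ ≐ ν)) → Goal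
        go (ν , p , Y , a , b , c , cl , e) = Y , b , c , cl , ∈-respˡ (≐-sym e) (proj₁ (∩-out p)) ,
          S , a S (pair-inˡ ≐-refl) , d , ∈-respˡ (≐-sym e) (proj₂ (∩-out p))
      by : (∃[ x ] ∃[ S ] Fam x S × Stat (T ∩ S)) ⊎ ¬ (∃[ x ] ∃[ S ] Fam x S × Stat (T ∩ S)) → Goal
      by (inj₁ (x , S , f , s)) = use S (inj₁ (x , f)) s
      by (inj₂ n) = use T (inj₂ (sT , λ x S f s → n (x , S , f , s)))
        (Stat-resp (⊆-antisym (λ z p → ∩-in p p) (λ z p → proj₁ (∩-out p))) sT)

    module _ {N} (ch : Chain std Q N) where
      open ChainFacts ch

      -- If no set for `x` entered the chain, each `Dense` set in the chain would be disjoint from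
      -- `S*` on a club. The diagonal intersection of these clubs meets `S*` in some ν that is the
      -- trace of `N ‵ ν`, and `Q` puts this ν into one of those `Dense` sets.
      captured : ∀ {x S*} → Fam x S* → ∃[ S ] S ∈ W × Fam x S
      captured {x} {S*} f* = dne λ none → absurd none (≼⇒Inj (W≼ω₁ pairing))
        where
        absurd : ¬ (∃[ S ] S ∈ W × Fam x S) → ¬ Inj W ω₁
        absurd none (φ , φ-ext , φ∈ , φ-inj) = finish (point (fam-stat f*) (B ⊕ K))
          where
          W′ : V
          W′ = ⟪ W ∣ Dense ⟫
          disjoint : ∀ {S} → S ∈ W → Dense S → ¬ Stat (S ∩ S*)
          disjoint p (inj₁ (x′ , f)) s = none (_ , p , fam-resp (fam-unique f f* s) ≐-refl f)
          disjoint p (inj₂ (_ , n)) s = n x S* f* s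
          Avoid : V → V → Set₁
          Avoid S C = IsClub₁ C × (∀ α → α ∈ C → ¬ α ∈ S ∩ S*)
          club-resp : Resp IsClub₁
          club-resp e (a , b , c) = (λ z p → a z (∈-respʳ (≐-sym e) p)) ,
            (λ α p → let (β , q , r) = b α p in β , ∈-respʳ e q , r) ,
            (λ α p l h → ∈-respʳ e (c α p l λ β q → let (γ , r , s) = h β q in γ , ∈-respʳ (≐-sym e) r , s))
          clubs : Σ (V → V) λ g → Ext g × (∀ S → S ∈ W′ → Avoid S (g S))
          clubs = choose W′ Avoid
            (λ e e′ (c , n) → club-resp e′ c , λ α p q → n α (∈-respʳ (≐-sym e′) p) (∈-respʳ (∩-ext (≐-sym e) ≐-refl) q))
            (λ S p → let (q , d) = sep-out Dense-resp p in dne λ n → disjoint q d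
              ((λ z r → dense-⊆ d z (proj₁ (∩-out r))) , λ C c → dne λ m → n (C , c , λ α r s → m (α , r , s))))
          g : V → V
          g = proj₁ clubs
          g-ext : Ext g
          g-ext = proj₁ (proj₂ clubs)
          Above : V → V → V → Set₁
          Above S j β = Lift 1ℓ (β ∈ g S × j ∈ β)
          rA : ∀ {S j} → Resp (Above S j)
          rA e (lift (p , q)) = lift (∈-respˡ e p , ∈-respʳ e q)
          nx : V → V → V
          nx S j = least ω₁ (Above S j)
          nx-spec : ∀ {S j} → S ∈ W′ → j ∈ ω₁ → nx S j ∈ ω₁ × Above S j (nx S j)
          nx-spec {S} {j} p q =
            let ((c⊆ , unb , _) , _) = proj₂ (proj₂ clubs) S p ; (β , r , s) = unb j q
                (a , b , _) = least-spec ord-ω₁ rA (β , c⊆ β r , lift (r , s)) in a , b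
          nx-ext : ∀ {S S′ j j′} → S ≐ S′ → j ≐ j′ → nx S j ≐ nx S′ j′
          nx-ext e e′ = least-ext rA rA ≐-refl
            (λ ξ (lift (p , q)) → lift (∈-respʳ (g-ext e) p , ∈-respˡ e′ q))
            (λ ξ (lift (p , q)) → lift (∈-respʳ (g-ext (≐-sym e)) p , ∈-respˡ (≐-sym e′) q))
          Next : V → V → V → Set₁
          Next i j β = ∃[ S ] S ∈ W′ × φ S ≐ i × β ≐ nx S j
          rN : ∀ {i j} → Resp (Next i j)
          rN e (S , p , q , r) = S , p , q , ≐-trans (≐-sym e) r
          -- `B` gives every set in `N ‵ ν` an index below ν, and `K` makes ν a limit of points of
          -- each club with such an index: together a diagonal intersection.
          K B : Ops ω₁
          K = binary (λ i j → ⟪ ω₁ ∣ Next i j ⟫)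
            (λ e e′ → sep-ext rN rN ≐-refl (λ _ _ (S , p , q , r) → S , p , ≐-trans q e , ≐-trans r (nx-ext ≐-refl e′))
              (λ _ _ (S , p , q , r) → S , p , ≐-trans q (≐-sym e) , ≐-trans r (nx-ext ≐-refl (≐-sym e′))))
            (λ i j _ _ → sep-⊆ rN)
            (λ i j _ _ → one i j (lem (∃[ S ] S ∈ W′ × φ S ≐ i)))
            where
            one : ∀ i j → (∃[ S ] S ∈ W′ × φ S ≐ i) ⊎ ¬ (∃[ S ] S ∈ W′ × φ S ≐ i) → Cov (_∈ ⟪ ω₁ ∣ Next i j ⟫)
            one i j (inj₁ (S , p , q)) = cov-one (nx S j) λ z r → let (_ , S′ , p′ , q′ , r′) = sep-out rN r in
              ≐-trans r′ (nx-ext (φ-inj S′ S (sep-⊆ Dense-resp _ p′) (sep-⊆ Dense-resp _ p) (≐-trans q′ (≐-sym q))) ≐-refl)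
            one i j (inj₂ n) = cov-∅ λ z r → let (_ , S′ , p′ , q′ , _) = sep-out rN r in n (S′ , p′ , q′)
          b : V → V
          b ζ = bnd (Im φ (N ‵ ζ))
          b-ext : Ext b
          b-ext e = bnd-ext (Im-ext φ-ext (N-ext e))
          B = singleton b b-ext λ ζ p →
            bnd∈ω₁ (cov-image φ-ext (λ y r → let (x , s , t) = Im-out r in x , s , t) (cov p))
              λ z r → let (x , s , t) = Im-out r in ∈-respˡ (≐-sym t) (φ∈ x (W-in p s))
          finish : ¬ (∃[ ν ] ν ∈ S* × ν ∈ ω₁ × IsLimit ν × Closed (B ⊕ K) ν × N ‵ ν ∩ ω₁ ≐ ν)
          finish (ν , ν∈S* , ν∈ω₁ , lim , cl , tr) = go (holds ν∈ω₁)
            where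
            go : ¬ Q (N ‵ ν)
            go (S , p , d , q) = proj₂ cS ν (proj₂ (proj₂ (proj₁ cS)) ν ν∈ω₁ lim λ β r →
                let (n∈ , lift (n∈C , β∈)) = nx-spec S∈W′ (ord-trans ord-ω₁ r ν∈ω₁) in
                nx S β , n∈C , values (closed-⊕ʳ B K cl) (φ S ∷ β ∷ []) (φS∈ν ∷ r ∷ []) (nx S β)
                  (sep-in rN n∈ (S , S∈W′ , ≐-refl , ≐-refl)) , β∈)
                (∩-in (∈-respˡ tr q) ν∈S*)
              where
              S∈W′ : S ∈ W′
              S∈W′ = sep-in Dense-resp (W-in ν∈ω₁ p) d
              cS : Avoid S (g S)
              cS = proj₂ (proj₂ clubs) S S∈W′
              φS∈ν : φ S ∈ ν
              φS∈ν = let (ζ , r , s) = limit-out ν∈ω₁ lim S p in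
                ord-trans (proj₁ lim) (bnd-in (Im-in φ-ext s ≐-refl))
                  (values (closed-⊕ˡ B K cl) (ζ ∷ []) (r ∷ []) (b ζ) (pair-inˡ ≐-refl))

    saturation : ∃[ A ] A ≼ ω₁ × (∀ x S → Fam x S → ∃[ S′ ] S′ ∈ A × Fam x S′)
    saturation = by (chain std Q Q-resp enough)
      where
      by : (∃[ N ] Chain std Q N) → ∃[ A ] A ≼ ω₁ × (∀ x S → Fam x S → ∃[ S′ ] S′ ∈ A × Fam x S′)
      by (N , ch) = ChainFacts.W ch , ChainFacts.W≼ω₁ ch pairing , λ x S f → captured ch f

-- Coding inside models, and agreement of models on subsets of γ.

module Nodes (em : ExcludedMiddle 1ℓ) (choice : Choice) (ω₁ ω₂ : V)
  (s₁ : IsSuccessorCardinal ω ω₁) (s₂ : IsSuccessorCardinal ω₁ ω₂) where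
  open import Data.Fin.Base using (Fin; zero; suc)
  open import Data.List.Base using (List; []; _∷_)
  open import Data.List.Relation.Binary.Pointwise.Base using (Pointwise; []; _∷_)
  open import Data.List.Relation.Unary.All using ([]; _∷_)
  open import Data.Vec.Base using (Vec; []; _∷_; lookup)
  import Data.Vec.Relation.Unary.All as Vec

  open Sets em
  open Cardinals em choice ω₁ ω₂ s₁ s₂
  open Collapse em choice ω₁ ω₂ s₁ s₂
  open Clubs em choice ω₁ ω₂ s₁ s₂
  open Closed

  private
    #0 : ∀ {n} → Fin (suc n)
    #0 = zero
    #1 : ∀ {n} → Fin (suc (suc n))
    #1 = suc zero
    #2 : ∀ {n} → Fin (suc (suc (suc n)))
    #2 = suc (suc zero)
    #3 : ∀ {n} → Fin (suc (suc (suc (suc n))))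
    #3 = suc (suc (suc zero))
    #4 : ∀ {n} → Fin (suc (suc (suc (suc (suc n)))))
    #4 = suc (suc (suc (suc zero)))
    #5 : ∀ {n} → Fin (suc (suc (suc (suc (suc (suc n))))))
    #5 = suc (suc (suc (suc (suc zero))))

  -- related e ξ η: the set e contains the pair {ξ , η}, where ξ ≤ η.
  related : ∀ {n} → (e ξ η : Fin n) → Formula n
  related e ξ η = (∃̇ (#0 ∈̇ suc e ∧̇ isUnorderedPair #0 (suc ξ) (suc η))) ∧̇ (ξ ∈̇ η ∨̇ ξ ≈̇ η)

  -- Variables: e, Y.
  isCollapse : Formula 2
  isCollapse =
      (∀̇ (#0 ∈̇ #2 ⇒̇ (∃̇ (related #2 #0 #1))))
    ∧̇ (∀̇ (∀̇ (#1 ∈̇ #3 ∧̇ related #2 #0 #1 ⇒̇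
         (∀̇ (#0 ∈̇ #1 ⇔̇ (∃̇ (#0 ∈̇ #5 ∧̇ (#0 ∈̇ #3 ∧̇ related #4 #1 #0))))))))

  -- Variables: x, e, Y, a.
  isImage isPreimage : Formula 4
  isImage = ∀̇ (#0 ∈̇ #1 ⇔̇ (∃̇ (#0 ∈̇ #5 ∧̇ (#0 ∈̇ #4 ∧̇ related #3 #1 #0))))
  isPreimage = ∀̇ (#0 ∈̇ #1 ⇔̇ (#0 ∈̇ #3 ∧̇ (∃̇ (#0 ∈̇ #5 ∧̇ related #3 #0 #1))))

  -- Variables: x, u, v.
  isMeet : Formula 3
  isMeet = ∀̇ (#0 ∈̇ #1 ⇔̇ (#0 ∈̇ #2 ∧̇ #0 ∈̇ #3))

  -- A collapse never moves an ordinal up, so the unordered pair together with the order of its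
  -- entries tells which one is the image. This spares ordered pairs inside the formulas.
  Rel : V → V → V → Set
  Rel e ξ η = ｛ ξ , η ｝ ∈ e × (ξ ∈ η ⊎ ξ ≐ η)

  CollapseRel : V → V → Set₁
  CollapseRel e Y = (∀ η → η ∈ Y → ∃[ ξ ] Rel e ξ η)
    × (∀ η ξ → η ∈ Y → Rel e ξ η → ∀ w → (w ∈ ξ → ∃[ η′ ] η′ ∈ Y × η′ ∈ η × Rel e w η′)
      × (∀ η′ → η′ ∈ Y → η′ ∈ η → Rel e w η′ → w ∈ ξ))

  ImageRel PreimageRel : V → V → V → V → Set₁
  ImageRel x e Y a = ∀ ξ → (ξ ∈ x → ∃[ η ] η ∈ a × η ∈ Y × Rel e ξ η) × (∀ η → η ∈ a → η ∈ Y → Rel e ξ η → ξ ∈ x)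
  PreimageRel x e Y a = ∀ η → (η ∈ x → η ∈ Y × (∃[ ξ ] ξ ∈ a × Rel e ξ η)) × (η ∈ Y → ∀ ξ → ξ ∈ a → Rel e ξ η → η ∈ x)

  module Semantics (θ : V) where

    𝒟 : V → Set₁
    𝒟 = D.H θ

    private
      variable
        n : ℕ

    ⇒I : {A B : Set₁} → (A → B) → ¬ (A × ¬ B)
    ⇒I f (a , n) = n (f a)

    ⇒E : {A B : Set₁} → ¬ (A × ¬ B) → A → B
    ⇒E h a = dne λ n → h (a , n)

    ∨I : {A B : Set₁} → A ⊎ B → ¬ (¬ A × ¬ B)
    ∨I (inj₁ a) (n , _) = n a
    ∨I (inj₂ b) (_ , n) = n b

    ∨E : {A B : Set₁} → ¬ (¬ A × ¬ B) → A ⊎ B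
    ∨E {A} {B} h = [ inj₁ , (λ na → inj₂ (dne λ nb → h (na , nb))) ]′ (lem A)

    ∃I : (φ : Formula (suc n)) (ρ : Vec V n) → ∀ x → 𝒟 x → 𝒟 ⊨ φ [ x ∷ ρ ] → 𝒟 ⊨ ∃̇ φ [ ρ ]
    ∃I φ ρ x d h k = k x d h

    ∃E : (φ : Formula (suc n)) (ρ : Vec V n) → 𝒟 ⊨ ∃̇ φ [ ρ ] → ∃[ x ] 𝒟 x × 𝒟 ⊨ φ [ x ∷ ρ ]
    ∃E φ ρ h = dne λ k → h λ x d p → k (x , d , p)

    opaque
      unfolding _∈_

      𝒟-∈ : ∀ {x y} → 𝒟 x → y ∈ x → 𝒟 y
      𝒟-∈ {x} {y} d p = H-∈ {θ} {x} {y} p d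

      H⇒𝒟 : ∀ {x} → H θ x → 𝒟 x
      H⇒𝒟 h = h

      related-out : (e ξ η : Fin n) (ρ : Vec V n) → 𝒟 (lookup ρ e) → 𝒟 (lookup ρ ξ) → 𝒟 (lookup ρ η) →
        𝒟 ⊨ related e ξ η [ ρ ] → Rel (lookup ρ e) (lookup ρ ξ) (lookup ρ η)
      related-out e ξ η ρ de dξ dη (p , q) =
        let (z , dz , lift z∈ , h) = ∃E (#0 ∈̇ suc e ∧̇ isUnorderedPair #0 (suc ξ) (suc η)) ρ p in
        ∈-respˡ {z} {｛ lookup ρ ξ , lookup ρ η ｝} {lookup ρ e} (⊆-antisym {z} {｛ lookup ρ ξ , lookup ρ η ｝}
          (λ w r → [ (λ (lift s) → pair-inˡ {lookup ρ ξ} {lookup ρ η} {w} s) ,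
              (λ (lift s) → pair-inʳ {lookup ρ ξ} {lookup ρ η} {w} s) ]′
            (∨E (⇒E (proj₁ (h w (𝒟-∈ {z} {w} dz r))) (lift r))))
          (λ w r → [ (λ s → back z w dz h (H-resp {θ} {lookup ρ ξ} {w} (≐-sym {w} {lookup ρ ξ} s) dξ) (inj₁ (lift s))) ,
              (λ s → back z w dz h (H-resp {θ} {lookup ρ η} {w} (≐-sym {w} {lookup ρ η} s) dη) (inj₂ (lift s))) ]′
            (pair-out {lookup ρ ξ} {lookup ρ η} {w} r))) z∈ ,
        [ (λ (lift s) → inj₁ s) , (λ (lift s) → inj₂ s) ]′ (∨E q)
        where
        back : ∀ z w → 𝒟 z → 𝒟 ⊨ isUnorderedPair #0 (suc ξ) (suc η) [ z ∷ ρ ] → 𝒟 w →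
          Lift 1ℓ (w ≐ lookup ρ ξ) ⊎ Lift 1ℓ (w ≐ lookup ρ η) → w ∈ z
        back z w dz h dw s = lower (⇒E (proj₂ (h w dw)) (∨I s))

      related-in : (e ξ η : Fin n) (ρ : Vec V n) → 𝒟 (lookup ρ e) → Rel (lookup ρ e) (lookup ρ ξ) (lookup ρ η) →
        𝒟 ⊨ related e ξ η [ ρ ]
      related-in e ξ η ρ de (p , q) =
        ∃I (#0 ∈̇ suc e ∧̇ isUnorderedPair #0 (suc ξ) (suc η)) ρ ｛ lookup ρ ξ , lookup ρ η ｝
          (𝒟-∈ {lookup ρ e} {｛ lookup ρ ξ , lookup ρ η ｝} de p)
          (lift p , λ w _ →
            (⇒I λ (lift r) → ∨I ([ (λ s → inj₁ (lift s)) , (λ s → inj₂ (lift s)) ]′ (pair-out {lookup ρ ξ} {lookup ρ η} {w} r))) ,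
            (⇒I λ r → lift ([ (λ (lift s) → pair-inˡ {lookup ρ ξ} {lookup ρ η} {w} s) ,
              (λ (lift s) → pair-inʳ {lookup ρ ξ} {lookup ρ η} {w} s) ]′ (∨E r)))) ,
        ∨I ([ (λ s → inj₁ (lift s)) , (λ s → inj₂ (lift s)) ]′ q)

      Rel-𝒟 : ∀ {e ξ η} → 𝒟 e → Rel e ξ η → 𝒟 ξ × 𝒟 η
      Rel-𝒟 {e} {ξ} {η} de (p , _) = 𝒟-∈ {｛ ξ , η ｝} {ξ} dz (pair-inˡ {ξ} {η} {ξ} (≐-refl {ξ})) ,
          𝒟-∈ {｛ ξ , η ｝} {η} dz (pair-inʳ {ξ} {η} {η} (≐-refl {η}))
        where
        dz : 𝒟 ｛ ξ , η ｝
        dz = 𝒟-∈ {e} {｛ ξ , η ｝} de p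

      isCollapse-in : ∀ e Y → 𝒟 e → 𝒟 Y → CollapseRel e Y → 𝒟 ⊨ isCollapse [ e ∷ Y ∷ [] ]
      isCollapse-in e Y de dY (h , k) =
        (λ η dη → ⇒I λ (lift p) → let (ξ , r) = h η p in
          ∃I (related #2 #0 #1) (η ∷ e ∷ Y ∷ []) ξ (proj₁ (Rel-𝒟 {e} {ξ} {η} de r))
            (related-in #2 #0 #1 (ξ ∷ η ∷ e ∷ Y ∷ []) de r)) ,
        (λ η dη ξ dξ → ⇒I λ (lift p , r) w dw →
          let (f , g) = k η ξ p (related-out #2 #0 #1 (ξ ∷ η ∷ e ∷ Y ∷ []) de dξ dη r) w in
          (⇒I λ (lift q) → let (η′ , a , b , c) = f q in
            ∃I (#0 ∈̇ #5 ∧̇ (#0 ∈̇ #3 ∧̇ related #4 #1 #0)) (w ∷ ξ ∷ η ∷ e ∷ Y ∷ []) η′ (𝒟-∈ {Y} {η′} dY a)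
              (lift a , lift b , related-in #4 #1 #0 (η′ ∷ w ∷ ξ ∷ η ∷ e ∷ Y ∷ []) de c)) ,
          (⇒I λ q → let (η′ , dη′ , lift a , lift b , c) = ∃E (#0 ∈̇ #5 ∧̇ (#0 ∈̇ #3 ∧̇ related #4 #1 #0)) (w ∷ ξ ∷ η ∷ e ∷ Y ∷ []) q in
            lift (g η′ a b (related-out #4 #1 #0 (η′ ∷ w ∷ ξ ∷ η ∷ e ∷ Y ∷ []) de dw dη′ c))))

      isCollapse-out : ∀ e Y → 𝒟 e → 𝒟 Y → 𝒟 ⊨ isCollapse [ e ∷ Y ∷ [] ] → CollapseRel e Y
      isCollapse-out e Y de dY (h , k) =
        (λ η p → let (ξ , dξ , r) = ∃E (related #2 #0 #1) (η ∷ e ∷ Y ∷ []) (⇒E (h η (𝒟-∈ {Y} {η} dY p)) (lift p)) in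
          ξ , related-out #2 #0 #1 (ξ ∷ η ∷ e ∷ Y ∷ []) de dξ (𝒟-∈ {Y} {η} dY p) r) ,
        (λ η ξ p r w →
          let (dξ , dη) = Rel-𝒟 {e} {ξ} {η} de r
              at : ∀ w → 𝒟 w → _
              at = ⇒E (k η dη ξ dξ) (lift p , related-in #2 #0 #1 (ξ ∷ η ∷ e ∷ Y ∷ []) de r) in
          (λ q → let dw = 𝒟-∈ {ξ} {w} dξ q
                     (η′ , dη′ , lift a , lift b , c) = ∃E (#0 ∈̇ #5 ∧̇ (#0 ∈̇ #3 ∧̇ related #4 #1 #0)) (w ∷ ξ ∷ η ∷ e ∷ Y ∷ [])
                       (⇒E (proj₁ (at w dw)) (lift q)) in
            η′ , a , b , related-out #4 #1 #0 (η′ ∷ w ∷ ξ ∷ η ∷ e ∷ Y ∷ []) de dw dη′ c) ,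
          (λ η′ a b c → let (dw , dη′) = Rel-𝒟 {e} {w} {η′} de c in
            lower (⇒E (proj₂ (at w dw)) (∃I (#0 ∈̇ #5 ∧̇ (#0 ∈̇ #3 ∧̇ related #4 #1 #0)) (w ∷ ξ ∷ η ∷ e ∷ Y ∷ []) η′ dη′
              (lift a , lift b , related-in #4 #1 #0 (η′ ∷ w ∷ ξ ∷ η ∷ e ∷ Y ∷ []) de c)))))

      isImage-in : ∀ x e Y a → 𝒟 e → 𝒟 a → ImageRel x e Y a → 𝒟 ⊨ isImage [ x ∷ e ∷ Y ∷ a ∷ [] ]
      isImage-in x e Y a de da h ξ dξ =
        (⇒I λ (lift p) → let (η , q , r , s) = proj₁ (h ξ) p in
          ∃I (#0 ∈̇ #5 ∧̇ (#0 ∈̇ #4 ∧̇ related #3 #1 #0)) (ξ ∷ x ∷ e ∷ Y ∷ a ∷ []) η (𝒟-∈ {a} {η} da q)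
            (lift q , lift r , related-in #3 #1 #0 (η ∷ ξ ∷ x ∷ e ∷ Y ∷ a ∷ []) de s)) ,
        (⇒I λ p → let (η , dη , lift q , lift r , s) = ∃E (#0 ∈̇ #5 ∧̇ (#0 ∈̇ #4 ∧̇ related #3 #1 #0)) (ξ ∷ x ∷ e ∷ Y ∷ a ∷ []) p in
          lift (proj₂ (h ξ) η q r (related-out #3 #1 #0 (η ∷ ξ ∷ x ∷ e ∷ Y ∷ a ∷ []) de dξ dη s)))

      isImage-out : ∀ x e Y a → 𝒟 x → 𝒟 e → 𝒟 ⊨ isImage [ x ∷ e ∷ Y ∷ a ∷ [] ] → ImageRel x e Y a
      isImage-out x e Y a dx de h ξ =
        (λ p → let dξ = 𝒟-∈ {x} {ξ} dx p
                   (η , dη , lift q , lift r , s) = ∃E (#0 ∈̇ #5 ∧̇ (#0 ∈̇ #4 ∧̇ related #3 #1 #0)) (ξ ∷ x ∷ e ∷ Y ∷ a ∷ [])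
                     (⇒E (proj₁ (h ξ dξ)) (lift p)) in
          η , q , r , related-out #3 #1 #0 (η ∷ ξ ∷ x ∷ e ∷ Y ∷ a ∷ []) de dξ dη s) ,
        (λ η q r s → let (dξ , dη) = Rel-𝒟 {e} {ξ} {η} de s in
          lower (⇒E (proj₂ (h ξ dξ)) (∃I (#0 ∈̇ #5 ∧̇ (#0 ∈̇ #4 ∧̇ related #3 #1 #0)) (ξ ∷ x ∷ e ∷ Y ∷ a ∷ []) η dη
            (lift q , lift r , related-in #3 #1 #0 (η ∷ ξ ∷ x ∷ e ∷ Y ∷ a ∷ []) de s))))

      isPreimage-in : ∀ x e Y a → 𝒟 e → 𝒟 a → PreimageRel x e Y a → 𝒟 ⊨ isPreimage [ x ∷ e ∷ Y ∷ a ∷ [] ]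
      isPreimage-in x e Y a de da h η dη =
        (⇒I λ (lift p) → let (q , ξ , r , s) = proj₁ (h η) p in lift q ,
          ∃I (#0 ∈̇ #5 ∧̇ related #3 #0 #1) (η ∷ x ∷ e ∷ Y ∷ a ∷ []) ξ (𝒟-∈ {a} {ξ} da r)
            (lift r , related-in #3 #0 #1 (ξ ∷ η ∷ x ∷ e ∷ Y ∷ a ∷ []) de s)) ,
        (⇒I λ (lift q , p) → let (ξ , dξ , lift r , s) = ∃E (#0 ∈̇ #5 ∧̇ related #3 #0 #1) (η ∷ x ∷ e ∷ Y ∷ a ∷ []) p in
          lift (proj₂ (h η) q ξ r (related-out #3 #0 #1 (ξ ∷ η ∷ x ∷ e ∷ Y ∷ a ∷ []) de dξ dη s)))

      isPreimage-out : ∀ x e Y a → 𝒟 x → 𝒟 e → 𝒟 ⊨ isPreimage [ x ∷ e ∷ Y ∷ a ∷ [] ] → PreimageRel x e Y a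
      isPreimage-out x e Y a dx de h η =
        (λ p → let dη = 𝒟-∈ {x} {η} dx p
                   (lift q , k) = ⇒E (proj₁ (h η dη)) (lift p)
                   (ξ , dξ , lift r , s) = ∃E (#0 ∈̇ #5 ∧̇ related #3 #0 #1) (η ∷ x ∷ e ∷ Y ∷ a ∷ []) k in
          q , ξ , r , related-out #3 #0 #1 (ξ ∷ η ∷ x ∷ e ∷ Y ∷ a ∷ []) de dξ dη s) ,
        (λ q ξ r s → let (dξ , dη) = Rel-𝒟 {e} {ξ} {η} de s in
          lower (⇒E (proj₂ (h η dη)) (lift q , ∃I (#0 ∈̇ #5 ∧̇ related #3 #0 #1) (η ∷ x ∷ e ∷ Y ∷ a ∷ []) ξ dξ
            (lift r , related-in #3 #0 #1 (ξ ∷ η ∷ x ∷ e ∷ Y ∷ a ∷ []) de s))))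

      isMeet-in : ∀ x u v → (∀ w → (w ∈ x → w ∈ u × w ∈ v) × (w ∈ u → w ∈ v → w ∈ x)) → 𝒟 ⊨ isMeet [ x ∷ u ∷ v ∷ [] ]
      isMeet-in x u v h w _ = (⇒I λ (lift p) → let (a , b) = proj₁ (h w) p in lift a , lift b) ,
        (⇒I λ (lift a , lift b) → lift (proj₂ (h w) a b))

      isMeet-out : ∀ x u v → 𝒟 x → 𝒟 u → 𝒟 ⊨ isMeet [ x ∷ u ∷ v ∷ [] ] →
        ∀ w → (w ∈ x → w ∈ u × w ∈ v) × (w ∈ u → w ∈ v → w ∈ x)
      isMeet-out x u v dx du h w =
        (λ p → let (lift a , lift b) = ⇒E (proj₁ (h w (𝒟-∈ {x} {w} dx p))) (lift p) in a , b) ,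
        (λ a b → lower (⇒E (proj₂ (h w (𝒟-∈ {u} {w} du a))) (lift a , lift b)))

  Nice : V → V → V → Set₁
  Nice M λ′ Y = Y ∈ M × Countable Y × Y ⊆ M × Y ⊆ λ′

  -- Codes a subset of a countable set `y` of ordinals by a set of countable ordinals, without
  -- reference to any model.
  tr : V → V → V
  tr y A = Im (coll y) A

  coll-≤ : ∀ {Y η} → IsOrdinal η → coll Y η ⊆ η
  coll-≤ {Y} {η} = ∈-ind (λ η → IsOrdinal η → coll Y η ⊆ η) (λ η ih o z p →
    let (η′ , q , _ , e) = coll-out p in
    ord-⊆∈ (IsOrdinal-resp (≐-sym e) (ord-coll (ord-elt o q))) o (λ w r → ih η′ q (ord-elt o q) w (∈-respʳ e r)) q) η

  Coll-part : ∀ {M Y} → Y ⊆ M → ∀ {z} → z ∈ coll M Y → ∃[ η ] η ∈ Y × z ≐ coll M η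
  Coll-part h p = let (η , q , _ , e) = coll-out p in η , q , e

  module ModelFacts {M : V} (mod : Model M) where
    open Model mod public
    open Semantics θ

    opaque
      unfolding _∈_

      elem-H : ∀ {x} → x ∈ M → H θ x
      elem-H p = proj₁ elementary _ p

      -- Elementarity in the form of the Tarski-Vaught test: a condition with parameters in `M` that
      -- is solvable in `H θ` is solvable in `M`.
      elem : ∀ {n} (φ : Formula (suc n)) (ρ : Vec V n) → Vec.All (_∈ M) ρ → ∀ x → H θ x → 𝒟 ⊨ φ [ x ∷ ρ ] →
        ∃[ x ] x ∈ M × 𝒟 ⊨ φ [ x ∷ ρ ]
      elem {n} φ ρ h x d p = dne λ none →
        from (proj₂ elementary (∃̇ φ) ρ h) (λ k → k x d p)
          λ y y∈ q → none (y , y∈ , to (proj₂ elementary φ (y ∷ ρ) (y∈ Vec.∷ h)) q)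

      elem-𝒟 : ∀ {x} → x ∈ M → 𝒟 x
      elem-𝒟 p = proj₁ elementary _ p

    M-∩ : ∀ {u v} → u ∈ M → v ∈ M → u ∩ v ∈ M
    M-∩ {u} {v} p q =
      let (x , x∈ , h) = elem isMeet (u ∷ v ∷ []) (p Vec.∷ q Vec.∷ Vec.[]) (u ∩ v) (H-⊆ (λ z r → proj₁ (∩-out r)) (elem-H p))
                           (isMeet-in (u ∩ v) u v λ w → ∩-out , ∩-in)
          k = isMeet-out x u v (elem-𝒟 x∈) (elem-𝒟 p) h in
      ∈-respˡ (⊆-antisym (λ z r → let (a , b) = proj₁ (k z) r in ∩-in a b)
        (λ z r → let (a , b) = ∩-out r in proj₂ (k z) a b)) x∈

    -- The graph of the collapse of `Y` belongs to `H θ` and obeys a recursion expressible with the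
    -- parameter `Y`. Elementarity gives some `e` in `M` obeying it, and the recursion determines
    -- the relation on `Y`.
    graph-in-M : ∀ {λ′ Y} → IsOrdinal λ′ → λ′ ∈ M → Nice M λ′ Y →
      ∃[ e ] e ∈ M × (∀ η ξ → η ∈ Y → (Rel e ξ η → ξ ≐ coll Y η) × (ξ ≐ coll Y η → Rel e ξ η))
    graph-in-M {λ′} {Y} oλ λ∈ (Y∈ , cY , _ , Y⊆λ) =
      let (e , e∈ , h) = elem isCollapse (Y ∷ []) (Y∈ Vec.∷ Vec.[]) e₀ He₀
                           (isCollapse-in e₀ Y (H⇒𝒟 He₀) (elem-𝒟 Y∈) rel₀) in
      e , e∈ , unique e (isCollapse-out e Y (elem-𝒟 e∈) (elem-𝒟 Y∈) h)
      where
      ordY : ∀ {η} → η ∈ Y → IsOrdinal η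
      ordY p = ord-elt oλ (Y⊆λ _ p)
      pr : V → V
      pr η = ｛ coll Y η , η ｝
      pr-ext : Ext pr
      pr-ext e = pair-cong (coll-ext e) e
      e₀ : V
      e₀ = Im pr Y
      le : ∀ {η} → η ∈ Y → coll Y η ∈ η ⊎ coll Y η ≐ η
      le p = ord-⊆ (ord-coll (ordY p)) (ordY p) (coll-≤ (ordY p))
      in₀ : ∀ {η ξ} → η ∈ Y → ξ ≐ coll Y η → Rel e₀ ξ η
      in₀ p e = Im-in pr-ext p (pair-cong e ≐-refl) , [ (λ q → inj₁ (∈-respˡ (≐-sym e) q)) , (λ q → inj₂ (≐-trans e q)) ]′ (le p)
      -- A pair {ξ , η} with ξ ≤ η determines ξ and η.
      out₀ : ∀ {ξ η} → Rel e₀ ξ η → η ∈ Y × ξ ≐ coll Y η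
      out₀ {ξ} {η} (p , c) = let (η′ , q , e) = Im-out p in
          by q (le q) (pair-out (∈-respʳ (≐-sym e) (pair-inʳ ≐-refl))) (pair-out (∈-respʳ (≐-sym e) (pair-inˡ ≐-refl)))
            (pair-out (∈-respʳ e (pair-inˡ ≐-refl))) (pair-out (∈-respʳ e (pair-inʳ ≐-refl))) c
        where
        same : ∀ {η′} → η′ ∈ Y → η′ ≐ η → coll Y η′ ≐ ξ ⊎ coll Y η′ ≐ η → ξ ≐ coll Y η′ ⊎ ξ ≐ η′ → η ∈ Y × ξ ≐ coll Y η
        same {η′} q e d f = ∈-respˡ e q , ≐-trans (first d f) (coll-ext e)
          where
          first : coll Y η′ ≐ ξ ⊎ coll Y η′ ≐ η → ξ ≐ coll Y η′ ⊎ ξ ≐ η′ → ξ ≐ coll Y η′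
          first _ (inj₁ s) = s
          first (inj₁ s) _ = ≐-sym s
          first (inj₂ s) (inj₂ t) = ≐-trans t (≐-trans e (≐-sym s))
        by : ∀ {η′} → η′ ∈ Y → coll Y η′ ∈ η′ ⊎ coll Y η′ ≐ η′ → η′ ≐ ξ ⊎ η′ ≐ η → coll Y η′ ≐ ξ ⊎ coll Y η′ ≐ η →
          ξ ≐ coll Y η′ ⊎ ξ ≐ η′ → η ≐ coll Y η′ ⊎ η ≐ η′ → ξ ∈ η ⊎ ξ ≐ η → η ∈ Y × ξ ≐ coll Y η
        by q l (inj₂ b) d f g c = same q b d f
        by q l (inj₁ b) d f (inj₂ t) c = same q (≐-sym t) d f
        by q (inj₂ l) (inj₁ b) d f (inj₁ t) c = same q (≐-sym (≐-trans t l)) d f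
        by q (inj₁ l) (inj₁ b) d f (inj₁ t) c = ⊥-elim
          ([ ∈-asym η∈ξ , (λ u → ∈-irrefl (∈-respʳ u η∈ξ)) ]′ c)
          where
          η∈ξ : η ∈ ξ
          η∈ξ = ∈-respˡ (≐-sym t) (∈-respʳ b l)
      rel₀ : CollapseRel e₀ Y
      rel₀ = (λ η p → coll Y η , in₀ p ≐-refl) ,
        λ η ξ p r w → (λ q → let (η′ , a , b , e) = coll-out (∈-respʳ (proj₂ (out₀ r)) q) in η′ , b , a , in₀ b e) ,
          λ η′ a b r′ → ∈-respˡ (≐-sym (proj₂ (out₀ r′))) (∈-respʳ (≐-sym (proj₂ (out₀ r))) (coll-in b a))
      He₀ : H θ e₀
      He₀ = by (elem-H λ∈)
        where
        by : H θ λ′ → H θ e₀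
        -- The transitive closure of `e₀` adds at most countably many pairs to λ′, so joining ω to
        -- the bound for λ′ is enough.
        by (α , α∈ , i) = α ∪ ω , ord-max ord-θ α∈ ω∈θ , ≼-trans (⊆⇒≼ (trcl-min t e₀ λ z p → ∪-inʳ p))
          (absorb (≼-trans (⊆⇒≼ (trcl-self λ′)) (≼-trans i (⊆⇒≼ λ z p → ∪-inˡ p)))
            (cov-image pr-ext (λ y p → let (x , q , e) = Im-out p in x , q , e) (countable⇒cov cY)) λ z p → ∪-inʳ p)
          where
          t : Transitive (λ′ ∪ e₀)
          t y p z q = [ (λ r → ∪-inˡ (proj₁ oλ y r z q)) , (λ r → let (η , s , e) = Im-out r in ∪-inˡ
            ([ (λ u → ord-⊆∈ (IsOrdinal-resp (≐-sym u) (ord-coll (ordY s))) oλ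
                  (λ w v → coll-≤ (ordY s) w (∈-respʳ u v)) (Y⊆λ η s)) ,
               (λ u → ∈-respˡ (≐-sym u) (Y⊆λ η s)) ]′ (pair-out (∈-respʳ e q)))) ]′ (∪-out p)
      unique : ∀ e → CollapseRel e Y → ∀ η ξ → η ∈ Y → (Rel e ξ η → ξ ≐ coll Y η) × (ξ ≐ coll Y η → Rel e ξ η)
      unique e (tot , rec) η ξ p = fwd η p ξ , bwd
        where
        fwd : ∀ η → η ∈ Y → ∀ ξ → Rel e ξ η → ξ ≐ coll Y η
        fwd = ∈-ind (λ η → η ∈ Y → ∀ ξ → Rel e ξ η → ξ ≐ coll Y η) λ η ih p ξ r → ⊆-antisym
          (λ w q → let (η′ , a , b , r′) = proj₁ (rec η ξ p r w) q in ∈-respˡ (≐-sym (ih η′ b a w r′)) (coll-in b a))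
          (λ w q → let (η′ , b , a , e′) = coll-out q ; (ξ′ , r′) = tot η′ a in
            ∈-respˡ (≐-trans (ih η′ b a ξ′ r′) (≐-sym e′)) (proj₂ (rec η ξ p r ξ′) η′ a b r′))
        bwd : ξ ≐ coll Y η → Rel e ξ η
        bwd q = let (ξ′ , r) = tot η p ; e′ = ≐-trans (fwd η p ξ′ r) (≐-sym q) in
          ∈-respˡ (pair-cong e′ ≐-refl) (proj₁ r) , [ (λ s → inj₁ (∈-respˡ e′ s)) , (λ s → inj₂ (≐-trans (≐-sym e′) s)) ]′ (proj₂ r)

    -- For nice Y the collapse of M has the same subsets of y = coll M Y as of the order type of y.
    module _ {λ′ : V} (oλ : IsOrdinal λ′) (λ∈ : λ′ ∈ M) {Y : V} (nice : Nice M λ′ Y) where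

      private
        Y∈ : Y ∈ M
        Y∈ = proj₁ nice
        Y⊆M : Y ⊆ M
        Y⊆M = proj₁ (proj₂ (proj₂ nice))
        ordY : ∀ {η} → η ∈ Y → IsOrdinal η
        ordY p = ord-elt oλ (proj₂ (proj₂ (proj₂ nice)) _ p)

      order-type : V
      order-type = coll Y λ′

      coll-Y⊆ : ∀ {η} → η ∈ Y → coll Y η ∈ order-type
      coll-Y⊆ p = coll-in (proj₂ (proj₂ (proj₂ nice)) _ p) p

      order-type∈ω₁ : order-type ∈ ω₁
      order-type∈ω₁ = ∈ω₁ (ord-coll oλ) (cov-image coll-ext
        (λ z p → let (η , _ , q , e) = coll-out p in η , q , e) (countable⇒cov (proj₁ (proj₂ nice))))

      Graph : V → Set₁
      Graph e = ∀ η ξ → η ∈ Y → (Rel e ξ η → ξ ≐ coll Y η) × (ξ ≐ coll Y η → Rel e ξ η)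

      IsImage IsPreimage : V → V → Set₁
      IsImage a x = ∀ ξ → (ξ ∈ x → ∃[ η ] η ∈ a × η ∈ Y × ξ ≐ coll Y η) × (∀ η → η ∈ a → η ∈ Y → ξ ≐ coll Y η → ξ ∈ x)
      IsPreimage a x = ∀ η → (η ∈ x → η ∈ Y × coll Y η ∈ a) × (η ∈ Y → coll Y η ∈ a → η ∈ x)

      image-in-M : ∀ {a} → a ∈ M → ∃[ x ] x ∈ M × IsImage a x
      image-in-M {a} a∈ = by (graph-in-M oλ λ∈ nice)
        where
        K : V → Set₁
        K ξ = ∃[ η ] η ∈ a × η ∈ Y × ξ ≐ coll Y η
        rK : Resp K
        rK e (η , p , q , f) = η , p , q , ≐-trans (≐-sym e) f
        x₀ : V
        x₀ = ⟪ order-type ∣ K ⟫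
        by : (∃[ e ] e ∈ M × Graph e) → ∃[ x ] x ∈ M × IsImage a x
        by (e , e∈ , g) = finish (elem isImage (e ∷ Y ∷ a ∷ []) (e∈ Vec.∷ Y∈ Vec.∷ a∈ Vec.∷ Vec.[]) x₀
            (H-⊆ (sep-⊆ rK) (elem-H (ω₁⊆M _ order-type∈ω₁))) (isImage-in x₀ e Y a (elem-𝒟 e∈) (elem-𝒟 a∈) image₀))
          where
          image₀ : ImageRel x₀ e Y a
          image₀ ξ = (λ p → let (η , q , r , f) = proj₂ (sep-out rK p) in η , q , r , proj₂ (g η ξ r) f) ,
            (λ η q r f → let f′ = proj₁ (g η ξ r) f in
              sep-in rK (∈-respˡ (≐-sym f′) (coll-Y⊆ r)) (η , q , r , f′))
          finish : (∃[ x ] x ∈ M × 𝒟 ⊨ isImage [ x ∷ e ∷ Y ∷ a ∷ [] ]) → ∃[ x ] x ∈ M × IsImage a x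
          finish (x , x∈ , h) = x , x∈ , λ ξ →
              (λ p → let (η , q , r , f) = proj₁ (k ξ) p in η , q , r , proj₁ (g η ξ r) f) ,
              λ η q r f → proj₂ (k ξ) η q r (proj₂ (g η ξ r) f)
            where
            k : ImageRel x e Y a
            k = isImage-out x e Y a (elem-𝒟 x∈) (elem-𝒟 e∈) h

      preimage-in-M : ∀ {a} → a ∈ M → ∃[ x ] x ∈ M × IsPreimage a x
      preimage-in-M {a} a∈ = by (graph-in-M oλ λ∈ nice)
        where
        K : V → Set₁
        K η = Lift 1ℓ (coll Y η ∈ a)
        rK : Resp K
        rK e (lift p) = lift (∈-respˡ (coll-ext e) p)
        x₀ : V
        x₀ = ⟪ Y ∣ K ⟫
        by : (∃[ e ] e ∈ M × Graph e) → ∃[ x ] x ∈ M × IsPreimage a x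
        by (e , e∈ , g) = finish (elem isPreimage (e ∷ Y ∷ a ∷ []) (e∈ Vec.∷ Y∈ Vec.∷ a∈ Vec.∷ Vec.[]) x₀
            (H-⊆ (sep-⊆ rK) (elem-H Y∈)) (isPreimage-in x₀ e Y a (elem-𝒟 e∈) (elem-𝒟 a∈) preimage₀))
          where
          preimage₀ : PreimageRel x₀ e Y a
          preimage₀ η = (λ p → let (q , lift r) = sep-out rK p in q , coll Y η , r , proj₂ (g η _ q) ≐-refl) ,
            (λ q ξ r f → sep-in rK q (lift (∈-respˡ (proj₁ (g η ξ q) f) r)))
          finish : (∃[ x ] x ∈ M × 𝒟 ⊨ isPreimage [ x ∷ e ∷ Y ∷ a ∷ [] ]) → ∃[ x ] x ∈ M × IsPreimage a x
          finish (x , x∈ , h) = x , x∈ , λ η →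
              (λ p → let (q , ξ , r , f) = proj₁ (k η) p in q , ∈-respˡ (proj₁ (g η ξ q) f) r) ,
              λ q r → proj₂ (k η) q (coll Y η) r (proj₂ (g η _ q) ≐-refl)
            where
            k : PreimageRel x e Y a
            k = isPreimage-out x e Y a (elem-𝒟 x∈) (elem-𝒟 e∈) h

      module _ {y : V} (y≐ : y ≐ coll M Y) where

        y-out : ∀ {z} → z ∈ y → ∃[ η ] η ∈ Y × z ≐ coll M η
        y-out p = Coll-part Y⊆M (∈-respʳ y≐ p)

        y-in : ∀ {η} → η ∈ Y → coll M η ∈ y
        y-in p = ∈-respʳ (≐-sym y≐) (coll-in p (Y⊆M _ p))

        -- `coll M` maps `Y` isomorphically onto `y`, so collapsing either set gives the same
        -- ordinals.
        coll-coll : ∀ η → η ∈ Y → coll y (coll M η) ≐ coll Y η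
        coll-coll = ∈-ind (λ η → η ∈ Y → coll y (coll M η) ≐ coll Y η) λ η ih p → ⊆-antisym
          (λ z q → let (ζ , a , b , e) = coll-out q ; (η′ , a′ , c′ , e′) = coll-out a ; (η″ , b′ , e″) = y-out b
                       f = coll-inj c′ (Y⊆M _ b′) (≐-trans (≐-sym e′) e″) ; η″∈η = ∈-respˡ f a′ in
            ∈-respˡ (≐-sym (≐-trans e (≐-trans (coll-ext e″) (ih η″ η″∈η b′)))) (coll-in η″∈η b′))
          (λ z q → let (η′ , a , b , e) = coll-out q in
            ∈-respˡ (≐-trans (ih η′ a b) (≐-sym e)) (coll-in (coll-in a (Y⊆M _ b)) (y-in b)))

        tr-Bdd : ∀ {A} → A ⊆ y → Bdd (tr y A)
        tr-Bdd h = order-type , order-type∈ω₁ , λ z p → let (ζ , q , e) = Im-out p ; (η , r , f) = y-out (h ζ q) in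
          ∈-respˡ (≐-sym (≐-trans e (≐-trans (coll-ext f) (coll-coll η r)))) (coll-Y⊆ r)

        -- If `A` is the collapse of `a`, its code is the image of `a ∩ Y` under the collapse of
        -- `Y`, which is computed in `M`.
        tr-to : ∀ {A} → A ⊆ y → A ∈ Coll M → tr y A ∈ M
        tr-to {A} h p = by (Coll-out p)
          where
          by : (∃[ a ] a ∈ M × A ≐ coll M a) → tr y A ∈ M
          by (a , a∈ , e) = let (x , x∈ , k) = image-in-M a∈ in ∈-respˡ (⊆-antisym
              (λ ξ q → let (η , r , s , f) = proj₁ (k ξ) q in
                Im-in coll-ext (∈-respʳ (≐-sym e) (coll-in r (Y⊆M η s))) (≐-trans f (≐-sym (coll-coll η s))))
              (λ ξ q → let (ζ , r , f) = Im-out q ; (η , s , g) = y-out (h ζ r) ; (η′ , a′ , c , g′) = coll-out (∈-respʳ e r)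
                           η∈a = ∈-respˡ (coll-inj c (Y⊆M η s) (≐-trans (≐-sym g′) g)) a′ in
                proj₂ (k ξ) η η∈a s (≐-trans f (≐-trans (coll-ext g) (coll-coll η s))))) x∈

        -- The preimage of the code under the collapse of `Y` lies in `M` and collapses to `A`. This
        -- is how a set known only through its code enters another model.
        tr-from : ∀ {A} → A ⊆ y → tr y A ∈ M → A ∈ Coll M
        tr-from {A} h p = let (a , a∈ , k) = preimage-in-M p in Im-in coll-ext a∈ (⊆-antisym
          (λ ζ q → let (η , r , f) = y-out (h ζ q) in ∈-respˡ (≐-sym f)
            (coll-in (proj₂ (k η) r (Im-in coll-ext q (≐-trans (≐-sym (coll-coll η r)) (coll-ext (≐-sym f))))) (Y⊆M η r)))
          (λ ζ q → let (η , r , _ , f) = coll-out q ; (s , t) = proj₁ (k η) r ; (ζ′ , u , g) = Im-out t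
                       (η′ , s′ , f′) = y-out (h ζ′ u)
                       same = coll-strict (ordY s) (ordY s′) s s′ (≐-trans g (≐-trans (coll-ext f′) (coll-coll η′ s′))) in
            ∈-respˡ (≐-trans f′ (≐-trans (coll-ext (≐-sym same)) (≐-sym f))) u))

  -- Under the injection E γ, the sets y γ ν form a continuous exhaustion of γ by countable sets.
  y : V → V → V
  y γ ν = ⟪ γ ∣ (λ ξ → Lift 1ℓ (E γ ‵ ξ ∈ ν)) ⟫

  y-resp : ∀ {γ ν} → Resp (λ ξ → Lift 1ℓ (E γ ‵ ξ ∈ ν))
  y-resp e (lift p) = lift (∈-respˡ (‵-ext ≐-refl e) p)

  y-cong : ∀ {γ γ′ ν ν′} → γ ≐ γ′ → ν ≐ ν′ → y γ ν ≐ y γ′ ν′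
  y-cong e e′ = sep-ext y-resp y-resp e
    (λ _ _ (lift p) → lift (∈-respˡ (‵-ext (E-ext e) ≐-refl) (∈-respʳ e′ p)))
    (λ _ _ (lift p) → lift (∈-respˡ (‵-ext (E-ext (≐-sym e)) ≐-refl) (∈-respʳ (≐-sym e′) p)))

  -- Beyond membership of `y γ ν` in `Coll M`, this asks for a countable preimage that is a member
  -- and a subset of `M`, which is what allows subsets to be coded and decoded.
  Guess : V → V → V → V → Set₁
  Guess M λ′ γ ν = ∃[ Y ] Nice M λ′ Y × coll M Y ≐ y γ ν

  Guess-resp : ∀ {M λ′ γ} → Resp (Guess M λ′ γ)
  Guess-resp e (Y , n , f) = Y , n , ≐-trans f (y-cong ≐-refl e)

  S : V → V → V → V
  S M λ′ γ = ⟪ ω₁ ∣ Guess M λ′ γ ⟫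

  R-out : ∀ {M x} → x ∈ R M → x ∈ M × Bdd x
  R-out = sep-out Bdd-resp

  -- Approximation for `M′`: a countable `z` meets γ inside some `y γ ν` guessed by both models. The
  -- part of `A` in `y γ ν` is coded in `M` by a bounded subset of ω₁; the code lies in `M′` because
  -- `R M ≐ R M′`, and there it is decoded.
  agree : ∀ {M M′ λ′ λ″ γ} → Model M → Model M′ → R M ≐ R M′ → IsOrdinal λ′ → λ′ ∈ M → IsOrdinal λ″ → λ″ ∈ M′ →
    coll M′ λ″ ≐ γ → γ ∈ ω₂ → (∀ η → η ∈ ω₁ → ∃[ ν ] η ∈ ν × ν ∈ S M λ′ γ ∩ S M′ λ″ γ) →
    ∀ A → A ⊆ γ → A ∈ Coll M → A ∈ Coll M′
  agree {M} {M′} {λ′} {λ″} {γ} m m′ R≐ o p o′ p′ γ≐ γ∈ω₂ common A A⊆γ A∈ = M″.approx γ A γ∈ A⊆γ λ z z∈ c → by z z∈ c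
      (common (bnd (Im (E γ ‵_) (z ∩ γ))) (bnd∈ω₁ (cov-image E-ext′ (λ y q → let (x , r , e) = Im-out q in x , r , e)
        (cov-mono (λ x q → proj₁ (∩-out q)) (countable⇒cov c)))
        λ x q → let (ξ , r , e) = Im-out q in ∈-respˡ (≐-sym e) (E∈ γ∈ω₂ (proj₂ (∩-out r)))))
    where
    module M′ = ModelFacts m
    module M″ = ModelFacts m′
    E-ext′ : Ext (E γ ‵_)
    E-ext′ = ‵-ext ≐-refl
    γ∈ : γ ∈ Coll M′
    γ∈ = Im-in coll-ext p′ (≐-sym γ≐)
    by : ∀ z → z ∈ Coll M′ → Countable z →
      (∃[ ν ] bnd (Im (E γ ‵_) (z ∩ γ)) ∈ ν × ν ∈ S M λ′ γ ∩ S M′ λ″ γ) → z ∩ A ∈ Coll M′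
    by z z∈ c (ν , b∈ν , ν∈) = go (proj₂ (sep-out Guess-resp (proj₁ (∩-out ν∈)))) (sep-out Guess-resp (proj₂ (∩-out ν∈)))
      where
      go : Guess M λ′ γ ν → ν ∈ ω₁ × Guess M′ λ″ γ ν → z ∩ A ∈ Coll M′
      go (Y , n , e) (ν∈ω₁ , (Y′ , n′ , e′)) = ∈-respˡ (⊆-antisym
          (λ x q → let (r , s) = ∩-out q in ∩-in r (proj₁ (∩-out s)))
          (λ x q → let (r , s) = ∩-out q ; xγ = A⊆γ x s in ∩-in r (∩-in s (sep-in y-resp xγ (lift
            (ord-trans (ord-elt ord-ω₁ ν∈ω₁) (bnd-in (Im-in E-ext′ (∩-in r xγ) ≐-refl)) b∈ν))))))
          (M″.Coll-∩ z∈ (M″.tr-from o′ p′ n′ (≐-sym e′) (λ x q → proj₂ (∩-out q)) (proj₁ (R-out (∈-respʳ R≐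
            (sep-in Bdd-resp (M′.tr-to o p n (≐-sym e) (λ x q → proj₂ (∩-out q)) (M′.Coll-∩ A∈ y∈))
              (M′.tr-Bdd o p n (≐-sym e) λ x q → proj₂ (∩-out q))))))))
        where
        y∈ : y γ ν ∈ Coll M
        y∈ = ∈-respˡ e (coll∈Coll (proj₁ n))

  constant : ∀ {X} x → x ∈ X → Ops X
  constant {X} x p = record { app = f ; app-ext = f-ext ; app-⊆ = f-⊆ ; app-cov = λ {l} _ → f-cov l }
    where
    f : List V → V
    f [] = ｛ x , x ｝
    f (_ ∷ _) = ∅
    f-ext : ∀ {l l′} → Pointwise _≐_ l l′ → f l ≐ f l′
    f-ext [] = ≐-refl
    f-ext (_ ∷ _) = ≐-refl
    f-⊆ : ∀ {l} → l ⊆* X → f l ⊆ X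
    f-⊆ [] z q = ∈-respˡ (≐-sym (single-out q)) p
    f-⊆ (_ ∷ _) z q = ⊥-elim (∅-out q)
    f-cov : ∀ l → Cov (_∈ f l)
    f-cov [] = cov-single
    f-cov (_ ∷ _) = cov-∅ λ _ → ∅-out

  -- Internal stationarity gives a `Y` in `M` closed under suitable operations; let ν be its trace
  -- on ω₁. Closure under `coll M` followed by `E γ`, and under the inverse, says that `Y ∩ λ′`
  -- collapses onto `y γ ν`; closure under the next point of `C` puts ν into `C`.
  S-stationary : ∀ {M λ′ γ} → Model M → IsOrdinal λ′ → λ′ ∈ M → coll M λ′ ≐ γ → γ ∈ ω₂ → Stat (S M λ′ γ)
  S-stationary {M} {λ′} {γ} m o p γ≐ γ∈ω₂ = sep-⊆ Guess-resp , λ C c → hit C c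
    where
    module M′ = ModelFacts m
    hit : ∀ C → IsClub₁ C → ∃[ ν ] ν ∈ C × ν ∈ S M λ′ γ
    hit C (C⊆ , unb , cl) = by (ops⇒club G)
      where
      Above : V → V → Set₁
      Above j β = Lift 1ℓ (β ∈ C × j ∈ β)
      rA : ∀ {j} → Resp (Above j)
      rA e (lift (q , r)) = lift (∈-respˡ e q , ∈-respʳ e r)
      nx : V → V
      nx j = least ω₁ (Above j)
      nx-ext : Ext nx
      nx-ext e = least-ext rA rA ≐-refl (λ ξ (lift (q , r)) → lift (q , ∈-respˡ e r))
        (λ ξ (lift (q , r)) → lift (q , ∈-respˡ (≐-sym e) r))
      nx-spec : ∀ {j} → j ∈ ω₁ → nx j ∈ ω₁ × Above j (nx j)
      nx-spec {j} q = let (β , r , s) = unb j q ; (a , b , _) = least-spec ord-ω₁ rA (β , C⊆ β r , lift (r , s)) in a , b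
      Val : V → V → Set₁
      Val x i = Lift 1ℓ (x ∈ λ′ × i ≐ E γ ‵ coll M x)
      rV : ∀ {x} → Resp (Val x)
      rV e (lift (q , r)) = lift (q , ≐-trans (≐-sym e) r)
      E-coll : Ext (λ x → E γ ‵ coll M x)
      E-coll e = ‵-ext ≐-refl (coll-ext e)
      Inv : V → V → Set₁
      Inv i x = Lift 1ℓ (x ∈ λ′ × i ≐ E γ ‵ coll M x)
      rI : ∀ {i} → Resp (Inv i)
      rI e (lift (q , r)) = lift (∈-respˡ e q , ≐-trans r (E-coll e))
      in-γ : ∀ {x} → x ∈ λ′ → x ∈ M → coll M x ∈ γ
      in-γ q r = ∈-respʳ γ≐ (coll-in q r)
      Nx : V → V → Set₁
      Nx j β = Lift 1ℓ (j ∈ ω₁ × β ≐ nx j)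
      rNx : ∀ {j} → Resp (Nx j)
      rNx e (lift (q , r)) = lift (q , ≐-trans (≐-sym e) r)
      -- `G₀` and `G₂` make the trace on ω₁ a nonempty ordinal, `G₁` reaches the next point of `C`,
      -- and `G₃` and `G₄` serve `E γ` and its inverse.
      G₀ G₁ G₂ G₃ G : Ops M
      G₀ = constant ∅ (M′.ω₁⊆M ∅ ∅∈ω₁)
      G₁ = unary (λ j → ⟪ ω₁ ∣ Nx j ⟫)
        (λ e → sep-ext rNx rNx ≐-refl (λ _ _ (lift (q , r)) → lift (∈-respˡ e q , ≐-trans r (nx-ext e)))
          (λ _ _ (lift (q , r)) → lift (∈-respˡ (≐-sym e) q , ≐-trans r (nx-ext (≐-sym e)))))
        (λ j _ z q → M′.ω₁⊆M z (sep-⊆ rNx z q))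
        (λ j _ → cov-one (nx j) λ z q → proj₂ (lower (proj₂ (sep-out rNx q))))
      G₂ = unary (λ ε → ⟪ ε ∣ (λ z → Lift 1ℓ (ε ∈ ω₁)) ⟫)
        (λ e → sep-ext (λ _ q → q) (λ _ q → q) e (λ _ _ (lift q) → lift (∈-respˡ e q)) (λ _ _ (lift q) → lift (∈-respˡ (≐-sym e) q)))
        (λ ε _ z q → let (r , lift s) = sep-out (λ _ q → q) q in M′.ω₁⊆M z (ord-trans ord-ω₁ r s))
        (λ ε _ → [ (λ q → cov-mono (λ z r → proj₁ (sep-out (λ _ q → q) r)) (ω₁-cov q)) ,
          (λ n → cov-∅ λ z r → n (lower (proj₂ (sep-out (λ _ q → q) r)))) ]′ (lem₀ (ε ∈ ω₁)))
      G₃ = unary (λ x → ⟪ ω₁ ∣ Val x ⟫)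
        (λ e → sep-ext rV rV ≐-refl (λ _ _ (lift (q , r)) → lift (∈-respˡ e q , ≐-trans r (E-coll e)))
          (λ _ _ (lift (q , r)) → lift (∈-respˡ (≐-sym e) q , ≐-trans r (E-coll (≐-sym e)))))
        (λ x _ z q → M′.ω₁⊆M z (sep-⊆ rV z q))
        (λ x _ → cov-one (E γ ‵ coll M x) λ z q → proj₂ (lower (proj₂ (sep-out rV q))))
      G₄ : Ops M
      G₄ = unary (λ i → ⟪ M ∣ Inv i ⟫)
        (λ e → sep-ext rI rI ≐-refl (λ _ _ (lift (q , r)) → lift (q , ≐-trans (≐-sym e) r))
          (λ _ _ (lift (q , r)) → lift (q , ≐-trans e r)))
        (λ i _ → sep-⊆ rI)
        (λ i _ → one i (lem (∃[ x ] x ∈ M × Inv i x)))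
        where
        one : ∀ i → (∃[ x ] x ∈ M × Inv i x) ⊎ ¬ (∃[ x ] x ∈ M × Inv i x) → Cov (_∈ ⟪ M ∣ Inv i ⟫)
        one i (inj₁ (x , q , lift (r , e))) = cov-one x λ z s → let (q′ , lift (r′ , e′)) = sep-out rI s in
          M′.coll-inj q′ q (E-inj γ∈ω₂ (in-γ r′ q′) (in-γ r q) (≐-trans (≐-sym e′) e))
        one i (inj₂ n) = cov-∅ λ z s → n (z , sep-out rI s)
      G = G₀ ⊕ G₁ ⊕ G₂ ⊕ G₃ ⊕ G₄
      by : (∃[ K ] IsClubω M K × (∀ Y → Y ∈ K → Closed G Y)) → ∃[ ν ] ν ∈ C × ν ∈ S M λ′ γ
      by (K , cK , closedK) = go (M′.stationary K cK)
        where
        go : (∃[ Y ] Y ∈ K × Y ∈ M × Y ⊆ M × Countable Y) → ∃[ ν ] ν ∈ C × ν ∈ S M λ′ γ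
        go (Y , Y∈K , Y∈M , Y⊆M , cY) = ν , ν∈C , sep-in Guess-resp ν∈ω₁ (Y ∩ λ′ ,
            (M′.M-∩ Y∈M p , ≼-trans (⊆⇒≼ λ z q → proj₁ (∩-out q)) cY , (λ z q → Y⊆M z (proj₁ (∩-out q))) ,
              λ z q → proj₂ (∩-out q)) ,
            ⊆-antisym
              (λ z q → let (x , r , s , e) = coll-out q ; (a , b) = ∩-out r ; zγ = in-γ b s in
                sep-in y-resp (∈-respˡ (≐-sym e) zγ) (lift (∈-respˡ (‵-ext ≐-refl (≐-sym e)) (∩-in (c₃ a b (E∈ γ∈ω₂ zγ)) (E∈ γ∈ω₂ zγ)))))
              (λ z q → let (a , lift b) = sep-out y-resp q ; (x , r , s , e) = coll-out (∈-respʳ (≐-sym γ≐) a) in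
                ∈-respˡ (≐-sym e) (coll-in (∩-in (c₄ (proj₁ (∩-out b)) s r (‵-ext ≐-refl e)) r) s)))
          where
          cG : Closed G Y
          cG = closedK Y Y∈K
          ν : V
          ν = Y ∩ ω₁
          cG₁ : Closed (G₁ ⊕ G₂ ⊕ G₃ ⊕ G₄) Y
          cG₁ = closed-⊕ʳ G₀ (G₁ ⊕ G₂ ⊕ G₃ ⊕ G₄) cG
          cG₂ : Closed (G₂ ⊕ G₃ ⊕ G₄) Y
          cG₂ = closed-⊕ʳ G₁ (G₂ ⊕ G₃ ⊕ G₄) cG₁
          cG₃ : Closed (G₃ ⊕ G₄) Y
          cG₃ = closed-⊕ʳ G₂ (G₃ ⊕ G₄) cG₂
          c₀ : ∅ ∈ Y
          c₀ = values (closed-⊕ˡ G₀ (G₁ ⊕ G₂ ⊕ G₃ ⊕ G₄) cG) [] [] ∅ (pair-inˡ ≐-refl)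
          c₁ : ∀ {j} → j ∈ Y → j ∈ ω₁ → nx j ∈ Y
          c₁ {j} q r = values (closed-⊕ˡ G₁ (G₂ ⊕ G₃ ⊕ G₄) cG₁) (j ∷ []) (q ∷ []) (nx j)
            (sep-in rNx (proj₁ (nx-spec r)) (lift (r , ≐-refl)))
          c₂ : ∀ {ε} → ε ∈ Y → ε ∈ ω₁ → ε ⊆ Y
          c₂ {ε} q r z s = values (closed-⊕ˡ G₂ (G₃ ⊕ G₄) cG₂) (ε ∷ []) (q ∷ []) z (sep-in (λ _ q → q) s (lift r))
          c₃ : ∀ {x} → x ∈ Y → x ∈ λ′ → E γ ‵ coll M x ∈ ω₁ → E γ ‵ coll M x ∈ Y
          c₃ {x} q r s = values (closed-⊕ˡ G₃ G₄ cG₃) (x ∷ []) (q ∷ []) _ (sep-in rV s (lift (r , ≐-refl)))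
          c₄ : ∀ {i x} → i ∈ Y → x ∈ M → x ∈ λ′ → i ≐ E γ ‵ coll M x → x ∈ Y
          c₄ {i} {x} q r s e = values (closed-⊕ʳ G₃ G₄ cG₃) (i ∷ []) (q ∷ []) x (sep-in rI r (lift (s , e)))
          ord-ν : IsOrdinal ν
          ord-ν = (λ y q z r → let (a , b) = ∩-out q in ∩-in (c₂ a b z r) (ord-trans ord-ω₁ r b)) ,
            λ y q → proj₁ (ord-elt ord-ω₁ (proj₂ (∩-out q)))
          ν∈ω₁ : ν ∈ ω₁
          ν∈ω₁ = ∈ω₁ ord-ν (cov-mono (λ z q → proj₁ (∩-out q)) (countable⇒cov cY))
          next : ∀ β → β ∈ ν → ∃[ γ ] γ ∈ C × γ ∈ ν × β ∈ γ
          next β q = let (a , b) = ∩-out q ; (n∈ , lift (n∈C , β∈n)) = nx-spec b in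
            nx β , n∈C , ∩-in (c₁ a b) n∈ , β∈n
          ν∈C : ν ∈ C
          ν∈C = cl ν ν∈ω₁ (ord-ν , ∩-in c₀ ∅∈ω₁ , λ β q → let (γ′ , _ , r , s) = next β q in
            ord-⊆∈ (ord-succ (ord-elt ord-ν q)) ord-ν
              (λ z t → [ (λ u → ord-trans (ord-elt ord-ν r) u s) , (λ e → ∈-respˡ (≐-sym e) s) ]′ (succ-out t)) r) next

-- The tree of nodes and its branch.

module Tree (em : ExcludedMiddle 1ℓ) (choice : Choice) (ω₁ ω₂ : V)
  (s₁ : IsSuccessorCardinal ω ω₁) (s₂ : IsSuccessorCardinal ω₁ ω₂) (srp : SRP ω₁ ω₂) (tp : TreeProperty ω₂) where
  open import Data.List.Base using ([])
  open import Data.List.Relation.Unary.All using ([])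

  open Sets em
  open Cardinals em choice ω₁ ω₂ s₁ s₂
  open Collapse em choice ω₁ ω₂ s₁ s₂
  open Clubs em choice ω₁ ω₂ s₁ s₂
  open Closed
  open Reflection em choice ω₁ ω₂ s₁ s₂ srp
  open Nodes em choice ω₁ ω₂ s₁ s₂

  opaque
    unfolding _∈_

    pred : (T R t : V) → V
    pred = D.pred

    pred-in : ∀ {T R s t} → s ∈ T → ⟨ s , t ⟩ ∈ R → s ∈ pred T R t
    pred-in {sup A f} {R} {s} {t} (i , e) q = (i , ∈-respˡ {⟨ s , t ⟩} {⟨ f i , t ⟩} {R} (⟨⟩-cong {s} {t} {f i} {t} e (≐-refl {t})) q) , e

    pred-out : ∀ {T R s t} → s ∈ pred T R t → s ∈ T × ⟨ s , t ⟩ ∈ R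
    pred-out {sup A f} {R} {s} {t} ((i , q) , e) = (i , e) ,
      ∈-respˡ {⟨ f i , t ⟩} {⟨ s , t ⟩} {R} (⟨⟩-cong {f i} {t} {s} {t} (≐-sym {s} {f i} e) (≐-refl {t})) q

  HasHeight : (T R t α : V) → Set₁
  HasHeight T R t α = IsOrdinal α × (∃[ f ] (IsInjection f (pred T R t) α × (∀ y → y ∈ α → ∃[ x ] x ∈ pred T R t × f ‵ x ≐ y))
    × (∀ r s → r ∈ pred T R t → s ∈ pred T R t → ⟨ r , s ⟩ ∈ R ⇔ f ‵ r ∈ f ‵ s))

  record TreeAxioms (T R : V) : Set₁ where
    field
      irreflexive : ∀ s → s ∈ T → ¬ (⟨ s , s ⟩ ∈ R)
      transitive : ∀ s t u → s ∈ T → t ∈ T → u ∈ T → ⟨ s , t ⟩ ∈ R → ⟨ t , u ⟩ ∈ R → ⟨ s , u ⟩ ∈ R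
      linear : ∀ t → t ∈ T → ∀ r s → r ∈ pred T R t → s ∈ pred T R t → ⟨ r , s ⟩ ∈ R ⊎ r ≐ s ⊎ ⟨ s , r ⟩ ∈ R
      wellFounded : ∀ t → t ∈ T → ∀ a → a ⊆ pred T R t → (∃[ s ] s ∈ a) → ∃[ s ] s ∈ a × (∀ r → r ∈ a → ¬ (⟨ r , s ⟩ ∈ R))
      height-out : ∀ α → α ∈ ω₂ → ∃[ t ] t ∈ T × HasHeight T R t α
      height-in : ∀ α t → t ∈ T → HasHeight T R t α → α ∈ ω₂
      levels : ∀ α → α ∈ ω₂ → ∃[ L ] (∀ t → t ∈ L → t ∈ T × HasHeight T R t α) × (∀ t → t ∈ T → HasHeight T R t α → t ∈ L) × L ≼ ω₁

  opaque
    unfolding _∈_ pred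

    branch : ∀ {T R} → TreeAxioms T R → ∃[ b ] b ⊆ T
      × (∀ s t → s ∈ b → t ∈ b → ⟨ s , t ⟩ ∈ R ⊎ s ≐ t ⊎ ⟨ t , s ⟩ ∈ R)
      × (∀ α → α ∈ ω₂ → ∃[ t ] t ∈ b × HasHeight T R t α)
    branch {T} {R} ax =
      let (b , c) = tp T R tree (λ α → mk⇔ (A.height-out α) (λ (t , p , q) → A.height-in α t p q))
                      (λ α p → let (L , f , g , h) = A.levels α p in
                        L , (λ t → mk⇔ (f t) (λ (q , r) → g t q r)) , ω₁ , ω₁∈ω₂ , h) in
      b , IsCofinalBranch.subset c , IsCofinalBranch.linear c , IsCofinalBranch.cofinal c
      where
      module A = TreeAxioms ax
      tree : IsTree T R
      tree = record { irreflexive = A.irreflexive ; transitive = A.transitive ; linear = A.linear ; wellFounded = A.wellFounded }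

  module _ (pairing : Pairing) (r : V) (reflect : ∀ β → β ∈ ω₂ → Witness r β) where

    resp-∈ : ∀ {x} → Resp (λ y → Lift 1ℓ (y ∈ x))
    resp-∈ e (lift p) = lift (∈-respˡ e p)

    trace : V → V → V
    trace γ M = ⟪ Pow γ ∣ (λ a → Lift 1ℓ (a ∈ Coll M)) ⟫

    trace-in : ∀ {γ M a} → a ⊆ γ → a ∈ Coll M → a ∈ trace γ M
    trace-in h p = sep-in resp-∈ (Pow-in h) (lift p)

    trace-out : ∀ {γ M a} → a ∈ trace γ M → a ⊆ γ × a ∈ Coll M
    trace-out p = let (a , lift b) = sep-out resp-∈ p in Pow-out a , b

    record NodeOf (γ 𝒜 M ξ : V) : Set₁ where
      field
        model : Model M
        reals : R M ≐ r
        ord : IsOrdinal ξ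
        mem∈ : ξ ∈ M
        height : coll M ξ ≐ γ
        trace≐ : 𝒜 ≐ trace γ M

      γ∈Coll : γ ∈ Coll M
      γ∈Coll = Im-in coll-ext mem∈ (≐-sym height)

      γ∈ω₂ : γ ∈ ω₂
      γ∈ω₂ = ∈-respˡ height (∈ω₂ (ord-coll ord) (≼-trans (⊆⇒≼ (Coll-trans _ (coll∈Coll mem∈))) (Model.Coll≼ω₁ model)))

      out : ∀ {a} → a ∈ 𝒜 → a ⊆ γ × a ∈ Coll M
      out p = trace-out (∈-respʳ trace≐ p)

      into : ∀ {a} → a ⊆ γ → a ∈ Coll M → a ∈ 𝒜
      into h p = ∈-respʳ (≐-sym trace≐) (trace-in h p)

      -- The ordinal γ belongs to `𝒜`, so a node determines its level, and the tree can consist of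
      -- the bare sets `𝒜`.
      ⋃≐ : ⋃ 𝒜 ≐ γ
      ⋃≐ = ⊆-antisym (λ z p → let (a , q , s) = ⋃-out p in proj₁ (out q) z s)
        (λ z p → ⋃-in p (into (λ _ q → q) γ∈Coll))

    Node : V → V → Set₁
    Node γ 𝒜 = ∃[ M ] ∃[ ξ ] NodeOf γ 𝒜 M ξ

    NodeOf-resp : ∀ {γ γ′ 𝒜 𝒜′ M ξ} → γ ≐ γ′ → 𝒜 ≐ 𝒜′ → NodeOf γ 𝒜 M ξ → NodeOf γ′ 𝒜′ M ξ
    NodeOf-resp e f n = record { model = N.model ; reals = N.reals ; ord = N.ord ; mem∈ = N.mem∈
      ; height = ≐-trans N.height e
      ; trace≐ = ⊆-antisym
          (λ a p → let (h , q) = N.out (∈-respʳ (≐-sym f) p) in trace-in (λ z s → ∈-respʳ e (h z s)) q)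
          (λ a p → let (h , q) = trace-out p in ∈-respʳ f (N.into (λ z s → ∈-respʳ (≐-sym e) (h z s)) q)) }
      where module N = NodeOf n

    Node-resp : ∀ {γ γ′ 𝒜 𝒜′} → γ ≐ γ′ → 𝒜 ≐ 𝒜′ → Node γ 𝒜 → Node γ′ 𝒜′
    Node-resp e f (M , ξ , n) = M , ξ , NodeOf-resp e f n

    node-⋃ : ∀ {γ 𝒜} → Node γ 𝒜 → ⋃ 𝒜 ≐ γ
    node-⋃ (M , ξ , n) = NodeOf.⋃≐ n

    node-ω₂ : ∀ {γ 𝒜} → Node γ 𝒜 → γ ∈ ω₂
    node-ω₂ (M , ξ , n) = NodeOf.γ∈ω₂ n

    -- The same model serves: an ordinal below `coll M ξ` is `coll M η` for some η in both ξ and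
    -- `M`.
    node-restrict : ∀ {γ 𝒜 γ′} → Node γ 𝒜 → γ′ ∈ γ → Node γ′ (𝒜 ∩ Pow γ′)
    node-restrict {γ} {𝒜} {γ′} (M , ξ , n) p = by (coll-out (∈-respʳ (≐-sym N.height) p))
      where
      module N = NodeOf n
      by : (∃[ η ] η ∈ ξ × η ∈ M × γ′ ≐ coll M η) → Node γ′ (𝒜 ∩ Pow γ′)
      by (η , q , s , e) = M , η , record { model = N.model ; reals = N.reals ; ord = ord-elt N.ord q ; mem∈ = s
        ; height = ≐-sym e
        ; trace≐ = ⊆-antisym
            (λ a t → let (u , v) = ∩-out t in trace-in (Pow-out v) (proj₂ (N.out u)))
            (λ a t → let (u , v) = trace-out t in
              ∩-in (N.into (λ z w → ord-trans (ord-elt ord-ω₂ N.γ∈ω₂) (u z w) p) v) (Pow-in u)) }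

    node-exists : ∀ γ → γ ∈ ω₂ → ∃[ 𝒜 ] Node γ 𝒜
    node-exists γ p = by (reflect (succ γ) (succ∈ω₂ p))
      where
      by : Witness r (succ γ) → ∃[ 𝒜 ] Node γ 𝒜
      by (M , ξ , m , e , q , o , h) = go (coll-out (h γ succ-self))
        where
        go : (∃[ η ] η ∈ ξ × η ∈ M × γ ≐ coll M η) → ∃[ 𝒜 ] Node γ 𝒜
        go (η , s , t , f) = trace γ M , M , η ,
          record { model = m ; reals = e ; ord = ord-elt o s ; mem∈ = t ; height = ≐-sym f ; trace≐ = ≐-refl }

    module AtLevel (γ : V) (γ∈ω₂ : γ ∈ ω₂) where

      -- By `agree`, different nodes guess the exhaustion of γ on sets with nonstationary
      -- intersection. So these sets form an antichain, indexed by the nodes, to which saturation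
      -- applies.
      Fam : V → V → Set₁
      Fam 𝒜 T = ∃[ M ] ∃[ ξ ] NodeOf γ 𝒜 M ξ × T ≐ S M ξ γ

      fam-resp : ∀ {x x′ T T′} → x ≐ x′ → T ≐ T′ → Fam x T → Fam x′ T′
      fam-resp e f (M , ξ , n , g) = M , ξ , NodeOf-resp ≐-refl e n , ≐-trans (≐-sym f) g

      stat-resp : Resp Stat
      stat-resp e (h , k) = (λ z p → h z (∈-respʳ (≐-sym e) p)) , λ C c → let (α , p , q) = k C c in α , p , ∈-respʳ e q

      fam-stat : ∀ {x T} → Fam x T → Stat T
      fam-stat (M , ξ , n , g) = stat-resp (≐-sym g) (S-stationary N.model N.ord N.mem∈ N.height γ∈ω₂)
        where module N = NodeOf n

      unbounded : ∀ {T} → Stat T → ∀ η → η ∈ ω₁ → ∃[ ν ] η ∈ ν × ν ∈ T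
      unbounded s η p = let (ν , q , _ , c) = closed-point s (constant η p) in
        ν , values c [] [] η (pair-inˡ ≐-refl) , q

      half : ∀ {x x′ M M′ ξ ξ′} → NodeOf γ x M ξ → NodeOf γ x′ M′ ξ′ → Stat (S M ξ γ ∩ S M′ ξ′ γ) → x ⊆ x′
      half n n′ s a p = let (h , q) = N.out p in N′.into h
          (agree N.model N′.model (≐-trans N.reals (≐-sym N′.reals)) N.ord N.mem∈ N′.ord N′.mem∈ N′.height γ∈ω₂
            (unbounded s) a h q)
        where
        module N = NodeOf n
        module N′ = NodeOf n′

      fam-unique : ∀ {x x′ T T′} → Fam x T → Fam x′ T′ → Stat (T ∩ T′) → x ≐ x′
      fam-unique (M , ξ , n , g) (M′ , ξ′ , n′ , g′) s = ⊆-antisym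
        (half n n′ (stat-resp (∩-ext g g′) s))
        (half n′ n (stat-resp (≐-trans (∩-ext g g′) (⊆-antisym (λ _ p → let (a , b) = ∩-out p in ∩-in b a)
          (λ _ p → let (a , b) = ∩-out p in ∩-in b a))) s))

      rNode : Resp (Node γ)
      rNode = Node-resp ≐-refl

      level : V
      level = ⟪ Pow (Pow ω₂) ∣ Node γ ⟫

      -- Each node picks one of its stationary sets in the small family given by saturation, and
      -- that set determines the node.
      level≼ω₁ : level ≼ ω₁
      level≼ω₁ = by (Saturation.saturation pairing Fam fam-resp fam-stat fam-unique)
        where
        by : (∃[ A ] A ≼ ω₁ × (∀ x T → Fam x T → ∃[ T′ ] T′ ∈ A × Fam x T′)) → level ≼ ω₁
        by (A , A≼ , cap) = ≼-trans (Inj⇒≼ (g , g-ext , (λ x p → lower (proj₁ (g-spec x p))) , inj)) A≼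
          where
          G : Σ (V → V) λ g → Ext g × (∀ x → x ∈ level → Lift 1ℓ (g x ∈ A) × Fam x (g x))
          G = choose level (λ x T → Lift 1ℓ (T ∈ A) × Fam x T)
            (λ e e′ (lift p , f) → lift (∈-respˡ e′ p) , fam-resp e e′ f)
            (λ x p → let (M , ξ , n) = proj₂ (sep-out rNode p) ; (T , q , f) = cap x (S M ξ γ) (M , ξ , n , ≐-refl) in T , lift q , f)
          g : V → V
          g = proj₁ G
          g-ext : Ext g
          g-ext = proj₁ (proj₂ G)
          g-spec : ∀ x → x ∈ level → Lift 1ℓ (g x ∈ A) × Fam x (g x)
          g-spec = proj₂ (proj₂ G)
          inj : ∀ x y → x ∈ level → y ∈ level → g x ≐ g y → x ≐ y
          inj x y p q e = fam-unique f (proj₂ (g-spec y q))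
              (stat-resp (⊆-antisym (λ z s → ∩-in s (∈-respʳ e s)) (λ z s → proj₁ (∩-out s))) (fam-stat f))
            where
            f : Fam x (g x)
            f = proj₂ (g-spec x p)

    IsNode : V → Set₁
    IsNode 𝒜 = ∃[ γ ] Node γ 𝒜

    rIsNode : Resp IsNode
    rIsNode e (γ , n) = γ , Node-resp ≐-refl e n

    node-Pow : ∀ {γ 𝒜} → Node γ 𝒜 → 𝒜 ∈ Pow (Pow ω₂)
    node-Pow (M , ξ , n) = Pow-in λ a p → Pow-in λ z q → ord-trans ord-ω₂ (proj₁ (NodeOf.out n p) z q) (NodeOf.γ∈ω₂ n)

    -- The order of restriction, with the level of a node read off as its union.
    Below : V → V → Set
    Below s t = ⋃ s ∈ ⋃ t × s ≐ t ∩ Pow (⋃ s)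

    Pow-ext : ∀ {a b} → a ≐ b → Pow a ≐ Pow b
    Pow-ext e = ⊆-antisym (λ x p → Pow-in λ z q → ∈-respʳ e (Pow-out p z q))
      (λ x p → Pow-in λ z q → ∈-respʳ (≐-sym e) (Pow-out p z q))

    Below-resp : ∀ {s s′ t t′} → s ≐ s′ → t ≐ t′ → Below s t → Below s′ t′
    Below-resp e f (p , q) = ∈-respˡ (⋃-ext e) (∈-respʳ (⋃-ext f) p) ,
      ≐-trans (≐-sym e) (≐-trans q (∩-ext f (Pow-ext (⋃-ext e))))

    BelowPair : V → Set₁
    BelowPair p = ∃[ s ] ∃[ t ] p ≐ ⟨ s , t ⟩ × Below s t

    rBelowPair : Resp BelowPair
    rBelowPair e (s , t , f , b) = s , t , ≐-trans (≐-sym e) f , b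

    opaque
      Tr ◁ : V
      Tr = ⟪ Pow (Pow ω₂) ∣ IsNode ⟫
      ◁ = ⟪ Prod Tr Tr ∣ BelowPair ⟫

      Tr-in : ∀ {γ 𝒜} → Node γ 𝒜 → 𝒜 ∈ Tr
      Tr-in n = sep-in rIsNode (node-Pow n) (_ , n)

      Tr-out : ∀ {𝒜} → 𝒜 ∈ Tr → Node (⋃ 𝒜) 𝒜
      Tr-out p = let (_ , γ , n) = sep-out rIsNode p in Node-resp (≐-sym (node-⋃ n)) ≐-refl n

      ◁-in : ∀ {s t} → s ∈ Tr → t ∈ Tr → Below s t → ⟨ s , t ⟩ ∈ ◁
      ◁-in p q b = sep-in rBelowPair (Prod-in p q) (_ , _ , ≐-refl , b)

      ◁-out : ∀ {s t} → ⟨ s , t ⟩ ∈ ◁ → Below s t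
      ◁-out p = let (_ , s′ , t′ , e , b) = sep-out rBelowPair p ; (f , g) = ⟨⟩-inj e in
        Below-resp (≐-sym f) (≐-sym g) b

    ord-⋃Tr : ∀ {t} → t ∈ Tr → IsOrdinal (⋃ t)
    ord-⋃Tr p = ord-elt ord-ω₂ (node-ω₂ (Tr-out p))

    below-below : ∀ {r s t} → IsOrdinal (⋃ s) → ⋃ r ∈ ⋃ s → r ≐ t ∩ Pow (⋃ r) → s ≐ t ∩ Pow (⋃ s) → Below r s
    below-below o p e f = p , ≐-trans e (⊆-antisym
      (λ a q → let (u , v) = ∩-out q in
        ∩-in (∈-respʳ (≐-sym f) (∩-in u (Pow-in λ z w → proj₁ o _ p z (Pow-out v z w)))) v)
      (λ a q → let (u , v) = ∩-out q in ∩-in (proj₁ (∩-out (∈-respʳ f u))) v))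

    restrict-below : ∀ {t γ} → t ∈ Tr → γ ∈ ⋃ t → t ∩ Pow γ ∈ Tr × Below (t ∩ Pow γ) t × ⋃ (t ∩ Pow γ) ≐ γ
    restrict-below {t} {γ} p q = Tr-in n , (∈-respˡ (≐-sym e) q , ∩-ext ≐-refl (Pow-ext (≐-sym e))) , e
      where
      n : Node γ (t ∩ Pow γ)
      n = node-restrict (Tr-out p) q
      e : ⋃ (t ∩ Pow γ) ≐ γ
      e = node-⋃ n

    pr-out : ∀ {s t} → s ∈ pred Tr ◁ t → s ∈ Tr × Below s t
    pr-out p = let (a , b) = pred-out p in a , ◁-out b

    pr-in : ∀ {s t} → s ∈ Tr → t ∈ Tr → Below s t → s ∈ pred Tr ◁ t
    pr-in p q b = pred-in p (◁-in p q b)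

    height-⋃ : ∀ {t} → t ∈ Tr → HasHeight Tr ◁ t (⋃ t)
    height-⋃ {t} p = ord-⋃Tr p , graph Pr ⋃ , (F , onto) , order
      where
      Pr : V
      Pr = pred Tr ◁ t
      val : ∀ {s} → s ∈ Pr → graph Pr ⋃ ‵ s ≐ ⋃ s
      val = graph-value ⋃-ext
      F : IsInjection (graph Pr ⋃) Pr (⋃ t)
      F = graph-fun ⋃-ext , (λ s q → ∈-respˡ (≐-sym (val q)) (proj₁ (proj₂ (pr-out q)))) ,
        λ s s′ q q′ e → let e′ = ≐-trans (≐-sym (val q)) (≐-trans e (val q′)) in
          ≐-trans (proj₂ (proj₂ (pr-out q))) (≐-trans (∩-ext ≐-refl (Pow-ext e′)) (≐-sym (proj₂ (proj₂ (pr-out q′)))))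
      onto : ∀ y → y ∈ ⋃ t → ∃[ x ] x ∈ Pr × graph Pr ⋃ ‵ x ≐ y
      onto y q = let (a , b , e) = restrict-below p q ; x∈ = pr-in a p b in t ∩ Pow y , x∈ , ≐-trans (val x∈) e
      order : ∀ r s → r ∈ Pr → s ∈ Pr → ⟨ r , s ⟩ ∈ ◁ ⇔ graph Pr ⋃ ‵ r ∈ graph Pr ⋃ ‵ s
      order r s q q′ = mk⇔
        (λ u → ∈-respˡ (≐-sym (val q)) (∈-respʳ (≐-sym (val q′)) (proj₁ (◁-out u))))
        (λ u → let (a , b) = pr-out q ; (a′ , b′) = pr-out q′ in
          ◁-in a a′ (below-below (ord-⋃Tr a′) (∈-respˡ (val q) (∈-respʳ (val q′) u)) (proj₂ b) (proj₂ b′)))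

    -- Any isomorphism of the predecessors with an ordinal agrees with the level map, by induction
    -- on the level.
    height-unique : ∀ {t α} → t ∈ Tr → HasHeight Tr ◁ t α → α ≐ ⋃ t
    height-unique {t} {α} p (oα , f , ((_ , into , _) , onto) , order) = ⊆-antisym
        (λ w q → let (s , u , e) = onto w q in ∈-respˡ (≐-trans (≐-sym (same u)) e) (proj₁ (proj₂ (pr-out u))))
        (λ w q → let (a , b , e) = restrict-below p q ; u = pr-in a p b in
          ∈-respˡ (≐-trans (same u) e) (into _ u))
      where
      same : ∀ {s} → s ∈ pred Tr ◁ t → f ‵ s ≐ ⋃ s
      same {s} u = go (⋃ s) s u ≐-refl
        where
        go : ∀ γ s → s ∈ pred Tr ◁ t → ⋃ s ≐ γ → f ‵ s ≐ ⋃ s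
        go = ∈-ind (λ γ → ∀ s → s ∈ pred Tr ◁ t → ⋃ s ≐ γ → f ‵ s ≐ ⋃ s) λ γ ih s u e → ⊆-antisym
          (λ w q → let (r , v , e′) = onto w (ord-trans oα q (into s u))
                       b = proj₁ (◁-out (from (order r s v u) (∈-respˡ (≐-sym e′) q))) in
            ∈-respˡ (≐-trans (≐-sym (ih (⋃ r) (∈-respʳ e b) r v ≐-refl)) e′) b)
          (λ w q → let (s∈ , b) = pr-out u ; w∈t = ord-trans (ord-⋃Tr p) q (proj₁ b)
                       (a , b′ , e′) = restrict-below p w∈t ; v = pr-in a p b′ in
            ∈-respˡ (≐-trans (ih _ (∈-respʳ e (∈-respˡ (≐-sym e′) q)) _ v ≐-refl) e′)
              (to (order _ s v u) (◁-in a s∈ (below-below (ord-⋃Tr s∈) (∈-respˡ (≐-sym e′) q) (proj₂ b′) (proj₂ b)))))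

    axioms : TreeAxioms Tr ◁
    axioms = record
      { irreflexive = λ s _ p → ∈-irrefl (proj₁ (◁-out p))
      ; transitive = λ s t u p q v a b → let (x , e) = ◁-out a ; (y , f) = ◁-out b in
          ◁-in p v (ord-trans (ord-⋃Tr v) x y , ≐-trans e (⊆-antisym
            (λ c w → let (k , l) = ∩-out w in ∩-in (proj₁ (∩-out (∈-respʳ f k))) l)
            (λ c w → let (k , l) = ∩-out w in
              ∩-in (∈-respʳ (≐-sym f) (∩-in k (Pow-in λ z m → proj₁ (ord-⋃Tr q) _ x z (Pow-out l z m)))) l)))
      ; linear = λ t p a b u v → let (a∈ , ea) = pr-out u ; (b∈ , eb) = pr-out v in
          [ (λ q → inj₁ (◁-in a∈ b∈ (below-below (ord-⋃Tr b∈) q (proj₂ ea) (proj₂ eb)))) , [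
            (λ q → inj₂ (inj₁ (≐-trans (proj₂ ea) (≐-trans (∩-ext ≐-refl (Pow-ext q)) (≐-sym (proj₂ eb)))))) ,
            (λ q → inj₂ (inj₂ (◁-in b∈ a∈ (below-below (ord-⋃Tr a∈) q (proj₂ eb) (proj₂ ea))))) ]′ ]′
          (trichotomy (ord-⋃Tr a∈) (ord-⋃Tr b∈))
      ; wellFounded = λ t p a h (s , q) →
          let (γ , (m , u , e) , least) = minimal (λ γ → ∃[ s ] s ∈ a × ⋃ s ≐ γ) (⋃ s) (s , q , ≐-refl) in
          m , u , λ k v w → least (⋃ k) (∈-respʳ e (proj₁ (◁-out w))) (k , v , ≐-refl)
      ; height-out = λ α p → let (𝒜 , n) = node-exists α p in
          𝒜 , Tr-in n , height-resp (node-⋃ n) (height-⋃ (Tr-in n))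
      ; height-in = λ α t p h → ∈-respˡ (≐-sym (height-unique p h)) (node-ω₂ (Tr-out p))
      ; levels = λ α p → AtLevel.level α p ,
          (λ t q → let n = proj₂ (sep-out (AtLevel.rNode α p) q) in Tr-in n , height-resp (node-⋃ n) (height-⋃ (Tr-in n))) ,
          (λ t q h → let n = Node-resp (≐-sym (height-unique q h)) ≐-refl (Tr-out q) in
            sep-in (AtLevel.rNode α p) (node-Pow n) n) ,
          AtLevel.level≼ω₁ α p
      }
      where
      height-resp : ∀ {t α β} → α ≐ β → HasHeight Tr ◁ t α → HasHeight Tr ◁ t β
      height-resp e (o , f , ((F , into , inj) , onto) , ord) = IsOrdinal-resp e o , f ,
        ((F , (λ x p → ∈-respʳ e (into x p)) , inj) , λ y p → onto y (∈-respʳ (≐-sym e) p)) , ord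

    -- A cofinal branch is a coherent choice of nodes at all levels.
    coherent : ∃[ B ] (∀ γ → γ ∈ ω₂ → ∃[ 𝒜 ] Node γ 𝒜 × (∀ a → a ⊆ γ → (a ∈ B → a ∈ 𝒜) × (a ∈ 𝒜 → a ∈ B)))
    coherent = by (branch axioms)
      where
      by : (∃[ b ] b ⊆ Tr × (∀ s t → s ∈ b → t ∈ b → ⟨ s , t ⟩ ∈ ◁ ⊎ s ≐ t ⊎ ⟨ t , s ⟩ ∈ ◁)
        × (∀ α → α ∈ ω₂ → ∃[ t ] t ∈ b × HasHeight Tr ◁ t α)) →
        ∃[ B ] (∀ γ → γ ∈ ω₂ → ∃[ 𝒜 ] Node γ 𝒜 × (∀ a → a ⊆ γ → (a ∈ B → a ∈ 𝒜) × (a ∈ 𝒜 → a ∈ B)))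
      by (b , b⊆ , lin , cof) = ⋃ b , at
        where
        at : ∀ γ → γ ∈ ω₂ → ∃[ 𝒜 ] Node γ 𝒜 × (∀ a → a ⊆ γ → (a ∈ ⋃ b → a ∈ 𝒜) × (a ∈ 𝒜 → a ∈ ⋃ b))
        at γ p = go (cof γ p)
          where
          go : (∃[ t ] t ∈ b × HasHeight Tr ◁ t γ) → ∃[ 𝒜 ] Node γ 𝒜 × (∀ a → a ⊆ γ → (a ∈ ⋃ b → a ∈ 𝒜) × (a ∈ 𝒜 → a ∈ ⋃ b))
          go (t , t∈ , h) = t , Node-resp (≐-sym e) ≐-refl (Tr-out (b⊆ t t∈)) , λ a a⊆ →
              (λ q → let (s , s∈ , a∈s) = ⋃-out q in case a a⊆ s a∈s (lin s t s∈ t∈)) , λ q → ⋃-in q t∈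
            where
            e : γ ≐ ⋃ t
            e = height-unique (b⊆ t t∈) h
            case : ∀ a → a ⊆ γ → ∀ s → a ∈ s → ⟨ s , t ⟩ ∈ ◁ ⊎ s ≐ t ⊎ ⟨ t , s ⟩ ∈ ◁ → a ∈ t
            case a a⊆ s q (inj₁ u) = proj₁ (∩-out (∈-respʳ (proj₂ (◁-out u)) q))
            case a a⊆ s q (inj₂ (inj₁ u)) = ∈-respʳ u q
            case a a⊆ s q (inj₂ (inj₂ u)) = ∈-respʳ (≐-sym (proj₂ (◁-out u))) (∩-in q (Pow-in λ z v → ∈-respʳ e (a⊆ z v)))

-- The game producing 2^ω sets with one trace on ω₁ and distinct traces on ω₂.

module Game (em : ExcludedMiddle 1ℓ) (choice : Choice) (ω₁ ω₂ : V)
  (s₁ : IsSuccessorCardinal ω ω₁) (s₂ : IsSuccessorCardinal ω₁ ω₂) (srp : SRP ω₁ ω₂) where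
  open import Data.List.Base using (List; []; _∷_; map)
  open import Data.List.Relation.Binary.Pointwise.Base using (Pointwise; []; _∷_)
  open import Data.List.Relation.Unary.All using ([]; _∷_)

  open Sets em
  open Cardinals em choice ω₁ ω₂ s₁ s₂
  open Collapse em choice ω₁ ω₂ s₁ s₂ using (coll; coll-ext; coll-in; coll-out; coll-strict; ord-coll)
  open Clubs em choice ω₁ ω₂ s₁ s₂
  open Closed
  open Reflection em choice ω₁ ω₂ s₁ s₂ srp

  -- Re-indexing along the injection turns `a` into values of a function on ω₁, with ∅ at the
  -- indices outside its range, so that the regularity of ω₂ applies.
  small-bnd : Pairing → ∀ {a} → a ⊆ ω₂ → a ≼ ω₁ → bnd a ∈ ω₂
  small-bnd pr {a} h i = by (≼⇒Inj i)
    where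
    by : Inj a ω₁ → bnd a ∈ ω₂
    by (φ , φ-ext , φ∈ , φ-inj) = ord-⊆∈ (ord-bnd λ x p → ord-elt ord-ω₂ (h x p)) ord-ω₂
        (λ z p → let (x , q , r) = bnd-out p in
          ⋃-in (∈-respʳ (succ-ext (≐-sym (g-≐ q))) r) (Im-in succ-ext (Im-in g-ext (φ∈ x q) ≐-refl) ≐-refl))
        (bnd∈ω₂ pr g-ext λ j _ → g∈ j)
      where
      D : V → V → Set₁
      D j β = Lift 1ℓ (β ∈ a × φ β ≐ j)
      rD : ∀ {j} → Resp (D j)
      rD e (lift (p , q)) = lift (∈-respˡ e p , ≐-trans (φ-ext (≐-sym e)) q)
      g : V → V
      g j = the ω₂ (D j)
      g-ext : Ext g
      g-ext e = the-ext rD rD ≐-refl (λ _ _ (lift (p , q)) → lift (p , ≐-trans q e))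
        (λ _ _ (lift (p , q)) → lift (p , ≐-trans q (≐-sym e)))
      g-≐′ : ∀ {x j} → x ∈ a → φ x ≐ j → g j ≐ x
      g-≐′ p q = the-≐ rD (h _ p) (lift (p , q)) λ z _ (lift (p′ , q′)) → φ-inj z _ p′ p (≐-trans q′ (≐-sym q))
      g-≐ : ∀ {x} → x ∈ a → g (φ x) ≐ x
      g-≐ p = g-≐′ p ≐-refl
      g∈ : ∀ j → g j ∈ ω₂
      g∈ j = cases (lem (∃[ x ] D j x))
        where
        cases : (∃[ x ] D j x) ⊎ ¬ (∃[ x ] D j x) → g j ∈ ω₂
        cases (inj₁ (x , lift (p , q))) = ∈-respˡ (≐-sym (g-≐′ p q)) (h x p)
        cases (inj₂ n) = ∈-respˡ (≐-sym (the-∅ rD λ z q → n (z , q))) (ω₁⊆ω₂ ∅ ∅∈ω₁)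

  set : List V → V
  set [] = ∅
  set (x ∷ l) = ｛ x , x ｝ ∪ set l

  set-in : ∀ {l Y} → l ⊆* Y → set l ⊆ Y
  set-in [] z p = ⊥-elim (∅-out p)
  set-in (q ∷ qs) z p = [ (λ r → ∈-respˡ (≐-sym (single-out r)) q) , set-in qs z ]′ (∪-out p)

  set-ext : ∀ {l l′} → Pointwise _≐_ l l′ → set l ≐ set l′
  set-ext [] = ≐-refl
  set-ext (e ∷ es) = ∪-ext (pair-cong e e) (set-ext es)

  set-cov : ∀ l → Cov (_∈ set l)
  set-cov [] = cov-∅ λ _ → ∅-out
  set-cov (x ∷ l) = cov-∪ cov-single (set-cov l)

  opaque
    Eᵒ : Ops Hω₂
    Eᵒ = binary val
      (λ {x} {x′} {y} {y′} e f → sep-ext rP rP ≐-refl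
        (λ _ _ (lift (p , q , r)) → lift (∈-respˡ e p , ∈-respˡ f (∈-respʳ e q) , ≐-trans r (‵-ext (E-ext e) f)))
        (λ _ _ (lift (p , q , r)) → lift (∈-respˡ (≐-sym e) p , ∈-respˡ (≐-sym f) (∈-respʳ (≐-sym e) q) ,
          ≐-trans r (‵-ext (E-ext (≐-sym e)) (≐-sym f)))))
      (λ β ξ _ _ z p → ω₁⊆Hω₂ z (sep-⊆ rP z p))
      (λ β ξ _ _ → cov-one (E β ‵ ξ) λ z p → proj₂ (proj₂ (lower (proj₂ (sep-out rP p)))))
      where
      IsVal : V → V → V → Set₁
      IsVal β ξ z = Lift 1ℓ (β ∈ ω₂ × ξ ∈ β × z ≐ E β ‵ ξ)
      rP : ∀ {β ξ} → Resp (IsVal β ξ)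
      rP e (lift (p , q , r)) = lift (p , q , ≐-trans (≐-sym e) r)
      val : V → V → V
      val β ξ = ⟪ ω₁ ∣ IsVal β ξ ⟫

    E-closed : ∀ {Y β ξ} → Closed Eᵒ Y → β ∈ ω₂ → ξ ∈ β → β ∈ Y → ξ ∈ Y → E β ‵ ξ ∈ Y
    E-closed {Y} {β} {ξ} c p q r s = values c (β ∷ ξ ∷ []) (r ∷ s ∷ []) (E β ‵ ξ)
      (sep-in (λ { e (lift (p , q , r)) → lift (p , q , ≐-trans (≐-sym e) r) }) (E∈ p q) (lift (p , q , ≐-refl)))

  -- In the game at ν one player plays ordinals α, the other answers with β > α, and the
  -- second player loses when the hull of ν and the β's contains new countable ordinals.
  module Play (pairing : Pairing) (G : Ops Hω₂) where
    open Hull G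

    record Bad (ν : V) (t : List V) : Set₁ where
      constructor bad
      field
        new : ∃[ x ] x ∈ hull (ν ∪ set t) × x ∈ ω₁ × ¬ x ∈ ν

    Bad-resp : ∀ {ν ν′ t t′} → ν ≐ ν′ → Pointwise _≐_ t t′ → Bad ν t → Bad ν′ t′
    Bad-resp e f (bad (x , p , q , n)) =
      bad (x , ∈-respʳ (hull-ext (∪-ext e (set-ext f))) p , q , λ r → n (∈-respʳ (≐-sym e) r))

    Bad-more : ∀ {ν β t} → Bad ν t → Bad ν (β ∷ t)
    Bad-more (bad (x , p , q , n)) =
      bad (x , hull-mono (λ z r → [ ∪-inˡ , (λ s → ∪-inʳ (∪-inʳ s)) ]′ (∪-out r)) x p , q , n)

    -- The second player loses at position t, by rank x.
    L : V → V → List V → Set₁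
    L (sup A f) ν t = Bad ν t ⊎ (∃[ α ] α ∈ ω₂ × (∀ β → β ∈ ω₂ → α ∈ β → Σ A λ i → L (f i) ν (β ∷ t)))

    L-bad : ∀ x {ν t} → Bad ν t → L x ν t
    L-bad (sup A f) = inj₁

    opaque
      unfolding _∈_

      L-resp : ∀ x x′ {ν ν′ t t′} → x ≐ x′ → ν ≐ ν′ → Pointwise _≐_ t t′ → L x ν t → L x′ ν′ t′
      L-resp (sup A f) (sup B g) e e′ es (inj₁ b) = inj₁ (Bad-resp e′ es b)
      L-resp (sup A f) (sup B g) {ν} {ν′} {t} {t′} (h , _) e′ es (inj₂ (α , p , k)) = inj₂ (α , p , λ β q r →
        let (i , l) = k β q r ; (j , e) = h i in
        j , L-resp (f i) (g j) {ν} {ν′} {β ∷ t} {β ∷ t′} e e′ (≐-refl {β} ∷ es) l)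

      L-out : ∀ x {ν t} → L x ν t → Bad ν t ⊎ (∃[ α ] α ∈ ω₂ × (∀ β → β ∈ ω₂ → α ∈ β → ∃[ x′ ] x′ ∈ x × L x′ ν (β ∷ t)))
      L-out (sup A f) (inj₁ b) = inj₁ b
      L-out (sup A f) (inj₂ (α , p , k)) = inj₂ (α , p , λ β q r → let (i , l) = k β q r in f i , (i , ≐-refl {f i}) , l)

    Lose : V → List V → Set₁
    Lose ν t = ∃[ x ] L x ν t

    -- Ranks are arbitrary sets: that of a position need only contain ranks of the lost positions
    -- one move later, and one set indexed by ω₂ gathers these.
    lose-in : ∀ {ν t α} → α ∈ ω₂ → (∀ β → β ∈ ω₂ → α ∈ β → Lose ν (β ∷ t)) → Lose ν t
    lose-in {ν} {t} {α} p h = sup (Index ω₂) rank , inj₂ (α , p , λ β q r → by β q r (mem q))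
      where
      pick : ∀ {A : V → Set₁} → (∃[ x ] A x) ⊎ ¬ (∃[ x ] A x) → V
      pick (inj₁ (x , _)) = x
      pick (inj₂ _) = ∅
      pick-spec : ∀ {A : V → Set₁} (d : (∃[ x ] A x) ⊎ ¬ (∃[ x ] A x)) → (∃[ x ] A x) → A (pick d)
      pick-spec (inj₁ (_ , a)) _ = a
      pick-spec (inj₂ n) e = ⊥-elim (n e)
      rank : Index ω₂ → V
      rank i = pick {λ x → L x ν (elt ω₂ i ∷ t)} (lem _)
      by : ∀ β → β ∈ ω₂ → α ∈ β → Σ (Index ω₂) (λ i → β ≐ elt ω₂ i) → Σ (Index ω₂) λ i → L (rank i) ν (β ∷ t)
      by β q r (i , e) = i , L-resp (rank i) (rank i) ≐-refl ≐-refl (≐-sym e ∷ Pointwise-refl t)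
        (pick-spec {λ x → L x ν (elt ω₂ i ∷ t)} (lem _) (let (x , l) = h β q r in x , L-resp x x ≐-refl ≐-refl (e ∷ Pointwise-refl t) l))

    Win : V → List V → Set₁
    Win ν t = t ⊆* ω₂ × ¬ Lose ν t

    win-good : ∀ {ν t} → Win ν t → hull (ν ∪ set t) ∩ ω₁ ⊆ ν
    win-good (_ , n) x p = dne₀ λ q → n (∅ , L-bad ∅ (bad (x , proj₁ (∩-out p) , proj₂ (∩-out p) , q)))

    -- Determinacy of the open game: if every answer above α lost, then α would be a winning move of
    -- the first player.
    win-more : ∀ {ν t} → Win ν t → ∀ α → α ∈ ω₂ → ∃[ β ] β ∈ ω₂ × α ∈ β × Win ν (β ∷ t)
    win-more (h , n) α p = dne λ m → n (lose-in p λ β q r → dne λ l → m (β , q , r , q ∷ h , l))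

    -- If the first player could win at all ν ∈ T, then answering to all his strategies at once
    -- gives a sequence which is not lost at the ν closed under it.
    module _ {T : V} (sT : Stat T) where

      -- One play against the strategies for all ν in `T` at once, with a rank of defeat for each ν.
      record State : Set₁ where
        no-eta-equality
        field
          t : List V
          t⊆ : t ⊆* ω₂
          x : V → V
          x-ext : Ext x
          lost : ∀ ν → ν ∈ T → L (x ν) ν t
      open State

      Next : State → State → Set₁
      Next s s′ = ∀ ν → ν ∈ T → Bad ν (t s) ⊎ x s′ ν ∈ x s ν

      -- The moves of at most ω₁ strategies are exceeded by one ordinal, as ω₂ is regular. At every
      -- ν where the position is not yet bad the rank drops to one of its members.
      next : ∀ s → Σ State (Next s)
      next s = by (choose T D rD exists)
        where
        D : V → V → Set₁
        D ν α = Lift 1ℓ (α ∈ ω₂) × (Bad ν (t s) ⊎ (∀ β → β ∈ ω₂ → α ∈ β → ∃[ x′ ] x′ ∈ x s ν × L x′ ν (β ∷ t s)))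
        rD : ∀ {ν ν′ α α′} → ν ≐ ν′ → α ≐ α′ → D ν α → D ν′ α′
        rD e f (lift p , inj₁ b) = lift (∈-respˡ f p) , inj₁ (Bad-resp e (Pointwise-refl _) b)
        rD e f (lift p , inj₂ k) = lift (∈-respˡ f p) , inj₂ λ β q r →
          let (x′ , a , l) = k β q (∈-respˡ (≐-sym f) r) in
          x′ , ∈-respʳ (x-ext s e) a , L-resp x′ x′ ≐-refl e (Pointwise-refl _) l
        exists : ∀ ν → ν ∈ T → ∃[ α ] D ν α
        exists ν p = [ (λ b → ∅ , lift (ω₁⊆ω₂ ∅ ∅∈ω₁) , inj₁ b) , (λ (α , q , k) → α , lift q , inj₂ k) ]′
          (L-out (x s ν) (lost s ν p))
        by : (Σ (V → V) λ α → Ext α × (∀ ν → ν ∈ T → D ν (α ν))) → Σ State (Next s)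
        by (α , α-ext , α-D) = finish (choose T D′ rD′ exists′)
          where
          α′ : V → V
          α′ ν = cond (Lift 1ℓ (ν ∈ T)) (α ν) ∅
          α′-ext : Ext α′
          α′-ext e = cond-ext (λ (lift p) → lift (∈-respˡ e p)) (λ (lift p) → lift (∈-respˡ (≐-sym e) p)) (α-ext e) ≐-refl
          α′∈ : ∀ ν → ν ∈ ω₁ → α′ ν ∈ ω₂
          α′∈ ν _ = [ (λ p → ∈-respˡ (≐-sym (cond-yes (lift p))) (lower (proj₁ (α-D ν p)))) ,
            (λ n → ∈-respˡ (≐-sym (cond-no λ (lift p) → n p)) (ω₁⊆ω₂ ∅ ∅∈ω₁)) ]′ (lem₀ (ν ∈ T))
          β : V
          β = bnd (Im α′ ω₁)
          β∈ω₂ : β ∈ ω₂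
          β∈ω₂ = bnd∈ω₂ pairing α′-ext α′∈
          α∈β : ∀ ν → ν ∈ T → α ν ∈ β
          α∈β ν p = bnd-in (Im-in α′-ext (proj₁ sT ν p) (≐-sym (cond-yes (lift p))))
          D′ : V → V → Set₁
          D′ ν y = L y ν (β ∷ t s) × (Bad ν (t s) ⊎ y ∈ x s ν)
          rD′ : ∀ {ν ν′ y y′} → ν ≐ ν′ → y ≐ y′ → D′ ν y → D′ ν′ y′
          rD′ {y = y} {y′} e f (l , c) = L-resp y y′ f e (Pointwise-refl _) l ,
            [ (λ b → inj₁ (Bad-resp e (Pointwise-refl _) b)) , (λ q → inj₂ (∈-respˡ f (∈-respʳ (x-ext s e) q))) ]′ c
          exists′ : ∀ ν → ν ∈ T → ∃[ y ] D′ ν y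
          exists′ ν p = cases (proj₂ (α-D ν p))
            where
            cases : Bad ν (t s) ⊎ (∀ β → β ∈ ω₂ → α ν ∈ β → ∃[ x′ ] x′ ∈ x s ν × L x′ ν (β ∷ t s)) → ∃[ y ] D′ ν y
            -- A filler: a bad position is lost with any rank, and it stays bad.
            cases (inj₁ b) = ∅ , L-bad ∅ (Bad-more b) , inj₁ b
            cases (inj₂ k) = let (y , q , l) = k β β∈ω₂ (α∈β ν p) in y , l , inj₂ q
          finish : (Σ (V → V) λ y → Ext y × (∀ ν → ν ∈ T → D′ ν (y ν))) → Σ State (Next s)
          finish (y , y-ext , y-D) = record { t = β ∷ t s ; t⊆ = β∈ω₂ ∷ t⊆ s ; x = y ; x-ext = y-ext
            ; lost = λ ν p → proj₁ (y-D ν p) } , λ ν p → proj₂ (y-D ν p)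

      winning : ∃[ ν ] ν ∈ T × Win ν []
      winning = dne λ none → absurd (choose T (λ ν x → L x ν []) (λ {ν} {ν′} {x} {x′} e f l → L-resp x x′ f e [] l)
          λ ν p → dne λ n → none (ν , p , [] , n))
        where
        absurd : ¬ (Σ (V → V) λ x → Ext x × (∀ ν → ν ∈ T → L (x ν) ν []))
        absurd (x₀ , x₀-ext , x₀-L) = finish (trace-point ω₁⊆Hω₂ A⊆ (cov-mono (λ z → ⋃ₙ-out) (cov-⋃ λ n → set-cov (t (s n)))) sT G)
          where
          s : ℕ → State
          s zero = record { t = [] ; t⊆ = [] ; x = x₀ ; x-ext = x₀-ext ; lost = x₀-L }
          s (suc n) = proj₁ (next (s n))
          A : V
          A = ⋃ₙ λ n → set (t (s n))
          A⊆ : A ⊆ Hω₂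
          A⊆ z p = let (n , q) = ⋃ₙ-out p in ω₂⊆Hω₂ z (set-in (t⊆ (s n)) z q)
          finish : ¬ (∃[ ν ] ν ∈ T × IsLimit ν × hull (ν ∪ A) ∩ ω₁ ⊆ ν)
          -- At this ν no position of the sequence is bad, so the ranks would descend infinitely,
          -- against foundation.
          finish (ν , ν∈ , _ , h) = let (m , (n , lift e) , least) = minimal (λ y → Σ ℕ λ n → Lift 1ℓ (y ≐ x (s n) ν))
                                          (x (s 0) ν) (0 , lift ≐-refl) in
            least (x (s (suc n)) ν) (∈-respʳ (≐-sym e) (down n)) (suc n , lift ≐-refl)
            where
            good : ∀ n → ¬ Bad ν (t (s n))
            good n (bad (z , p , q , k)) = k (h z (∩-in (hull-mono (λ w r → [ ∪-inˡ , (λ u → ∪-inʳ (⋃ₙ-in n u)) ]′ (∪-out r)) z p) q))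
            down : ∀ n → x (s (suc n)) ν ∈ x (s n) ν
            down n = [ (λ b → ⊥-elim (good n b)) , id ]′ (proj₂ (next (s n)) ν ν∈)

    -- `apart` is the source of distinctness: a set with trace ν that is closed under the injections
    -- `E β` cannot contain both `β₀` and `β₁`.
    record Split (ν : V) (t : List V) : Set₁ where
      no-eta-equality
      field
        β₀ β₁ : V
        β₀∈β₁ : β₀ ∈ β₁
        win₀ : Win ν (β₀ ∷ t)
        win₁ : Win ν (β₁ ∷ t)
        apart : ¬ E β₁ ‵ β₀ ∈ ν

    -- Otherwise the set of winning answers would have countable initial segments, hence be bounded in ω₂.
    split : ∀ {ν t} → ν ∈ ω₁ → Win ν t → Split ν t
    split {ν} {t} ν∈ω₁ w = dne λ none → absurd λ β₀ β₁ p (q , win₀) (_ , win₁) → dne₀ λ n →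
        none (record { β₀ = β₀ ; β₁ = β₁ ; β₀∈β₁ = p ; win₀ = win₀ ; win₁ = win₁ ; apart = n })
      where
      W : V → Set₁
      W β = Win ν (β ∷ t)
      rW : Resp W
      rW e (h , n) = ⊆*-resp es h , λ (x , l) → n (x , L-resp x x ≐-refl ≐-refl (Pointwise-sym es) l)
        where
        es : Pointwise _≐_ _ _
        es = e ∷ Pointwise-refl t
      B : V
      B = ⟪ ω₂ ∣ W ⟫
      absurd : ¬ (∀ β₀ β₁ → β₀ ∈ β₁ → β₀ ∈ ω₂ × W β₀ → β₁ ∈ ω₂ × W β₁ → E β₁ ‵ β₀ ∈ ν)
      absurd h = let (β , p , q , w′) = win-more w (bnd B) (small-bnd pairing (sep-⊆ rW) B≼ω₁) in
          ∈-asym q (bnd-in (sep-in rW p w′))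
        where
        ord : ∀ {β} → β ∈ B → IsOrdinal β
        ord p = ord-elt ord-ω₂ (sep-⊆ rW _ p)
        segment : ∀ {β} → β ∈ B → Countable (B ∩ β)
        segment {β} p = ≼-trans (Inj⇒≼ ((λ ξ → E β ‵ ξ) , ‵-ext ≐-refl ,
            (λ ξ q → let (a , b) = ∩-out q in h ξ β b (sep-out rW a) (sep-out rW p)) ,
            λ ξ η q r e → E-inj (sep-⊆ rW _ p) (proj₂ (∩-out q)) (proj₂ (∩-out r)) e)) (ω₁-countable ν∈ω₁)
        B≼ω₁ : B ≼ ω₁
        B≼ω₁ = Inj⇒≼ (coll B , coll-ext , (λ β p → ∈ω₁ (ord-coll (ord p))
          (cov-image coll-ext (λ z q → let (ξ , r , s , e) = coll-out q in ξ , ∩-in s r , e) (countable⇒cov (segment p)))) ,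
          λ β β′ p q e → coll-strict (ord p) (ord q) p q e)

    -- `X` is indexed by the branches of a binary tree of plays. Distinctness of the traces is
    -- conditional on closure under `Eᵒ`, which is available once `G` is taken to include it.
    record Perfect (T : V) : Set₁ where
      no-eta-equality
      field
        ν γ : V
        ν∈T : ν ∈ T
        γ∈ω₂ : γ ∈ ω₂
        X : (ℕ → Bool) → V
        X-⊆ : ∀ r → X r ⊆ Hω₂
        X-cov : ∀ r → Cov (_∈ X r)
        X-closed : ∀ r → Closed G (X r)
        X-trace : ∀ r → X r ∩ ω₁ ≐ ν
        X-bound : ∀ r → X r ∩ ω₂ ⊆ γ
        X-inj : (∀ r → Closed Eᵒ (X r)) → ∀ r s → X r ∩ ω₂ ≐ X s ∩ ω₂ → ∀ n → r n ≡ s n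

    record Pos (ν : V) : Set₁ where
      no-eta-equality
      field
        list : List V
        win : Win ν list
    open Pos

    pick : Bool → V → V → V
    pick false x y = x
    pick true x y = y

    -- Positions are attached to finite binary sequences, latest bit first; each bit chooses between
    -- the two answers of a split.
    module Plays (ν : V) (ν∈ω₁ : ν ∈ ω₁) (pos : List Bool → List V) (wins : ∀ l → Win ν (pos l))
      (β₀ β₁ : List Bool → V) (pos-∷ : ∀ b l → pos (b ∷ l) ≡ pick b (β₀ l) (β₁ l) ∷ pos l)
      (β₀∈β₁ : ∀ l → β₀ l ∈ β₁ l) (apart : ∀ l → ¬ E (β₁ l) ‵ β₀ l ∈ ν) where

      pos⊆ : ∀ l → ν ∪ set (pos l) ⊆ Hω₂
      pos⊆ l z p = [ (λ q → ω₁⊆Hω₂ z (ord-trans ord-ω₁ q ν∈ω₁)) , (λ q → ω₂⊆Hω₂ z (set-in (proj₁ (wins l)) z q)) ]′ (∪-out p)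

      opaque
        prefix : (ℕ → Bool) → ℕ → List Bool
        prefix r zero = []
        prefix r (suc n) = r n ∷ prefix r n

        prefix-0 : ∀ r s → prefix r 0 ≡ prefix s 0
        prefix-0 r s = refl

        prefix-suc : ∀ r n → prefix r (suc n) ≡ r n ∷ prefix r n
        prefix-suc r n = refl

        phase : (ℕ → Bool) → ℕ → V
        phase r n = hull (ν ∪ set (pos (prefix r n)))

        X : (ℕ → Bool) → V
        X r = ⋃ₙ (phase r)

        X-out : ∀ {r z} → z ∈ X r → Σ ℕ λ n → z ∈ hull (ν ∪ set (pos (prefix r n)))
        X-out p = ⋃ₙ-out p

        X-in : ∀ {r z} n → z ∈ hull (ν ∪ set (pos (prefix r n))) → z ∈ X r
        X-in n p = ⋃ₙ-in n p

        pos-more : ∀ b l → set (pos l) ⊆ set (pos (b ∷ l))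
        pos-more b l z p = subst (λ t → z ∈ set t) (sym (pos-∷ b l)) (∪-inʳ p)

        inc : ∀ r n → phase r n ⊆ phase r (suc n)
        inc r n = hull-mono λ z p → [ ∪-inˡ , (λ q → ∪-inʳ (pos-more (r n) (prefix r n) z q)) ]′ (∪-out p)

        X-closed : ∀ r → Closed G (X r)
        X-closed r = closed-union G (phase r) (λ n → hull-closed) (λ n z → ⋃ₙ-in n)
          (chain-bound (phase r) (inc r) (λ z → ⋃ₙ-out))

      answer∈ : ∀ r n → pick (r n) (β₀ (prefix r n)) (β₁ (prefix r n)) ∈ X r
      answer∈ r n = X-in (suc n) (hull-self _ (∪-inʳ (subst (λ l → x ∈ set (pos l)) (sym (prefix-suc r n))
          (subst (λ t → x ∈ set t) (sym (pos-∷ (r n) (prefix r n))) (∪-inˡ (pair-inˡ ≐-refl))))))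
        where
        x : V
        x = pick (r n) (β₀ (prefix r n)) (β₁ (prefix r n))

      X-trace : ∀ r → X r ∩ ω₁ ≐ ν
      X-trace r = ⊆-antisym
        (λ z p → let (a , b) = ∩-out p ; (n , q) = X-out a in win-good (wins (prefix r n)) z (∩-in q b))
        (λ z p → ∩-in (X-in 0 (hull-self z (∪-inˡ p))) (ord-trans ord-ω₁ p ν∈ω₁))

      X-⊆ : ∀ r → X r ⊆ Hω₂
      X-⊆ r z p = let (n , q) = X-out p in hull-⊆ (pos⊆ (prefix r n)) z q

      X-cov : ∀ r → Cov (_∈ X r)
      X-cov r = cov-mono (λ z → X-out) (cov-⋃ λ n →
        hull-cov (pos⊆ (prefix r n)) (cov-∪ (ω₁-cov ν∈ω₁) (set-cov (pos (prefix r n)))))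

      opaque
        toBool : ℕ → Bool
        toBool zero = false
        toBool (suc _) = true

        decode : ℕ → List Bool
        decode n = map toBool (unlist n)

        decode-surj : ∀ l → Σ ℕ λ n → decode n ≡ l
        decode-surj l = let (n , e) = unlist-surj (map code l) in n , trans (cong (map toBool) e) (inverse l)
          where
          code : Bool → ℕ
          code false = 0
          code true = 1
          inverse : ∀ l → map toBool (map code l) ≡ l
          inverse [] = refl
          inverse (false ∷ l) = cong (false ∷_) (inverse l)
          inverse (true ∷ l) = cong (true ∷_) (inverse l)

      -- All answers in the whole binary tree together: still a countable set, so a single γ bounds
      -- the traces of all `X r`.
      A : V
      A = ⋃ₙ λ n → set (pos (decode n))

      A⊆ : ν ∪ A ⊆ Hω₂
      A⊆ z p = [ (λ q → ω₁⊆Hω₂ z (ord-trans ord-ω₁ q ν∈ω₁)) ,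
        (λ q → let (n , s) = ⋃ₙ-out q in pos⊆ (decode n) z (∪-inʳ s)) ]′ (∪-out p)

      γ : V
      γ = bnd (hull (ν ∪ A) ∩ ω₂)

      γ∈ω₂ : γ ∈ ω₂
      γ∈ω₂ = small-bnd pairing (λ z p → proj₂ (∩-out p)) (≼-trans (cov⇒countable (cov-mono (λ z p → proj₁ (∩-out p))
        (hull-cov A⊆ (cov-∪ (ω₁-cov ν∈ω₁) (cov-mono (λ z → ⋃ₙ-out) (cov-⋃ λ n → set-cov (pos (decode n)))))))) (⊆⇒≼ ω⊆ω₁))

      X-bound : ∀ r → X r ∩ ω₂ ⊆ γ
      X-bound r z p = let (a , b) = ∩-out p ; (n , q) = X-out a ; (m , e) = decode-surj (prefix r n) in
        bnd-in (∩-in (hull-mono (λ w s → [ ∪-inˡ , (λ u → ∪-inʳ (⋃ₙ-in m (subst (λ l → w ∈ set (pos l)) (sym e) u))) ]′ (∪-out s)) z q) b)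

      β∈ω₂ : ∀ b l → pick b (β₀ l) (β₁ l) ∈ ω₂
      β∈ω₂ b l = head∈ (subst (_⊆* ω₂) (pos-∷ b l) (proj₁ (wins (b ∷ l))))
        where
        head∈ : ∀ {x t} → (x ∷ t) ⊆* ω₂ → x ∈ ω₂
        head∈ (p ∷ _) = p

      module _ (c : ∀ r → Closed Eᵒ (X r)) where

        -- Where two branches part, one set contains `β₀` and the other `β₁`. With equal traces on
        -- ω₂ the latter contains both, and closure under `E` puts a countable ordinal outside ν
        -- into its trace.
        clash : ∀ r s → X r ∩ ω₂ ≐ X s ∩ ω₂ → ∀ n → prefix r n ≡ prefix s n → r n ≡ false → ¬ s n ≡ true
        clash r s e n same f g = apart l (∈-respʳ (X-trace s) (∩-in
            (E-closed (c s) (β∈ω₂ true l) (β₀∈β₁ l) β₁∈Xs β₀∈Xs) (E∈ (β∈ω₂ true l) (β₀∈β₁ l))))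
          where
          l : List Bool
          l = prefix s n
          β₁∈Xs : β₁ l ∈ X s
          β₁∈Xs = subst (λ b → pick b (β₀ l) (β₁ l) ∈ X s) g (answer∈ s n)
          β₀∈Xr : β₀ l ∈ X r
          β₀∈Xr = subst (λ k → β₀ k ∈ X r) same
            (subst (λ b → pick b (β₀ (prefix r n)) (β₁ (prefix r n)) ∈ X r) f (answer∈ r n))
          β₀∈Xs : β₀ l ∈ X s
          β₀∈Xs = proj₁ (∩-out (∈-respʳ e (∩-in β₀∈Xr (β∈ω₂ false l))))

        bit : ∀ r s → X r ∩ ω₂ ≐ X s ∩ ω₂ → ∀ n → prefix r n ≡ prefix s n → ∀ a b → r n ≡ a → s n ≡ b → r n ≡ s n
        bit r s e n q false false u v = trans u (sym v)
        bit r s e n q true true u v = trans u (sym v)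
        bit r s e n q false true u v = ⊥-elim (clash r s e n q u v)
        bit r s e n q true false u v = ⊥-elim (clash s r (≐-sym e) n (sym q) v u)

        same : ∀ r s → X r ∩ ω₂ ≐ X s ∩ ω₂ → ∀ n → prefix r n ≡ prefix s n
        same r s e zero = prefix-0 r s
        same r s e (suc n) = trans (prefix-suc r n) (trans
          (cong₂ _∷_ (bit r s e n (same r s e n) (r n) (s n) refl refl) (same r s e n)) (sym (prefix-suc s n)))

        X-inj : ∀ r s → X r ∩ ω₂ ≐ X s ∩ ω₂ → ∀ n → r n ≡ s n
        X-inj r s e n = bit r s e n (same r s e n) (r n) (s n) refl refl

    perfect : ∀ {T} → Stat T → Perfect T
    perfect {T} sT = by (winning sT)
      where
      by : (∃[ ν ] ν ∈ T × Win ν []) → Perfect T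
      by (ν , ν∈T , w₀) = record { ν = ν ; γ = X.γ ; ν∈T = ν∈T ; γ∈ω₂ = X.γ∈ω₂ ; X = X.X ; X-⊆ = X.X-⊆ ; X-cov = X.X-cov
          ; X-closed = X.X-closed ; X-trace = X.X-trace ; X-bound = X.X-bound ; X-inj = X.X-inj }
        where
        ν∈ω₁ : ν ∈ ω₁
        ν∈ω₁ = proj₁ sT ν ν∈T
        sp : (p : Pos ν) → Split ν (list p)
        sp p = split ν∈ω₁ (win p)
        child : Bool → Pos ν → Pos ν
        child false p = record { list = Split.β₀ (sp p) ∷ list p ; win = Split.win₀ (sp p) }
        child true p = record { list = Split.β₁ (sp p) ∷ list p ; win = Split.win₁ (sp p) }
        node : List Bool → Pos ν
        node [] = record { list = [] ; win = w₀ }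
        node (b ∷ l) = child b (node l)
        node-∷ : ∀ b l → list (node (b ∷ l)) ≡ pick b (Split.β₀ (sp (node l))) (Split.β₁ (sp (node l))) ∷ list (node l)
        node-∷ false l = refl
        node-∷ true l = refl
        module X = Plays ν ν∈ω₁ (λ l → list (node l)) (λ l → win (node l)) (λ l → Split.β₀ (sp (node l)))
          (λ l → Split.β₁ (sp (node l))) node-∷ (λ l → Split.β₀∈β₁ (sp (node l))) (λ l → Split.apart (sp (node l)))

-- The chain that avoids the branch, and the contradiction.

module Conclusion (em : ExcludedMiddle 1ℓ) (choice : Choice) (ω₁ ω₂ : V)
  (s₁ : IsSuccessorCardinal ω ω₁) (s₂ : IsSuccessorCardinal ω₁ ω₂) (srp : SRP ω₁ ω₂) (tp : TreeProperty ω₂) where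
  open import Data.List.Base using ([]; _∷_)
  open import Data.List.Relation.Unary.All using ([]; _∷_)

  open Sets em
  open Cardinals em choice ω₁ ω₂ s₁ s₂
  open Collapse em choice ω₁ ω₂ s₁ s₂
  open Clubs em choice ω₁ ω₂ s₁ s₂
  open Closed
  open Reflection em choice ω₁ ω₂ s₁ s₂ srp
  open Nodes em choice ω₁ ω₂ s₁ s₂
  open Tree em choice ω₁ ω₂ s₁ s₂ srp tp
  open Game em choice ω₁ ω₂ s₁ s₂ srp

  opaque
    IsInv : V → V → V → Set₁
    IsInv β i ξ = Lift 1ℓ (β ∈ ω₂ × ξ ∈ β × E β ‵ ξ ≐ i)

    rInv : ∀ {β i} → Resp (IsInv β i)
    rInv e (lift (p , q , r)) = lift (p , ∈-respˡ e q , ≐-trans (‵-ext ≐-refl (≐-sym e)) r)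

    -- Closure under these operations makes the trace on ω₂ of the union of the chain an ordinal:
    -- from β and the countable ordinals all members of β are recovered.
    E⁻¹ᵒ : Ops Hω₂
    E⁻¹ᵒ = binary (λ β i → ⟪ β ∣ IsInv β i ⟫)
      (λ e f → sep-ext rInv rInv e
        (λ _ _ (lift (p , q , r)) → lift (∈-respˡ e p , ∈-respʳ e q , ≐-trans (‵-ext (E-ext (≐-sym e)) ≐-refl) (≐-trans r f)))
        (λ _ _ (lift (p , q , r)) → lift (∈-respˡ (≐-sym e) p , ∈-respʳ (≐-sym e) q ,
          ≐-trans (‵-ext (E-ext e) ≐-refl) (≐-trans r (≐-sym f)))))
      (λ β i _ _ z p → let (a , lift (b , c , _)) = sep-out rInv p in ω₂⊆Hω₂ z (ord-trans ord-ω₂ c b))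
      (λ β i _ _ → one β i (lem (∃[ ξ ] IsInv β i ξ)))
      where
      one : ∀ β i → (∃[ ξ ] IsInv β i ξ) ⊎ ¬ (∃[ ξ ] IsInv β i ξ) → Cov (_∈ ⟪ β ∣ IsInv β i ⟫)
      one β i (inj₁ (ξ , lift (p , q , r))) = cov-one ξ λ z s → let (_ , lift (_ , q′ , r′)) = sep-out rInv s in
        E-inj p q′ q (≐-trans r′ (≐-sym r))
      one β i (inj₂ n) = cov-∅ λ z s → n (z , proj₂ (sep-out rInv s))

    E⁻¹-closed : ∀ {Y β ξ} → Closed E⁻¹ᵒ Y → β ∈ ω₂ → ξ ∈ β → β ∈ Y → E β ‵ ξ ∈ Y → ξ ∈ Y
    E⁻¹-closed {Y} {β} {ξ} c p q r s = values c (β ∷ E β ‵ ξ ∷ []) (r ∷ s ∷ []) ξ (sep-in rInv q (lift (p , q , ≐-refl)))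

  -- `uncountable` expresses that 2^ω does not inject into ω₁; `B` stands for the union of the nodes
  -- on the branch.
  module Contradiction (pairing : Pairing) (r : V) (reflect : ∀ β → β ∈ ω₂ → Witness r β)
    (uncountable : (ρ : (ℕ → Bool) → V) → (∀ s → ρ s ∈ ω₁) → ¬ (∀ s t → ρ s ≐ ρ t → ∀ n → s n ≡ t n))
    (B : V) (coherent : ∀ γ → γ ∈ ω₂ → ∃[ 𝒜 ] Node pairing r reflect γ 𝒜 × (∀ a → a ⊆ γ → (a ∈ B → a ∈ 𝒜) × (a ∈ 𝒜 → a ∈ B))) where

    Q : V → Set₁
    Q Y = Lift 1ℓ (¬ Y ∩ ω₂ ∈ B)

    Q-resp : Resp Q
    Q-resp e (lift n) = lift λ p → n (∈-respˡ (∩-ext (≐-sym e) ≐-refl) p)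

    -- The traces of the sets X s all lie in one node, of size ω₁, unless some trace avoids B.
    enough : ∀ T → Stat T → (G : Ops Hω₂) → ∃[ Y ] Y ⊆ Hω₂ × Cov (_∈ Y) × Closed G Y × Y ∩ ω₁ ∈ T × Q Y
    enough T sT G = by (Play.perfect pairing (G ⊕ Eᵒ) sT)
      where
      by : Play.Perfect pairing (G ⊕ Eᵒ) T → ∃[ Y ] Y ⊆ Hω₂ × Cov (_∈ Y) × Closed G Y × Y ∩ ω₁ ∈ T × Q Y
      by pf = dne λ none → absurd λ s → dne₀ λ n → none (X s , X-⊆ s , X-cov s , closed-⊕ˡ G Eᵒ (X-closed s) ,
          ∈-respˡ (≐-sym (X-trace s)) ν∈T , lift n)
        where
        open Play.Perfect pf
        absurd : ¬ (∀ s → X s ∩ ω₂ ∈ B)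
        absurd h = go (coherent γ γ∈ω₂)
          where
          go : ¬ (∃[ 𝒜 ] Node pairing r reflect γ 𝒜 × (∀ a → a ⊆ γ → (a ∈ B → a ∈ 𝒜) × (a ∈ 𝒜 → a ∈ B)))
          go (𝒜 , (M , ξ , n) , k) = count (≼⇒Inj (Model.Coll≼ω₁ (NodeOf.model n)))
            where
            in-Coll : ∀ s → X s ∩ ω₂ ∈ Coll M
            in-Coll s = proj₂ (NodeOf.out n (proj₁ (k _ (X-bound s)) (h s)))
            count : ¬ Inj (Coll M) ω₁
            count (φ , _ , φ∈ , φ-inj) = uncountable (λ s → φ (X s ∩ ω₂)) (λ s → φ∈ _ (in-Coll s))
              λ s t e → X-inj (λ s → closed-⊕ʳ G Eᵒ (X-closed s)) s t (φ-inj _ _ (in-Coll s) (in-Coll t) e)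

    module _ {N} (ch : Chain E⁻¹ᵒ Q N) where
      open ChainFacts ch

      γ : V
      γ = W ∩ ω₂

      -- A member ξ of β is recovered from β and `E β ‵ ξ` at a stage beyond both, as every stage
      -- includes its own index; so γ is transitive. Its size is at most ω₁ because the union of the
      -- chain has size at most ω₁.
      γ∈ω₂ : γ ∈ ω₂
      γ∈ω₂ = ∈ω₂ (down , λ β p → proj₁ (ord-elt ord-ω₂ (proj₂ (∩-out p)))) (≼-trans (⊆⇒≼ λ z p → proj₁ (∩-out p)) (W≼ω₁ pairing))
        where
        down : Transitive γ
        down β p ξ q = by (W-out (proj₁ (∩-out p)))
          where
          β∈ω₂ : β ∈ ω₂
          β∈ω₂ = proj₂ (∩-out p)
          i : V
          i = E β ‵ ξ
          i∈ω₁ : i ∈ ω₁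
          i∈ω₁ = E∈ β∈ω₂ q
          by : (∃[ ζ ] ζ ∈ ω₁ × β ∈ N ‵ ζ) → ξ ∈ γ
          by (ζ , ζ∈ , β∈N) = ∩-in (W-in η∈ (E⁻¹-closed (closedᶠ η∈) β∈ω₂ q
                (mono η∈ (ord-⊆∈ (ord-elt ord-ω₁ ζ∈) (ord-elt ord-ω₁ η∈) (λ z → ∪-inˡ) succ-self) β β∈N)
                (self⊆ η∈ i (ord-⊆∈ (ord-elt ord-ω₁ i∈ω₁) (ord-elt ord-ω₁ η∈) (λ z → ∪-inʳ) succ-self))))
              (ord-trans ord-ω₂ q β∈ω₂)
            where
            η∈ : succ (ζ ∪ i) ∈ ω₁
            η∈ = succ∈ω₁ (ord-max ord-ω₁ ζ∈ i∈ω₁)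

      E-ext′ : Ext (E γ ‵_)
      E-ext′ = ‵-ext ≐-refl

      b : V → V
      b ζ = bnd (Im (E γ ‵_) (N ‵ ζ ∩ γ))

      b-ext : Ext b
      b-ext e = bnd-ext (Im-ext E-ext′ (∩-ext (N-ext e) ≐-refl))

      b∈ : ∀ {ζ} → ζ ∈ ω₁ → b ζ ∈ ω₁
      b∈ p = bnd∈ω₁ (cov-image E-ext′ (λ y q → let (x , r , e) = Im-out q in x , proj₁ (∩-out r) , e) (cov p))
        λ z q → let (x , r , e) = Im-out q in ∈-respˡ (≐-sym e) (E∈ γ∈ω₂ (proj₂ (∩-out r)))

      -- At most one ξ satisfies the premise, as `E γ` is injective; the universal form also covers
      -- an `i` outside its range.
      Captures : V → V → Set₁
      Captures i ζ = ∀ ξ → ξ ∈ γ → E γ ‵ ξ ≐ i → ξ ∈ N ‵ ζ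

      rCap : ∀ {i} → Resp (Captures i)
      rCap e h ξ p q = ∈-respʳ (N-ext e) (h ξ p q)

      c : V → V
      c i = least ω₁ (Captures i)

      c-ext : Ext c
      c-ext e = least-ext rCap rCap ≐-refl (λ ζ h ξ p q → h ξ p (≐-trans q (≐-sym e))) (λ ζ h ξ p q → h ξ p (≐-trans q e))

      c-spec : ∀ i → c i ∈ ω₁ × Captures i (c i)
      c-spec i = let (p , q , _) = least-spec ord-ω₁ rCap (by (lem (∃[ ξ ] Lift 1ℓ (ξ ∈ γ × E γ ‵ ξ ≐ i)))) in p , q
        where
        by : (∃[ ξ ] Lift 1ℓ (ξ ∈ γ × E γ ‵ ξ ≐ i)) ⊎ ¬ (∃[ ξ ] Lift 1ℓ (ξ ∈ γ × E γ ‵ ξ ≐ i)) → ∃[ ζ ] ζ ∈ ω₁ × Captures i ζ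
        by (inj₁ (ξ , lift (p , q))) = let (ζ , ζ∈ , s) = W-out (proj₁ (∩-out p)) in ζ , ζ∈ , λ ξ′ p′ q′ →
          ∈-respˡ (E-inj γ∈ω₂ p p′ (≐-trans q (≐-sym q′))) s
        by (inj₂ n) = ∅ , ∅∈ω₁ , λ ξ p q → ⊥-elim (n (ξ , lift (p , q)))

      -- At a limit ν closed under both, the chain and `E γ` exhaust γ to the same extent: `K₁`
      -- bounds the values of `E γ` on earlier stages, and `K₂` finds a stage below ν for each
      -- preimage.
      K₁ K₂ : Ops ω₁
      K₁ = singleton b b-ext λ ζ → b∈
      K₂ = singleton c c-ext λ i _ → proj₁ (c-spec i)

      absurd : ⊥
      absurd = go (coherent γ γ∈ω₂)
        where
        go : ¬ (∃[ 𝒜 ] Node pairing r reflect γ 𝒜 × (∀ a → a ⊆ γ → (a ∈ B → a ∈ 𝒜) × (a ∈ 𝒜 → a ∈ B)))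
        go (𝒜 , (M , ξ , n) , k) = finish (point (S-stationary O.model O.ord O.mem∈ O.height γ∈ω₂) (K₁ ⊕ K₂))
          where
          module O = NodeOf n
          finish : ¬ (∃[ ν ] ν ∈ S M ξ γ × ν ∈ ω₁ × IsLimit ν × Closed (K₁ ⊕ K₂) ν × N ‵ ν ∩ ω₁ ≐ ν)
          finish (ν , ν∈S , ν∈ω₁ , lim , cl , _) = lower (holds ν∈ω₁) (guess (proj₂ (sep-out Guess-resp ν∈S)))
            where
            trace≐y : N ‵ ν ∩ ω₂ ≐ y γ ν
            trace≐y = ⊆-antisym
              (λ z p → let (q , s) = ∩-out p ; (ζ , ζ∈ , t) = limit-out ν∈ω₁ lim z q ; z∈γ = ∩-in (W-in ν∈ω₁ q) s in
                sep-in y-resp z∈γ (lift (ord-trans (proj₁ lim) (bnd-in (Im-in E-ext′ (∩-in t z∈γ) ≐-refl))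
                  (values (closed-⊕ˡ K₁ K₂ cl) (ζ ∷ []) (ζ∈ ∷ []) (b ζ) (pair-inˡ ≐-refl)))))
              (λ z p → let (z∈γ , lift q) = sep-out y-resp p in
                ∩-in (limit-in ν∈ω₁ lim z (c (E γ ‵ z))
                    (values (closed-⊕ʳ K₁ K₂ cl) (E γ ‵ z ∷ []) (q ∷ []) (c (E γ ‵ z)) (pair-inˡ ≐-refl))
                    (proj₂ (c-spec (E γ ‵ z)) z z∈γ ≐-refl))
                  (proj₂ (∩-out z∈γ)))
            -- A guessed `y γ ν` lies in the collapse, hence in the node at γ and in `B`; but `Q`
            -- excludes this for the trace of a set in the chain.
            guess : Guess M ξ γ ν → N ‵ ν ∩ ω₂ ∈ B
            guess (Y , nice , e) = ∈-respˡ (≐-sym trace≐y) (proj₂ (k (y γ ν) y⊆γ)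
                (O.into y⊆γ (∈-respˡ e (coll∈Coll (proj₁ nice)))))
              where
              y⊆γ : y γ ν ⊆ γ
              y⊆γ = sep-⊆ y-resp

    contradiction : ⊥
    contradiction = by (chain E⁻¹ᵒ Q Q-resp enough)
      where
      by : ¬ (∃[ N ] Chain E⁻¹ᵒ Q N)
      by (N , ch) = absurd ch

theorem3 : ExcludedMiddle 1ℓ → Choice →
    ∀ ω₁ ω₂ → IsSuccessorCardinal ω ω₁ → IsSuccessorCardinal ω₁ ω₂ →
    SRP ω₁ ω₂ → TreeProperty ω₂ →
    ∀ δ κ U I → IsTower δ κ U I → TowerConcentratesOn κ U I (GIS ω₁) →
    ¬ IsPresaturated δ κ U I
theorem3 em choice ω₁ ω₂ s₁ s₂ srp tp δ κ U I tower conc presat =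
  let (_ , model) = T.some-model
      pairing = C.Model.pairing model
      (r , reflect) = T.reflect
      (B , coherent) = R.coherent pairing r reflect in
  F.Contradiction.contradiction pairing r reflect T.Continuum.contradiction B coherent
  where
  module C = Collapse em choice ω₁ ω₂ s₁ s₂
  module T = Tower em choice ω₁ ω₂ s₁ s₂ δ κ U I tower conc presat
  module R = Tree em choice ω₁ ω₂ s₁ s₂ srp tp
  module F = Conclusion em choice ω₁ ω₂ s₁ s₂ srp tp
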